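{- Assume the Kernel conjecture: for every $N\ge 2$, $$\ker(D_{<N})\cap\mathcal Z^f_N=\mathbb Q\,\zeta^f(N),\qquad D_{<N}=\bigoplus_{3\le 2r+1<N}D_{2r+1}.$$ Let $a,b\ge 0$ be integers. Then $$\zeta^f(\{2\}^a,3,\{2\}^b)=\sum_{r=1}^{a+b+1}c_{a,b}^r\,\zeta^f(2r+1)\,\zeta^f(\{2\}^{a+b+1-r}),$$ where $$c_{a,b}^r=2\cdot(-1)^r\Big(\binom{2r}{2b+2}-(1-2^{ -2r})\binom{2r}{2a+1}\Big).$$
   Context: Let $X=\{x_0,x_1\}$ and let $\mathbb Q\langle X\rangle$ be the free non-commutative $\mathbb Q$-algebra on $X$, with word basis, empty word $\mathbf 1$ and weight equal to length. Write $(f\mid w)$ for coefficients. Shuffle product: $\mathbf 1\sqcup\!\sqcup w=w\sqcup\!\sqcup\mathbf 1=w$ and $au\sqcup\!\sqcup bv=a(u\sqcup\!\sqcup bv)+b(au\sqcup\!\sqcup v)$. Stuffle product on $\mathbb Q\langle Y\rangle$, $Y=\{y_1,y_2,\dots\}$: $\mathbf 1*w=w*\mathbf 1=w$ and $y_iu*y_jv=y_i(u*y_jv)+y_j(y_iu*v)+y_{i+j}(u*v)$. Let $\iota(y_{k_1}\cdots y_{k_d})=x_0^{k_1-1}x_1\cdots x_0^{k_d-1}x_1$, $\mathfrak h^0=\mathbb Q\mathbf 1+x_0\mathbb Q\langle X\rangle x_1$ and $\mathfrak h^1=\mathbb Q\mathbf 1+\mathbb Q\langle X\rangle x_1$. $\mathcal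 Z^f=(\mathbb Q\langle X\rangle,\sqcup\!\sqcup)/R$, with $R$ the ideal generated by $x_0$, $x_1$ and all $u\sqcup\!\sqcup v-\iota(\iota^{ -1}(u)*\iota^{ -1}(v))$ ($u\in\mathfrak h^0$, $v\in\mathfrak h^1$). It is weight-graded with pieces $\mathcal Z^f_N$. $\zeta^f$ is the projection, and $\zeta^f(k_1,\dots,k_d)=\zeta^f(x_0^{k_1-1}x_1\cdots x_0^{k_d-1}x_1)$. Here $\{2\}^n$ denotes $n$ repetitions of $2$, and $\zeta^f(\{2\}^0)=1$. Binomial coefficients $\binom{n}{k}$ are $0$ for $k>n$. Let $\mathcal A^f=\mathcal Z^f/(\zeta^f(2))$ with projection $\pi$. Goncharov coproduct. Let $S(\varepsilon_1\cdots\varepsilon_n)=(-1)^n\varepsilon_n\cdots\varepsilon_1$. Set $I(a;f;b)=f$ if $(a,b)=(x_1,x_0)$, $S(f)$ if $(a,b)=(x_0,x_1)$, and $(f\mid\mathbf 1)\mathbf 1$ if $a=b$. With $\varepsilon_0=x_1$ and $\varepsilon_{n+1}=x_0$, $$\Delta_{\mathrm{Gon}}(\varepsilon_1\cdots\varepsilon_n)=\sum_{0=i_0<\dots<i_{k+1}=n+1}\Big(\mathop{\sqcup\!\sqcup}_{p=0}^k I(\varepsilon_{i_p};\varepsilon_{i_p+1}\cdots\varepsilon_{i_{p+1}-1};\varepsilon_{i_{p+1}})\Big)\otimes\varepsilon_{i_1}\cdots\varepsilon_{i_k}.$$ The coaction $\Delta:\mathcal Z^f\to\mathcal A^f\otimes\mathcal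 Z^f$ is $\Delta(\zeta^f(w))=(\pi\zeta^f\otimes\zeta^f)\Delta_{\mathrm{Gon}}(w)$; it is well defined. Let $\mathcal L=\mathcal A^f_{>0}/(\mathcal A^f_{>0})^2$ be the weight-graded indecomposables, and let $\pi_{2r+1}:\mathcal A^f_{>0}\to\mathcal L_{2r+1}$ be the projection. Define $D_{2r+1}=(\pi_{2r+1}\otimes\mathrm{id})\circ(\Delta-\mathbf 1\otimes\mathrm{id}):\mathcal Z^f\to\mathcal L_{2r+1}\otimes\mathcal Z^f$. -}

module Defs where

open import Data.Nat as ℕ using (ℕ; zero; suc; _∸_; _≤_; _<_)
open import Data.Nat.Combinatorics using (_C_)
open import Data.Integer using (+_)
open import Data.Rational using (ℚ; 0ℚ; 1ℚ; ½; _+_; _*_; -_; _-_; _/_)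
open import Data.List using (List; []; _∷_; _++_; map; concatMap; replicate; reverse; length; upTo; [_])
import Data.List.Properties as LP
import Data.Product.Properties as PP
open import Data.Product using (Σ; Σ-syntax; ∃; _×_; _,_)
open import Data.Sum using (_⊎_)
open import Relation.Binary.PropositionalEquality using (_≡_; _≢_; refl)
open import Relation.Binary.Definitions using (DecidableEquality)
open import Relation.Nullary using (yes; no)
open import Function.Bundles using (_⇔_)

FC : Set → Set
FC A = List (ℚ × A)

scale : {A : Set} → ℚ → FC A → FC A
scale q = map (λ { (p , a) → (q * p , a) })

neg : {A : Set} → FC A → FC A
neg = scale (- 1ℚ)

_⊖_ : {A : Set} → FC A → FC A → FC A
f ⊖ g = f ++ neg g

lincomb : {A : Set} {S : FC A → Set} → List (ℚ × Σ (FC A) S) → FC A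
lincomb = concatMap (λ { (q , g , _) → scale q g })

module _ {A : Set} (_≟A_ : DecidableEquality A) where

  coeff : FC A → A → ℚ
  coeff [] a = 0ℚ
  coeff ((q , b) ∷ f) a with a ≟A b
  ... | yes _ = q + coeff f a
  ... | no  _ = coeff f a

  Same : FC A → FC A → Set
  Same f g = ∀ a → coeff f a ≡ coeff g a

  Span : (FC A → Set) → FC A → Set
  Span S f = Σ (List (ℚ × Σ (FC A) S)) λ L → Same f (lincomb L)

data X : Set where
  x0 x1 : X

_≟X_ : DecidableEquality X
x0 ≟X x0 = yes refl
x0 ≟X x1 = no λ ()
x1 ≟X x0 = no λ ()
x1 ≟X x1 = yes refl

Word : Set
Word = List X

_≟W_ : DecidableEquality Word
_≟W_ = LP.≡-dec _≟X_

Poly : Set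
Poly = FC Word

coeffP : Poly → Word → ℚ
coeffP = coeff _≟W_

SpanP : (Poly → Set) → Poly → Set
SpanP = Span _≟W_

wd : Word → Poly
wd w = [ (1ℚ , w) ]

prefix : X → Poly → Poly
prefix a = map (λ { (q , w) → (q , a ∷ w) })

shw : Word → Word → Poly
shw [] v = wd v
shw (a ∷ u) [] = wd (a ∷ u)
shw (a ∷ u) (b ∷ v) = prefix a (shw u (b ∷ v)) ++ prefix b (shw (a ∷ u) v)

sh : Poly → Poly → Poly
sh f g = concatMap (λ { (p , u) → concatMap (λ { (q , v) → scale (p * q) (shw u v) }) g }) f

-- Words in Y = {y1, y2, ...}: y_k is encoded by the natural number k (k ≥ 1)

YWord : Set
YWord = List ℕ

YPoly : Set
YPoly = FC YWord

prefixY : ℕ → YPoly → YPoly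
prefixY i = map (λ { (q , w) → (q , i ∷ w) })

st : YWord → YWord → YPoly
st [] v = [ (1ℚ , v) ]
st (i ∷ u) [] = [ (1ℚ , i ∷ u) ]
st (i ∷ u) (j ∷ v) =
  prefixY i (st u (j ∷ v)) ++ prefixY j (st (i ∷ u) v) ++ prefixY (i ℕ.+ j) (st u v)

ι : YWord → Word
ι [] = []
ι (k ∷ ks) = replicate (k ∸ 1) x0 ++ x1 ∷ ι ks

ιP : YPoly → Poly
ιP = map (λ { (q , w) → (q , ι w) })

-- inverse of ι on words of h^1 (the counter n counts pending x0's)
ιinvAux : ℕ → Word → YWord
ιinvAux n [] = []
ιinvAux n (x0 ∷ w) = ιinvAux (suc n) w
ιinvAux n (x1 ∷ w) = suc n ∷ ιinvAux 0 w

ιinv : Word → YWord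
ιinv = ιinvAux 0

InH0 : Word → Set
InH0 w = w ≡ [] ⊎ Σ Word λ u → w ≡ x0 ∷ (u ++ [ x1 ])

InH1 : Word → Set
InH1 w = w ≡ [] ⊎ Σ Word λ u → w ≡ u ++ [ x1 ]

data GenR : Poly → Set where
  gen-x0 : GenR (wd [ x0 ])
  gen-x1 : GenR (wd [ x1 ])
  gen-ds : (u v : Word) → InH0 u → InH1 v →
           GenR (shw u v ⊖ ιP (st (ιinv u) (ιinv v)))

IdealGen : Poly → Set
IdealGen h = Σ Word λ w → Σ Poly λ g → GenR g × h ≡ sh (wd w) g

InR : Poly → Set
InR = SpanP IdealGen

-- ζ^f(f) = ζ^f(g) in Z^f
ZEq : Poly → Poly → Set
ZEq f g = InR (f ⊖ g)

Hom : ℕ → Poly → Set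
Hom N f = ∀ w → coeffP f w ≢ 0ℚ → length w ≡ N

-- Kernel of Q<X>_{>0} → A^f_{>0} → L = A^f_{>0}/(A^f_{>0})^2 :
-- spanned by R, the ideal (ζ^f(2)) = x0x1 ш Q<X>, and products of
-- positive-weight elements.

data GenK : Poly → Set where
  k-R    : (f : Poly) → InR f → GenK f
  k-ζ2   : (w : Word) → GenK (sh (wd (x0 ∷ x1 ∷ [])) (wd w))
  k-prod : (a : X) (u : Word) (b : X) (v : Word) → GenK (shw (a ∷ u) (b ∷ v))

InK : Poly → Set
InK = SpanP GenK

Tensor : Set
Tensor = FC (Word × Word)

_≟WW_ : DecidableEquality (Word × Word)
_≟WW_ = PP.≡-dec _≟W_ _≟W_

_⊗w_ : Poly → Word → Tensor
f ⊗w v = map (λ { (q , u) → (q , (u , v)) }) f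

_w⊗_ : Word → Poly → Tensor
u w⊗ g = map (λ { (q , v) → (q , (u , v)) }) g

-- kernel of Q<X> ⊗ Q<X> → L ⊗ Z^f is  K ⊗ Q<X> + Q<X> ⊗ R
data GenT : Tensor → Set where
  t-left  : (k : Poly) → InK k → (v : Word) → GenT (k ⊗w v)
  t-right : (u : Word) → (g : Poly) → InR g → GenT (u w⊗ g)

TensorZero : Tensor → Set
TensorZero = Span _≟WW_ GenT

sgn : ℕ → ℚ
sgn zero = 1ℚ
sgn (suc n) = - sgn n

Iseg : X → Word → X → Poly
Iseg x1 f x0 = wd f
Iseg x0 f x1 = [ (sgn (length f) , reverse f) ]
Iseg x0 [] x0 = wd []
Iseg x0 (_ ∷ _) x0 = []
Iseg x1 [] x1 = wd []
Iseg x1 (_ ∷ _) x1 = []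

-- a : left endpoint of the current segment, buf : letters of the current
-- segment, rest : remaining letters; returns (left factor, right word) for
-- every choice of positions i_1 < ... < i_k among the remaining letters.
gonAux : X → Word → Word → List (Poly × Word)
gonAux a buf [] = [ (Iseg a buf x0 , []) ]
gonAux a buf (e ∷ rest) =
  map (λ { (L , Rw) → (sh (Iseg a buf e) L , e ∷ Rw) }) (gonAux e [] rest)
  ++ gonAux a (buf ++ [ e ]) rest

gon : Word → List (Poly × Word)
gon w = gonAux x1 [] w

-- representative in Q<X> ⊗ Q<X> of D_{2r+1}(ζ^f(w)): the terms of
-- Δ_Gon(w) whose left factor has weight 2r+1 (i.e. k = n - (2r+1))
Dword : ℕ → Word → Tensor
Dword r w = concatMap (λ { (L , Rw) → DT (length Rw ℕ.+ (2 ℕ.* r ℕ.+ 1) ℕ.≟ length w) L Rw }) (gon w)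
  where
  open import Relation.Nullary using (Dec)
  DT : {P : Set} → Dec P → Poly → Word → Tensor
  DT (yes _) L Rw = L ⊗w Rw
  DT (no _)  L Rw = []

Dpoly : ℕ → Poly → Tensor
Dpoly r f = concatMap (λ { (q , w) → scale q (Dword r w) }) f

DVanish : ℕ → Poly → Set
DVanish r f = TensorZero (Dpoly r f)

InKerD< : ℕ → Poly → Set
InKerD< N f = (r : ℕ) → 3 ≤ 2 ℕ.* r ℕ.+ 1 → 2 ℕ.* r ℕ.+ 1 < N → DVanish r f

zetaN : ℕ → Word
zetaN N = ι [ N ]

KernelConjecture : Set
KernelConjecture =
  (N : ℕ) → 2 ≤ N → (f : Poly) → Hom N f →
  (InKerD< N f ⇔ (Σ ℚ λ q → ZEq f (scale q (wd (zetaN N)))))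

powℚ : ℚ → ℕ → ℚ
powℚ q zero = 1ℚ
powℚ q (suc n) = q * powℚ q n

ℕtoℚ : ℕ → ℚ
ℕtoℚ n = + n / 1

c : ℕ → ℕ → ℕ → ℚ
c a b r = (ℕtoℚ 2 * powℚ (- 1ℚ) r) *
  (ℕtoℚ ((2 ℕ.* r) C (2 ℕ.* b ℕ.+ 2))
   - (1ℚ - powℚ ½ (2 ℕ.* r)) * ℕtoℚ ((2 ℕ.* r) C (2 ℕ.* a ℕ.+ 1)))

lhs : ℕ → ℕ → Poly
lhs a b = wd (ι (replicate a 2 ++ 3 ∷ replicate b 2))

rhs : ℕ → ℕ → Poly
rhs a b = concatMap term (map suc (upTo (a ℕ.+ b ℕ.+ 1)))
  where
  term : ℕ → Poly
  term r = scale (c a b r)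
    (sh (wd (ι [ 2 ℕ.* r ℕ.+ 1 ])) (wd (ι (replicate (a ℕ.+ b ℕ.+ 1 ∸ r) 2))))

-- Modulo products in the left factor, only the terms of the Goncharov coproduct with one non-trivial segment contribute, and they form a
-- derivation for the shuffle product. By induction on the weight, D_{2r+1} of the left hand side is therefore c^r_{a,b} ζ(2r+1) ⊗ ζ({2}^{a+b+1-r}),
-- in agreement with the right hand side, and by the kernel conjecture the two sides differ by a rational multiple of ζ^f(2a+2b+3).
-- The multiple is zero by Zagier's theorem for the real numbers ζ({2}^a,3,{2}^b). Real numbers are avoided: regularised polylogarithms truncated
-- at M give linear forms with rational values that are O(log^k M / M) on R and are the truncated multiple zeta values on convergent words.
-- The generating function of the truncated ζ({2}^a,3,{2}^b) is a product of two generating functions of truncated ζ({2}^k) with that of the sums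
-- Σ_{k ≤ j} (-1)^j μ_j k^-(2a+1) j^-(2b+2), where μ_j → 1; a partial fraction expansion of 1/(j^q (j+k)^p) evaluates these up to o(1).
module Submission where

open import Defs renaming (c to coefficient)
open import Data.Nat as ℕ using (ℕ; zero; suc; z≤n; s≤s)
import Data.Nat.Properties as ℕP
open import Data.Nat.Combinatorics using (nCn≡1; nCk+nC[k+1]≡[n+1]C[k+1]; nCk≡nC[n∸k]; k>n⇒nCk≡0) renaming (_C_ to _choose_)
import Data.Integer as ℤ
import Data.Integer.Properties as ℤP
open import Data.Rational using (ℚ; 0ℚ; 1ℚ; ½; _+_; _*_; -_; _-_; _/_; _≤_; _<_; ∣_∣; toℚᵘ; nonNegative; mkℚ; 1/_; ≢-nonZero)
open import Data.Rational.Properties as ℚP using (+-*-commutativeRing; +-*-ring)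
import Data.Rational.Unnormalised as ℚᵘ
import Data.Rational.Unnormalised.Properties as ℚᵘP
open import Data.List using (List; []; _∷_; _++_; map; concatMap; length; replicate; reverse; foldl; [_]; _∷ʳ_; upTo; applyUpTo)
import Data.List.Properties as LP
open import Data.List.Relation.Unary.All using (All; []; _∷_)
open import Data.Maybe using (Maybe; just; nothing)
open import Data.Product using (Σ; _×_; _,_; proj₁; proj₂)
open import Data.Sum using (_⊎_; inj₁; inj₂)
open import Data.Empty using (⊥-elim)
open import Function using (_∘_; flip)
open import Function.Bundles using (Equivalence)
open import Level using (0ℓ)
open import Relation.Nullary using (Dec; yes; no; ¬_)
open import Relation.Binary.Definitions using (DecidableEquality; tri<; tri≈; tri>)
open import Relation.Binary.PropositionalEquality hiding ([_]; J)
import Relation.Binary.Reasoning.Setoid as SetoidReasoning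
open import Algebra.Bundles using (CommutativeMonoid)
open import Algebra.Module.Bundles using (LeftModule)
import Algebra.Module.Construct.TensorUnit as TensorUnit
import Algebra.Properties.CommutativeSemigroup as CommSemigroup
open import Tactic.RingSolver using (solve-∀)
open import Tactic.RingSolver.Core.AlmostCommutativeRing using (AlmostCommutativeRing; fromCommutativeRing)

module Sums where

  ℚ-ring : AlmostCommutativeRing 0ℓ 0ℓ
  ℚ-ring = fromCommutativeRing +-*-commutativeRing λ x → zero? (0ℚ ℚP.≟ x)
    where
    zero? : {x : ℚ} → Dec (0ℚ ≡ x) → Maybe (0ℚ ≡ x)
    zero? (yes p) = just p
    zero? (no _)  = nothing

  ℕtoℚ-+ : ∀ m n → ℕtoℚ (m ℕ.+ n) ≡ ℕtoℚ m + ℕtoℚ n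
  ℕtoℚ-+ m n = ℚP.toℚᵘ-injective (begin
    toℚᵘ (ℕtoℚ (m ℕ.+ n))                        ≈⟨ ℚP.toℚᵘ-fromℚᵘ (ℚᵘ.mkℚᵘ (ℤ.+ (m ℕ.+ n)) 0) ⟩
    ℚᵘ.mkℚᵘ (ℤ.+ (m ℕ.+ n)) 0                    ≈⟨ ℚᵘ.*≡* (cong (ℤ._* ℤ.1ℤ) (cong₂ ℤ._+_ (sym (ℤP.*-identityʳ (ℤ.+ m))) (sym (ℤP.*-identityʳ (ℤ.+ n))))) ⟩
    ℚᵘ.mkℚᵘ (ℤ.+ m) 0 ℚᵘ.+ ℚᵘ.mkℚᵘ (ℤ.+ n) 0     ≈⟨ ℚᵘP.+-cong (ℚP.toℚᵘ-fromℚᵘ (ℚᵘ.mkℚᵘ (ℤ.+ m) 0)) (ℚP.toℚᵘ-fromℚᵘ (ℚᵘ.mkℚᵘ (ℤ.+ n) 0)) ⟨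
    toℚᵘ (ℕtoℚ m) ℚᵘ.+ toℚᵘ (ℕtoℚ n)             ≈⟨ ℚP.toℚᵘ-homo-+ (ℕtoℚ m) (ℕtoℚ n) ⟨
    toℚᵘ (ℕtoℚ m + ℕtoℚ n)                       ∎)
    where open ℚᵘP.≃-Reasoning

  ℕtoℚ-* : ∀ m n → ℕtoℚ (m ℕ.* n) ≡ ℕtoℚ m * ℕtoℚ n
  ℕtoℚ-* m n = ℚP.toℚᵘ-injective (begin
    toℚᵘ (ℕtoℚ (m ℕ.* n))                        ≈⟨ ℚP.toℚᵘ-fromℚᵘ (ℚᵘ.mkℚᵘ (ℤ.+ (m ℕ.* n)) 0) ⟩
    ℚᵘ.mkℚᵘ (ℤ.+ (m ℕ.* n)) 0                    ≈⟨ ℚᵘ.*≡* (cong (ℤ._* ℤ.1ℤ) (ℤP.pos-* m n)) ⟩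
    ℚᵘ.mkℚᵘ (ℤ.+ m) 0 ℚᵘ.* ℚᵘ.mkℚᵘ (ℤ.+ n) 0     ≈⟨ ℚᵘP.*-cong (ℚP.toℚᵘ-fromℚᵘ (ℚᵘ.mkℚᵘ (ℤ.+ m) 0)) (ℚP.toℚᵘ-fromℚᵘ (ℚᵘ.mkℚᵘ (ℤ.+ n) 0)) ⟨
    toℚᵘ (ℕtoℚ m) ℚᵘ.* toℚᵘ (ℕtoℚ n)             ≈⟨ ℚP.toℚᵘ-homo-* (ℕtoℚ m) (ℕtoℚ n) ⟨
    toℚᵘ (ℕtoℚ m * ℕtoℚ n)                       ∎)
    where open ℚᵘP.≃-Reasoning

  ℕtoℚ-suc : ∀ n → ℕtoℚ (suc n) ≡ 1ℚ + ℕtoℚ n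
  ℕtoℚ-suc n = ℕtoℚ-+ 1 n

  -- Reciprocals are shifted, inv n = 1/(n+1), so that no non-zeroness side condition is needed.
  opaque
    inv : ℕ → ℚ
    inv n = ℤ.+ 1 / suc n

    inv-cancel : ∀ n → inv n * ℕtoℚ (suc n) ≡ 1ℚ
    inv-cancel n = ℚP.toℚᵘ-injective (begin
      toℚᵘ (inv n * ℕtoℚ (suc n))                      ≈⟨ ℚP.toℚᵘ-homo-* (inv n) (ℕtoℚ (suc n)) ⟩
      toℚᵘ (inv n) ℚᵘ.* toℚᵘ (ℕtoℚ (suc n))            ≈⟨ ℚᵘP.*-cong (ℚP.toℚᵘ-fromℚᵘ (ℚᵘ.mkℚᵘ (ℤ.+ 1) n)) (ℚP.toℚᵘ-fromℚᵘ (ℚᵘ.mkℚᵘ (ℤ.+ suc n) 0)) ⟩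
      ℚᵘ.mkℚᵘ (ℤ.+ 1) n ℚᵘ.* ℚᵘ.mkℚᵘ (ℤ.+ suc n) 0     ≈⟨ ℚᵘ.*≡* (cong ℤ.+_ (cross n)) ⟩
      toℚᵘ 1ℚ                                          ∎)
      where
      open ℚᵘP.≃-Reasoning
      cross : ∀ n → (1 ℕ.* suc n) ℕ.* 1 ≡ 1 ℕ.* (suc n ℕ.* 1)
      cross n = trans (ℕP.*-identityʳ (1 ℕ.* suc n)) (cong (1 ℕ.*_) (sym (ℕP.*-identityʳ (suc n))))

    inv-0 : inv 0 ≡ 1ℚ
    inv-0 = refl

    inv-nonneg : ∀ n → 0ℚ ≤ inv n
    inv-nonneg n = ℚP.nonNegative⁻¹ (inv n) {{ℚP.normalize-nonNeg 1 (suc n)}}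

    /≡*inv : ∀ n d → (ℤ.+ n) / suc d ≡ ℕtoℚ n * inv d
    /≡*inv n d = ℚP.toℚᵘ-injective (begin
      toℚᵘ ((ℤ.+ n) / suc d)                           ≈⟨ ℚP.toℚᵘ-fromℚᵘ (ℚᵘ.mkℚᵘ (ℤ.+ n) d) ⟩
      ℚᵘ.mkℚᵘ (ℤ.+ n) d                                ≈⟨ ℚᵘ.*≡* (cong₂ ℤ._*_ (sym (ℤP.*-identityʳ (ℤ.+ n))) (cong ℤ.+_ (ℕP.*-identityˡ (suc d)))) ⟩
      ℚᵘ.mkℚᵘ (ℤ.+ n) 0 ℚᵘ.* ℚᵘ.mkℚᵘ (ℤ.+ 1) d         ≈⟨ ℚᵘP.*-cong (ℚP.toℚᵘ-fromℚᵘ (ℚᵘ.mkℚᵘ (ℤ.+ n) 0)) (ℚP.toℚᵘ-fromℚᵘ (ℚᵘ.mkℚᵘ (ℤ.+ 1) d)) ⟨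
      toℚᵘ (ℕtoℚ n) ℚᵘ.* toℚᵘ (inv d)                  ≈⟨ ℚP.toℚᵘ-homo-* (ℕtoℚ n) (inv d) ⟨
      toℚᵘ (ℕtoℚ n * inv d)                            ∎)
      where open ℚᵘP.≃-Reasoning

  module _ where
    open ℚP.≤-Reasoning

    *-monoˡ : ∀ {a b c} → 0ℚ ≤ a → b ≤ c → a * b ≤ a * c
    *-monoˡ {a} 0≤a = ℚP.*-monoˡ-≤-nonNeg a {{nonNegative 0≤a}}

    *-monoʳ : ∀ {a b c} → 0ℚ ≤ a → b ≤ c → b * a ≤ c * a
    *-monoʳ {a} 0≤a = ℚP.*-monoʳ-≤-nonNeg a {{nonNegative 0≤a}}

    *-nonneg : ∀ {a b} → 0ℚ ≤ a → 0ℚ ≤ b → 0ℚ ≤ a * b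
    *-nonneg {a} {b} 0≤a 0≤b = ℚP.≤-trans (ℚP.≤-reflexive (sym (ℚP.*-zeroʳ a))) (*-monoˡ 0≤a 0≤b)

    +-nonneg : ∀ {a b} → 0ℚ ≤ a → 0ℚ ≤ b → 0ℚ ≤ a + b
    +-nonneg = ℚP.+-mono-≤

    *-mono : ∀ {a b c d} → 0ℚ ≤ b → 0ℚ ≤ c → a ≤ b → c ≤ d → a * c ≤ b * d
    *-mono 0≤b 0≤c a≤b c≤d = ℚP.≤-trans (*-monoʳ 0≤c a≤b) (*-monoˡ 0≤b c≤d)

    0≤1 : 0ℚ ≤ 1ℚ
    0≤1 = ℚP.nonNegative⁻¹ 1ℚ

    p≤p+q : ∀ {p q} → 0ℚ ≤ q → p ≤ p + q
    p≤p+q {p} 0≤q = ℚP.≤-trans (ℚP.≤-reflexive (sym (ℚP.+-identityʳ p))) (ℚP.+-monoʳ-≤ p 0≤q)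

    q≤p+q : ∀ {p q} → 0ℚ ≤ p → q ≤ p + q
    q≤p+q {p} {q} 0≤p = ℚP.≤-trans (ℚP.≤-reflexive (sym (ℚP.+-identityˡ q))) (ℚP.+-monoˡ-≤ q 0≤p)

    ∣+∣≤ : ∀ {p q P Q} → ∣ p ∣ ≤ P → ∣ q ∣ ≤ Q → ∣ p + q ∣ ≤ P + Q
    ∣+∣≤ {p} {q} p≤ q≤ = ℚP.≤-trans (ℚP.∣p+q∣≤∣p∣+∣q∣ p q) (ℚP.+-mono-≤ p≤ q≤)

    ∣*∣≤ : ∀ {p q P Q} → ∣ p ∣ ≤ P → ∣ q ∣ ≤ Q → ∣ p * q ∣ ≤ P * Q
    ∣*∣≤ {p} {q} p≤ q≤ = ℚP.≤-trans (ℚP.≤-reflexive (ℚP.∣p*q∣≡∣p∣*∣q∣ p q))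
      (*-mono (ℚP.≤-trans (ℚP.0≤∣p∣ p) p≤) (ℚP.0≤∣p∣ q) p≤ q≤)

    sub-nonneg : ∀ {p q} → 0ℚ ≤ q - p → p ≤ q
    sub-nonneg {p} {q} h = begin
      p           ≤⟨ p≤p+q h ⟩
      p + (q - p) ≡⟨ regroup p q ⟩
      q           ∎
      where
      regroup : ∀ p q → p + (q - p) ≡ q
      regroup = solve-∀ ℚ-ring

  ℕtoℚ-nonneg : ∀ n → 0ℚ ≤ ℕtoℚ n
  ℕtoℚ-nonneg zero    = ℚP.≤-refl
  ℕtoℚ-nonneg (suc n) = subst (0ℚ ≤_) (sym (ℕtoℚ-suc n)) (+-nonneg 0≤1 (ℕtoℚ-nonneg n))

  ℕtoℚ-mono : ∀ {m n} → m ℕ.≤ n → ℕtoℚ m ≤ ℕtoℚ n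
  ℕtoℚ-mono {m} {n} m≤n = subst (ℕtoℚ m ≤_) (trans (sym (ℕtoℚ-+ m (n ℕ.∸ m))) (cong ℕtoℚ (ℕP.m+[n∸m]≡n m≤n)))
    (p≤p+q (ℕtoℚ-nonneg (n ℕ.∸ m)))

  inv-≤ : ∀ n {p} → 1ℚ ≤ ℕtoℚ (suc n) * p → inv n ≤ p
  inv-≤ n {p} h = begin
    inv n                         ≡⟨ ℚP.*-identityʳ (inv n) ⟨
    inv n * 1ℚ                    ≤⟨ *-monoˡ (inv-nonneg n) h ⟩
    inv n * (ℕtoℚ (suc n) * p)    ≡⟨ ℚP.*-assoc (inv n) (ℕtoℚ (suc n)) p ⟨
    inv n * ℕtoℚ (suc n) * p      ≡⟨ cong (_* p) (inv-cancel n) ⟩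
    1ℚ * p                        ≡⟨ ℚP.*-identityˡ p ⟩
    p                             ∎
    where open ℚP.≤-Reasoning

  inv-anti : ∀ {m n} → m ℕ.≤ n → inv n ≤ inv m
  inv-anti {m} {n} m≤n = inv-≤ n (begin
    1ℚ                        ≡⟨ trans (sym (inv-cancel m)) (ℚP.*-comm (inv m) _) ⟩
    ℕtoℚ (suc m) * inv m      ≤⟨ *-monoʳ (inv-nonneg m) (ℕtoℚ-mono (s≤s m≤n)) ⟩
    ℕtoℚ (suc n) * inv m      ∎)
    where open ℚP.≤-Reasoning

  inv≤1 : ∀ n → inv n ≤ 1ℚ
  inv≤1 n = subst (inv n ≤_) inv-0 (inv-anti {0} {n} z≤n)

  ∣inv∣ : ∀ n → ∣ inv n ∣ ≡ inv n
  ∣inv∣ n = ℚP.0≤p⇒∣p∣≡p (inv-nonneg n)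

  *-inv : ∀ m n → inv m * inv n ≡ inv (suc m ℕ.+ n) * (inv m + inv n)
  *-inv m n = begin
    inv m * inv n                                                        ≡⟨ ℚP.*-identityˡ _ ⟨
    1ℚ * (inv m * inv n)                                                 ≡⟨ cong (_* (inv m * inv n)) (inv-cancel (suc m ℕ.+ n)) ⟨
    inv (suc m ℕ.+ n) * ℕtoℚ (suc (suc m ℕ.+ n)) * (inv m * inv n)       ≡⟨ cong (λ z → inv (suc m ℕ.+ n) * z * (inv m * inv n)) split ⟩
    inv (suc m ℕ.+ n) * (ℕtoℚ (suc m) + ℕtoℚ (suc n)) * (inv m * inv n)  ≡⟨ regroup (inv (suc m ℕ.+ n)) (ℕtoℚ (suc m)) (ℕtoℚ (suc n)) (inv m) (inv n) ⟩
    inv (suc m ℕ.+ n) * (inv m * (inv n * ℕtoℚ (suc n)) + inv n * (inv m * ℕtoℚ (suc m)))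
      ≡⟨ cong₂ (λ u v → inv (suc m ℕ.+ n) * (inv m * u + inv n * v)) (inv-cancel n) (inv-cancel m) ⟩
    inv (suc m ℕ.+ n) * (inv m * 1ℚ + inv n * 1ℚ)                        ≡⟨ cong₂ (λ u v → inv (suc m ℕ.+ n) * (u + v)) (ℚP.*-identityʳ (inv m)) (ℚP.*-identityʳ (inv n)) ⟩
    inv (suc m ℕ.+ n) * (inv m + inv n)                                  ∎
    where
    open ≡-Reasoning
    split : ℕtoℚ (suc (suc m ℕ.+ n)) ≡ ℕtoℚ (suc m) + ℕtoℚ (suc n)
    split = trans (cong ℕtoℚ (sym (ℕP.+-suc (suc m) n))) (ℕtoℚ-+ (suc m) (suc n))
    regroup : ∀ i a b x y → i * (a + b) * (x * y) ≡ i * (x * (y * b) + y * (x * a))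
    regroup = solve-∀ ℚ-ring

  inv-suc : ∀ n → inv n ≡ inv (suc n) * (1ℚ + inv n)
  inv-suc n = trans (sym (ℚP.*-identityˡ (inv n))) (subst (λ z → z * inv n ≡ inv (suc n) * (z + inv n)) inv-0 (*-inv 0 n))

  powℚ-+ : ∀ q m n → powℚ q (m ℕ.+ n) ≡ powℚ q m * powℚ q n
  powℚ-+ q zero    n = sym (ℚP.*-identityˡ _)
  powℚ-+ q (suc m) n = trans (cong (q *_) (powℚ-+ q m n)) (sym (ℚP.*-assoc q _ _))

  powℚ-* : ∀ p q n → powℚ (p * q) n ≡ powℚ p n * powℚ q n
  powℚ-* p q zero    = refl
  powℚ-* p q (suc n) = trans (cong (p * q *_) (powℚ-* p q n)) (regroup p q (powℚ p n) (powℚ q n))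
    where
    regroup : ∀ p q a b → p * q * (a * b) ≡ p * a * (q * b)
    regroup = solve-∀ ℚ-ring

  powℚ-1 : ∀ n → powℚ 1ℚ n ≡ 1ℚ
  powℚ-1 zero    = refl
  powℚ-1 (suc n) = trans (ℚP.*-identityˡ _) (powℚ-1 n)

  powℚ-nonneg : ∀ {q} → 0ℚ ≤ q → ∀ n → 0ℚ ≤ powℚ q n
  powℚ-nonneg 0≤q zero    = 0≤1
  powℚ-nonneg 0≤q (suc n) = *-nonneg 0≤q (powℚ-nonneg 0≤q n)

  powℚ-mono : ∀ {p q} → 0ℚ ≤ p → p ≤ q → ∀ n → powℚ p n ≤ powℚ q n
  powℚ-mono 0≤p p≤q zero    = ℚP.≤-refl
  powℚ-mono 0≤p p≤q (suc n) = *-mono (ℚP.≤-trans 0≤p p≤q) (powℚ-nonneg 0≤p n) p≤q (powℚ-mono 0≤p p≤q n)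

  powℚ-incr : ∀ {q} → 1ℚ ≤ q → ∀ {m n} → m ℕ.≤ n → powℚ q m ≤ powℚ q n
  powℚ-incr {q} 1≤q {n = n} z≤n = 1≤pow n
    where
    1≤pow : ∀ n → 1ℚ ≤ powℚ q n
    1≤pow zero    = ℚP.≤-refl
    1≤pow (suc n) = *-mono (ℚP.≤-trans 0≤1 1≤q) 0≤1 1≤q (1≤pow n)
  powℚ-incr 1≤q (s≤s m≤n) = *-monoˡ (ℚP.≤-trans 0≤1 1≤q) (powℚ-incr 1≤q m≤n)

  powℚ-neg : ∀ q n → powℚ (- q) n ≡ sgn n * powℚ q n
  powℚ-neg q zero    = refl
  powℚ-neg q (suc n) = trans (cong (- q *_) (powℚ-neg q n)) (regroup q (sgn n) (powℚ q n))
    where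
    regroup : ∀ q s a → - q * (s * a) ≡ - s * (q * a)
    regroup = solve-∀ ℚ-ring

  sgn-+ : ∀ m n → sgn (m ℕ.+ n) ≡ sgn m * sgn n
  sgn-+ zero    n = sym (ℚP.*-identityˡ _)
  sgn-+ (suc m) n = trans (cong -_ (sgn-+ m n)) (ℚP.neg-distribˡ-* (sgn m) (sgn n))

  sgn-square : ∀ n → sgn n * sgn n ≡ 1ℚ
  sgn-square zero    = refl
  sgn-square (suc n) = trans (regroup (sgn n)) (sgn-square n)
    where
    regroup : ∀ s → - s * - s ≡ s * s
    regroup = solve-∀ ℚ-ring

  ∣sgn∣ : ∀ n → ∣ sgn n ∣ ≡ 1ℚ
  ∣sgn∣ zero    = refl
  ∣sgn∣ (suc n) = trans (ℚP.∣-p∣≡∣p∣ (sgn n)) (∣sgn∣ n)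

  sum : ℕ → (ℕ → ℚ) → ℚ
  sum zero    f = 0ℚ
  sum (suc n) f = sum n f + f n

  sum-cong< : ∀ n {f g} → (∀ i → i ℕ.< n → f i ≡ g i) → sum n f ≡ sum n g
  sum-cong< zero    h = refl
  sum-cong< (suc n) h = cong₂ _+_ (sum-cong< n (λ i i<n → h i (ℕP.m≤n⇒m≤1+n i<n))) (h n ℕP.≤-refl)

  sum-cong : ∀ n {f g} → (∀ i → f i ≡ g i) → sum n f ≡ sum n g
  sum-cong n h = sum-cong< n (λ i _ → h i)

  sum-+ : ∀ n f g → sum n (λ i → f i + g i) ≡ sum n f + sum n g
  sum-+ zero    f g = refl
  sum-+ (suc n) f g = trans (cong (_+ (f n + g n)) (sum-+ n f g)) (regroup (sum n f) (sum n g) (f n) (g n))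
    where
    regroup : ∀ a b c d → a + b + (c + d) ≡ a + c + (b + d)
    regroup = solve-∀ ℚ-ring

  sum-*ˡ : ∀ n c f → sum n (λ i → c * f i) ≡ c * sum n f
  sum-*ˡ zero    c f = sym (ℚP.*-zeroʳ c)
  sum-*ˡ (suc n) c f = trans (cong (_+ c * f n) (sum-*ˡ n c f)) (sym (ℚP.*-distribˡ-+ c _ _))

  sum-*ʳ : ∀ n c f → sum n (λ i → f i * c) ≡ sum n f * c
  sum-*ʳ n c f = trans (sum-cong n (λ i → ℚP.*-comm (f i) c)) (trans (sum-*ˡ n c f) (ℚP.*-comm c _))

  sum-neg : ∀ n f → sum n (λ i → - f i) ≡ - sum n f
  sum-neg zero    f = refl
  sum-neg (suc n) f = trans (cong (_- f n) (sum-neg n f)) (sym (ℚP.neg-distrib-+ (sum n f) (f n)))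

  sum-- : ∀ n f g → sum n (λ i → f i - g i) ≡ sum n f - sum n g
  sum-- n f g = trans (sum-+ n f (λ i → - g i)) (cong (sum n f +_) (sum-neg n g))

  sum-0 : ∀ n → sum n (λ _ → 0ℚ) ≡ 0ℚ
  sum-0 zero    = refl
  sum-0 (suc n) = trans (ℚP.+-identityʳ _) (sum-0 n)

  sum-shift : ∀ n f → sum (suc n) f ≡ f 0 + sum n (f ∘ suc)
  sum-shift zero    f = trans (ℚP.+-identityˡ (f 0)) (sym (ℚP.+-identityʳ (f 0)))
  sum-shift (suc n) f = trans (cong (_+ f (suc n)) (sum-shift n f)) (ℚP.+-assoc (f 0) _ _)

  sum-swap : ∀ m n (f : ℕ → ℕ → ℚ) → sum m (λ i → sum n (f i)) ≡ sum n (λ j → sum m (λ i → f i j))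
  sum-swap zero    n f = sym (sum-0 n)
  sum-swap (suc m) n f = trans (cong (_+ sum n (f m)) (sum-swap m n f)) (sym (sum-+ n _ _))

  sum-split : ∀ m n f → sum (m ℕ.+ n) f ≡ sum m f + sum n (λ i → f (m ℕ.+ i))
  sum-split m zero    f = trans (cong (λ k → sum k f) (ℕP.+-identityʳ m)) (sym (ℚP.+-identityʳ _))
  sum-split m (suc n) f = trans (cong (λ k → sum k f) (ℕP.+-suc m n))
    (trans (cong (_+ f (m ℕ.+ n)) (sum-split m n f)) (ℚP.+-assoc (sum m f) _ _))

  sum-mono< : ∀ n {f g} → (∀ i → i ℕ.< n → f i ≤ g i) → sum n f ≤ sum n g
  sum-mono< zero    h = ℚP.≤-refl
  sum-mono< (suc n) h = ℚP.+-mono-≤ (sum-mono< n (λ i i<n → h i (ℕP.m≤n⇒m≤1+n i<n))) (h n ℕP.≤-refl)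

  sum-nonneg : ∀ n {f} → (∀ i → 0ℚ ≤ f i) → 0ℚ ≤ sum n f
  sum-nonneg zero    h = ℚP.≤-refl
  sum-nonneg (suc n) h = +-nonneg (sum-nonneg n h) (h n)

  ∣sum∣≤ : ∀ n {f g} → (∀ i → i ℕ.< n → ∣ f i ∣ ≤ g i) → ∣ sum n f ∣ ≤ sum n g
  ∣sum∣≤ zero    h = ℚP.≤-refl
  ∣sum∣≤ (suc n) h = ∣+∣≤ (∣sum∣≤ n (λ i i<n → h i (ℕP.m≤n⇒m≤1+n i<n))) (h n ℕP.≤-refl)

  sum-reverse : ∀ n f → sum n (λ i → f (n ℕ.∸ suc i)) ≡ sum n f
  sum-reverse zero    f = refl
  sum-reverse (suc n) f = trans (sum-shift n (λ i → f (n ℕ.∸ i)))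
    (trans (cong (f n +_) (sum-reverse n f)) (ℚP.+-comm (f n) _))

  -- Cauchy products

  conv : (ℕ → ℚ) → (ℕ → ℚ) → ℕ → ℚ
  conv f g zero    = f 0 * g 0
  conv f g (suc n) = f 0 * g (suc n) + conv (f ∘ suc) g n

  conv-cong≤ : ∀ n {f f′ g g′} → (∀ i → i ℕ.≤ n → f i ≡ f′ i) → (∀ i → i ℕ.≤ n → g i ≡ g′ i) → conv f g n ≡ conv f′ g′ n
  conv-cong≤ zero    hf hg = cong₂ _*_ (hf 0 z≤n) (hg 0 z≤n)
  conv-cong≤ (suc n) hf hg = cong₂ _+_ (cong₂ _*_ (hf 0 z≤n) (hg (suc n) ℕP.≤-refl))
    (conv-cong≤ n (λ i i≤n → hf (suc i) (s≤s i≤n)) (λ i i≤n → hg i (ℕP.m≤n⇒m≤1+n i≤n)))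

  conv-cong : ∀ n {f f′ g g′} → (∀ i → f i ≡ f′ i) → (∀ i → g i ≡ g′ i) → conv f g n ≡ conv f′ g′ n
  conv-cong n hf hg = conv-cong≤ n (λ i _ → hf i) (λ i _ → hg i)

  conv-+ˡ : ∀ n f f′ g → conv (λ i → f i + f′ i) g n ≡ conv f g n + conv f′ g n
  conv-+ˡ zero    f f′ g = ℚP.*-distribʳ-+ (g 0) (f 0) (f′ 0)
  conv-+ˡ (suc n) f f′ g = trans (cong ((f 0 + f′ 0) * g (suc n) +_) (conv-+ˡ n (f ∘ suc) (f′ ∘ suc) g))
    (regroup (f 0) (f′ 0) (g (suc n)) (conv (f ∘ suc) g n) (conv (f′ ∘ suc) g n))
    where
    regroup : ∀ a b c d e → (a + b) * c + (d + e) ≡ a * c + d + (b * c + e)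
    regroup = solve-∀ ℚ-ring

  conv-*ˡ : ∀ n c f g → conv (λ i → c * f i) g n ≡ c * conv f g n
  conv-*ˡ zero    c f g = ℚP.*-assoc c (f 0) (g 0)
  conv-*ˡ (suc n) c f g = trans (cong (c * f 0 * g (suc n) +_) (conv-*ˡ n c (f ∘ suc) g))
    (regroup c (f 0) (g (suc n)) (conv (f ∘ suc) g n))
    where
    regroup : ∀ c a b d → c * a * b + c * d ≡ c * (a * b + d)
    regroup = solve-∀ ℚ-ring

  conv-suc : ∀ n f g → conv f g (suc n) ≡ conv f (g ∘ suc) n + f (suc n) * g 0
  conv-suc zero    f g = refl
  conv-suc (suc n) f g = trans (cong (f 0 * g (suc (suc n)) +_) (conv-suc n (f ∘ suc) g))
    (sym (ℚP.+-assoc (f 0 * g (suc (suc n))) _ _))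

  conv-comm : ∀ n f g → conv f g n ≡ conv g f n
  conv-comm zero    f g = ℚP.*-comm (f 0) (g 0)
  conv-comm (suc n) f g = trans (conv-suc n f g) (trans (cong₂ _+_ (conv-comm n f (g ∘ suc)) (ℚP.*-comm (f (suc n)) (g 0)))
    (ℚP.+-comm _ (g 0 * f (suc n))))

  conv-+ʳ : ∀ n f g g′ → conv f (λ i → g i + g′ i) n ≡ conv f g n + conv f g′ n
  conv-+ʳ n f g g′ = trans (conv-comm n f _) (trans (conv-+ˡ n g g′ f) (cong₂ _+_ (conv-comm n g f) (conv-comm n g′ f)))

  conv-*ʳ : ∀ n c f g → conv f (λ i → c * g i) n ≡ c * conv f g n
  conv-*ʳ n c f g = trans (conv-comm n f _) (trans (conv-*ˡ n c g f) (cong (c *_) (conv-comm n g f)))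

  conv-0ˡ : ∀ n g → conv (λ _ → 0ℚ) g n ≡ 0ℚ
  conv-0ˡ zero    g = ℚP.*-zeroˡ (g 0)
  conv-0ˡ (suc n) g = trans (cong₂ _+_ (ℚP.*-zeroˡ (g (suc n))) (conv-0ˡ n g)) (ℚP.+-identityˡ 0ℚ)

  conv-assoc : ∀ n f g h → conv (conv f g) h n ≡ conv f (conv g h) n
  conv-assoc zero    f g h = ℚP.*-assoc (f 0) (g 0) (h 0)
  conv-assoc (suc n) f g h = begin
    f 0 * g 0 * h (suc n) + conv (λ i → f 0 * g (suc i) + conv (f ∘ suc) g i) h n
      ≡⟨ cong (f 0 * g 0 * h (suc n) +_) (conv-+ˡ n (λ i → f 0 * g (suc i)) (conv (f ∘ suc) g) h) ⟩
    f 0 * g 0 * h (suc n) + (conv (λ i → f 0 * g (suc i)) h n + conv (conv (f ∘ suc) g) h n)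
      ≡⟨ cong (f 0 * g 0 * h (suc n) +_) (cong₂ _+_ (conv-*ˡ n (f 0) (g ∘ suc) h) (conv-assoc n (f ∘ suc) g h)) ⟩
    f 0 * g 0 * h (suc n) + (f 0 * conv (g ∘ suc) h n + conv (f ∘ suc) (conv g h) n)
      ≡⟨ regroup (f 0) (g 0) (h (suc n)) (conv (g ∘ suc) h n) (conv (f ∘ suc) (conv g h) n) ⟩
    f 0 * (g 0 * h (suc n) + conv (g ∘ suc) h n) + conv (f ∘ suc) (conv g h) n ∎
    where
    open ≡-Reasoning
    regroup : ∀ a b c d e → a * b * c + (a * d + e) ≡ a * (b * c + d) + e
    regroup = solve-∀ ℚ-ring

  δ : ℕ → ℚ
  δ zero    = 1ℚ
  δ (suc _) = 0ℚ

  conv-δ : ∀ n g → conv δ g n ≡ g n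
  conv-δ zero    g = ℚP.*-identityˡ (g 0)
  conv-δ (suc n) g = trans (cong₂ _+_ (ℚP.*-identityˡ (g (suc n))) (conv-0ˡ n g)) (ℚP.+-identityʳ _)

  -- Multiplication of a generating function by 1 - c t
  Δ : ℚ → (ℕ → ℚ) → ℕ → ℚ
  Δ c f zero    = f 0
  Δ c f (suc n) = f (suc n) - c * f n

  Δ-convˡ : ∀ c n f g → Δ c (conv f g) n ≡ conv (Δ c f) g n
  Δ-convˡ c zero    f g = refl
  Δ-convˡ c (suc n) f g = sym (begin
    f 0 * g (suc n) + conv (λ i → f (suc i) - c * f i) g n
      ≡⟨ cong (f 0 * g (suc n) +_) (conv-cong n (λ i → regroup₁ c (f (suc i)) (f i)) (λ i → refl)) ⟩
    f 0 * g (suc n) + conv (λ i → f (suc i) + (- c) * f i) g n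
      ≡⟨ cong (f 0 * g (suc n) +_) (trans (conv-+ˡ n (f ∘ suc) (λ i → (- c) * f i) g) (cong (conv (f ∘ suc) g n +_) (conv-*ˡ n (- c) f g))) ⟩
    f 0 * g (suc n) + (conv (f ∘ suc) g n + (- c) * conv f g n)
      ≡⟨ regroup₂ c (f 0 * g (suc n)) (conv (f ∘ suc) g n) (conv f g n) ⟩
    f 0 * g (suc n) + conv (f ∘ suc) g n - c * conv f g n ∎)
    where
    open ≡-Reasoning
    regroup₁ : ∀ c a b → a - c * b ≡ a + (- c) * b
    regroup₁ = solve-∀ ℚ-ring
    regroup₂ : ∀ c a b d → a + (b + (- c) * d) ≡ a + b - c * d
    regroup₂ = solve-∀ ℚ-ring

  Δ-cong : ∀ c n {f g} → (∀ i → f i ≡ g i) → Δ c f n ≡ Δ c g n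
  Δ-cong c zero    h = h 0
  Δ-cong c (suc n) h = cong₂ (λ u v → u - c * v) (h (suc n)) (h n)

  Δ-convʳ : ∀ c n f g → Δ c (conv f g) n ≡ conv f (Δ c g) n
  Δ-convʳ c n f g = trans (Δ-cong c n (λ i → conv-comm i f g)) (trans (Δ-convˡ c n g f) (conv-comm n (Δ c g) f))

  θ : (ℕ → ℚ) → ℕ → ℚ
  θ f n = ℕtoℚ n * f n

  θ-conv : ∀ n f g → θ (conv f g) n ≡ conv (θ f) g n + conv f (θ g) n
  θ-conv zero f g = regroup (f 0) (g 0)
    where
    regroup : ∀ a b → 0ℚ * (a * b) ≡ 0ℚ * a * b + a * (0ℚ * b)
    regroup = solve-∀ ℚ-ring
  θ-conv (suc n) f g = begin
    ℕtoℚ (suc n) * (f 0 * g (suc n) + conv (f ∘ suc) g n)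
      ≡⟨ cong (_* (f 0 * g (suc n) + conv (f ∘ suc) g n)) (ℕtoℚ-suc n) ⟩
    (1ℚ + ℕtoℚ n) * (f 0 * g (suc n) + conv (f ∘ suc) g n)
      ≡⟨ regroup₁ (ℕtoℚ n) (f 0) (g (suc n)) (conv (f ∘ suc) g n) ⟩
    f 0 * ((1ℚ + ℕtoℚ n) * g (suc n)) + conv (f ∘ suc) g n + ℕtoℚ n * conv (f ∘ suc) g n
      ≡⟨ cong₂ (λ u v → f 0 * (u * g (suc n)) + conv (f ∘ suc) g n + v) (sym (ℕtoℚ-suc n)) (θ-conv n (f ∘ suc) g) ⟩
    f 0 * θ g (suc n) + conv (f ∘ suc) g n + (conv (θ (f ∘ suc)) g n + conv (f ∘ suc) (θ g) n)
      ≡⟨ regroup₂ (f 0) (θ g (suc n)) (g (suc n)) (conv (f ∘ suc) g n) (conv (θ (f ∘ suc)) g n) (conv (f ∘ suc) (θ g) n) ⟩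
    0ℚ * f 0 * g (suc n) + (conv (f ∘ suc) g n + conv (θ (f ∘ suc)) g n) + (f 0 * θ g (suc n) + conv (f ∘ suc) (θ g) n)
      ≡⟨ cong (λ u → 0ℚ * f 0 * g (suc n) + u + (f 0 * θ g (suc n) + conv (f ∘ suc) (θ g) n)) (sym shifted) ⟩
    0ℚ * f 0 * g (suc n) + conv (θ f ∘ suc) g n + (f 0 * θ g (suc n) + conv (f ∘ suc) (θ g) n) ∎
    where
    open ≡-Reasoning
    regroup₁ : ∀ n a b c → (1ℚ + n) * (a * b + c) ≡ a * ((1ℚ + n) * b) + c + n * c
    regroup₁ = solve-∀ ℚ-ring
    regroup₂ : ∀ a b x c d e → a * b + c + (d + e) ≡ 0ℚ * a * x + (c + d) + (a * b + e)
    regroup₂ = solve-∀ ℚ-ring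
    regroup₃ : ∀ n x → (1ℚ + n) * x ≡ x + n * x
    regroup₃ = solve-∀ ℚ-ring
    shifted : conv (θ f ∘ suc) g n ≡ conv (f ∘ suc) g n + conv (θ (f ∘ suc)) g n
    shifted = trans (conv-cong n (λ i → trans (cong (_* f (suc i)) (ℕtoℚ-suc i)) (regroup₃ (ℕtoℚ i) (f (suc i)))) (λ i → refl))
      (conv-+ˡ n (f ∘ suc) (θ (f ∘ suc)) g)

  -- Partial sums, the last index being included
  psum : (ℕ → ℚ) → ℕ → ℚ
  psum f n = sum (suc n) f

  psum-conv : ∀ n f g → psum (conv f g) n ≡ conv f (psum g) n
  psum-conv zero    f g = regroup (f 0) (g 0)
    where
    regroup : ∀ a b → 0ℚ + a * b ≡ a * (0ℚ + b)
    regroup = solve-∀ ℚ-ring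
  psum-conv (suc n) f g = begin
    psum (conv f g) n + conv f g (suc n)                     ≡⟨ cong₂ _+_ (psum-conv n f g) (conv-cong (suc n) {f} (λ _ → refl) diff) ⟩
    conv f (psum g) n + conv f (Δ 1ℚ (psum g)) (suc n)       ≡⟨ cong (conv f (psum g) n +_) (Δ-convʳ 1ℚ (suc n) f (psum g)) ⟨
    conv f (psum g) n + (conv f (psum g) (suc n) - 1ℚ * conv f (psum g) n) ≡⟨ regroup (conv f (psum g) n) (conv f (psum g) (suc n)) ⟩
    conv f (psum g) (suc n)                                  ∎
    where
    open ≡-Reasoning
    regroup : ∀ a b → a + (b - 1ℚ * a) ≡ b
    regroup = solve-∀ ℚ-ring
    regroup′ : ∀ a b → b ≡ a + b - 1ℚ * a
    regroup′ = solve-∀ ℚ-ring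
    diff : ∀ i → g i ≡ Δ 1ℚ (psum g) i
    diff zero    = sym (ℚP.+-identityˡ (g 0))
    diff (suc i) = regroup′ (psum g i) (g (suc i))

module Growth where

  open Sums

  -- One more than the n-th harmonic number, so that its powers increase.
  h : ℕ → ℚ
  h n = 1ℚ + sum n inv

  h-suc : ∀ n → h (suc n) ≡ h n + inv n
  h-suc n = sym (ℚP.+-assoc 1ℚ (sum n inv) (inv n))

  1≤h : ∀ n → 1ℚ ≤ h n
  1≤h n = p≤p+q (sum-nonneg n inv-nonneg)

  0≤h : ∀ n → 0ℚ ≤ h n
  0≤h n = ℚP.≤-trans 0≤1 (1≤h n)

  h-mono : ∀ {m n} → m ℕ.≤ n → h m ≤ h n
  h-mono {m} {n} m≤n = begin
    h m                                                  ≤⟨ p≤p+q (sum-nonneg (n ℕ.∸ m) (λ i → inv-nonneg (m ℕ.+ i))) ⟩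
    h m + sum (n ℕ.∸ m) (λ i → inv (m ℕ.+ i))            ≡⟨ ℚP.+-assoc 1ℚ (sum m inv) _ ⟩
    1ℚ + (sum m inv + sum (n ℕ.∸ m) (λ i → inv (m ℕ.+ i)))  ≡⟨ cong (1ℚ +_) (sum-split m (n ℕ.∸ m) inv) ⟨
    h (m ℕ.+ (n ℕ.∸ m))                                  ≡⟨ cong h (ℕP.m+[n∸m]≡n m≤n) ⟩
    h n                                                  ∎
    where open ℚP.≤-Reasoning

  h-suc≤ : ∀ n → h (suc n) ≤ h n + h n
  h-suc≤ n = subst (_≤ h n + h n) (sym (h-suc n)) (ℚP.+-monoʳ-≤ (h n) (ℚP.≤-trans (inv≤1 n) (1≤h n)))

  powh-mono : ∀ k {m n} → m ℕ.≤ n → powℚ (h m) k ≤ powℚ (h n) k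
  powh-mono k {m} m≤n = powℚ-mono (0≤h m) (h-mono m≤n) k

  pow-secant : ∀ j {x y} → 0ℚ ≤ x → x ≤ y → powℚ y (suc j) ≤ powℚ x (suc j) + ℕtoℚ (suc j) * ((y - x) * powℚ y j)
  pow-secant zero {x} {y} 0≤x x≤y = ℚP.≤-reflexive (regroup x y)
    where
    regroup : ∀ x y → y * 1ℚ ≡ x * 1ℚ + 1ℚ * ((y - x) * 1ℚ)
    regroup = solve-∀ ℚ-ring
  pow-secant (suc j) {x} {y} 0≤x x≤y = begin
    y * powℚ y (suc j)
      ≤⟨ *-monoˡ 0≤y (pow-secant j 0≤x x≤y) ⟩
    y * (x′ + ℕtoℚ (suc j) * ((y - x) * powℚ y j))
      ≡⟨ regroup₁ x y x′ (ℕtoℚ (suc j)) (powℚ y j) ⟩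
    x * x′ + (ℕtoℚ (suc j) * ((y - x) * y′) + (y - x) * x′)
      ≤⟨ ℚP.+-monoʳ-≤ (x * x′) (ℚP.+-monoʳ-≤ (ℕtoℚ (suc j) * ((y - x) * y′)) (*-monoˡ 0≤y-x (powℚ-mono 0≤x x≤y (suc j)))) ⟩
    x * x′ + (ℕtoℚ (suc j) * ((y - x) * y′) + (y - x) * y′)
      ≡⟨ cong (x * x′ +_) (trans (regroup₂ (ℕtoℚ (suc j)) ((y - x) * y′)) (cong (_* ((y - x) * y′)) (sym (ℕtoℚ-suc (suc j))))) ⟩
    x * x′ + ℕtoℚ (suc (suc j)) * ((y - x) * y′) ∎
    where
    open ℚP.≤-Reasoning
    x′ = powℚ x (suc j)
    y′ = powℚ y (suc j)
    0≤y = ℚP.≤-trans 0≤x x≤y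
    0≤y-x : 0ℚ ≤ y - x
    0≤y-x = subst (_≤ y - x) (ℚP.+-inverseʳ x) (ℚP.+-monoˡ-≤ (- x) x≤y)
    regroup₁ : ∀ x y x′ n b → y * (x′ + n * ((y - x) * b)) ≡ x * x′ + (n * ((y - x) * (y * b)) + (y - x) * x′)
    regroup₁ = solve-∀ ℚ-ring
    regroup₂ : ∀ n a → n * a + a ≡ (1ℚ + n) * a
    regroup₂ = solve-∀ ℚ-ring

  powh≤ : ∀ k → Σ ℚ λ c → 0ℚ ≤ c × (∀ m → powℚ (h m) k ≤ c * ℕtoℚ (suc m))
  powh≤ zero = 1ℚ , 0≤1 , λ m → subst (1ℚ ≤_) (sym (ℚP.*-identityˡ (ℕtoℚ (suc m)))) (ℕtoℚ-mono {1} {suc m} (s≤s z≤n))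
  powh≤ (suc k) with powh≤ k
  ... | c , 0≤c , hk = c′ , +-nonneg 0≤1 0≤e , go
    where
    open ℚP.≤-Reasoning
    e = ℕtoℚ (suc k) * (c + c)
    c′ = 1ℚ + e
    0≤e : 0ℚ ≤ e
    0≤e = *-nonneg (ℕtoℚ-nonneg (suc k)) (+-nonneg 0≤c 0≤c)
    step : ∀ m → inv m * powℚ (h (suc m)) k ≤ c + c
    step m = begin
      inv m * powℚ (h (suc m)) k                       ≤⟨ *-monoˡ (inv-nonneg m) (hk (suc m)) ⟩
      inv m * (c * ℕtoℚ (suc (suc m)))                 ≡⟨ cong (λ z → inv m * (c * z)) (ℕtoℚ-suc (suc m)) ⟩
      inv m * (c * (1ℚ + ℕtoℚ (suc m)))                ≡⟨ regroup (inv m) c (ℕtoℚ (suc m)) ⟩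
      c * inv m + c * (inv m * ℕtoℚ (suc m))           ≡⟨ cong (λ z → c * inv m + c * z) (inv-cancel m) ⟩
      c * inv m + c * 1ℚ                               ≤⟨ ℚP.+-monoˡ-≤ (c * 1ℚ) (*-monoˡ 0≤c (inv≤1 m)) ⟩
      c * 1ℚ + c * 1ℚ                                  ≡⟨ cong₂ _+_ (ℚP.*-identityʳ c) (ℚP.*-identityʳ c) ⟩
      c + c                                            ∎
      where
      regroup : ∀ i c n → i * (c * (1ℚ + n)) ≡ c * i + c * (i * n)
      regroup = solve-∀ ℚ-ring
    go : ∀ m → powℚ (h m) (suc k) ≤ c′ * ℕtoℚ (suc m)
    go zero = begin
      powℚ (h 0) (suc k)   ≡⟨ one (suc k) ⟩
      1ℚ                   ≤⟨ p≤p+q 0≤e ⟩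
      c′                   ≡⟨ ℚP.*-identityʳ c′ ⟨
      c′ * ℕtoℚ 1          ∎
      where
      one : ∀ k → powℚ (h 0) k ≡ 1ℚ
      one zero    = refl
      one (suc k) = trans (cong (h 0 *_) (one k)) (ℚP.*-identityʳ 1ℚ)
    go (suc m) = begin
      powℚ (h (suc m)) (suc k)
        ≤⟨ pow-secant k (0≤h m) (h-mono (ℕP.n≤1+n m)) ⟩
      powℚ (h m) (suc k) + ℕtoℚ (suc k) * ((h (suc m) - h m) * powℚ (h (suc m)) k)
        ≡⟨ cong (λ z → powℚ (h m) (suc k) + ℕtoℚ (suc k) * ((z - h m) * powℚ (h (suc m)) k)) (h-suc m) ⟩
      powℚ (h m) (suc k) + ℕtoℚ (suc k) * ((h m + inv m - h m) * powℚ (h (suc m)) k)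
        ≡⟨ cong (λ z → powℚ (h m) (suc k) + ℕtoℚ (suc k) * (z * powℚ (h (suc m)) k)) (cancel (h m) (inv m)) ⟩
      powℚ (h m) (suc k) + ℕtoℚ (suc k) * (inv m * powℚ (h (suc m)) k)
        ≤⟨ ℚP.+-mono-≤ (go m) (*-monoˡ (ℕtoℚ-nonneg (suc k)) (step m)) ⟩
      c′ * ℕtoℚ (suc m) + e
        ≤⟨ ℚP.+-monoʳ-≤ (c′ * ℕtoℚ (suc m)) (q≤p+q 0≤1) ⟩
      c′ * ℕtoℚ (suc m) + c′
        ≡⟨ regroup c′ (ℕtoℚ (suc m)) ⟩
      c′ * (1ℚ + ℕtoℚ (suc m))
        ≡⟨ cong (c′ *_) (ℕtoℚ-suc (suc m)) ⟨
      c′ * ℕtoℚ (suc (suc m)) ∎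
      where
      cancel : ∀ a b → a + b - a ≡ b
      cancel = solve-∀ ℚ-ring
      regroup : ∀ a b → a * b + a ≡ a * (1ℚ + b)
      regroup = solve-∀ ℚ-ring

  nonneg-fraction : ∀ p → 0ℚ ≤ p → Σ ℕ λ n → Σ ℕ λ d → p ≡ ℕtoℚ n * inv d
  nonneg-fraction p@(mkℚ (ℤ.+ n) d _) _ = n , d , trans (sym (ℚP.↥p/↧p≡p p)) (/≡*inv n d)
  nonneg-fraction p@(mkℚ ℤ.-[1+ n ] d _) 0≤p = ⊥-elim (ℚP.<-irrefl refl (ℚP.<-≤-trans (ℚP.negative⁻¹ p) 0≤p))

  archimedean : ∀ {p D} → 0ℚ ≤ p → 0ℚ ≤ D → (∀ L → p ≤ D * inv L) → p ≡ 0ℚ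
  archimedean {p} {D} 0≤p 0≤D bound with nonneg-fraction p 0≤p | nonneg-fraction D 0≤D
  ... | zero  , d , refl | _ = ℚP.*-zeroˡ (inv d)
  ... | suc n , d , refl | N , e , refl = ⊥-elim (ℚP.<-irrefl refl (ℚP.<-≤-trans n<1+n (begin
    ℕtoℚ (suc L)                                         ≡⟨ one (ℕtoℚ (suc L)) (inv-cancel d) ⟩
    inv d * ℕtoℚ (suc d) * ℕtoℚ (suc L)                  ≤⟨ *-monoʳ (ℕtoℚ-nonneg (suc L)) (*-monoʳ (ℕtoℚ-nonneg (suc d)) (inv≤p)) ⟩
    ℕtoℚ (suc n) * inv d * ℕtoℚ (suc d) * ℕtoℚ (suc L)   ≤⟨ *-monoʳ (ℕtoℚ-nonneg (suc L)) (*-monoʳ (ℕtoℚ-nonneg (suc d)) (bound L)) ⟩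
    ℕtoℚ N * inv e * inv L * ℕtoℚ (suc d) * ℕtoℚ (suc L) ≡⟨ regroup (ℕtoℚ N) (inv e) (inv L) (ℕtoℚ (suc d)) (ℕtoℚ (suc L)) ⟩
    ℕtoℚ N * ℕtoℚ (suc d) * inv e * (inv L * ℕtoℚ (suc L)) ≡⟨ cong (ℕtoℚ N * ℕtoℚ (suc d) * inv e *_) (inv-cancel L) ⟩
    ℕtoℚ N * ℕtoℚ (suc d) * inv e * 1ℚ                   ≡⟨ ℚP.*-identityʳ _ ⟩
    ℕtoℚ N * ℕtoℚ (suc d) * inv e                        ≤⟨ *-monoˡ (*-nonneg (ℕtoℚ-nonneg N) (ℕtoℚ-nonneg (suc d))) (inv≤1 e) ⟩
    ℕtoℚ N * ℕtoℚ (suc d) * 1ℚ                           ≡⟨ ℚP.*-identityʳ _ ⟩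
    ℕtoℚ N * ℕtoℚ (suc d)                                ≡⟨ ℕtoℚ-* N (suc d) ⟨
    ℕtoℚ L                                               ∎)))
    where
    open ℚP.≤-Reasoning
    L = N ℕ.* suc d
    one : ∀ x {y} → y ≡ 1ℚ → x ≡ y * x
    one x refl = sym (ℚP.*-identityˡ x)
    inv≤p : inv d ≤ ℕtoℚ (suc n) * inv d
    inv≤p = subst (_≤ ℕtoℚ (suc n) * inv d) (ℚP.*-identityˡ (inv d)) (*-monoʳ (inv-nonneg d) (ℕtoℚ-mono {1} {suc n} (s≤s z≤n)))
    regroup : ∀ a b c d e → a * b * c * d * e ≡ a * d * b * (c * e)
    regroup = solve-∀ ℚ-ring
    n<1+n : ℕtoℚ L < ℕtoℚ (suc L)
    n<1+n = subst₂ _<_ (ℚP.+-identityˡ (ℕtoℚ L)) (sym (ℕtoℚ-suc L)) (ℚP.+-monoˡ-< (ℕtoℚ L) (ℚP.positive⁻¹ 1ℚ))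

  -- Growth classes: s = O(η^k g) for some k, where η plays the role of a logarithm.

  record Bnd (η g s : ℕ → ℚ) : Set where
    constructor bnd
    field
      C     : ℚ
      k     : ℕ
      0≤C   : 0ℚ ≤ C
      bound : ∀ m → ∣ s m ∣ ≤ C * powℚ (η m) k * g m

  bnd-cong : ∀ {η g s t} → (∀ m → s m ≡ t m) → Bnd η g s → Bnd η g t
  bnd-cong e (bnd C k 0≤C b) = bnd C k 0≤C (λ m → subst (λ z → ∣ z ∣ ≤ _) (e m) (b m))

  bnd-neg : ∀ {η g s} → Bnd η g s → Bnd η g (λ m → - s m)
  bnd-neg {s = s} (bnd C k 0≤C b) = bnd C k 0≤C (λ m → subst (_≤ _) (sym (ℚP.∣-p∣≡∣p∣ (s m))) (b m))

  bnd-∘ : ∀ {η g s} (u : ℕ → ℕ) → Bnd η g s → Bnd (η ∘ u) (g ∘ u) (s ∘ u)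
  bnd-∘ u (bnd C k 0≤C b) = bnd C k 0≤C (b ∘ u)

  module Classes (η : ℕ → ℚ) (1≤η : ∀ m → 1ℚ ≤ η m) where
    open ℚP.≤-Reasoning

    private
      pow-≤ : ∀ {m n} → m ℕ.≤ n → ∀ i → powℚ (η i) m ≤ powℚ (η i) n
      pow-≤ m≤n i = powℚ-incr (1≤η i) m≤n
      pow-0≤ : ∀ i k → 0ℚ ≤ powℚ (η i) k
      pow-0≤ i = powℚ-nonneg (ℚP.≤-trans 0≤1 (1≤η i))

    bnd-+ : ∀ {g s t} → (∀ m → 0ℚ ≤ g m) → Bnd η g s → Bnd η g t → Bnd η g (λ m → s m + t m)
    bnd-+ {g} {s} {t} 0≤g (bnd C k 0≤C b) (bnd D l 0≤D b′) = bnd (C + D) (k ℕ.+ l) (+-nonneg 0≤C 0≤D) λ m → begin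
      ∣ s m + t m ∣                                                 ≤⟨ ∣+∣≤ (b m) (b′ m) ⟩
      C * powℚ (η m) k * g m + D * powℚ (η m) l * g m
        ≤⟨ ℚP.+-mono-≤ (*-monoʳ (0≤g m) (*-monoˡ 0≤C (pow-≤ (ℕP.m≤m+n k l) m))) (*-monoʳ (0≤g m) (*-monoˡ 0≤D (pow-≤ (ℕP.m≤n+m l k) m))) ⟩
      C * P m * g m + D * P m * g m                                 ≡⟨ regroup C D (P m) (g m) ⟩
      (C + D) * P m * g m                                           ∎
      where
      P : ℕ → ℚ
      P m = powℚ (η m) (k ℕ.+ l)
      regroup : ∀ c d p g → c * p * g + d * p * g ≡ (c + d) * p * g
      regroup = solve-∀ ℚ-ring

    bnd-* : ∀ {g g′ s t} → Bnd η g s → Bnd η g′ t → Bnd η (λ m → g m * g′ m) (λ m → s m * t m)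
    bnd-* {g} {g′} {s} {t} (bnd C k 0≤C b) (bnd D l 0≤D b′) = bnd (C * D) (k ℕ.+ l) (*-nonneg 0≤C 0≤D) λ m → begin
      ∣ s m * t m ∣                                                 ≤⟨ ∣*∣≤ (b m) (b′ m) ⟩
      C * powℚ (η m) k * g m * (D * powℚ (η m) l * g′ m)            ≡⟨ regroup C D (powℚ (η m) k) (powℚ (η m) l) (g m) (g′ m) ⟩
      C * D * (powℚ (η m) k * powℚ (η m) l) * (g m * g′ m)          ≡⟨ cong (λ z → C * D * z * (g m * g′ m)) (powℚ-+ (η m) k l) ⟨
      C * D * powℚ (η m) (k ℕ.+ l) * (g m * g′ m)                   ∎
      where
      regroup : ∀ c d p q g g′ → c * p * g * (d * q * g′) ≡ c * d * (p * q) * (g * g′)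
      regroup = solve-∀ ℚ-ring

    bnd-≤ : ∀ {g g′ s} c → 0ℚ ≤ c → (∀ m → g m ≤ c * g′ m) → Bnd η g s → Bnd η g′ s
    bnd-≤ {g} {g′} {s} c 0≤c le (bnd C k 0≤C b) = bnd (C * c) k (*-nonneg 0≤C 0≤c) λ m → begin
      ∣ s m ∣                             ≤⟨ b m ⟩
      C * powℚ (η m) k * g m              ≤⟨ *-monoˡ (*-nonneg 0≤C (pow-0≤ m k)) (le m) ⟩
      C * powℚ (η m) k * (c * g′ m)       ≡⟨ regroup C c (powℚ (η m) k) (g′ m) ⟩
      C * c * powℚ (η m) k * g′ m         ∎
      where
      regroup : ∀ a c p g → a * p * (c * g) ≡ a * c * p * g
      regroup = solve-∀ ℚ-ring

    one : ℕ → ℚ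
    one _ = 1ℚ

    bnd-const : ∀ c → Bnd η one (λ _ → c)
    bnd-const c = bnd ∣ c ∣ 0 (ℚP.0≤∣p∣ c) (λ m → ℚP.≤-reflexive (sym (trans (ℚP.*-identityʳ _) (ℚP.*-identityʳ _))))

    bnd-*one : ∀ {g s t} → (∀ m → 0ℚ ≤ g m) → Bnd η one s → Bnd η g t → Bnd η g (λ m → s m * t m)
    bnd-*one {g} 0≤g x y = bnd-≤ 1ℚ 0≤1 (λ m → ℚP.≤-refl) (bnd-* x y)

    bnd-scale : ∀ {g s} → (∀ m → 0ℚ ≤ g m) → ∀ c → Bnd η g s → Bnd η g (λ m → c * s m)
    bnd-scale 0≤g c x = bnd-*one 0≤g (bnd-const c) x

    bnd-- : ∀ {g s t} → (∀ m → 0ℚ ≤ g m) → Bnd η g s → Bnd η g t → Bnd η g (λ m → s m - t m)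
    bnd-- 0≤g x y = bnd-+ 0≤g x (bnd-neg y)

    bnd-0 : ∀ {g} → (∀ m → 0ℚ ≤ g m) → Bnd η g (λ _ → 0ℚ)
    bnd-0 {g} 0≤g = bnd 0ℚ 0 ℚP.≤-refl (λ m → ℚP.≤-reflexive (sym (trans (cong (_* g m) (ℚP.*-zeroˡ 1ℚ)) (ℚP.*-zeroˡ (g m)))))

    bnd-sum : ∀ {g} → (∀ m → 0ℚ ≤ g m) → ∀ n {s : ℕ → ℕ → ℚ} → (∀ i → i ℕ.< n → Bnd η g (s i)) → Bnd η g (λ m → sum n (λ i → s i m))
    bnd-sum 0≤g zero    x = bnd-0 0≤g
    bnd-sum 0≤g (suc n) x = bnd-+ 0≤g (bnd-sum 0≤g n (λ i i<n → x i (ℕP.m≤n⇒m≤1+n i<n))) (x n ℕP.≤-refl)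

    bnd-conv : ∀ {g} → (∀ m → 0ℚ ≤ g m) → ∀ n {f e : ℕ → ℕ → ℚ} → (∀ i → i ℕ.≤ n → Bnd η one (f i)) → (∀ i → i ℕ.≤ n → Bnd η g (e i)) →
               Bnd η g (λ m → conv (λ i → f i m) (λ i → e i m) n)
    bnd-conv 0≤g zero    x y = bnd-*one 0≤g (x 0 z≤n) (y 0 z≤n)
    bnd-conv 0≤g (suc n) x y = bnd-+ 0≤g (bnd-*one 0≤g (x 0 z≤n) (y (suc n) ℕP.≤-refl))
      (bnd-conv 0≤g n (λ i i≤n → x (suc i) (s≤s i≤n)) (λ i i≤n → y i (ℕP.m≤n⇒m≤1+n i≤n)))

  open Classes h 1≤h public

  inv² : ℕ → ℚ
  inv² m = inv m * inv m

  inv²-nonneg : ∀ m → 0ℚ ≤ inv² m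
  inv²-nonneg m = *-nonneg (inv-nonneg m) (inv-nonneg m)

  Log Sml Sml² : (ℕ → ℚ) → Set
  Log  = Bnd h one
  Sml  = Bnd h inv
  Sml² = Bnd h inv²

  conv-as-sum : ∀ n f g → conv f g n ≡ sum (suc n) (λ i → f i * g (n ℕ.∸ i))
  conv-as-sum zero    f g = sym (ℚP.+-identityˡ _)
  conv-as-sum (suc n) f g = trans (cong (f 0 * g (suc n) +_) (conv-as-sum n (f ∘ suc) g))
    (sym (sum-shift (suc n) (λ i → f i * g (suc n ℕ.∸ i))))

  inv-conv-inv : ∀ n → conv inv inv n ≤ ℕtoℚ 4 * h n * inv n
  inv-conv-inv n = begin
    conv inv inv n                                             ≡⟨ conv-as-sum n inv inv ⟩
    sum (suc n) (λ i → inv i * inv (n ℕ.∸ i))                  ≡⟨ sum-cong< (suc n) (λ { i (s≤s i≤n) → trans (*-inv i (n ℕ.∸ i)) (cong (λ z → inv (suc z) * (inv i + inv (n ℕ.∸ i))) (ℕP.m+[n∸m]≡n i≤n)) }) ⟩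
    sum (suc n) (λ i → inv (suc n) * (inv i + inv (n ℕ.∸ i)))  ≡⟨ sum-*ˡ (suc n) (inv (suc n)) _ ⟩
    inv (suc n) * sum (suc n) (λ i → inv i + inv (n ℕ.∸ i))    ≡⟨ cong (inv (suc n) *_) (trans (sum-+ (suc n) inv (λ i → inv (n ℕ.∸ i))) (cong (sum (suc n) inv +_) (sum-reverse (suc n) inv))) ⟩
    inv (suc n) * (sum (suc n) inv + sum (suc n) inv)          ≤⟨ *-mono (inv-nonneg n) (+-nonneg 0≤S 0≤S) (inv-anti (ℕP.n≤1+n n)) (ℚP.+-mono-≤ S≤ S≤) ⟩
    inv n * (h n + h n + (h n + h n))                          ≡⟨ regroup (inv n) (h n) ⟩
    ℕtoℚ 4 * h n * inv n                                       ∎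
    where
    open ℚP.≤-Reasoning
    0≤S = sum-nonneg (suc n) inv-nonneg
    S≤ : sum (suc n) inv ≤ h n + h n
    S≤ = ℚP.≤-trans (q≤p+q 0≤1) (h-suc≤ n)
    regroup : ∀ i x → i * (x + x + (x + x)) ≡ ℕtoℚ 4 * x * i
    regroup = solve-∀ ℚ-ring

  -- Σ_{i+j=n} |x_i||y_j| for x_i = O(1/i), y_j = O(1/j) is O(log n / n).
  convolution-bound : ∀ n {X Y} (x y : ℕ → ℚ) → 0ℚ ≤ X → 0ℚ ≤ Y → (∀ i → i ℕ.≤ n → ∣ x i ∣ ≤ X * inv i) → (∀ i → i ℕ.≤ n → ∣ y i ∣ ≤ Y * inv (n ℕ.∸ i)) →
    ∣ sum (suc n) (λ i → x i * y i) ∣ ≤ ℕtoℚ 4 * (X * Y) * powℚ (h n) 1 * inv n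
  convolution-bound n {X} {Y} x y 0≤X 0≤Y hx hy = begin
    ∣ sum (suc n) (λ i → x i * y i) ∣                          ≤⟨ ∣sum∣≤ (suc n) (λ { i (s≤s i≤n) → ∣*∣≤ (hx i i≤n) (hy i i≤n) }) ⟩
    sum (suc n) (λ i → X * inv i * (Y * inv (n ℕ.∸ i)))        ≡⟨ sum-cong (suc n) (λ i → regroup₁ X Y (inv i) (inv (n ℕ.∸ i))) ⟩
    sum (suc n) (λ i → X * Y * (inv i * inv (n ℕ.∸ i)))        ≡⟨ sum-*ˡ (suc n) (X * Y) _ ⟩
    X * Y * sum (suc n) (λ i → inv i * inv (n ℕ.∸ i))          ≡⟨ cong (X * Y *_) (conv-as-sum n inv inv) ⟨
    X * Y * conv inv inv n                                     ≤⟨ *-monoˡ (*-nonneg 0≤X 0≤Y) (inv-conv-inv n) ⟩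
    X * Y * (ℕtoℚ 4 * h n * inv n)                             ≡⟨ regroup₂ (X * Y) (h n) (inv n) ⟩
    ℕtoℚ 4 * (X * Y) * powℚ (h n) 1 * inv n                    ∎
    where
    open ℚP.≤-Reasoning
    regroup₁ : ∀ a b i j → a * i * (b * j) ≡ a * b * (i * j)
    regroup₁ = solve-∀ ℚ-ring
    regroup₂ : ∀ a x i → a * (ℕtoℚ 4 * x * i) ≡ ℕtoℚ 4 * a * (x * 1ℚ) * i
    regroup₂ = solve-∀ ℚ-ring

  bound≤ : ∀ {g s} → (∀ m → 0ℚ ≤ g m) → (b : Bnd h g s) → ∀ {i n} → i ℕ.≤ n → ∣ s i ∣ ≤ Bnd.C b * powℚ (h n) (Bnd.k b) * g i
  bound≤ 0≤g (bnd C k 0≤C b) {i} i≤n = ℚP.≤-trans (b i) (*-monoʳ (0≤g i) (*-monoˡ 0≤C (powh-mono k i≤n)))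

  coef-nonneg : ∀ {g s} (b : Bnd h g s) n → 0ℚ ≤ Bnd.C b * powℚ (h n) (Bnd.k b)
  coef-nonneg b n = *-nonneg (Bnd.0≤C b) (powℚ-nonneg (0≤h n) (Bnd.k b))

  collect : ∀ C D k l x y {A} → A ≤ ℕtoℚ 4 * (C * powℚ x k * (D * powℚ x l)) * powℚ x 1 * y → A ≤ ℕtoℚ 4 * (C * D) * powℚ x (k ℕ.+ (l ℕ.+ 1)) * y
  collect C D k l x y {A} = subst (A ≤_) (trans (regroup (ℕtoℚ 4) C D (powℚ x k) (powℚ x l) (powℚ x 1) y)
    (cong (λ z → ℕtoℚ 4 * (C * D) * z * y) (sym (trans (powℚ-+ x k (l ℕ.+ 1)) (cong (powℚ x k *_) (powℚ-+ x l 1))))))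
    where
    regroup : ∀ f c d p q r y → f * (c * p * (d * q)) * r * y ≡ f * (c * d) * (p * (q * r)) * y
    regroup = solve-∀ ℚ-ring

  Sml-conv : ∀ {f g} → Sml f → Sml g → Sml (conv f g)
  Sml-conv {f} {g} x y = bnd (ℕtoℚ 4 * (Bnd.C x * Bnd.C y)) (Bnd.k x ℕ.+ (Bnd.k y ℕ.+ 1)) (*-nonneg (ℕtoℚ-nonneg 4) (*-nonneg (Bnd.0≤C x) (Bnd.0≤C y))) λ n →
    collect (Bnd.C x) (Bnd.C y) (Bnd.k x) (Bnd.k y) (h n) (inv n) (subst (λ z → ∣ z ∣ ≤ _) (sym (conv-as-sum n f g))
      (convolution-bound n f (λ i → g (n ℕ.∸ i)) (coef-nonneg x n) (coef-nonneg y n) (λ i → bound≤ inv-nonneg x) (λ i _ → bound≤ inv-nonneg y (ℕP.m∸n≤m n i))))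

  psum-Log : ∀ {f} → Sml f → Log (psum f)
  psum-Log {f} x@(bnd C k 0≤C _) = bnd (ℕtoℚ 2 * C) (k ℕ.+ 1) (*-nonneg (ℕtoℚ-nonneg 2) 0≤C) λ n → begin
    ∣ psum f n ∣                                            ≤⟨ ∣sum∣≤ (suc n) (λ { i (s≤s i≤n) → bound≤ inv-nonneg x i≤n }) ⟩
    sum (suc n) (λ i → C * powℚ (h n) k * inv i)            ≡⟨ sum-*ˡ (suc n) (C * powℚ (h n) k) inv ⟩
    C * powℚ (h n) k * sum (suc n) inv                      ≤⟨ *-monoˡ (coef-nonneg x n) (ℚP.≤-trans (q≤p+q 0≤1) (h-suc≤ n)) ⟩
    C * powℚ (h n) k * (h n + h n)                          ≡⟨ regroup C (powℚ (h n) k) (h n) ⟩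
    ℕtoℚ 2 * C * (powℚ (h n) k * powℚ (h n) 1) * 1ℚ         ≡⟨ cong (λ z → ℕtoℚ 2 * C * z * 1ℚ) (powℚ-+ (h n) k 1) ⟨
    ℕtoℚ 2 * C * powℚ (h n) (k ℕ.+ 1) * 1ℚ                  ∎
    where
    open ℚP.≤-Reasoning
    regroup : ∀ c p x → c * p * (x + x) ≡ ℕtoℚ 2 * c * (p * (x * 1ℚ)) * 1ℚ
    regroup = solve-∀ ℚ-ring

  inv-telescope : ∀ n → inv n - inv (suc n) ≡ inv n * inv (suc n)
  inv-telescope n = trans (cong (_- inv (suc n)) (inv-suc n)) (regroup (inv n) (inv (suc n)))
    where
    regroup : ∀ x y → y * (1ℚ + x) - y ≡ x * y
    regroup = solve-∀ ℚ-ring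

  inv²-tail : ∀ a d → sum d (λ i → inv² (suc a ℕ.+ i)) ≤ inv a - inv (a ℕ.+ d)
  inv²-tail a zero    = ℚP.≤-reflexive (sym (trans (cong (λ z → inv a - inv z) (ℕP.+-identityʳ a)) (ℚP.+-inverseʳ (inv a))))
  inv²-tail a (suc d) = begin
    sum d (λ i → inv² (suc a ℕ.+ i)) + inv² (suc a ℕ.+ d)           ≤⟨ ℚP.+-mono-≤ (inv²-tail a d) (*-monoʳ (inv-nonneg (suc (a ℕ.+ d))) (inv-anti (ℕP.n≤1+n (a ℕ.+ d)))) ⟩
    inv a - inv (a ℕ.+ d) + inv (a ℕ.+ d) * inv (suc (a ℕ.+ d))     ≡⟨ cong (inv a - inv (a ℕ.+ d) +_) (inv-telescope (a ℕ.+ d)) ⟨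
    inv a - inv (a ℕ.+ d) + (inv (a ℕ.+ d) - inv (suc (a ℕ.+ d)))   ≡⟨ regroup (inv a) (inv (a ℕ.+ d)) (inv (suc (a ℕ.+ d))) ⟩
    inv a - inv (suc (a ℕ.+ d))                                     ≡⟨ cong (λ z → inv a - inv z) (ℕP.+-suc a d) ⟨
    inv a - inv (a ℕ.+ suc d)                                       ∎
    where
    open ℚP.≤-Reasoning
    regroup : ∀ a b c → a - b + (b - c) ≡ a - c
    regroup = solve-∀ ℚ-ring

  psum-tail : ∀ {f} (x : Sml² f) {a n} → a ℕ.≤ n → ∣ psum f n - psum f a ∣ ≤ Bnd.C x * powℚ (h n) (Bnd.k x) * inv a
  psum-tail {f} x@(bnd C k 0≤C _) {a} {n} a≤n = begin
    ∣ psum f n - psum f a ∣                                       ≡⟨ cong ∣_∣ diff ⟩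
    ∣ sum d (λ i → f (suc a ℕ.+ i)) ∣                             ≤⟨ ∣sum∣≤ d (λ i i<d → bound≤ inv²-nonneg x (subst (suc a ℕ.+ i ℕ.≤_) (ℕP.m+[n∸m]≡n a≤n) (subst (ℕ._≤ a ℕ.+ d) (ℕP.+-suc a i) (ℕP.+-monoʳ-≤ a i<d)))) ⟩
    sum d (λ i → C * powℚ (h n) k * inv² (suc a ℕ.+ i))           ≡⟨ sum-*ˡ d (C * powℚ (h n) k) _ ⟩
    C * powℚ (h n) k * sum d (λ i → inv² (suc a ℕ.+ i))           ≤⟨ *-monoˡ (coef-nonneg x n) (ℚP.≤-trans (inv²-tail a d) (sub-nonneg (subst (0ℚ ≤_) (regroup (inv a) (inv (a ℕ.+ d))) (inv-nonneg (a ℕ.+ d))))) ⟩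
    C * powℚ (h n) k * inv a                                      ∎
    where
    open ℚP.≤-Reasoning
    d = n ℕ.∸ a
    regroup : ∀ a b → b ≡ a - (a - b)
    regroup = solve-∀ ℚ-ring
    cancel : ∀ a b → a + b - a ≡ b
    cancel = solve-∀ ℚ-ring
    diff : psum f n - psum f a ≡ sum d (λ i → f (suc a ℕ.+ i))
    diff = trans (cong (_- psum f a) (trans (cong (psum f) (sym (ℕP.m+[n∸m]≡n a≤n))) (sum-split (suc a) d f))) (cancel (psum f a) _)

  -- The terms f_i g_j with i, j ≤ n < i + j are negligible.
  psum-product : ∀ {f g} → Sml² f → Sml g → Sml (λ n → psum f n * psum g n - psum (conv f g) n)
  psum-product {f} {g} x y = bnd (ℕtoℚ 4 * (Bnd.C y * Bnd.C x)) (Bnd.k y ℕ.+ (Bnd.k x ℕ.+ 1)) (*-nonneg (ℕtoℚ-nonneg 4) (*-nonneg (Bnd.0≤C y) (Bnd.0≤C x))) λ n →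
    collect (Bnd.C y) (Bnd.C x) (Bnd.k y) (Bnd.k x) (h n) (inv n) (subst (λ z → ∣ z ∣ ≤ _) (sym (diff n))
      (convolution-bound n g (λ j → psum f n - psum f (n ℕ.∸ j)) (coef-nonneg y n) (coef-nonneg x n) (λ i → bound≤ inv-nonneg y) (λ i _ → psum-tail x (ℕP.m∸n≤m n i))))
    where
    open ≡-Reasoning
    regroup : ∀ a b c → a * b - a * c ≡ a * (b - c)
    regroup = solve-∀ ℚ-ring
    diff : ∀ n → psum f n * psum g n - psum (conv f g) n ≡ sum (suc n) (λ j → g j * (psum f n - psum f (n ℕ.∸ j)))
    diff n = begin
      psum f n * psum g n - psum (conv f g) n
        ≡⟨ cong₂ _-_ (trans (ℚP.*-comm (psum f n) (psum g n)) (sym (sum-*ʳ (suc n) (psum f n) g)))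
             (trans (sum-cong (suc n) (λ i → conv-comm i f g)) (trans (psum-conv n g f) (conv-as-sum n g (psum f)))) ⟩
      sum (suc n) (λ j → g j * psum f n) - sum (suc n) (λ j → g j * psum f (n ℕ.∸ j))
        ≡⟨ sum-- (suc n) _ _ ⟨
      sum (suc n) (λ j → g j * psum f n - g j * psum f (n ℕ.∸ j))
        ≡⟨ sum-cong (suc n) (λ j → regroup (g j) (psum f n) (psum f (n ℕ.∸ j))) ⟩
      sum (suc n) (λ j → g j * (psum f n - psum f (n ℕ.∸ j))) ∎

module Shuffles where

  open Sums

  ℚ-module : Set₁
  ℚ-module = LeftModule +-*-ring 0ℓ 0ℓ

  coeff-++ : {A : Set} (_≟A_ : DecidableEquality A) (f g : FC A) (a : A) → coeff _≟A_ (f ++ g) a ≡ coeff _≟A_ f a + coeff _≟A_ g a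
  coeff-++ _≟A_ []            g a = sym (ℚP.+-identityˡ _)
  coeff-++ _≟A_ ((q , b) ∷ f) g a with a ≟A b
  ... | yes _ = trans (cong (q +_) (coeff-++ _≟A_ f g a)) (sym (ℚP.+-assoc q _ _))
  ... | no  _ = coeff-++ _≟A_ f g a

  coeff-scale : {A : Set} (_≟A_ : DecidableEquality A) (c : ℚ) (f : FC A) (a : A) → coeff _≟A_ (scale c f) a ≡ c * coeff _≟A_ f a
  coeff-scale _≟A_ c []            a = sym (ℚP.*-zeroʳ c)
  coeff-scale _≟A_ c ((q , b) ∷ f) a with a ≟A b
  ... | yes _ = trans (cong (c * q +_) (coeff-scale _≟A_ c f a)) (sym (ℚP.*-distribˡ-+ c q _))
  ... | no  _ = coeff-scale _≟A_ c f a

  module _ {A : Set} (_≟A_ : DecidableEquality A) where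

    remove : A → FC A → FC A
    remove b []            = []
    remove b ((q , a) ∷ f) with b ≟A a
    ... | yes _ = remove b f
    ... | no  _ = (q , a) ∷ remove b f

    coeff-remove-same : ∀ b f → coeff _≟A_ (remove b f) b ≡ 0ℚ
    coeff-remove-same b []            = refl
    coeff-remove-same b ((q , a) ∷ f) with b ≟A a
    ... | yes _ = coeff-remove-same b f
    ... | no b≢a with b ≟A a
    ...   | yes b≡a = ⊥-elim (b≢a b≡a)
    ...   | no  _   = coeff-remove-same b f

    coeff-remove-other : ∀ b f a → a ≢ b → coeff _≟A_ (remove b f) a ≡ coeff _≟A_ f a
    coeff-remove-other b []            a a≢b = refl
    coeff-remove-other b ((q , c) ∷ f) a a≢b with b ≟A c
    coeff-remove-other b ((q , c) ∷ f) a a≢b | yes refl with a ≟A c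
    ... | yes a≡c = ⊥-elim (a≢b a≡c)
    ... | no  _   = coeff-remove-other b f a a≢b
    coeff-remove-other b ((q , c) ∷ f) a a≢b | no _ with a ≟A c
    ... | yes _ = cong (q +_) (coeff-remove-other b f a a≢b)
    ... | no  _ = coeff-remove-other b f a a≢b

    remove-length : ∀ b f → length (remove b f) ℕ.≤ length f
    remove-length b []            = z≤n
    remove-length b ((q , a) ∷ f) with b ≟A a
    ... | yes _ = ℕP.m≤n⇒m≤1+n (remove-length b f)
    ... | no  _ = s≤s (remove-length b f)

  module Pairing (V : ℚ-module) where
    open LeftModule V public
    open SetoidReasoning ≈ᴹ-setoid public
    open CommSemigroup (CommutativeMonoid.commutativeSemigroup +ᴹ-commutativeMonoid) public using (interchange; x∙yz≈y∙xz; xy∙z≈xz∙y)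

    private
      variable
        A B : Set

    ⟪_,_⟫ : FC A → (A → Carrierᴹ) → Carrierᴹ
    ⟪ [] , φ ⟫          = 0ᴹ
    ⟪ (q , a) ∷ f , φ ⟫ = q *ₗ φ a +ᴹ ⟪ f , φ ⟫

    pair-cong : ∀ (f : FC A) {φ ψ} → (∀ a → φ a ≈ᴹ ψ a) → ⟪ f , φ ⟫ ≈ᴹ ⟪ f , ψ ⟫
    pair-cong []            e = ≈ᴹ-refl
    pair-cong ((q , a) ∷ f) e = +ᴹ-cong (*ₗ-congˡ (e a)) (pair-cong f e)

    pair-++ : ∀ (f g : FC A) φ → ⟪ f ++ g , φ ⟫ ≈ᴹ ⟪ f , φ ⟫ +ᴹ ⟪ g , φ ⟫
    pair-++ []            g φ = ≈ᴹ-sym (+ᴹ-identityˡ _)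
    pair-++ ((q , a) ∷ f) g φ = ≈ᴹ-trans (+ᴹ-congˡ (pair-++ f g φ)) (≈ᴹ-sym (+ᴹ-assoc _ _ _))

    pair-scale : ∀ c (f : FC A) φ → ⟪ scale c f , φ ⟫ ≈ᴹ c *ₗ ⟪ f , φ ⟫
    pair-scale c []            φ = ≈ᴹ-sym (*ₗ-zeroʳ c)
    pair-scale c ((q , a) ∷ f) φ = ≈ᴹ-trans (+ᴹ-cong (*ₗ-assoc c q (φ a)) (pair-scale c f φ)) (≈ᴹ-sym (*ₗ-distribˡ c _ _))

    pair-map : ∀ (k : ℚ × A → ℚ × B) (φ : B → Carrierᴹ) (ψ : A → Carrierᴹ) →
      (∀ q a → ⟪ [ k (q , a) ] , φ ⟫ ≈ᴹ q *ₗ ψ a) → ∀ f → ⟪ map k f , φ ⟫ ≈ᴹ ⟪ f , ψ ⟫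
    pair-map k φ ψ e []            = ≈ᴹ-refl
    pair-map k φ ψ e ((q , a) ∷ f) = +ᴹ-cong (≈ᴹ-trans (≈ᴹ-sym (+ᴹ-identityʳ _)) (e q a)) (pair-map k φ ψ e f)

    pair-concatMap : ∀ (k : ℚ × A → FC B) (φ : B → Carrierᴹ) (ψ : A → Carrierᴹ) →
      (∀ q a → ⟪ k (q , a) , φ ⟫ ≈ᴹ q *ₗ ψ a) → ∀ f → ⟪ concatMap k f , φ ⟫ ≈ᴹ ⟪ f , ψ ⟫
    pair-concatMap k φ ψ e []            = ≈ᴹ-refl
    pair-concatMap k φ ψ e ((q , a) ∷ f) = ≈ᴹ-trans (pair-++ (k (q , a)) _ φ) (+ᴹ-cong (e q a) (pair-concatMap k φ ψ e f))

    pair-wd : ∀ (a : A) φ → ⟪ [ (1ℚ , a) ] , φ ⟫ ≈ᴹ φ a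
    pair-wd a φ = ≈ᴹ-trans (+ᴹ-identityʳ _) (*ₗ-identityˡ (φ a))

    *ₗ-zeroˡ′ : ∀ {q} → q ≡ 0ℚ → ∀ x → q *ₗ x ≈ᴹ 0ᴹ
    *ₗ-zeroˡ′ refl x = *ₗ-zeroˡ x

    neg-one : ∀ x → (- 1ℚ) *ₗ x +ᴹ x ≈ᴹ 0ᴹ
    neg-one x = begin
      (- 1ℚ) *ₗ x +ᴹ x          ≈⟨ +ᴹ-congˡ (*ₗ-identityˡ x) ⟨
      (- 1ℚ) *ₗ x +ᴹ 1ℚ *ₗ x    ≈⟨ *ₗ-distribʳ x (- 1ℚ) 1ℚ ⟨
      0ℚ *ₗ x                   ≈⟨ *ₗ-zeroˡ x ⟩
      0ᴹ                        ∎

    difference-zero : ∀ {x y} → x +ᴹ (- 1ℚ) *ₗ y ≈ᴹ 0ᴹ → x ≈ᴹ y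
    difference-zero {x} {y} e = begin
      x                             ≈⟨ +ᴹ-identityʳ x ⟨
      x +ᴹ 0ᴹ                       ≈⟨ +ᴹ-congˡ (neg-one y) ⟨
      x +ᴹ ((- 1ℚ) *ₗ y +ᴹ y)       ≈⟨ +ᴹ-assoc x _ _ ⟨
      x +ᴹ (- 1ℚ) *ₗ y +ᴹ y         ≈⟨ +ᴹ-congʳ e ⟩
      0ᴹ +ᴹ y                       ≈⟨ +ᴹ-identityˡ y ⟩
      y                             ∎

    pair-⊖ : ∀ (f g : FC A) φ → ⟪ f ⊖ g , φ ⟫ ≈ᴹ ⟪ f , φ ⟫ +ᴹ (- 1ℚ) *ₗ ⟪ g , φ ⟫
    pair-⊖ f g φ = ≈ᴹ-trans (pair-++ f (neg g) φ) (+ᴹ-congˡ (pair-scale (- 1ℚ) g φ))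

    module _ (_≟A_ : DecidableEquality A) where

      pair-remove : ∀ b f φ → ⟪ f , φ ⟫ ≈ᴹ coeff _≟A_ f b *ₗ φ b +ᴹ ⟪ remove _≟A_ b f , φ ⟫
      pair-remove b []            φ = ≈ᴹ-sym (≈ᴹ-trans (+ᴹ-identityʳ _) (*ₗ-zeroˡ (φ b)))
      pair-remove b ((q , a) ∷ f) φ with b ≟A a
      ... | yes refl = begin
        q *ₗ φ b +ᴹ ⟪ f , φ ⟫                                               ≈⟨ +ᴹ-congˡ (pair-remove b f φ) ⟩
        q *ₗ φ b +ᴹ (coeff _≟A_ f b *ₗ φ b +ᴹ ⟪ remove _≟A_ b f , φ ⟫)      ≈⟨ +ᴹ-assoc _ _ _ ⟨
        q *ₗ φ b +ᴹ coeff _≟A_ f b *ₗ φ b +ᴹ ⟪ remove _≟A_ b f , φ ⟫        ≈⟨ +ᴹ-congʳ (*ₗ-distribʳ (φ b) q _) ⟨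
        (q + coeff _≟A_ f b) *ₗ φ b +ᴹ ⟪ remove _≟A_ b f , φ ⟫              ∎
      ... | no _ = begin
        q *ₗ φ a +ᴹ ⟪ f , φ ⟫                                               ≈⟨ +ᴹ-congˡ (pair-remove b f φ) ⟩
        q *ₗ φ a +ᴹ (coeff _≟A_ f b *ₗ φ b +ᴹ ⟪ remove _≟A_ b f , φ ⟫)      ≈⟨ +ᴹ-assoc _ _ _ ⟨
        q *ₗ φ a +ᴹ coeff _≟A_ f b *ₗ φ b +ᴹ ⟪ remove _≟A_ b f , φ ⟫        ≈⟨ +ᴹ-congʳ (+ᴹ-comm _ _) ⟩
        coeff _≟A_ f b *ₗ φ b +ᴹ q *ₗ φ a +ᴹ ⟪ remove _≟A_ b f , φ ⟫        ≈⟨ +ᴹ-assoc _ _ _ ⟩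
        coeff _≟A_ f b *ₗ φ b +ᴹ (q *ₗ φ a +ᴹ ⟪ remove _≟A_ b f , φ ⟫)      ∎

      pair-zero : ∀ n f → length f ℕ.≤ n → (∀ a → coeff _≟A_ f a ≡ 0ℚ) → ∀ φ → ⟪ f , φ ⟫ ≈ᴹ 0ᴹ
      pair-zero n       []            _  z φ = ≈ᴹ-refl
      pair-zero (suc n) ((q , b) ∷ f) (s≤s le) z φ = begin
        ⟪ (q , b) ∷ f , φ ⟫                                                                ≈⟨ pair-remove b ((q , b) ∷ f) φ ⟩
        coeff _≟A_ ((q , b) ∷ f) b *ₗ φ b +ᴹ ⟪ remove _≟A_ b ((q , b) ∷ f) , φ ⟫           ≈⟨ +ᴹ-cong (*ₗ-zeroˡ′ (z b) (φ b)) (pair-zero n (remove _≟A_ b ((q , b) ∷ f)) shorter vanish φ) ⟩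
        0ᴹ +ᴹ 0ᴹ                                                                           ≈⟨ +ᴹ-identityˡ 0ᴹ ⟩
        0ᴹ                                                                                 ∎
        where
        shorter : length (remove _≟A_ b ((q , b) ∷ f)) ℕ.≤ n
        shorter with b ≟A b
        ... | yes _  = ℕP.≤-trans (remove-length _≟A_ b f) le
        ... | no b≢b = ⊥-elim (b≢b refl)
        vanish : ∀ a → coeff _≟A_ (remove _≟A_ b ((q , b) ∷ f)) a ≡ 0ℚ
        vanish a with a ≟A b
        ... | yes refl = coeff-remove-same _≟A_ b ((q , b) ∷ f)
        ... | no a≢b   = trans (coeff-remove-other _≟A_ b ((q , b) ∷ f) a a≢b) (z a)

      pair-Same : ∀ f g → Same _≟A_ f g → ∀ φ → ⟪ f , φ ⟫ ≈ᴹ ⟪ g , φ ⟫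
      pair-Same f g same φ = difference-zero (≈ᴹ-trans (≈ᴹ-sym (pair-⊖ f g φ)) (pair-zero _ (f ⊖ g) ℕP.≤-refl vanish φ))
        where
        cancel : ∀ x → x + (- 1ℚ) * x ≡ 0ℚ
        cancel = solve-∀ ℚ-ring
        vanish : ∀ a → coeff _≟A_ (f ⊖ g) a ≡ 0ℚ
        vanish a = trans (coeff-++ _≟A_ f (neg g) a) (trans (cong₂ _+_ (same a) (coeff-scale _≟A_ (- 1ℚ) g a)) (cancel (coeff _≟A_ g a)))

    Sh : Word → Word → (Word → Carrierᴹ) → Carrierᴹ
    Sh []      v       φ = φ v
    Sh (a ∷ u) []      φ = φ (a ∷ u)
    Sh (a ∷ u) (b ∷ v) φ = Sh u (b ∷ v) (φ ∘ (a ∷_)) +ᴹ Sh (a ∷ u) v (φ ∘ (b ∷_))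

    Sh-[] : ∀ u φ → Sh u [] φ ≈ᴹ φ u
    Sh-[] []      φ = ≈ᴹ-refl
    Sh-[] (a ∷ u) φ = ≈ᴹ-refl

    pair-prefix : ∀ a f φ → ⟪ prefix a f , φ ⟫ ≈ᴹ ⟪ f , φ ∘ (a ∷_) ⟫
    pair-prefix a f φ = pair-map _ φ (φ ∘ (a ∷_)) (λ q w → +ᴹ-identityʳ _) f

    pair-shw : ∀ u v φ → ⟪ shw u v , φ ⟫ ≈ᴹ Sh u v φ
    pair-shw []      v       φ = pair-wd v φ
    pair-shw (a ∷ u) []      φ = pair-wd (a ∷ u) φ
    pair-shw (a ∷ u) (b ∷ v) φ = ≈ᴹ-trans (pair-++ (prefix a (shw u (b ∷ v))) _ φ)
      (+ᴹ-cong (≈ᴹ-trans (pair-prefix a (shw u (b ∷ v)) φ) (pair-shw u (b ∷ v) _)) (≈ᴹ-trans (pair-prefix b (shw (a ∷ u) v) φ) (pair-shw (a ∷ u) v _)))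

    pair-sh : ∀ f g φ → ⟪ sh f g , φ ⟫ ≈ᴹ ⟪ f , (λ u → ⟪ g , (λ v → Sh u v φ) ⟫) ⟫
    pair-sh f g φ = pair-concatMap _ φ _ (λ p u →
      ≈ᴹ-trans (pair-concatMap _ φ (λ v → p *ₗ Sh u v φ) (λ q v → begin
        ⟪ scale (p * q) (shw u v) , φ ⟫     ≈⟨ pair-scale (p * q) (shw u v) φ ⟩
        (p * q) *ₗ ⟪ shw u v , φ ⟫          ≈⟨ *ₗ-cong (ℚP.*-comm p q) (pair-shw u v φ) ⟩
        (q * p) *ₗ Sh u v φ                 ≈⟨ *ₗ-assoc q p _ ⟩
        q *ₗ (p *ₗ Sh u v φ)                ∎) g) (pair-*ₗ p g _)) f
      where
      pair-*ₗ : ∀ p g (φ : Word → Carrierᴹ) → ⟪ g , (λ v → p *ₗ φ v) ⟫ ≈ᴹ p *ₗ ⟪ g , φ ⟫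
      pair-*ₗ p []            φ = ≈ᴹ-sym (*ₗ-zeroʳ p)
      pair-*ₗ p ((q , v) ∷ g) φ = begin
        q *ₗ (p *ₗ φ v) +ᴹ ⟪ g , (λ v → p *ₗ φ v) ⟫   ≈⟨ +ᴹ-cong (≈ᴹ-trans (≈ᴹ-sym (*ₗ-assoc q p (φ v))) (≈ᴹ-trans (*ₗ-congʳ (ℚP.*-comm q p)) (*ₗ-assoc p q (φ v)))) (pair-*ₗ p g φ) ⟩
        p *ₗ (q *ₗ φ v) +ᴹ p *ₗ ⟪ g , φ ⟫             ≈⟨ *ₗ-distribˡ p _ _ ⟨
        p *ₗ (q *ₗ φ v +ᴹ ⟪ g , φ ⟫)                  ∎

    Sh-cong : ∀ u v {φ ψ} → (∀ w → φ w ≈ᴹ ψ w) → Sh u v φ ≈ᴹ Sh u v ψ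
    Sh-cong []      v       e = e v
    Sh-cong (a ∷ u) []      e = e (a ∷ u)
    Sh-cong (a ∷ u) (b ∷ v) e = +ᴹ-cong (Sh-cong u (b ∷ v) (e ∘ (a ∷_))) (Sh-cong (a ∷ u) v (e ∘ (b ∷_)))

    Sh-+ : ∀ u v φ ψ → Sh u v (λ w → φ w +ᴹ ψ w) ≈ᴹ Sh u v φ +ᴹ Sh u v ψ
    Sh-+ []      v       φ ψ = ≈ᴹ-refl
    Sh-+ (a ∷ u) []      φ ψ = ≈ᴹ-refl
    Sh-+ (a ∷ u) (b ∷ v) φ ψ = ≈ᴹ-trans (+ᴹ-cong (Sh-+ u (b ∷ v) _ _) (Sh-+ (a ∷ u) v _ _)) (interchange _ _ _ _)

    Sh-0 : ∀ u v → Sh u v (λ _ → 0ᴹ) ≈ᴹ 0ᴹ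
    Sh-0 []      v       = ≈ᴹ-refl
    Sh-0 (a ∷ u) []      = ≈ᴹ-refl
    Sh-0 (a ∷ u) (b ∷ v) = ≈ᴹ-trans (+ᴹ-cong (Sh-0 u (b ∷ v)) (Sh-0 (a ∷ u) v)) (+ᴹ-identityˡ 0ᴹ)

    Sh-*ₗ : ∀ c u v φ → Sh u v (λ w → c *ₗ φ w) ≈ᴹ c *ₗ Sh u v φ
    Sh-*ₗ c []      v       φ = ≈ᴹ-refl
    Sh-*ₗ c (a ∷ u) []      φ = ≈ᴹ-refl
    Sh-*ₗ c (a ∷ u) (b ∷ v) φ = ≈ᴹ-trans (+ᴹ-cong (Sh-*ₗ c u (b ∷ v) _) (Sh-*ₗ c (a ∷ u) v _)) (≈ᴹ-sym (*ₗ-distribˡ c _ _))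

    Sh-comm : ∀ u v φ → Sh u v φ ≈ᴹ Sh v u φ
    Sh-comm []      v       φ = ≈ᴹ-sym (Sh-[] v φ)
    Sh-comm (a ∷ u) []      φ = ≈ᴹ-refl
    Sh-comm (a ∷ u) (b ∷ v) φ = ≈ᴹ-trans (+ᴹ-cong (Sh-comm u (b ∷ v) _) (Sh-comm (a ∷ u) v _)) (+ᴹ-comm _ _)

    Sh-∷ʳ : ∀ u a v b φ → Sh (u ∷ʳ a) (v ∷ʳ b) φ ≈ᴹ Sh u (v ∷ʳ b) (φ ∘ (_∷ʳ a)) +ᴹ Sh (u ∷ʳ a) v (φ ∘ (_∷ʳ b))
    Sh-∷ʳ []      a []      b φ = +ᴹ-comm _ _
    Sh-∷ʳ []      a (d ∷ v) b φ = begin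
      φ (a ∷ d ∷ v ∷ʳ b) +ᴹ Sh [ a ] (v ∷ʳ b) (φ ∘ (d ∷_))
        ≈⟨ +ᴹ-congˡ (Sh-∷ʳ [] a v b (φ ∘ (d ∷_))) ⟩
      φ (a ∷ d ∷ v ∷ʳ b) +ᴹ (φ (d ∷ (v ∷ʳ b) ∷ʳ a) +ᴹ Sh [ a ] v (φ ∘ (d ∷_) ∘ (_∷ʳ b)))
        ≈⟨ x∙yz≈y∙xz _ _ _ ⟩
      φ (d ∷ (v ∷ʳ b) ∷ʳ a) +ᴹ (φ (a ∷ d ∷ v ∷ʳ b) +ᴹ Sh [ a ] v (φ ∘ (d ∷_) ∘ (_∷ʳ b))) ∎
    Sh-∷ʳ (c ∷ u) a []      b φ = begin
      Sh (u ∷ʳ a) [ b ] (φ ∘ (c ∷_)) +ᴹ φ (b ∷ c ∷ u ∷ʳ a)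
        ≈⟨ +ᴹ-congʳ (Sh-∷ʳ u a [] b (φ ∘ (c ∷_))) ⟩
      Sh u [ b ] (φ ∘ (c ∷_) ∘ (_∷ʳ a)) +ᴹ Sh (u ∷ʳ a) [] (φ ∘ (c ∷_) ∘ (_∷ʳ b)) +ᴹ φ (b ∷ c ∷ u ∷ʳ a)
        ≈⟨ +ᴹ-congʳ (+ᴹ-congˡ (Sh-[] (u ∷ʳ a) _)) ⟩
      Sh u [ b ] (φ ∘ (c ∷_) ∘ (_∷ʳ a)) +ᴹ φ (c ∷ (u ∷ʳ a) ∷ʳ b) +ᴹ φ (b ∷ c ∷ u ∷ʳ a)
        ≈⟨ xy∙z≈xz∙y _ _ _ ⟩
      Sh u [ b ] (φ ∘ (c ∷_) ∘ (_∷ʳ a)) +ᴹ φ (b ∷ c ∷ u ∷ʳ a) +ᴹ φ (c ∷ (u ∷ʳ a) ∷ʳ b) ∎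
    Sh-∷ʳ (c ∷ u) a (d ∷ v) b φ = begin
      Sh (u ∷ʳ a) (d ∷ v ∷ʳ b) (φ ∘ (c ∷_)) +ᴹ Sh (c ∷ u ∷ʳ a) (v ∷ʳ b) (φ ∘ (d ∷_))
        ≈⟨ +ᴹ-cong (Sh-∷ʳ u a (d ∷ v) b (φ ∘ (c ∷_))) (Sh-∷ʳ (c ∷ u) a v b (φ ∘ (d ∷_))) ⟩
      Sh u (d ∷ v ∷ʳ b) (φ ∘ (c ∷_) ∘ (_∷ʳ a)) +ᴹ Sh (u ∷ʳ a) (d ∷ v) (φ ∘ (c ∷_) ∘ (_∷ʳ b)) +ᴹ
        (Sh (c ∷ u) (v ∷ʳ b) (φ ∘ (d ∷_) ∘ (_∷ʳ a)) +ᴹ Sh (c ∷ u ∷ʳ a) v (φ ∘ (d ∷_) ∘ (_∷ʳ b)))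
        ≈⟨ interchange _ _ _ _ ⟩
      Sh u (d ∷ v ∷ʳ b) (φ ∘ (c ∷_) ∘ (_∷ʳ a)) +ᴹ Sh (c ∷ u) (v ∷ʳ b) (φ ∘ (d ∷_) ∘ (_∷ʳ a)) +ᴹ
        (Sh (u ∷ʳ a) (d ∷ v) (φ ∘ (c ∷_) ∘ (_∷ʳ b)) +ᴹ Sh (c ∷ u ∷ʳ a) v (φ ∘ (d ∷_) ∘ (_∷ʳ b))) ∎

    KillsProducts : (Word → Carrierᴹ) → Set
    KillsProducts ψ = ∀ a u b v → Sh (a ∷ u) (b ∷ v) ψ ≈ᴹ 0ᴹ

    -- Modulo products the antipode w ↦ (-1)^|w| (reversal of w) is -1. The proof telescopes the products of a reversed prefix with a suffix.
    antipode : ∀ {ψ} → KillsProducts ψ → ∀ d v → ψ (d ∷ v) ≈ᴹ sgn (length v) *ₗ ψ (reverse (d ∷ v))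
    antipode {ψ} kill d v = go [] d v
      where
      go : ∀ p d v → Sh p v (ψ ∘ (d ∷_)) ≈ᴹ sgn (length v) *ₗ ψ (foldl (flip _∷_) (d ∷ p) v)
      go p d []      = ≈ᴹ-trans (Sh-[] p _) (≈ᴹ-sym (*ₗ-identityˡ _))
      go p d (e ∷ v) = begin
        Sh p (e ∷ v) (ψ ∘ (d ∷_))                                     ≈⟨ difference-zero negate ⟩
        (- 1ℚ) *ₗ Sh (d ∷ p) v (ψ ∘ (e ∷_))                           ≈⟨ *ₗ-congˡ (go (d ∷ p) e v) ⟩
        (- 1ℚ) *ₗ (sgn (length v) *ₗ ψ (foldl (flip _∷_) (e ∷ d ∷ p) v)) ≈⟨ *ₗ-assoc _ _ _ ⟨
        ((- 1ℚ) * sgn (length v)) *ₗ ψ (foldl (flip _∷_) (e ∷ d ∷ p) v)  ≈⟨ *ₗ-congʳ (minus (sgn (length v))) ⟩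
        sgn (length (e ∷ v)) *ₗ ψ (foldl (flip _∷_) (e ∷ d ∷ p) v)    ∎
        where
        minus : ∀ x → (- 1ℚ) * x ≡ - x
        minus = solve-∀ ℚ-ring
        negate : Sh p (e ∷ v) (ψ ∘ (d ∷_)) +ᴹ (- 1ℚ) *ₗ ((- 1ℚ) *ₗ Sh (d ∷ p) v (ψ ∘ (e ∷_))) ≈ᴹ 0ᴹ
        negate = begin
          Sh p (e ∷ v) (ψ ∘ (d ∷_)) +ᴹ (- 1ℚ) *ₗ ((- 1ℚ) *ₗ Sh (d ∷ p) v (ψ ∘ (e ∷_)))   ≈⟨ +ᴹ-congˡ (≈ᴹ-trans (≈ᴹ-sym (*ₗ-assoc _ _ _)) (*ₗ-identityˡ _)) ⟩
          Sh p (e ∷ v) (ψ ∘ (d ∷_)) +ᴹ Sh (d ∷ p) v (ψ ∘ (e ∷_))                         ≈⟨ kill d p e v ⟩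
          0ᴹ                                                                            ∎

  ℚV : ℚ-module
  ℚV = TensorUnit.leftModule

  module ℚ-Pairing = Pairing ℚV

module Polylogarithms where

  open Sums
  open Growth
  open Shuffles

  open ℚ-Pairing using (⟪_,_⟫; pair-wd; pair-++; pair-map; Sh; Sh-cong; Sh-+; Sh-*ₗ; Sh-∷ʳ)

  record Linear {A : Set} (L : (A → ℚ) → ℚ) : Set where
    field
      L-cong : ∀ {φ ψ} → (∀ a → φ a ≡ ψ a) → L φ ≡ L ψ
      L-+    : ∀ φ ψ → L (λ a → φ a + ψ a) ≡ L φ + L ψ
      L-*    : ∀ c φ → L (λ a → c * φ a) ≡ c * L φ

    L-0 : L (λ _ → 0ℚ) ≡ 0ℚ
    L-0 = trans (L-* 0ℚ (λ _ → 0ℚ)) (ℚP.*-zeroˡ (L (λ _ → 0ℚ)))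

    L-conv : ∀ n f (F : A → ℕ → ℚ) → L (λ a → conv f (F a) n) ≡ conv f (λ i → L (λ a → F a i)) n
    L-conv zero    f F = L-* (f 0) _
    L-conv (suc n) f F = trans (L-+ _ _) (cong₂ _+_ (L-* (f 0) _) (L-conv n (f ∘ suc) F))

    L-sum : ∀ n (F : A → ℕ → ℚ) → L (λ a → sum n (F a)) ≡ sum n (λ i → L (λ a → F a i))
    L-sum zero    F = L-0
    L-sum (suc n) F = trans (L-+ _ _) (cong (_+ L (λ a → F a n)) (L-sum n F))

  open Linear

  Sh-linear : ∀ u v → Linear (Sh u v)
  Sh-linear u v = record { L-cong = Sh-cong u v ; L-+ = Sh-+ u v ; L-* = λ c → Sh-*ₗ c u v }

  -- Regularised polylogarithms

  init : Word → Word
  init []          = []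
  init (a ∷ [])    = []
  init (a ∷ b ∷ w) = a ∷ init (b ∷ w)

  is-x0 : X → ℚ
  is-x0 x0 = 1ℚ
  is-x0 x1 = 0ℚ

  last-x0 : Word → ℚ
  last-x0 []          = 0ℚ
  last-x0 (a ∷ [])    = is-x0 a
  last-x0 (a ∷ b ∷ w) = last-x0 (b ∷ w)

  geo : X → ℕ → ℚ
  geo x0 n       = δ n
  geo x1 zero    = 0ℚ
  geo x1 (suc n) = 1ℚ

  -- V w n is the coefficient of t^n in the polylogarithm of w regularised at t = 0, so that it vanishes at w = x0.
  -- The generating series of V solves t dV/dt = (x0 + t/(1-t) x1) V - V x0, read off below letter by letter.
  Vn : ℕ → Word → ℕ → ℚ
  Vn _       []      n       = δ n
  Vn zero    (a ∷ w) n       = 0ℚ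
  Vn (suc k) (a ∷ w) zero    = 0ℚ
  Vn (suc k) (a ∷ w) (suc n) = inv n * (conv (geo a) (Vn k w) (suc n) - last-x0 (a ∷ w) * Vn k (init (a ∷ w)) (suc n))

  length-init : ∀ a w → length (init (a ∷ w)) ≡ length w
  length-init a []      = refl
  length-init a (b ∷ w) = cong suc (length-init b w)

  init-last : ∀ a w → Σ X λ b → a ∷ w ≡ init (a ∷ w) ∷ʳ b
  init-last a []      = a , refl
  init-last a (c ∷ w) with init-last c w
  ... | b , e = b , cong (a ∷_) e

  init-∷ʳ : ∀ w a → init (w ∷ʳ a) ≡ w
  init-∷ʳ []          a = refl
  init-∷ʳ (b ∷ [])    a = refl
  init-∷ʳ (b ∷ c ∷ w) a = cong (b ∷_) (init-∷ʳ (c ∷ w) a)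

  last-∷ʳ : ∀ w a → last-x0 (w ∷ʳ a) ≡ is-x0 a
  last-∷ʳ []          a = refl
  last-∷ʳ (b ∷ [])    a = refl
  last-∷ʳ (b ∷ c ∷ w) a = last-∷ʳ (c ∷ w) a

  opaque
    V : Word → ℕ → ℚ
    V w = Vn (length w) w

    V-[] : ∀ n → V [] n ≡ δ n
    V-[] n = refl

    V-0 : ∀ a w → V (a ∷ w) 0 ≡ 0ℚ
    V-0 a w = refl

    V-suc : ∀ a w n → V (a ∷ w) (suc n) ≡ inv n * (conv (geo a) (V w) (suc n) - last-x0 (a ∷ w) * V (init (a ∷ w)) (suc n))
    V-suc a w n = cong (λ z → inv n * (conv (geo a) (V w) (suc n) - last-x0 (a ∷ w) * Vn z (init (a ∷ w)) (suc n))) (sym (length-init a w))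

  left right : ℕ → Word → ℚ
  left n []      = 0ℚ
  left n (a ∷ w) = conv (geo a) (V w) n
  right n w = last-x0 w * V (init w) n

  θ-V : ∀ w n → θ (V w) n ≡ left n w - right n w
  θ-V [] n = trans (trans (cong (ℕtoℚ n *_) (V-[] n)) (zeroθδ n)) (sym (vanish (V [] n)))
    where
    vanish : ∀ x → 0ℚ - 0ℚ * x ≡ 0ℚ
    vanish = solve-∀ ℚ-ring
    zeroθδ : ∀ n → θ δ n ≡ 0ℚ
    zeroθδ zero    = refl
    zeroθδ (suc n) = ℚP.*-zeroʳ (ℕtoℚ (suc n))
  θ-V (a ∷ []) zero = sym (trans (cong₂ (λ x y → geo a 0 * x - is-x0 a * y) (V-[] 0) (V-[] 0)) (trans (at-zero a) (sym (ℚP.*-zeroˡ (V (a ∷ []) 0)))))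
    where
    at-zero : ∀ a → geo a 0 * 1ℚ - is-x0 a * 1ℚ ≡ 0ℚ
    at-zero x0 = refl
    at-zero x1 = refl
  θ-V (a ∷ b ∷ w) zero = sym (trans (cong₂ (λ x y → geo a 0 * x - last-x0 (b ∷ w) * y) (V-0 b w) (V-0 a (init (b ∷ w))))
      (trans (at-zero (geo a 0) (last-x0 (b ∷ w))) (sym (ℚP.*-zeroˡ (V (a ∷ b ∷ w) 0)))))
    where
    at-zero : ∀ x l → x * 0ℚ - l * 0ℚ ≡ 0ℚ
    at-zero = solve-∀ ℚ-ring
  θ-V (a ∷ w) (suc n) = begin
    ℕtoℚ (suc n) * V (a ∷ w) (suc n)                          ≡⟨ cong (ℕtoℚ (suc n) *_) (V-suc a w n) ⟩
    ℕtoℚ (suc n) * (inv n * R)                                ≡⟨ regroup (ℕtoℚ (suc n)) (inv n) R ⟩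
    inv n * ℕtoℚ (suc n) * R                                  ≡⟨ cong (_* R) (inv-cancel n) ⟩
    1ℚ * R                                                    ≡⟨ ℚP.*-identityˡ R ⟩
    R                                                         ∎
    where
    open ≡-Reasoning
    R = left (suc n) (a ∷ w) - right (suc n) (a ∷ w)
    regroup : ∀ a b c → a * (b * c) ≡ b * a * c
    regroup = solve-∀ ℚ-ring

  *-cancel-suc : ∀ n {x y} → ℕtoℚ (suc n) * x ≡ ℕtoℚ (suc n) * y → x ≡ y
  *-cancel-suc n {x} {y} e = begin
    x                              ≡⟨ unit x ⟩
    inv n * (ℕtoℚ (suc n) * x)     ≡⟨ cong (inv n *_) e ⟩
    inv n * (ℕtoℚ (suc n) * y)     ≡⟨ unit y ⟨
    y                              ∎
    where
    open ≡-Reasoning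
    unit : ∀ x → x ≡ inv n * (ℕtoℚ (suc n) * x)
    unit x = sym (trans (sym (ℚP.*-assoc (inv n) _ x)) (trans (cong (_* x) (inv-cancel n)) (ℚP.*-identityˡ x)))

  Sh-V : ∀ k u v → length u ℕ.+ length v ℕ.≤ k → ∀ n → Sh u v (λ w → V w n) ≡ conv (V u) (V v) n
  Sh-V k       []      v       _ n = sym (trans (conv-cong n {g = V v} V-[] (λ _ → refl)) (conv-δ n (V v)))
  Sh-V k       (a ∷ u) []      _ n = sym (trans (conv-comm n (V (a ∷ u)) (V [])) (trans (conv-cong n {g = V (a ∷ u)} V-[] (λ _ → refl)) (conv-δ n (V (a ∷ u)))))
  Sh-V (suc k) (a ∷ u) (b ∷ v) (s≤s le) zero = trans (cong₂ _+_ (trans (Sh-cong u (b ∷ v) (V-0 a)) (L-0 (Sh-linear u (b ∷ v))))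
                                                               (trans (Sh-cong (a ∷ u) v (V-0 b)) (L-0 (Sh-linear (a ∷ u) v))))
                                                          (sym (trans (cong (_* V (b ∷ v) 0) (V-0 a u)) (ℚP.*-zeroˡ (V (b ∷ v) 0))))
  Sh-V (suc k) u@(a ∷ u′) v@(b ∷ v′) (s≤s le) (suc m) = *-cancel-suc m (begin
    ℕtoℚ n * Sh u v (λ w → V w n)                                       ≡⟨ L-* ShL (ℕtoℚ n) (λ w → V w n) ⟨
    Sh u v (λ w → θ (V w) n)                                            ≡⟨ L-cong ShL (λ w → trans (θ-V w n) (minus (left n w) (right n w))) ⟩
    Sh u v (λ w → left n w + (- 1ℚ) * right n w)                        ≡⟨ trans (L-+ ShL (left n) (λ w → (- 1ℚ) * right n w)) (cong (Sh u v (left n) +_) (L-* ShL (- 1ℚ) (right n))) ⟩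
    Sh u v (left n) + (- 1ℚ) * Sh u v (right n)                         ≡⟨ cong₂ (λ x y → x + (- 1ℚ) * y) lefts rights ⟩
    conv (left′ u) (V v) n + conv (V u) (left′ v) n + (- 1ℚ) * (conv (right′ u) (V v) n + conv (V u) (right′ v) n)
                                                                        ≡⟨ regroup (conv (left′ u) (V v) n) (conv (V u) (left′ v) n) (conv (right′ u) (V v) n) (conv (V u) (right′ v) n) ⟩
    (conv (left′ u) (V v) n + (- 1ℚ) * conv (right′ u) (V v) n) + (conv (V u) (left′ v) n + (- 1ℚ) * conv (V u) (right′ v) n)
                                                                        ≡⟨ cong₂ _+_ (cong (conv (left′ u) (V v) n +_) (conv-*ˡ n (- 1ℚ) (right′ u) (V v))) (cong (conv (V u) (left′ v) n +_) (conv-*ʳ n (- 1ℚ) (V u) (right′ v))) ⟨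
    (conv (left′ u) (V v) n + conv (λ i → (- 1ℚ) * right′ u i) (V v) n) + (conv (V u) (left′ v) n + conv (V u) (λ i → (- 1ℚ) * right′ v i) n)
                                                                        ≡⟨ cong₂ _+_ (conv-+ˡ n (left′ u) (λ i → (- 1ℚ) * right′ u i) (V v)) (conv-+ʳ n (V u) (left′ v) (λ i → (- 1ℚ) * right′ v i)) ⟨
    conv (λ i → left′ u i + (- 1ℚ) * right′ u i) (V v) n + conv (V u) (λ i → left′ v i + (- 1ℚ) * right′ v i) n
                                                                        ≡⟨ cong₂ _+_ (conv-cong n {f′ = θ (V u)} {g = V v} (λ i → sym (trans (θ-V u i) (minus (left i u) (right i u)))) (λ _ → refl))
                                                                                      (conv-cong n {f = V u} {g′ = θ (V v)} (λ _ → refl) (λ i → sym (trans (θ-V v i) (minus (left i v) (right i v))))) ⟩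
    conv (θ (V u)) (V v) n + conv (V u) (θ (V v)) n                     ≡⟨ θ-conv n (V u) (V v) ⟨
    ℕtoℚ n * conv (V u) (V v) n                                         ∎)
    where
    open ≡-Reasoning
    n = suc m
    ShL = Sh-linear u v
    left′ right′ : Word → ℕ → ℚ
    left′ w i  = left i w
    right′ w i = right i w
    minus : ∀ x y → x - y ≡ x + (- 1ℚ) * y
    minus = solve-∀ ℚ-ring
    regroup : ∀ a b c d → a + b + (- 1ℚ) * (c + d) ≡ a + (- 1ℚ) * c + (b + (- 1ℚ) * d)
    regroup = solve-∀ ℚ-ring
    lefts : Sh u v (left n) ≡ conv (left′ u) (V v) n + conv (V u) (left′ v) n
    lefts = cong₂ _+_
      (begin
        Sh u′ v (λ w → conv (geo a) (V w) n)        ≡⟨ L-conv (Sh-linear u′ v) n (geo a) V ⟩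
        conv (geo a) (λ i → Sh u′ v (λ w → V w i)) n ≡⟨ conv-cong n {geo a} (λ _ → refl) (Sh-V k u′ v le) ⟩
        conv (geo a) (conv (V u′) (V v)) n          ≡⟨ conv-assoc n (geo a) (V u′) (V v) ⟨
        conv (conv (geo a) (V u′)) (V v) n          ∎)
      (begin
        Sh u v′ (λ w → conv (geo b) (V w) n)        ≡⟨ L-conv (Sh-linear u v′) n (geo b) V ⟩
        conv (geo b) (λ i → Sh u v′ (λ w → V w i)) n ≡⟨ conv-cong n {geo b} (λ _ → refl) (Sh-V k u v′ (subst (ℕ._≤ k) (ℕP.+-suc (length u′) (length v′)) le)) ⟩
        conv (geo b) (conv (V u) (V v′)) n          ≡⟨ conv-cong n {geo b} (λ _ → refl) (λ i → conv-comm i (V u) (V v′)) ⟩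
        conv (geo b) (conv (V v′) (V u)) n          ≡⟨ conv-assoc n (geo b) (V v′) (V u) ⟨
        conv (conv (geo b) (V v′)) (V u) n          ≡⟨ conv-comm n (conv (geo b) (V v′)) (V u) ⟩
        conv (V u) (conv (geo b) (V v′)) n          ∎)
    a₁ = proj₁ (init-last a u′)
    b₁ = proj₁ (init-last b v′)
    eu : u ≡ init u ∷ʳ a₁
    eu = proj₂ (init-last a u′)
    ev : v ≡ init v ∷ʳ b₁
    ev = proj₂ (init-last b v′)
    right-∷ʳ : ∀ w e → right n (w ∷ʳ e) ≡ is-x0 e * V w n
    right-∷ʳ w e = cong₂ (λ x y → x * V y n) (last-∷ʳ w e) (init-∷ʳ w e)
    last-u : is-x0 a₁ ≡ last-x0 u
    last-u = trans (sym (last-∷ʳ (init u) a₁)) (cong last-x0 (sym eu))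
    last-v : is-x0 b₁ ≡ last-x0 v
    last-v = trans (sym (last-∷ʳ (init v) b₁)) (cong last-x0 (sym ev))
    rights : Sh u v (right n) ≡ conv (right′ u) (V v) n + conv (V u) (right′ v) n
    rights = begin
      Sh u v (right n)
        ≡⟨ cong₂ (λ x y → Sh x y (right n)) eu ev ⟩
      Sh (init u ∷ʳ a₁) (init v ∷ʳ b₁) (right n)
        ≡⟨ Sh-∷ʳ (init u) a₁ (init v) b₁ (right n) ⟩
      Sh (init u) (init v ∷ʳ b₁) (right n ∘ (_∷ʳ a₁)) + Sh (init u ∷ʳ a₁) (init v) (right n ∘ (_∷ʳ b₁))
        ≡⟨ cong₂ (λ x y → Sh (init u) y (right n ∘ (_∷ʳ a₁)) + Sh x (init v) (right n ∘ (_∷ʳ b₁))) eu ev ⟨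
      Sh (init u) v (right n ∘ (_∷ʳ a₁)) + Sh u (init v) (right n ∘ (_∷ʳ b₁))
        ≡⟨ cong₂ _+_ (trans (Sh-cong (init u) v (λ w → right-∷ʳ w a₁)) (Sh-*ₗ (is-x0 a₁) (init u) v (λ w → V w n))) (trans (Sh-cong u (init v) (λ w → right-∷ʳ w b₁)) (Sh-*ₗ (is-x0 b₁) u (init v) (λ w → V w n))) ⟩
      is-x0 a₁ * Sh (init u) v (λ w → V w n) + is-x0 b₁ * Sh u (init v) (λ w → V w n)
        ≡⟨ cong₂ _+_ (cong₂ _*_ last-u (Sh-V k (init u) v (subst (λ z → z ℕ.+ length v ℕ.≤ k) (sym (length-init a u′)) le) n))
                     (cong₂ _*_ last-v (Sh-V k u (init v) (subst (λ z → length u ℕ.+ z ℕ.≤ k) (sym (length-init b v′)) (subst (ℕ._≤ k) (ℕP.+-suc (length u′) (length v′)) le)) n)) ⟩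
      last-x0 u * conv (V (init u)) (V v) n + last-x0 v * conv (V u) (V (init v)) n
        ≡⟨ cong₂ _+_ (conv-*ˡ n (last-x0 u) (V (init u)) (V v)) (conv-*ʳ n (last-x0 v) (V u) (V (init v))) ⟨
      conv (right′ u) (V v) n + conv (V u) (right′ v) n ∎

  V-shuffle : ∀ u v n → Sh u v (λ w → V w n) ≡ conv (V u) (V v) n
  V-shuffle u v = Sh-V _ u v ℕP.≤-refl

  V-x0 : ∀ n → V [ x0 ] n ≡ 0ℚ
  V-x0 zero    = V-0 x0 []
  V-x0 (suc n) = trans (V-suc x0 [] n) (trans (cong₂ (λ y z → inv n * (y - 1ℚ * z)) (trans (conv-δ (suc n) (V [])) (V-[] (suc n))) (V-[] (suc n))) (ℚP.*-zeroʳ (inv n)))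

  inv≤2inv : ∀ n → inv n ≤ ℕtoℚ 2 * inv (suc n)
  inv≤2inv n = begin
    inv n                          ≡⟨ inv-suc n ⟩
    inv (suc n) * (1ℚ + inv n)     ≤⟨ *-monoˡ (inv-nonneg (suc n)) (ℚP.+-monoʳ-≤ 1ℚ (inv≤1 n)) ⟩
    inv (suc n) * (1ℚ + 1ℚ)        ≡⟨ ℚP.*-comm (inv (suc n)) (ℕtoℚ 2) ⟩
    ℕtoℚ 2 * inv (suc n)           ∎
    where open ℚP.≤-Reasoning

  bnd-div : ∀ {g s t} → (∀ m → 0ℚ ≤ g m) → t 0 ≡ 0ℚ → (∀ n → t (suc n) ≡ inv n * s (suc n)) → Bnd h g s → Bnd h (λ m → inv m * g m) t
  bnd-div {g} {s} {t} 0≤g t0 ts x@(bnd C k 0≤C b) = bnd (ℕtoℚ 2 * C) k (*-nonneg (ℕtoℚ-nonneg 2) 0≤C) λ where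
      zero    → subst (λ z → ∣ z ∣ ≤ ℕtoℚ 2 * C * powℚ (h 0) k * (inv 0 * g 0)) (sym t0)
                  (*-nonneg {ℕtoℚ 2 * C * powℚ (h 0) k} {inv 0 * g 0} (*-nonneg {ℕtoℚ 2 * C} {powℚ (h 0) k} (*-nonneg {ℕtoℚ 2} {C} (ℕtoℚ-nonneg 2) 0≤C) (powℚ-nonneg (0≤h 0) k)) (*-nonneg {inv 0} {g 0} (inv-nonneg 0) (0≤g 0)))
      (suc n) → begin
        ∣ t (suc n) ∣                                                     ≡⟨ cong ∣_∣ (ts n) ⟩
        ∣ inv n * s (suc n) ∣                                             ≤⟨ ∣*∣≤ (ℚP.≤-trans (ℚP.≤-reflexive (∣inv∣ n)) (inv≤2inv n)) (b (suc n)) ⟩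
        ℕtoℚ 2 * inv (suc n) * (C * powℚ (h (suc n)) k * g (suc n))       ≡⟨ regroup (ℕtoℚ 2) (inv (suc n)) C (powℚ (h (suc n)) k) (g (suc n)) ⟩
        ℕtoℚ 2 * C * powℚ (h (suc n)) k * (inv (suc n) * g (suc n))       ∎
    where
    open ℚP.≤-Reasoning
    regroup : ∀ t i c p g → t * i * (c * p * g) ≡ t * c * p * (i * g)
    regroup = solve-∀ ℚ-ring

  0≤one : ∀ m → 0ℚ ≤ one m
  0≤one m = 0≤1

  Sml⇒Log : ∀ {s} → Sml s → Log s
  Sml⇒Log = bnd-≤ 1ℚ 0≤1 (λ m → inv≤1 m)

  δ-Sml : Sml δ
  δ-Sml = bnd 1ℚ 0 0≤1 (λ n → subst (∣ δ n ∣ ≤_) (sym (unit (inv n))) (le n))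
    where
    unit : ∀ x → 1ℚ * 1ℚ * x ≡ x
    unit = solve-∀ ℚ-ring
    le : ∀ n → ∣ δ n ∣ ≤ inv n
    le zero    = subst (1ℚ ≤_) (sym inv-0) ℚP.≤-refl
    le (suc n) = inv-nonneg (suc n)

  conv-geo-x1 : ∀ f n → conv (geo x1) f (suc n) ≡ psum f n
  conv-geo-x1 f n = trans (cong₂ _+_ (ℚP.*-zeroˡ (f (suc n))) (ones n)) (ℚP.+-identityˡ _)
    where
    ones : ∀ n → conv (geo x1 ∘ suc) f n ≡ psum f n
    ones n = trans (conv-as-sum n (geo x1 ∘ suc) f)
      (trans (sum-cong (suc n) {λ i → 1ℚ * f (n ℕ.∸ i)} {λ i → f (n ℕ.∸ i)} (λ i → ℚP.*-identityˡ (f (n ℕ.∸ i)))) (sum-reverse (suc n) f))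

  geo-Log : ∀ a {f} → Sml f → Log (conv (geo a) f)
  geo-Log x0 {f} x = bnd-cong (λ n → sym (conv-δ n f)) (Sml⇒Log x)
  geo-Log x1 {f} x = delay (psum-Log x)
    where
    delay : Log (psum f) → Log (conv (geo x1) f)
    delay y@(bnd C k 0≤C b) = bnd C k 0≤C λ where
      zero    → subst (λ z → ∣ z ∣ ≤ C * powℚ (h 0) k * 1ℚ) (sym (ℚP.*-zeroˡ (f 0))) (*-nonneg {C * powℚ (h 0) k} {1ℚ} (coef-nonneg y 0) 0≤1)
      (suc n) → subst (λ z → ∣ z ∣ ≤ C * powℚ (h (suc n)) k * 1ℚ) (sym (conv-geo-x1 f n)) (bound≤ 0≤one y (ℕP.n≤1+n n))

  Vn-Sml : ∀ k w → Sml (Vn k w)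
  Vn-Sml zero    []      = δ-Sml
  Vn-Sml (suc k) []      = δ-Sml
  Vn-Sml zero    (a ∷ w) = bnd-0 inv-nonneg
  Vn-Sml (suc k) (a ∷ w) = bnd-≤ 1ℚ 0≤1 (λ m → ℚP.≤-reflexive (ℚP.*-comm (inv m) 1ℚ))
    (bnd-div {s = λ m → conv (geo a) (Vn k w) m - last-x0 (a ∷ w) * Vn k (init (a ∷ w)) m} {t = Vn (suc k) (a ∷ w)} 0≤one refl (λ n → refl) (bnd-- 0≤one (geo-Log a (Vn-Sml k w)) (bnd-scale 0≤one (last-x0 (a ∷ w)) (Sml⇒Log (Vn-Sml k (init (a ∷ w)))))))

  opaque
    unfolding V
    V-Sml : ∀ w → Sml (V w)
    V-Sml w = Vn-Sml (length w) w

  V-x0∷ : ∀ w → last-x0 (x0 ∷ w) ≡ 0ℚ → ∀ n → V (x0 ∷ w) (suc n) ≡ inv n * V w (suc n)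
  V-x0∷ w l n = trans (V-suc x0 w n) (cong (inv n *_) (trans (cong₂ (λ y z → y - z * V (init (x0 ∷ w)) (suc n)) (conv-δ (suc n) (V w)) l) (regroup (V w (suc n)) (V (init (x0 ∷ w)) (suc n)))))
    where
    regroup : ∀ a b → a - 0ℚ * b ≡ a
    regroup = solve-∀ ℚ-ring

  V-x1∷ : ∀ w → last-x0 (x1 ∷ w) ≡ 0ℚ → ∀ n → V (x1 ∷ w) (suc n) ≡ inv n * psum (V w) n
  V-x1∷ w l n = trans (V-suc x1 w n) (cong (inv n *_) (trans (cong₂ (λ y z → y - z * V (init (x1 ∷ w)) (suc n)) (conv-geo-x1 (V w) n) l) (regroup (psum (V w) n) (V (init (x1 ∷ w)) (suc n)))))
    where
    regroup : ∀ a b → a - 0ℚ * b ≡ a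
    regroup = solve-∀ ℚ-ring

  V-Sml² : ∀ w → last-x0 (x0 ∷ w) ≡ 0ℚ → Sml² (V (x0 ∷ w))
  V-Sml² w l = bnd-div {s = V w} inv-nonneg (V-0 x0 w) (V-x0∷ w l) (V-Sml w)

  -- Truncated multiple zeta values; the letter 0 is read as 1, as ι does.

  zs : YWord → ℕ → ℚ
  zs []       M       = 1ℚ
  zs (k ∷ ks) zero    = 0ℚ
  zs (k ∷ ks) (suc M) = zs (k ∷ ks) M + powℚ (inv M) (suc (k ℕ.∸ 1)) * zs ks M

  last-ι : ∀ j ks → last-x0 (replicate j x0 ++ x1 ∷ ι ks) ≡ 0ℚ
  last-ι zero    []       = refl
  last-ι zero    (k ∷ ks) = nonempty (k ℕ.∸ 1) (last-ι (k ℕ.∸ 1) ks)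
    where
    nonempty : ∀ j → last-x0 (replicate j x0 ++ x1 ∷ ι ks) ≡ 0ℚ → last-x0 (x1 ∷ replicate j x0 ++ x1 ∷ ι ks) ≡ 0ℚ
    nonempty zero    e = e
    nonempty (suc j) e = e
  last-ι (suc zero)    ks = last-ι zero ks
  last-ι (suc (suc j)) ks = last-ι (suc j) ks

  V-ι : ∀ j ks n → V (replicate j x0 ++ x1 ∷ ι ks) (suc n) ≡ powℚ (inv n) (suc j) * psum (V (ι ks)) n
  V-ι zero    ks n = trans (V-x1∷ (ι ks) (last-ι zero ks) n) (cong (_* psum (V (ι ks)) n) (sym (ℚP.*-identityʳ (inv n))))
  V-ι (suc j) ks n = trans (V-x0∷ _ (last-ι (suc j) ks) n) (trans (cong (inv n *_) (V-ι j ks n)) (sym (ℚP.*-assoc (inv n) _ _)))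

  psum-V : ∀ ks M → psum (V (ι ks)) M ≡ zs ks M
  psum-V []       zero    = trans (ℚP.+-identityˡ (V [] 0)) (V-[] 0)
  psum-V []       (suc M) = trans (cong (psum (V []) M +_) (V-[] (suc M))) (trans (ℚP.+-identityʳ _) (psum-V [] M))
  psum-V (k ∷ ks) zero    = trans (ℚP.+-identityˡ _) (first (k ℕ.∸ 1))
    where
    first : ∀ j → V (replicate j x0 ++ x1 ∷ ι ks) 0 ≡ 0ℚ
    first zero    = V-0 x1 (ι ks)
    first (suc j) = V-0 x0 _
  psum-V (k ∷ ks) (suc M) = cong₂ _+_ (psum-V (k ∷ ks) M) (trans (V-ι (k ℕ.∸ 1) ks M) (cong (powℚ (inv M) (suc (k ℕ.∸ 1)) *_) (psum-V ks M)))

  St : YWord → YWord → (YWord → ℚ) → ℚ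
  St []      v       φ = φ v
  St (i ∷ u) []      φ = φ (i ∷ u)
  St (i ∷ u) (j ∷ v) φ = St u (j ∷ v) (φ ∘ (i ∷_)) + (St (i ∷ u) v (φ ∘ (j ∷_)) + St u v (φ ∘ ((i ℕ.+ j) ∷_)))

  pair-st : ∀ u v φ → ⟪ st u v , φ ⟫ ≡ St u v φ
  pair-st []      v       φ = pair-wd v φ
  pair-st (i ∷ u) []      φ = pair-wd (i ∷ u) φ
  pair-st (i ∷ u) (j ∷ v) φ = trans (pair-++ (prefixY i (st u (j ∷ v))) _ φ) (cong₂ _+_ (pre i (st u (j ∷ v)) (pair-st u (j ∷ v) _))
    (trans (pair-++ (prefixY j (st (i ∷ u) v)) _ φ) (cong₂ _+_ (pre j (st (i ∷ u) v) (pair-st (i ∷ u) v _)) (pre (i ℕ.+ j) (st u v) (pair-st u v _)))))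
    where
    pre : ∀ i f {x} → ⟪ f , φ ∘ (i ∷_) ⟫ ≡ x → ⟪ prefixY i f , φ ⟫ ≡ x
    pre i f e = trans (pair-map _ φ (φ ∘ (i ∷_)) (λ q w → ℚP.+-identityʳ _) f) e

  St-linear : ∀ u v → Linear (St u v)
  St-linear u v = record { L-cong = cng u v ; L-+ = plus u v ; L-* = λ c → times c u v }
    where
    cng : ∀ u v {φ ψ} → (∀ w → φ w ≡ ψ w) → St u v φ ≡ St u v ψ
    cng []      v       e = e v
    cng (i ∷ u) []      e = e (i ∷ u)
    cng (i ∷ u) (j ∷ v) e = cong₂ _+_ (cng u (j ∷ v) (e ∘ (i ∷_))) (cong₂ _+_ (cng (i ∷ u) v (e ∘ (j ∷_))) (cng u v (e ∘ ((i ℕ.+ j) ∷_))))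
    regroup : ∀ a b c d e f → a + b + (c + d + (e + f)) ≡ a + (c + e) + (b + (d + f))
    regroup = solve-∀ ℚ-ring
    plus : ∀ u v φ ψ → St u v (λ w → φ w + ψ w) ≡ St u v φ + St u v ψ
    plus []      v       φ ψ = refl
    plus (i ∷ u) []      φ ψ = refl
    plus (i ∷ u) (j ∷ v) φ ψ = trans (cong₂ _+_ (plus u (j ∷ v) _ _) (cong₂ _+_ (plus (i ∷ u) v _ _) (plus u v _ _)))
      (regroup (St u (j ∷ v) _) (St u (j ∷ v) _) (St (i ∷ u) v _) (St (i ∷ u) v _) (St u v _) (St u v _))
    regroup′ : ∀ c x y z → c * x + (c * y + c * z) ≡ c * (x + (y + z))
    regroup′ = solve-∀ ℚ-ring
    times : ∀ c u v φ → St u v (λ w → c * φ w) ≡ c * St u v φ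
    times c []      v       φ = refl
    times c (i ∷ u) []      φ = refl
    times c (i ∷ u) (j ∷ v) φ = trans (cong₂ _+_ (times c u (j ∷ v) _) (cong₂ _+_ (times c (i ∷ u) v _) (times c u v _)))
      (regroup′ c (St u (j ∷ v) _) (St (i ∷ u) v _) (St u v _))

  Positive : YWord → Set
  Positive = All (1 ℕ.≤_)

  zs-stuffle : ∀ M {u v} → Positive u → Positive v → St u v (λ w → zs w M) ≡ zs u M * zs v M
  zs-stuffle M []      pv = sym (ℚP.*-identityˡ _)
  zs-stuffle M {i ∷ u} (pi ∷ pu) [] = sym (ℚP.*-identityʳ _)
  zs-stuffle zero {i ∷ u} {j ∷ v} (pi ∷ pu) (pj ∷ pv) = cong₂ _+_ (L-0 (St-linear u (j ∷ v))) (cong₂ _+_ (L-0 (St-linear (i ∷ u) v)) (L-0 (St-linear u v)))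
  zs-stuffle (suc M) {i ∷ u} {j ∷ v} (pi ∷ pu) (pj ∷ pv) = begin
    St u (j ∷ v) (λ w → zs (i ∷ w) (suc M)) + (St (i ∷ u) v (λ w → zs (j ∷ w) (suc M)) + St u v (λ w → zs ((i ℕ.+ j) ∷ w) (suc M)))
      ≡⟨ cong₂ _+_ (step u (j ∷ v) i) (cong₂ _+_ (step (i ∷ u) v j) (step u v (i ℕ.+ j))) ⟩
    A + p i * St u (j ∷ v) Z + (B + p j * St (i ∷ u) v Z + (C + p (i ℕ.+ j) * St u v Z))
      ≡⟨ regroup₁ A B C (p i * St u (j ∷ v) Z) (p j * St (i ∷ u) v Z) (p (i ℕ.+ j) * St u v Z) ⟩
    A + (B + C) + (p i * St u (j ∷ v) Z + p j * St (i ∷ u) v Z + p (i ℕ.+ j) * St u v Z)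
      ≡⟨ cong₂ _+_ (zs-stuffle M (pi ∷ pu) (pj ∷ pv)) (cong₂ _+_ (cong₂ _+_ (cong (p i *_) (zs-stuffle M pu (pj ∷ pv))) (cong (p j *_) (zs-stuffle M (pi ∷ pu) pv)))
                                       (cong₂ _*_ (pow-+ pi pj) (zs-stuffle M pu pv))) ⟩
    zs (i ∷ u) M * zs (j ∷ v) M + (p i * (zs u M * zs (j ∷ v) M) + p j * (zs (i ∷ u) M * zs v M) + p i * p j * (zs u M * zs v M))
      ≡⟨ regroup₂ (zs (i ∷ u) M) (zs (j ∷ v) M) (p i) (p j) (zs u M) (zs v M) ⟩
    (zs (i ∷ u) M + p i * zs u M) * (zs (j ∷ v) M + p j * zs v M) ∎
    where
    open ≡-Reasoning
    Z : YWord → ℚ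
    Z w = zs w M
    p : ℕ → ℚ
    p k = powℚ (inv M) (suc (k ℕ.∸ 1))
    A = St u (j ∷ v) (λ w → zs (i ∷ w) M)
    B = St (i ∷ u) v (λ w → zs (j ∷ w) M)
    C = St u v (λ w → zs ((i ℕ.+ j) ∷ w) M)
    step : ∀ u v k → St u v (λ w → zs (k ∷ w) M + p k * zs w M) ≡ St u v (λ w → zs (k ∷ w) M) + p k * St u v Z
    step u v k = trans (L-+ (St-linear u v) _ _) (cong (St u v (λ w → zs (k ∷ w) M) +_) (L-* (St-linear u v) (p k) Z))
    pow-+ : ∀ {i j} → 1 ℕ.≤ i → 1 ℕ.≤ j → p (i ℕ.+ j) ≡ p i * p j
    pow-+ {suc i} {suc j} _ _ = powℚ-+ (inv M) (suc i) (suc j)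
    regroup₁ : ∀ a b c d e f → a + d + (b + e + (c + f)) ≡ a + (b + c) + (d + e + f)
    regroup₁ = solve-∀ ℚ-ring
    regroup₂ : ∀ x y p q u v → x * y + (p * (u * y) + q * (x * v) + p * q * (u * v)) ≡ (x + p * u) * (y + q * v)
    regroup₂ = solve-∀ ℚ-ring

module Realisation where

  open Sums
  open Growth
  open Shuffles
  open Polylogarithms

  open ℚ-Pairing using (⟪_,_⟫; pair-Same; pair-⊖; pair-wd; pair-sh; pair-shw; pair-++; pair-scale; pair-map; Sh; Sh-[]; Sh-cong; Sh-+; Sh-*ₗ)
  open Linear

  -- Regularisation at t = 1

  E : ℕ → ℕ → ℚ
  E zero    n = δ n
  E (suc k) n = - inv k * conv (V [ x1 ]) (E k) n

  -- W 0 is the product of exp(-x1 V_{x1}) with the generating series of V; E k is the coefficient of x1^k in the first factor.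
  W : ℕ → Word → ℕ → ℚ
  W k []       n = conv (E k) (V []) n
  W k (x0 ∷ w) n = conv (E k) (V (x0 ∷ w)) n
  W k (x1 ∷ w) n = conv (E k) (V (x1 ∷ w)) n + W (suc k) w n

  strip : (Word → ℚ) → Word → ℚ
  strip ψ []       = 0ℚ
  strip ψ (x0 ∷ w) = 0ℚ
  strip ψ (x1 ∷ w) = ψ w

  W-split : ∀ k w n → W k w n ≡ conv (E k) (V w) n + strip (λ w → W (suc k) w n) w
  W-split k []       n = sym (ℚP.+-identityʳ _)
  W-split k (x0 ∷ w) n = sym (ℚP.+-identityʳ _)
  W-split k (x1 ∷ w) n = refl

  Sh-strip : ∀ u v ψ → Sh u v (strip ψ) ≡ strip (λ u′ → Sh u′ v ψ) u + strip (λ v′ → Sh u v′ ψ) v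
  Sh-strip []       []       ψ = refl
  Sh-strip []       (x0 ∷ v) ψ = refl
  Sh-strip []       (x1 ∷ v) ψ = sym (ℚP.+-identityˡ _)
  Sh-strip (x0 ∷ u) []       ψ = refl
  Sh-strip (x1 ∷ u) []       ψ = trans (sym (Sh-[] u ψ)) (sym (ℚP.+-identityʳ _))
  Sh-strip (x0 ∷ u) (x0 ∷ v) ψ = cong₂ _+_ (L-0 (Sh-linear u (x0 ∷ v))) (L-0 (Sh-linear (x0 ∷ u) v))
  Sh-strip (x0 ∷ u) (x1 ∷ v) ψ = cong (_+ Sh (x0 ∷ u) v ψ) (L-0 (Sh-linear u (x1 ∷ v)))
  Sh-strip (x1 ∷ u) (x0 ∷ v) ψ = cong (Sh u (x0 ∷ v) ψ +_) (L-0 (Sh-linear (x1 ∷ u) v))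
  Sh-strip (x1 ∷ u) (x1 ∷ v) ψ = refl

  W-shuffle : ∀ k u v n → Sh u v (λ w → W k w n) ≡
    conv (E k) (conv (V u) (V v)) n + (strip (λ u′ → Sh u′ v (λ w → W (suc k) w n)) u + strip (λ v′ → Sh u v′ (λ w → W (suc k) w n)) v)
  W-shuffle k u v n = begin
    Sh u v (λ w → W k w n)
      ≡⟨ Sh-cong u v (λ w → W-split k w n) ⟩
    Sh u v (λ w → conv (E k) (V w) n + strip (λ w → W (suc k) w n) w)
      ≡⟨ Sh-+ u v (λ w → conv (E k) (V w) n) (strip (λ w → W (suc k) w n)) ⟩
    Sh u v (λ w → conv (E k) (V w) n) + Sh u v (strip (λ w → W (suc k) w n))
      ≡⟨ cong₂ _+_ (trans (L-conv (Sh-linear u v) n (E k) V) (conv-cong n {f = E k} (λ _ → refl) (V-shuffle u v))) (Sh-strip u v (λ w → W (suc k) w n)) ⟩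
    conv (E k) (conv (V u) (V v)) n + (strip (λ u′ → Sh u′ v (λ w → W (suc k) w n)) u + strip (λ v′ → Sh u v′ (λ w → W (suc k) w n)) v) ∎
    where open ≡-Reasoning

  conv-0ʳ : ∀ n f {g} → (∀ i → g i ≡ 0ℚ) → conv f g n ≡ 0ℚ
  conv-0ʳ n f {g} z = trans (conv-comm n f g) (trans (conv-cong n {g = f} z (λ _ → refl)) (conv-0ˡ n f))

  W-kills-x0 : ∀ k w n → Sh w [ x0 ] (λ y → W k y n) ≡ 0ℚ
  W-kills-x0 k w n = trans (W-shuffle k w [ x0 ] n)
    (trans (cong₂ _+_ (conv-0ʳ n (E k) (λ i → conv-0ʳ i (V w) V-x0)) (trans (ℚP.+-identityʳ _) (tail w))) (ℚP.+-identityˡ 0ℚ))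
    where
    tail : ∀ w → strip (λ u′ → Sh u′ [ x0 ] (λ y → W (suc k) y n)) w ≡ 0ℚ
    tail []       = refl
    tail (x0 ∷ w) = refl
    tail (x1 ∷ w) = W-kills-x0 (suc k) w n

  E-suc : ∀ k n → conv (V [ x1 ]) (E k) n ≡ - (ℕtoℚ (suc k) * E (suc k) n)
  E-suc k n = begin
    Y                                        ≡⟨ ℚP.*-identityˡ Y ⟨
    1ℚ * Y                                   ≡⟨ cong (_* Y) (inv-cancel k) ⟨
    inv k * ℕtoℚ (suc k) * Y                 ≡⟨ regroup (inv k) (ℕtoℚ (suc k)) Y ⟩
    - (ℕtoℚ (suc k) * (- inv k * Y))         ∎
    where
    open ≡-Reasoning
    Y = conv (V [ x1 ]) (E k) n
    regroup : ∀ i m x → i * m * x ≡ - (m * (- i * x))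
    regroup = solve-∀ ℚ-ring

  W-x1 : ∀ k w n → Sh w [ x1 ] (λ y → W k y n) ≡ - (ℕtoℚ k * W (suc k) w n)
  W-x1 k w n = begin
    Sh w [ x1 ] (λ y → W k y n)
      ≡⟨ W-shuffle k w [ x1 ] n ⟩
    conv (E k) (conv (V w) (V [ x1 ])) n + (strip (λ u′ → Sh u′ [ x1 ] (λ y → W (suc k) y n)) w + Sh w [] (λ y → W (suc k) y n))
      ≡⟨ cong₂ _+_ first (cong₂ _+_ (tail w) (trans (Sh-[] w (λ y → W (suc k) y n)) (W-split (suc k) w n))) ⟩
    - (ℕtoℚ (suc k) * A) + (- (ℕtoℚ (suc k) * B) + (A + B))
      ≡⟨ cong (λ z → - (z * A) + (- (z * B) + (A + B))) (ℕtoℚ-suc k) ⟩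
    - ((1ℚ + ℕtoℚ k) * A) + (- ((1ℚ + ℕtoℚ k) * B) + (A + B))
      ≡⟨ regroup (ℕtoℚ k) A B ⟩
    - (ℕtoℚ k * (A + B))
      ≡⟨ cong (λ z → - (ℕtoℚ k * z)) (W-split (suc k) w n) ⟨
    - (ℕtoℚ k * W (suc k) w n) ∎
    where
    open ≡-Reasoning
    A = conv (E (suc k)) (V w) n
    B = strip (λ w → W (suc (suc k)) w n) w
    regroup : ∀ k a b → - ((1ℚ + k) * a) + (- ((1ℚ + k) * b) + (a + b)) ≡ - (k * (a + b))
    regroup = solve-∀ ℚ-ring
    minus : ∀ a b → - (a * b) ≡ (- a) * b
    minus = solve-∀ ℚ-ring
    first : conv (E k) (conv (V w) (V [ x1 ])) n ≡ - (ℕtoℚ (suc k) * A)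
    first = begin
      conv (E k) (conv (V w) (V [ x1 ])) n            ≡⟨ conv-cong n {f = E k} (λ _ → refl) (λ i → conv-comm i (V w) (V [ x1 ])) ⟩
      conv (E k) (conv (V [ x1 ]) (V w)) n            ≡⟨ conv-assoc n (E k) (V [ x1 ]) (V w) ⟨
      conv (conv (E k) (V [ x1 ])) (V w) n            ≡⟨ conv-cong n {g = V w} (λ i → trans (conv-comm i (E k) (V [ x1 ])) (trans (E-suc k i) (minus (ℕtoℚ (suc k)) (E (suc k) i)))) (λ _ → refl) ⟩
      conv (λ i → (- ℕtoℚ (suc k)) * E (suc k) i) (V w) n  ≡⟨ conv-*ˡ n (- ℕtoℚ (suc k)) (E (suc k)) (V w) ⟩
      (- ℕtoℚ (suc k)) * A                            ≡⟨ minus (ℕtoℚ (suc k)) A ⟨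
      - (ℕtoℚ (suc k) * A)                            ∎
    tail : ∀ w → strip (λ u′ → Sh u′ [ x1 ] (λ y → W (suc k) y n)) w ≡ - (ℕtoℚ (suc k) * strip (λ w → W (suc (suc k)) w n) w)
    tail []       = sym (cong -_ (ℚP.*-zeroʳ (ℕtoℚ (suc k))))
    tail (x0 ∷ w) = sym (cong -_ (ℚP.*-zeroʳ (ℕtoℚ (suc k))))
    tail (x1 ∷ w) = W-x1 (suc k) w n

  W-kills-x1 : ∀ w n → Sh w [ x1 ] (λ y → W 0 y n) ≡ 0ℚ
  W-kills-x1 w n = trans (W-x1 0 w n) (cong -_ (ℚP.*-zeroˡ (W 1 w n)))

  E-Sml : ∀ k → Sml (E k)
  E-Sml zero    = δ-Sml
  E-Sml (suc k) = bnd-scale inv-nonneg (- inv k) (Sml-conv (V-Sml [ x1 ]) (E-Sml k))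

  -- Double shuffle

  DS : YWord → YWord → (Word → ℚ) → ℚ
  DS us vs φ = Sh (ι us) (ι vs) φ - St us vs (φ ∘ ι)

  DS-linear : ∀ us vs → Linear (DS us vs)
  DS-linear us vs = record
    { L-cong = λ e → cong₂ _-_ (Sh-cong (ι us) (ι vs) e) (L-cong (St-linear us vs) (e ∘ ι))
    ; L-+ = λ φ ψ → trans (cong₂ _-_ (Sh-+ (ι us) (ι vs) φ ψ) (L-+ (St-linear us vs) (φ ∘ ι) (ψ ∘ ι)))
                      (plus (Sh (ι us) (ι vs) φ) (Sh (ι us) (ι vs) ψ) (St us vs (φ ∘ ι)) (St us vs (ψ ∘ ι)))
    ; L-* = λ q φ → trans (cong₂ _-_ (Sh-*ₗ q (ι us) (ι vs) φ) (L-* (St-linear us vs) q (φ ∘ ι)))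
                      (times q (Sh (ι us) (ι vs) φ) (St us vs (φ ∘ ι)))
    }
    where
    plus : ∀ a b c d → a + b - (c + d) ≡ a - c + (b - d)
    plus = solve-∀ ℚ-ring
    times : ∀ q a b → q * a - q * b ≡ q * (a - b)
    times = solve-∀ ℚ-ring

  stripY : (YWord → ℚ) → YWord → ℚ
  stripY χ []                = 0ℚ
  stripY χ (zero ∷ w)        = χ w
  stripY χ (suc zero ∷ w)    = χ w
  stripY χ (suc (suc _) ∷ w) = 0ℚ

  strip-ι : ∀ ψ vs → strip ψ (ι vs) ≡ stripY (ψ ∘ ι) vs
  strip-ι ψ []                = refl
  strip-ι ψ (zero ∷ w)        = refl
  strip-ι ψ (suc zero ∷ w)    = refl
  strip-ι ψ (suc (suc _) ∷ w) = refl

  stripY-minus : ∀ φ ψ vs → stripY φ vs - stripY ψ vs ≡ stripY (λ w → φ w - ψ w) vs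
  stripY-minus φ ψ []                = refl
  stripY-minus φ ψ (zero ∷ w)        = refl
  stripY-minus φ ψ (suc zero ∷ w)    = refl
  stripY-minus φ ψ (suc (suc _) ∷ w) = refl

  module _ (i : ℕ) (us′ : YWord) (pus′ : Positive us′) where
    private
      us = suc (suc i) ∷ us′
      pus : Positive us
      pus = s≤s z≤n ∷ pus′

    St-strip : ∀ χ vs → Positive vs → St us vs (stripY χ) ≡ stripY (λ vs′ → St us vs′ χ) vs
    St-strip χ [] _ = refl
    St-strip χ (zero ∷ vs) (() ∷ _)
    St-strip χ (suc j ∷ vs) _ = trans (cong₂ _+_ (L-0 (St-linear us′ (suc j ∷ vs))) (cong₂ _+_ (second j) (third j)))
      (trans (ℚP.+-identityˡ _) (ℚP.+-identityʳ _))
      where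
      second : ∀ j → St us vs (stripY χ ∘ (suc j ∷_)) ≡ stripY (λ vs′ → St us vs′ χ) (suc j ∷ vs)
      second zero    = refl
      second (suc j) = L-0 (St-linear us vs)
      third : ∀ j → St us′ vs (stripY χ ∘ ((suc (suc i) ℕ.+ suc j) ∷_)) ≡ 0ℚ
      third j = L-0 (St-linear us′ vs)

    DS-strip : ∀ ψ vs → Positive vs → DS us vs (strip ψ) ≡ stripY (λ vs′ → DS us vs′ ψ) vs
    DS-strip ψ vs pvs = begin
      Sh (ι us) (ι vs) (strip ψ) - St us vs (strip ψ ∘ ι)
        ≡⟨ cong₂ _-_ (trans (Sh-strip (ι us) (ι vs) ψ) (ℚP.+-identityˡ (strip (λ v′ → Sh (ι us) v′ ψ) (ι vs)))) (trans (L-cong (St-linear us vs) (strip-ι ψ)) (St-strip (ψ ∘ ι) vs pvs)) ⟩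
      strip (λ v′ → Sh (ι us) v′ ψ) (ι vs) - stripY (λ vs′ → St us vs′ (ψ ∘ ι)) vs
        ≡⟨ cong (_- stripY (λ vs′ → St us vs′ (ψ ∘ ι)) vs) (strip-ι (λ v′ → Sh (ι us) v′ ψ) vs) ⟩
      stripY (λ vs′ → Sh (ι us) (ι vs′) ψ) vs - stripY (λ vs′ → St us vs′ (ψ ∘ ι)) vs
        ≡⟨ stripY-minus (λ vs′ → Sh (ι us) (ι vs′) ψ) (λ vs′ → St us vs′ (ψ ∘ ι)) vs ⟩
      stripY (λ vs′ → DS us vs′ ψ) vs ∎
      where open ≡-Reasoning

    dsV : YWord → ℕ → ℚ
    dsV vs n = DS us vs (λ y → V y n)

    dsV-Sml : ∀ vs → Positive vs → Sml (psum (dsV vs))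
    dsV-Sml vs pvs = bnd-cong (λ M → sym (expand M))
      (bnd-neg (psum-product (V-Sml² (replicate i x0 ++ x1 ∷ ι us′) (last-ι (suc i) us′)) (V-Sml (ι vs))))
      where
      open ≡-Reasoning
      A = V (ι us)
      B = V (ι vs)
      swap : ∀ a b → a - b ≡ - (b - a)
      swap = solve-∀ ℚ-ring
      expand : ∀ M → psum (dsV vs) M ≡ - (psum A M * psum B M - psum (conv A B) M)
      expand M = begin
        psum (dsV vs) M
          ≡⟨ sum-- (suc M) (λ n → Sh (ι us) (ι vs) (λ y → V y n)) (λ n → St us vs (λ y → V (ι y) n)) ⟩
        psum (λ n → Sh (ι us) (ι vs) (λ y → V y n)) M - psum (λ n → St us vs (λ y → V (ι y) n)) M
          ≡⟨ cong₂ _-_ (sum-cong (suc M) (V-shuffle (ι us) (ι vs))) (sym (L-sum (St-linear us vs) (suc M) (V ∘ ι))) ⟩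
        psum (conv A B) M - St us vs (λ y → psum (V (ι y)) M)
          ≡⟨ cong (λ z → psum (conv A B) M - z) (L-cong (St-linear us vs) (λ y → psum-V y M)) ⟩
        psum (conv A B) M - St us vs (λ y → zs y M)
          ≡⟨ cong (λ z → psum (conv A B) M - z) (trans (zs-stuffle M pus pvs) (sym (cong₂ _*_ (psum-V us M) (psum-V vs M)))) ⟩
        psum (conv A B) M - psum A M * psum B M
          ≡⟨ swap (psum (conv A B) M) (psum A M * psum B M) ⟩
        - (psum A M * psum B M - psum (conv A B) M) ∎

    dsW : Word → YWord → ℕ → ℕ → ℚ
    dsW w vs k n = DS us vs (λ y → Sh w y (λ z → W k z n))

    dsW-split : ∀ w vs k → Positive vs → ∀ n → dsW w vs k n ≡
      conv (conv (E k) (V w)) (dsV vs) n + (strip (λ w′ → dsW w′ vs (suc k) n) w + stripY (λ vs′ → dsW w vs′ (suc k) n) vs)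
    dsW-split w vs k pvs n = begin
      DS us vs (λ y → Sh w y (λ z → W k z n))
        ≡⟨ L-cong ds (λ y → W-shuffle k w y n) ⟩
      DS us vs (λ y → conv (E k) (conv (V w) (V y)) n + (strip (λ w′ → Sh w′ y W′) w + strip (λ y′ → Sh w y′ W′) y))
        ≡⟨ trans (L-+ ds _ _) (cong (DS us vs (λ y → conv (E k) (conv (V w) (V y)) n) +_) (L-+ ds _ _)) ⟩
      DS us vs (λ y → conv (E k) (conv (V w) (V y)) n) + (DS us vs (λ y → strip (λ w′ → Sh w′ y W′) w) + DS us vs (strip (λ y′ → Sh w y′ W′)))
        ≡⟨ cong₂ _+_ first (cong₂ _+_ (second w) (DS-strip (λ y′ → Sh w y′ W′) vs pvs)) ⟩
      conv (conv (E k) (V w)) (dsV vs) n + (strip (λ w′ → dsW w′ vs (suc k) n) w + stripY (λ vs′ → dsW w vs′ (suc k) n) vs) ∎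
      where
      open ≡-Reasoning
      ds = DS-linear us vs
      W′ : Word → ℚ
      W′ z = W (suc k) z n
      first : DS us vs (λ y → conv (E k) (conv (V w) (V y)) n) ≡ conv (conv (E k) (V w)) (dsV vs) n
      first = trans (L-conv ds n (E k) (λ y → conv (V w) (V y)))
        (trans (conv-cong n {f = E k} (λ _ → refl) (λ i → L-conv ds i (V w) V)) (sym (conv-assoc n (E k) (V w) (dsV vs))))
      second : ∀ w → DS us vs (λ y → strip (λ w′ → Sh w′ y W′) w) ≡ strip (λ w′ → dsW w′ vs (suc k) n) w
      second []       = L-0 ds
      second (x0 ∷ w) = L-0 ds
      second (x1 ∷ w) = refl

    dsW-Sml : ∀ w vs k → Positive vs → Sml (psum (dsW w vs k))
    dsW-Sml w vs k pvs = bnd-cong (λ M → sym (split M)) (bnd-+ inv-nonneg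
        (bnd-cong (λ M → sym (psum-conv M (conv (E k) (V w)) (dsV vs))) (Sml-conv (Sml-conv (E-Sml k) (V-Sml w)) (dsV-Sml vs pvs)))
        (bnd-+ inv-nonneg (left-Sml w) (right-Sml vs pvs)))
      where
      F₁ F₂ : ℕ → ℚ
      F₁ n = strip (λ w′ → dsW w′ vs (suc k) n) w
      F₂ n = stripY (λ vs′ → dsW w vs′ (suc k) n) vs
      split : ∀ M → psum (dsW w vs k) M ≡ psum (conv (conv (E k) (V w)) (dsV vs)) M + (psum F₁ M + psum F₂ M)
      split M = trans (sum-cong (suc M) (dsW-split w vs k pvs)) (trans (sum-+ (suc M) (conv (conv (E k) (V w)) (dsV vs)) (λ n → F₁ n + F₂ n))
        (cong (psum (conv (conv (E k) (V w)) (dsV vs)) M +_) (sum-+ (suc M) F₁ F₂)))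
      zero-Sml : Sml (psum (λ _ → 0ℚ))
      zero-Sml = bnd-cong (λ M → sym (sum-0 (suc M))) (bnd-0 inv-nonneg)
      left-Sml : ∀ w → Sml (psum (λ n → strip (λ w′ → dsW w′ vs (suc k) n) w))
      left-Sml []       = zero-Sml
      left-Sml (x0 ∷ w) = zero-Sml
      left-Sml (x1 ∷ w) = dsW-Sml w vs (suc k) pvs
      right-Sml : ∀ vs → Positive vs → Sml (psum (λ n → stripY (λ vs′ → dsW w vs′ (suc k) n) vs))
      right-Sml []                 _          = zero-Sml
      right-Sml (zero ∷ vs)        (() ∷ _)
      right-Sml (suc zero ∷ vs)    (_ ∷ pvs)  = dsW-Sml w vs (suc k) pvs
      right-Sml (suc (suc _) ∷ vs) _          = zero-Sml

  replicate-++-∷ : ∀ n (w : Word) → replicate n x0 ++ x0 ∷ w ≡ x0 ∷ replicate n x0 ++ w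
  replicate-++-∷ zero    w = refl
  replicate-++-∷ (suc n) w = cong (x0 ∷_) (replicate-++-∷ n w)

  ι-ιinvAux : ∀ n u → ι (ιinvAux n (u ++ [ x1 ])) ≡ replicate n x0 ++ u ++ [ x1 ]
  ι-ιinvAux n []       = refl
  ι-ιinvAux n (x0 ∷ u) = trans (ι-ιinvAux (suc n) u) (sym (replicate-++-∷ n (u ++ [ x1 ])))
  ι-ιinvAux n (x1 ∷ u) = cong (λ z → replicate n x0 ++ x1 ∷ z) (ι-ιinvAux 0 u)

  ιinvAux-positive : ∀ n w → Positive (ιinvAux n w)
  ιinvAux-positive n []       = []
  ιinvAux-positive n (x0 ∷ w) = ιinvAux-positive (suc n) w
  ιinvAux-positive n (x1 ∷ w) = s≤s z≤n ∷ ιinvAux-positive 0 w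

  ιinvAux-head : ∀ n u → Σ ℕ λ i → Σ YWord λ us → ιinvAux (suc n) (u ++ [ x1 ]) ≡ suc (suc i) ∷ us × Positive us
  ιinvAux-head n []       = n , [] , refl , []
  ιinvAux-head n (x0 ∷ u) = ιinvAux-head (suc n) u
  ιinvAux-head n (x1 ∷ u) = n , ιinvAux 0 (u ++ [ x1 ]) , refl , ιinvAux-positive 0 (u ++ [ x1 ])

  ι-ιinv : ∀ v → InH1 v → ι (ιinv v) ≡ v
  ι-ιinv v (inj₁ refl)       = refl
  ι-ιinv v (inj₂ (u , refl)) = ι-ιinvAux 0 u

  H0⇒H1 : ∀ u → InH0 u → InH1 u
  H0⇒H1 u (inj₁ e)       = inj₁ e
  H0⇒H1 u (inj₂ (w , e)) = inj₂ (x0 ∷ w , e)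

  -- Sums of coefficients up to M are values at t = 1 truncated at M.
  real : ℕ → Word → ℚ
  real M w = psum (W 0 w) M

  pair-ιP : ∀ f φ → ⟪ ιP f , φ ⟫ ≡ ⟪ f , φ ∘ ι ⟫
  pair-ιP f φ = pair-map _ φ (φ ∘ ι) (λ q w → ℚP.+-identityʳ _) f

  pair-DS : ∀ u v φ → InH0 u → InH1 v → ⟪ shw u v ⊖ ιP (st (ιinv u) (ιinv v)) , φ ⟫ ≡ DS (ιinv u) (ιinv v) φ
  pair-DS u v φ hu hv = begin
    ⟪ shw u v ⊖ ιP (st (ιinv u) (ιinv v)) , φ ⟫
      ≡⟨ pair-⊖ (shw u v) (ιP (st (ιinv u) (ιinv v))) φ ⟩
    ⟪ shw u v , φ ⟫ + (- 1ℚ) * ⟪ ιP (st (ιinv u) (ιinv v)) , φ ⟫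
      ≡⟨ cong₂ (λ x y → x + (- 1ℚ) * y) (pair-shw u v φ) (trans (pair-ιP (st (ιinv u) (ιinv v)) φ) (pair-st (ιinv u) (ιinv v) (φ ∘ ι))) ⟩
    Sh u v φ + (- 1ℚ) * St (ιinv u) (ιinv v) (φ ∘ ι)
      ≡⟨ minus (Sh u v φ) (St (ιinv u) (ιinv v) (φ ∘ ι)) ⟩
    Sh u v φ - St (ιinv u) (ιinv v) (φ ∘ ι)
      ≡⟨ cong₂ (λ x y → Sh x y φ - St (ιinv u) (ιinv v) (φ ∘ ι)) (ι-ιinv u (H0⇒H1 u hu)) (ι-ιinv v hv) ⟨
    DS (ιinv u) (ιinv v) φ ∎
    where
    open ≡-Reasoning
    minus : ∀ x y → x + (- 1ℚ) * y ≡ x - y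
    minus = solve-∀ ℚ-ring

  pair-ideal : ∀ w g φ → ⟪ sh (wd w) g , φ ⟫ ≡ ⟪ g , (λ v → Sh w v φ) ⟫
  pair-ideal w g φ = trans (pair-sh (wd w) g φ) (pair-wd w (λ u → ⟪ g , (λ v → Sh u v φ) ⟫))

  Sh-real : ∀ w v M → Sh w v (real M) ≡ psum (λ n → Sh w v (λ z → W 0 z n)) M
  Sh-real w v M = L-sum (Sh-linear w v) (suc M) (W 0)

  gen-Sml : ∀ w g → GenR g → Sml (λ M → ⟪ sh (wd w) g , real M ⟫)
  gen-Sml w _ gen-x0 = bnd-cong (λ M → sym (vanish M)) (bnd-0 inv-nonneg)
    where
    vanish : ∀ M → ⟪ sh (wd w) (wd [ x0 ]) , real M ⟫ ≡ 0ℚ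
    vanish M = trans (pair-ideal w (wd [ x0 ]) (real M)) (trans (pair-wd [ x0 ] (λ v → Sh w v (real M)))
      (trans (Sh-real w [ x0 ] M) (trans (sum-cong (suc M) (W-kills-x0 0 w)) (sum-0 (suc M)))))
  gen-Sml w _ gen-x1 = bnd-cong (λ M → sym (vanish M)) (bnd-0 inv-nonneg)
    where
    vanish : ∀ M → ⟪ sh (wd w) (wd [ x1 ]) , real M ⟫ ≡ 0ℚ
    vanish M = trans (pair-ideal w (wd [ x1 ]) (real M)) (trans (pair-wd [ x1 ] (λ v → Sh w v (real M)))
      (trans (Sh-real w [ x1 ] M) (trans (sum-cong (suc M) (W-kills-x1 w)) (sum-0 (suc M)))))
  gen-Sml w _ (gen-ds u v hu hv) = bnd-cong (λ M → sym (expand M)) (go (ιinv u) (shape hu))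
    where
    vs = ιinv v
    target : YWord → Set
    target us = Sml (λ M → DS us vs (λ y → Sh w y (real M)))
    expand : ∀ M → ⟪ sh (wd w) (shw u v ⊖ ιP (st (ιinv u) (ιinv v))) , real M ⟫ ≡ DS (ιinv u) vs (λ y → Sh w y (real M))
    expand M = trans (pair-ideal w (shw u v ⊖ ιP (st (ιinv u) (ιinv v))) (real M)) (pair-DS u v (λ y → Sh w y (real M)) hu hv)
    shape : InH0 u → ιinv u ≡ [] ⊎ (Σ ℕ λ i → Σ YWord λ us → ιinv u ≡ suc (suc i) ∷ us × Positive us)
    shape (inj₁ refl)        = inj₁ refl
    shape (inj₂ (u′ , refl)) = inj₂ (ιinvAux-head 0 u′)
    go : ∀ us → us ≡ [] ⊎ (Σ ℕ λ i → Σ YWord λ us′ → us ≡ suc (suc i) ∷ us′ × Positive us′) → target us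
    go us (inj₁ refl) = bnd-cong (λ M → sym (ℚP.+-inverseʳ (Sh w (ι vs) (real M)))) (bnd-0 inv-nonneg)
    go us (inj₂ (i , us′ , refl , pus′)) = bnd-cong (λ M → sym (trans (L-cong (DS-linear us vs) (λ y → Sh-real w y M))
        (L-sum (DS-linear us vs) (suc M) (λ y n → Sh w y (λ z → W 0 z n)))))
      (dsW-Sml i us′ pus′ w vs 0 (ιinvAux-positive 0 v))

  InR-Sml : ∀ f → InR f → Sml (λ M → ⟪ f , real M ⟫)
  InR-Sml f (L , same) = bnd-cong (λ M → sym (pair-Same _≟W_ f (lincomb L) same (real M))) (go L)
    where
    go : (L : List (ℚ × Σ Poly IdealGen)) → Sml (λ M → ⟪ lincomb L , real M ⟫)
    go []                                  = bnd-0 inv-nonneg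
    go ((q , _ , w , g , gen , refl) ∷ L) = bnd-cong (λ M → sym (trans (pair-++ (scale q (sh (wd w) g)) (lincomb L) (real M)) (cong (_+ ⟪ lincomb L , real M ⟫) (pair-scale q (sh (wd w) g) (real M)))))
      (bnd-+ inv-nonneg (bnd-scale inv-nonneg q (gen-Sml w g gen)) (go L))

  Admissible : YWord → Set
  Admissible us = us ≡ [] ⊎ (Σ ℕ λ i → Σ YWord λ us′ → us ≡ suc (suc i) ∷ us′)

  strip-admissible : ∀ {us} → Admissible us → ∀ ψ → strip ψ (ι us) ≡ 0ℚ
  strip-admissible (inj₁ refl)             ψ = refl
  strip-admissible (inj₂ (i , us′ , refl)) ψ = refl

  real-ι : ∀ {us} → Admissible us → ∀ M → real M (ι us) ≡ zs us M
  real-ι {us} adm M = trans (sum-cong (suc M) (λ n → trans (W-split 0 (ι us) n)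
      (trans (cong₂ _+_ (conv-δ n (V (ι us))) (strip-admissible adm (λ w → W 1 w n))) (ℚP.+-identityʳ _))))
    (psum-V us M)

  real-sh : ∀ {us vs} → Admissible us → Admissible vs → ∀ M → Sh (ι us) (ι vs) (real M) ≡ psum (conv (V (ι us)) (V (ι vs))) M
  real-sh {us} {vs} au av M = trans (Sh-real (ι us) (ι vs) M) (sum-cong (suc M) (λ n → trans (W-shuffle 0 (ι us) (ι vs) n)
      (trans (cong₂ _+_ (conv-δ n (conv (V (ι us)) (V (ι vs)))) (cong₂ _+_ (strip-admissible au (λ u′ → Sh u′ (ι vs) (λ w → W 1 w n))) (strip-admissible av (λ v′ → Sh (ι us) v′ (λ w → W 1 w n)))))
        (ℚP.+-identityʳ _))))

  real-product : ∀ i us′ {vs} → Admissible vs → let us = suc (suc i) ∷ us′ in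
    Sml (λ M → zs us M * zs vs M - Sh (ι us) (ι vs) (real M))
  real-product i us′ {vs} av = bnd-cong (λ M → cong₂ _-_ (cong₂ _*_ (psum-V us M) (psum-V vs M)) (sym (real-sh (inj₂ (i , us′ , refl)) av M)))
    (psum-product (V-Sml² (replicate i x0 ++ x1 ∷ ι us′) (last-ι (suc i) us′)) (V-Sml (ι vs)))
    where us = suc (suc i) ∷ us′

  zs-Log : ∀ us → Log (zs us)
  zs-Log us = bnd-cong (psum-V us) (psum-Log (V-Sml (ι us)))

module DoubleSums where

  open Sums
  open Polylogarithms

  dbl : ℕ → ℕ
  dbl zero    = zero
  dbl (suc n) = suc (suc (dbl n))

  sgn-dbl : ∀ n → sgn (dbl n) ≡ 1ℚ
  sgn-dbl zero    = refl
  sgn-dbl (suc n) = trans (double-neg (sgn (dbl n))) (sgn-dbl n)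
    where
    double-neg : ∀ x → - - x ≡ x
    double-neg = solve-∀ ℚ-ring

  Z : ℕ → ℕ → ℚ
  Z p M = sum M (λ i → powℚ (inv i) p)

  -- The sum over k ≤ i + 1, where the last term has weight one half.
  Z½ : ℕ → ℕ → ℚ
  Z½ p i = Z p i + ½ * powℚ (inv i) p

  -- μ M j = M!² / ((M-j)! (M+j)!), which vanishes for j > M
  μ : ℕ → ℕ → ℚ
  μ M zero    = 1ℚ
  μ M (suc j) = μ M j * ((ℕtoℚ M - ℕtoℚ j) * inv (M ℕ.+ j))

  μ-step : ∀ M j → μ M (suc j) * ℕtoℚ (suc (M ℕ.+ j)) ≡ μ M j * (ℕtoℚ M - ℕtoℚ j)
  μ-step M j = trans (regroup (μ M j) (ℕtoℚ M - ℕtoℚ j) (inv (M ℕ.+ j)) (ℕtoℚ (suc (M ℕ.+ j))))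
    (trans (cong (μ M j * (ℕtoℚ M - ℕtoℚ j) *_) (inv-cancel (M ℕ.+ j))) (ℚP.*-identityʳ _))
    where
    regroup : ∀ a b i s → a * (b * i) * s ≡ a * b * (i * s)
    regroup = solve-∀ ℚ-ring

  μ-end : ∀ m → μ m (suc m) ≡ 0ℚ
  μ-end m = trans (cong (λ z → μ m m * (z * inv (m ℕ.+ m))) (ℚP.+-inverseʳ (ℕtoℚ m))) (trans (cong (μ m m *_) (ℚP.*-zeroˡ (inv (m ℕ.+ m)))) (ℚP.*-zeroʳ (μ m m)))

  μ-lower : ∀ m j → (ℕtoℚ (suc m) * ℕtoℚ (suc m) - ℕtoℚ j * ℕtoℚ j) * μ (suc m) j ≡ ℕtoℚ (suc m) * ℕtoℚ (suc m) * μ m j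
  μ-lower m zero    = regroup (ℕtoℚ (suc m) * ℕtoℚ (suc m))
    where
    regroup : ∀ x → (x - 0ℚ * 0ℚ) * 1ℚ ≡ x * 1ℚ
    regroup = solve-∀ ℚ-ring
  μ-lower m (suc j) = begin
    (x′ * x′ - ℕtoℚ (suc j) * ℕtoℚ (suc j)) * (A * ((x′ - y) * I))
      ≡⟨ cong₂ (λ u v → (u * u - v * v) * (A * ((u - y) * I))) (ℕtoℚ-suc m) (ℕtoℚ-suc j) ⟩
    ((1ℚ + x) * (1ℚ + x) - (1ℚ + y) * (1ℚ + y)) * (A * (((1ℚ + x) - y) * I))
      ≡⟨ regroup₁ x y A I ⟩
    A * (1ℚ + x - y) * (x - y) * (I * (1ℚ + (1ℚ + (x + y))))
      ≡⟨ cong (A * (1ℚ + x - y) * (x - y) *_) (trans (cong (I *_) (sym (trans (ℕtoℚ-suc (suc m ℕ.+ j)) (cong (1ℚ +_) x+y)))) (inv-cancel (suc m ℕ.+ j))) ⟩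
    A * (1ℚ + x - y) * (x - y) * 1ℚ
      ≡⟨ cong (A * (1ℚ + x - y) * (x - y) *_) (trans (cong (J *_) (sym x+y)) (inv-cancel (m ℕ.+ j))) ⟨
    A * (1ℚ + x - y) * (x - y) * (J * (1ℚ + (x + y)))
      ≡⟨ regroup₂ x y A J ⟩
    ((1ℚ + x) * (1ℚ + x) - y * y) * A * ((x - y) * J)
      ≡⟨ cong (_* ((x - y) * J)) (trans (cong (λ u → (u * u - y * y) * A) (sym (ℕtoℚ-suc m))) (μ-lower m j)) ⟩
    x′ * x′ * B * ((x - y) * J)
      ≡⟨ ℚP.*-assoc (x′ * x′) B _ ⟩
    x′ * x′ * (B * ((x - y) * J)) ∎
    where
    open ≡-Reasoning
    x = ℕtoℚ m
    x′ = ℕtoℚ (suc m)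
    y = ℕtoℚ j
    A = μ (suc m) j
    B = μ m j
    I = inv (suc m ℕ.+ j)
    J = inv (m ℕ.+ j)
    x+y : ℕtoℚ (suc (m ℕ.+ j)) ≡ 1ℚ + (x + y)
    x+y = trans (ℕtoℚ-suc (m ℕ.+ j)) (cong (1ℚ +_) (ℕtoℚ-+ m j))
    regroup₁ : ∀ x y A I → ((1ℚ + x) * (1ℚ + x) - (1ℚ + y) * (1ℚ + y)) * (A * (((1ℚ + x) - y) * I)) ≡ A * (1ℚ + x - y) * (x - y) * (I * (1ℚ + (1ℚ + (x + y))))
    regroup₁ = solve-∀ ℚ-ring
    regroup₂ : ∀ x y A J → A * (1ℚ + x - y) * (x - y) * (J * (1ℚ + (x + y))) ≡ ((1ℚ + x) * (1ℚ + x) - y * y) * A * ((x - y) * J)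
    regroup₂ = solve-∀ ℚ-ring

  μ-div : ∀ m i → μ (suc m) (suc i) * (inv i * inv i - inv m * inv m) ≡ μ m (suc i) * (inv i * inv i)
  μ-div m i = begin
    A * (I * I - J * J)                                       ≡⟨ units A I J ⟩
    A * (I * I * (1ℚ * 1ℚ) - J * J * (1ℚ * 1ℚ))               ≡⟨ cong₂ (λ u v → A * (I * I * (u * u) - J * J * (v * v))) (inv-cancel m) (inv-cancel i) ⟨
    A * (I * I * (J * x * (J * x)) - J * J * (I * y * (I * y)))         ≡⟨ regroup₁ A I J x y ⟩
    (x * x - y * y) * A * (I * I * (J * J))                   ≡⟨ cong (_* (I * I * (J * J))) (μ-lower m (suc i)) ⟩
    x * x * B * (I * I * (J * J))                             ≡⟨ regroup₂ B I J x ⟩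
    B * (I * I) * (J * x * (J * x))                           ≡⟨ cong (λ u → B * (I * I) * (u * u)) (inv-cancel m) ⟩
    B * (I * I) * (1ℚ * 1ℚ)                                   ≡⟨ ℚP.*-identityʳ _ ⟩
    B * (I * I)                                               ∎
    where
    open ≡-Reasoning
    A = μ (suc m) (suc i)
    B = μ m (suc i)
    I = inv i
    J = inv m
    x = ℕtoℚ (suc m)
    y = ℕtoℚ (suc i)
    units : ∀ A I J → A * (I * I - J * J) ≡ A * (I * I * (1ℚ * 1ℚ) - J * J * (1ℚ * 1ℚ))
    units = solve-∀ ℚ-ring
    regroup₁ : ∀ A I J x y → A * (I * I * (J * x * (J * x)) - J * J * (I * y * (I * y))) ≡ (x * x - y * y) * A * (I * I * (J * J))
    regroup₁ = solve-∀ ℚ-ring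
    regroup₂ : ∀ B I J x → x * x * B * (I * I * (J * J)) ≡ B * (I * I) * (J * x * (J * x))
    regroup₂ = solve-∀ ℚ-ring

  -- The sum of (-1)^(j-1) μ (suc m) j over j > n
  tail : ℕ → ℕ → ℚ
  tail m n = ½ * (sgn n * μ (suc m) n * (1ℚ - ℕtoℚ n * inv m))

  tail-suc : ∀ m n → tail m (suc n) ≡ tail m n - sgn n * μ (suc m) (suc n)
  tail-suc m n = begin
    ½ * ((- s) * A′ * (1ℚ - ℕtoℚ (suc n) * J))                      ≡⟨ cong (λ z → ½ * ((- s) * A′ * (1ℚ - z * J))) (ℕtoℚ-suc n) ⟩
    ½ * ((- s) * A′ * (1ℚ - (1ℚ + y) * J))                          ≡⟨ regroup₁ s A′ y J ⟩
    ½ * (s * (A′ * (1ℚ + (1ℚ + y) * J))) - s * A′                   ≡⟨ cong (λ z → ½ * (s * z) - s * A′) key ⟩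
    ½ * (s * (A * (1ℚ - y * J))) - s * A′                           ≡⟨ cong (λ z → ½ * z - s * A′) (ℚP.*-assoc s A (1ℚ - y * J)) ⟨
    ½ * (s * A * (1ℚ - y * J)) - s * A′                             ∎
    where
    open ≡-Reasoning
    s = sgn n
    A = μ (suc m) n
    A′ = μ (suc m) (suc n)
    J = inv m
    x = ℕtoℚ (suc m)
    y = ℕtoℚ n
    regroup₁ : ∀ s a y j → ½ * ((- s) * a * (1ℚ - (1ℚ + y) * j)) ≡ ½ * (s * (a * (1ℚ + (1ℚ + y) * j))) - s * a
    regroup₁ = solve-∀ ℚ-ring
    regroup₂ : ∀ a y j x → a * (j * x + (1ℚ + y) * j) ≡ a * (1ℚ + (x + y)) * j
    regroup₂ = solve-∀ ℚ-ring
    regroup₃ : ∀ a y j x → a * (x - y) * j ≡ a * (j * x - y * j)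
    regroup₃ = solve-∀ ℚ-ring
    key : A′ * (1ℚ + (1ℚ + y) * J) ≡ A * (1ℚ - y * J)
    key = begin
      A′ * (1ℚ + (1ℚ + y) * J)          ≡⟨ cong (λ z → A′ * (z + (1ℚ + y) * J)) (inv-cancel m) ⟨
      A′ * (J * x + (1ℚ + y) * J)       ≡⟨ regroup₂ A′ y J x ⟩
      A′ * (1ℚ + (x + y)) * J           ≡⟨ cong (λ z → A′ * z * J) (trans (ℕtoℚ-suc (suc m ℕ.+ n)) (cong (1ℚ +_) (ℕtoℚ-+ (suc m) n))) ⟨
      A′ * ℕtoℚ (suc (suc m ℕ.+ n)) * J ≡⟨ cong (_* J) (μ-step (suc m) n) ⟩
      A * (x - y) * J                   ≡⟨ regroup₃ A y J x ⟩
      A * (J * x - y * J)               ≡⟨ cong (λ z → A * (z - y * J)) (inv-cancel m) ⟩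
      A * (1ℚ - y * J)                  ∎

  tail-end : ∀ m → tail m (suc m) ≡ 0ℚ
  tail-end m = trans (cong (λ z → ½ * (sgn (suc m) * μ (suc m) (suc m) * (1ℚ - z))) (trans (ℚP.*-comm (ℕtoℚ (suc m)) (inv m)) (inv-cancel m)))
    (regroup (sgn (suc m) * μ (suc m) (suc m)))
    where
    regroup : ∀ a → ½ * (a * (1ℚ - 1ℚ)) ≡ 0ℚ
    regroup = solve-∀ ℚ-ring

  tail-sum : ∀ m n → sum n (λ i → sgn i * μ (suc m) (suc i)) + tail m n ≡ ½
  tail-sum m zero    = trans (cong (λ z → 0ℚ + ½ * (1ℚ * 1ℚ * (1ℚ - z))) (ℚP.*-zeroˡ (inv m))) refl
  tail-sum m (suc n) = trans (cong (sum n (λ i → sgn i * μ (suc m) (suc i)) + sgn n * μ (suc m) (suc n) +_) (tail-suc m n))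
    (trans (regroup (sum n (λ i → sgn i * μ (suc m) (suc i))) (sgn n * μ (suc m) (suc n)) (tail m n)) (tail-sum m n))
    where
    regroup : ∀ a b c → a + b + (c - b) ≡ a + c
    regroup = solve-∀ ℚ-ring

  abel : ∀ m p n → sum n (λ i → sgn i * μ (suc m) (suc i) * Z½ p i) + tail m n * Z p n ≡
    sum n (λ i → powℚ (inv i) p * (½ * (sgn i * μ (suc m) (suc i) * (ℕtoℚ (suc i) * inv m))))
  abel m p zero    = trans (cong (0ℚ +_) (ℚP.*-zeroʳ (tail m 0))) refl
  abel m p (suc n) = begin
    S + s * A * (Z p n + ½ * P) + tail m (suc n) * (Z p n + P)
      ≡⟨ cong (λ z → S + s * A * (Z p n + ½ * P) + z) (trans (ℚP.*-distribˡ-+ (tail m (suc n)) (Z p n) P) (cong (λ z → z * Z p n + tail m (suc n) * P) (tail-suc m n))) ⟩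
    S + s * A * (Z p n + ½ * P) + ((tail m n - s * A) * Z p n + tail m (suc n) * P)
      ≡⟨ regroup S s A (Z p n) P (tail m n) (ℕtoℚ (suc n) * inv m) ⟩
    S + tail m n * Z p n + P * (½ * (s * A * (ℕtoℚ (suc n) * inv m)))
      ≡⟨ cong (_+ P * (½ * (s * A * (ℕtoℚ (suc n) * inv m)))) (abel m p n) ⟩
    sum n (λ i → powℚ (inv i) p * (½ * (sgn i * μ (suc m) (suc i) * (ℕtoℚ (suc i) * inv m)))) + P * (½ * (s * A * (ℕtoℚ (suc n) * inv m))) ∎
    where
    open ≡-Reasoning
    S = sum n (λ i → sgn i * μ (suc m) (suc i) * Z½ p i)
    s = sgn n
    A = μ (suc m) (suc n)
    P = powℚ (inv n) p
    regroup : ∀ S s A z P t y → S + s * A * (z + ½ * P) + ((t - s * A) * z + ½ * ((- s) * A * (1ℚ - y)) * P) ≡ S + t * z + P * (½ * (s * A * y))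
    regroup = solve-∀ ℚ-ring

  -- Coefficients of the inverse of the product of the 1 - t/j² over j ≤ M
  hc : ℕ → ℕ → ℚ
  hc M zero    = 1ℚ
  hc M (suc a) = sum M (λ i → ℕtoℚ 2 * (sgn i * μ M (suc i) * powℚ (inv i) (dbl (suc a))))

  hc-sum : ∀ m a → hc (suc m) a ≡ sum (suc m) (λ i → ℕtoℚ 2 * (sgn i * μ (suc m) (suc i) * powℚ (inv i) (dbl a)))
  hc-sum m (suc a) = refl
  hc-sum m zero    = sym (begin
    sum (suc m) (λ i → ℕtoℚ 2 * (sgn i * μ (suc m) (suc i) * 1ℚ))      ≡⟨ sum-*ˡ (suc m) (ℕtoℚ 2) _ ⟩
    ℕtoℚ 2 * sum (suc m) (λ i → sgn i * μ (suc m) (suc i) * 1ℚ)        ≡⟨ cong (ℕtoℚ 2 *_) (sum-cong (suc m) (λ i → ℚP.*-identityʳ (sgn i * μ (suc m) (suc i)))) ⟩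
    ℕtoℚ 2 * sum (suc m) (λ i → sgn i * μ (suc m) (suc i))             ≡⟨ cong (ℕtoℚ 2 *_) half ⟩
    ℕtoℚ 2 * ½                                                        ∎)
    where
    open ≡-Reasoning
    half : sum (suc m) (λ i → sgn i * μ (suc m) (suc i)) ≡ ½
    half = trans (sym (ℚP.+-identityʳ _)) (trans (cong (sum (suc m) (λ i → sgn i * μ (suc m) (suc i)) +_) (sym (tail-end m))) (tail-sum m (suc m)))

  drop-last : ∀ m {f} → f m ≡ 0ℚ → sum (suc m) f ≡ sum m f
  drop-last m {f} e = trans (cong (sum m f +_) e) (ℚP.+-identityʳ (sum m f))

  μ-pull : ∀ m i x y w → μ (suc m) (suc i) * (inv i * inv i - inv m * inv m) ≡ w * (inv i * inv i) →
    x * (μ (suc m) (suc i) * (inv i * (inv i * y))) - inv m * inv m * (x * (μ (suc m) (suc i) * y)) ≡ x * (w * (inv i * (inv i * y)))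
  μ-pull m i x y w e = trans (regroup₁ x y (μ (suc m) (suc i)) (inv i) (inv m)) (trans (cong (λ z → x * y * z) e) (regroup₂ x y w (inv i)))
    where
    regroup₁ : ∀ x y a i j → x * (a * (i * (i * y))) - j * j * (x * (a * y)) ≡ x * y * (a * (i * i - j * j))
    regroup₁ = solve-∀ ℚ-ring
    regroup₂ : ∀ x y w i → x * y * (w * (i * i)) ≡ x * (w * (i * (i * y)))
    regroup₂ = solve-∀ ℚ-ring

  Δ-hc : ∀ m a → Δ (inv m * inv m) (hc (suc m)) a ≡ hc m a
  Δ-hc m zero    = refl
  Δ-hc m (suc a) = begin
    hc (suc m) (suc a) - J² * hc (suc m) a
      ≡⟨ cong (λ z → hc (suc m) (suc a) - J² * z) (hc-sum m a) ⟩
    sum (suc m) (G (suc a)) - J² * sum (suc m) (G a)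
      ≡⟨ cong (λ z → sum (suc m) (G (suc a)) - z) (sum-*ˡ (suc m) J² (G a)) ⟨
    sum (suc m) (G (suc a)) - sum (suc m) (λ i → J² * G a i)
      ≡⟨ sum-- (suc m) (G (suc a)) (λ i → J² * G a i) ⟨
    sum (suc m) (λ i → G (suc a) i - J² * G a i)
      ≡⟨ sum-cong (suc m) step ⟩
    sum (suc m) G′
      ≡⟨ drop-last m {G′} (trans (cong (λ z → ℕtoℚ 2 * (sgn m * z * powℚ (inv m) (dbl (suc a)))) (μ-end m)) (vanish (sgn m) (powℚ (inv m) (dbl (suc a))))) ⟩
    sum m G′ ∎
    where
    open ≡-Reasoning
    J² = inv m * inv m
    G : ℕ → ℕ → ℚ
    G a i = ℕtoℚ 2 * (sgn i * μ (suc m) (suc i) * powℚ (inv i) (dbl a))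
    G′ : ℕ → ℚ
    G′ i = ℕtoℚ 2 * (sgn i * μ m (suc i) * powℚ (inv i) (dbl (suc a)))
    vanish : ∀ s p → ℕtoℚ 2 * (s * 0ℚ * p) ≡ 0ℚ
    vanish = solve-∀ ℚ-ring
    assoc : ∀ t s u p → t * (s * u * p) ≡ t * s * (u * p)
    assoc = solve-∀ ℚ-ring
    step : ∀ i → G (suc a) i - J² * G a i ≡ G′ i
    step i = trans (cong₂ (λ u v → u - J² * v) (assoc (ℕtoℚ 2) (sgn i) (μ (suc m) (suc i)) (powℚ (inv i) (dbl (suc a)))) (assoc (ℕtoℚ 2) (sgn i) (μ (suc m) (suc i)) (powℚ (inv i) (dbl a))))
      (trans (μ-pull m i (ℕtoℚ 2 * sgn i) (powℚ (inv i) (dbl a)) (μ m (suc i)) (μ-div m i)) (sym (assoc (ℕtoℚ 2) (sgn i) (μ m (suc i)) (powℚ (inv i) (dbl (suc a))))))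

  -- The double sum Σ_{k ≤ j ≤ M} 4 (-1)^(j-1) μ_j k^-(2a+1) j^-(2b+2), with weight one half on k = j
  Wt : ℕ → ℕ → ℕ → ℚ
  Wt M a b = sum M (λ i → ℕtoℚ 4 * (sgn i * Z½ (suc (dbl a)) i) * (μ M (suc i) * powℚ (inv i) (dbl (suc b))))

  Δ-Wt : ∀ m a b → Δ (inv m * inv m) (Wt (suc m) a) b ≡ Wt m a b + inv m * inv m * inv m * hc (suc m) a * δ b
  Δ-Wt m a (suc b) = trans main (sym (trans (cong (Wt m a (suc b) +_) (ℚP.*-zeroʳ (inv m * inv m * inv m * hc (suc m) a))) (ℚP.+-identityʳ _)))
    where
    open ≡-Reasoning
    J² = inv m * inv m
    w : ℕ → ℚ
    w i = ℕtoℚ 4 * (sgn i * Z½ (suc (dbl a)) i)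
    G : ℕ → ℕ → ℚ
    G b i = w i * (μ (suc m) (suc i) * powℚ (inv i) (dbl (suc b)))
    G′ : ℕ → ℚ
    G′ i = w i * (μ m (suc i) * powℚ (inv i) (dbl (suc (suc b))))
    main : Wt (suc m) a (suc b) - J² * Wt (suc m) a b ≡ Wt m a (suc b)
    main = begin
      sum (suc m) (G (suc b)) - J² * sum (suc m) (G b)             ≡⟨ cong (λ z → sum (suc m) (G (suc b)) - z) (sum-*ˡ (suc m) J² (G b)) ⟨
      sum (suc m) (G (suc b)) - sum (suc m) (λ i → J² * G b i)     ≡⟨ sum-- (suc m) (G (suc b)) (λ i → J² * G b i) ⟨
      sum (suc m) (λ i → G (suc b) i - J² * G b i)                 ≡⟨ sum-cong (suc m) (λ i → μ-pull m i (w i) (powℚ (inv i) (dbl (suc b))) (μ m (suc i)) (μ-div m i)) ⟩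
      sum (suc m) G′                                               ≡⟨ drop-last m {G′} (trans (cong (λ z → w m * (z * powℚ (inv m) (dbl (suc (suc b))))) (μ-end m))
                                                                        (vanish (w m) (powℚ (inv m) (dbl (suc (suc b)))))) ⟩
      sum m G′                                                     ∎
      where
      vanish : ∀ w p → w * (0ℚ * p) ≡ 0ℚ
      vanish = solve-∀ ℚ-ring
  Δ-Wt m a zero = begin
    sum (suc m) G                                                  ≡⟨ sum-cong (suc m) step ⟩
    sum (suc m) (λ i → G′ i + C₁ * Y i)                            ≡⟨ sum-+ (suc m) G′ (λ i → C₁ * Y i) ⟩
    sum (suc m) G′ + sum (suc m) (λ i → C₁ * Y i)                  ≡⟨ cong₂ _+_ (drop-last m {G′} (trans (cong (λ z → w m * (z * powℚ (inv m) 2)) (μ-end m)) (vanish (w m) (powℚ (inv m) 2)))) (sum-*ˡ (suc m) C₁ Y) ⟩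
    Wt m a 0 + C₁ * sum (suc m) Y                                  ≡⟨ cong (λ z → Wt m a 0 + C₁ * z) by-parts ⟩
    Wt m a 0 + C₁ * sum (suc m) (λ i → powℚ (inv i) (suc (dbl a)) * (½ * (sgn i * μ (suc m) (suc i) * (ℕtoℚ (suc i) * inv m))))
                                                                   ≡⟨ cong (Wt m a 0 +_) (trans (sym (sum-*ˡ (suc m) C₁ _)) (sum-cong (suc m) final)) ⟩
    Wt m a 0 + sum (suc m) (λ i → J * J * J * (ℕtoℚ 2 * (sgn i * μ (suc m) (suc i) * powℚ (inv i) (dbl a))))
                                                                   ≡⟨ cong (Wt m a 0 +_) (trans (sum-*ˡ (suc m) (J * J * J) _) (cong (J * J * J *_) (sym (hc-sum m a)))) ⟩
    Wt m a 0 + J * J * J * hc (suc m) a                            ≡⟨ cong (Wt m a 0 +_) (ℚP.*-identityʳ _) ⟨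
    Wt m a 0 + J * J * J * hc (suc m) a * 1ℚ                       ∎
    where
    open ≡-Reasoning
    J = inv m
    C₁ = ℕtoℚ 4 * (J * J)
    w : ℕ → ℚ
    w i = ℕtoℚ 4 * (sgn i * Z½ (suc (dbl a)) i)
    G G′ Y : ℕ → ℚ
    G i = w i * (μ (suc m) (suc i) * powℚ (inv i) 2)
    G′ i = w i * (μ m (suc i) * powℚ (inv i) 2)
    Y i = sgn i * μ (suc m) (suc i) * Z½ (suc (dbl a)) i
    vanish : ∀ w p → w * (0ℚ * p) ≡ 0ℚ
    vanish = solve-∀ ℚ-ring
    split : ∀ f s z a i j → f * (s * z) * (a * (i * (i * 1ℚ))) ≡ f * (s * z) * (a * (i * i - j * j)) + f * (j * j) * (s * a * z)
    split = solve-∀ ℚ-ring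
    back : ∀ w a i → w * (a * (i * i)) ≡ w * (a * (i * (i * 1ℚ)))
    back = solve-∀ ℚ-ring
    step : ∀ i → G i ≡ G′ i + C₁ * Y i
    step i = trans (split (ℕtoℚ 4) (sgn i) (Z½ (suc (dbl a)) i) (μ (suc m) (suc i)) (inv i) J)
      (cong (_+ C₁ * Y i) (trans (cong (w i *_) (μ-div m i)) (back (w i) (μ m (suc i)) (inv i))))
    by-parts : sum (suc m) Y ≡ sum (suc m) (λ i → powℚ (inv i) (suc (dbl a)) * (½ * (sgn i * μ (suc m) (suc i) * (ℕtoℚ (suc i) * inv m))))
    by-parts = trans (sym (ℚP.+-identityʳ (sum (suc m) Y))) (trans (cong (sum (suc m) Y +_) (sym (trans (cong (_* Z (suc (dbl a)) (suc m)) (tail-end m)) (ℚP.*-zeroˡ (Z (suc (dbl a)) (suc m))))))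
      (abel m (suc (dbl a)) (suc m)))
    regroup : ∀ j i p s u x → ℕtoℚ 4 * (j * j) * (i * p * (½ * (s * u * (x * j)))) ≡ j * j * j * (ℕtoℚ 2 * (s * u * p)) * (i * x)
    regroup = solve-∀ ℚ-ring
    final : ∀ i → C₁ * (powℚ (inv i) (suc (dbl a)) * (½ * (sgn i * μ (suc m) (suc i) * (ℕtoℚ (suc i) * inv m)))) ≡ J * J * J * (ℕtoℚ 2 * (sgn i * μ (suc m) (suc i) * powℚ (inv i) (dbl a)))
    final i = trans (regroup J (inv i) (powℚ (inv i) (dbl a)) (sgn i) (μ (suc m) (suc i)) (ℕtoℚ (suc i)))
      (trans (cong (J * J * J * (ℕtoℚ 2 * (sgn i * μ (suc m) (suc i) * powℚ (inv i) (dbl a))) *_) (inv-cancel i)) (ℚP.*-identityʳ _))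

  -- Coefficients of the product of the 1 - t/j² over j ≤ M
  Tc : ℕ → ℕ → ℚ
  Tc M k = sgn k * zs (replicate k 2) M

  Tc-0 : ∀ k → Tc 0 k ≡ δ k
  Tc-0 zero    = refl
  Tc-0 (suc k) = ℚP.*-zeroʳ (sgn (suc k))

  Tc-suc : ∀ m k → Tc (suc m) k ≡ Δ (inv m * inv m) (Tc m) k
  Tc-suc m zero    = refl
  Tc-suc m (suc k) = regroup (sgn k) (zs (replicate (suc k) 2) m) (inv m) (zs (replicate k 2) m)
    where
    regroup : ∀ s x i y → (- s) * (x + i * (i * 1ℚ) * y) ≡ (- s) * x - i * i * (s * y)
    regroup = solve-∀ ℚ-ring

  Tc-hc : ∀ M n → conv (Tc M) (hc M) n ≡ δ n
  Tc-hc zero    n = trans (conv-cong n {g = hc 0} Tc-0 (λ _ → refl)) (trans (conv-δ n (hc 0)) (hc-0 n))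
    where
    hc-0 : ∀ n → hc 0 n ≡ δ n
    hc-0 zero    = refl
    hc-0 (suc n) = refl
  Tc-hc (suc m) n = begin
    conv (Tc (suc m)) (hc (suc m)) n                        ≡⟨ conv-cong n {g = hc (suc m)} (Tc-suc m) (λ _ → refl) ⟩
    conv (Δ (inv m * inv m) (Tc m)) (hc (suc m)) n          ≡⟨ Δ-convˡ (inv m * inv m) n (Tc m) (hc (suc m)) ⟨
    Δ (inv m * inv m) (conv (Tc m) (hc (suc m))) n          ≡⟨ Δ-convʳ (inv m * inv m) n (Tc m) (hc (suc m)) ⟩
    conv (Tc m) (Δ (inv m * inv m) (hc (suc m))) n          ≡⟨ conv-cong n {f = Tc m} (λ _ → refl) (Δ-hc m) ⟩
    conv (Tc m) (hc m) n                                    ≡⟨ Tc-hc m n ⟩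
    δ n                                                     ∎
    where open ≡-Reasoning

  conv² : (ℕ → ℚ) → (ℕ → ℕ → ℚ) → ℕ → ℕ → ℚ
  conv² T f a b = conv T (λ i → conv T (f i) b) a

  H : ℕ → ℕ → YWord
  H a b = replicate a 2 ++ 3 ∷ replicate b 2

  Hc : ℕ → ℕ → ℕ → ℚ
  Hc M a b = sgn (a ℕ.+ b) * zs (H a b) M

  Hc-suc : ∀ m a b → Hc (suc m) a b ≡ Δ (inv m * inv m) (λ i → Hc m i b) a + inv m * inv m * inv m * Tc m b * δ a
  Hc-suc m zero    b = regroup (sgn b) (zs (H 0 b) m) (inv m) (zs (replicate b 2) m)
    where
    regroup : ∀ s x i y → s * (x + i * (i * (i * 1ℚ)) * y) ≡ s * x + i * i * i * (s * y) * 1ℚ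
    regroup = solve-∀ ℚ-ring
  Hc-suc m (suc a) b = regroup (sgn (a ℕ.+ b)) (zs (H (suc a) b) m) (inv m) (zs (H a b) m) (Tc m b)
    where
    regroup : ∀ s x i y t → (- s) * (x + i * (i * 1ℚ) * y) ≡ (- s) * x - i * i * (s * y) + i * i * i * t * 0ℚ
    regroup = solve-∀ ℚ-ring

  -- The truncated generating function of the ζ(2^a,3,2^b) is T(x) T(y) times that of the double sums Wt.
  Hc≡ : ∀ M a b → Hc M a b ≡ conv² (Tc M) (Wt M) a b
  Hc≡ zero    a b = trans (zero-H a) (sym (trans (conv-cong a {f = Tc 0} {g′ = λ _ → 0ℚ} (λ _ → refl) (λ i → trans (conv-comm b (Tc 0) (Wt 0 i)) (conv-0ˡ b (Tc 0)))) (trans (conv-comm a (Tc 0) (λ _ → 0ℚ)) (conv-0ˡ a (Tc 0)))))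
    where
    zero-H : ∀ a → sgn (a ℕ.+ b) * zs (H a b) 0 ≡ 0ℚ
    zero-H zero    = ℚP.*-zeroʳ (sgn b)
    zero-H (suc a) = ℚP.*-zeroʳ (sgn (suc a ℕ.+ b))
  Hc≡ (suc m) a b = sym (begin
    conv (Tc (suc m)) (λ i → conv (Tc (suc m)) (Wt (suc m) i) b) a
      ≡⟨ conv-cong a {f = Tc (suc m)} (λ _ → refl) inner ⟩
    conv (Tc (suc m)) (λ i → conv (Tc m) (Wt m i) b + J³ * Tc m b * hc (suc m) i) a
      ≡⟨ trans (conv-+ʳ a (Tc (suc m)) (λ i → conv (Tc m) (Wt m i) b) (λ i → J³ * Tc m b * hc (suc m) i))
           (cong (conv (Tc (suc m)) (λ i → conv (Tc m) (Wt m i) b) a +_) (conv-*ʳ a (J³ * Tc m b) (Tc (suc m)) (hc (suc m)))) ⟩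
    conv (Tc (suc m)) (λ i → conv (Tc m) (Wt m i) b) a + J³ * Tc m b * conv (Tc (suc m)) (hc (suc m)) a
      ≡⟨ cong₂ (λ u v → u + J³ * Tc m b * v) outer (Tc-hc (suc m) a) ⟩
    Δ J² (λ i → Hc m i b) a + J³ * Tc m b * δ a
      ≡⟨ Hc-suc m a b ⟨
    Hc (suc m) a b ∎)
    where
    open ≡-Reasoning
    J² = inv m * inv m
    J³ = inv m * inv m * inv m
    inner : ∀ i → conv (Tc (suc m)) (Wt (suc m) i) b ≡ conv (Tc m) (Wt m i) b + J³ * Tc m b * hc (suc m) i
    inner i = begin
      conv (Tc (suc m)) (Wt (suc m) i) b                    ≡⟨ conv-cong b {g = Wt (suc m) i} (Tc-suc m) (λ _ → refl) ⟩
      conv (Δ J² (Tc m)) (Wt (suc m) i) b                   ≡⟨ Δ-convˡ J² b (Tc m) (Wt (suc m) i) ⟨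
      Δ J² (conv (Tc m) (Wt (suc m) i)) b                   ≡⟨ Δ-convʳ J² b (Tc m) (Wt (suc m) i) ⟩
      conv (Tc m) (Δ J² (Wt (suc m) i)) b                   ≡⟨ conv-cong b {f = Tc m} (λ _ → refl) (Δ-Wt m i) ⟩
      conv (Tc m) (λ j → Wt m i j + J³ * hc (suc m) i * δ j) b
        ≡⟨ trans (conv-+ʳ b (Tc m) (Wt m i) (λ j → J³ * hc (suc m) i * δ j)) (cong (conv (Tc m) (Wt m i) b +_) (trans (conv-*ʳ b (J³ * hc (suc m) i) (Tc m) δ) (cong (J³ * hc (suc m) i *_) (trans (conv-comm b (Tc m) δ) (conv-δ b (Tc m)))))) ⟩
      conv (Tc m) (Wt m i) b + J³ * hc (suc m) i * Tc m b   ≡⟨ cong (conv (Tc m) (Wt m i) b +_) (swap J³ (hc (suc m) i) (Tc m b)) ⟩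
      conv (Tc m) (Wt m i) b + J³ * Tc m b * hc (suc m) i   ∎
      where
      swap : ∀ a b c → a * b * c ≡ a * c * b
      swap = solve-∀ ℚ-ring
    outer : conv (Tc (suc m)) (λ i → conv (Tc m) (Wt m i) b) a ≡ Δ J² (λ i → Hc m i b) a
    outer = begin
      conv (Tc (suc m)) (λ i → conv (Tc m) (Wt m i) b) a        ≡⟨ conv-cong a {g = λ i → conv (Tc m) (Wt m i) b} (Tc-suc m) (λ _ → refl) ⟩
      conv (Δ J² (Tc m)) (λ i → conv (Tc m) (Wt m i) b) a       ≡⟨ Δ-convˡ J² a (Tc m) (λ i → conv (Tc m) (Wt m i) b) ⟨
      Δ J² (λ i → conv² (Tc m) (Wt m) i b) a                    ≡⟨ Δ-cong J² a (λ i → Hc≡ m i b) ⟨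
      Δ J² (λ i → Hc m i b) a                                   ∎

module PartialFractions where

  open Sums
  open Polylogarithms

  sum-linear : ∀ n → Linear (sum n)
  sum-linear n = record { L-cong = sum-cong n ; L-+ = sum-+ n ; L-* = sum-*ˡ n }

  C-sym : ∀ m n → (m ℕ.+ n) choose m ≡ (m ℕ.+ n) choose n
  C-sym m n = trans (nCk≡nC[n∸k] (ℕP.m≤m+n m n)) (cong ((m ℕ.+ n) choose_) (ℕP.m+n∸m≡n m n))

  pw : ℚ → ℕ → ℚ
  pw x s = powℚ x (suc s)

  -- Coefficients of (K / (1 - K t))^(p+1)
  u : ℚ → ℕ → ℕ → ℚ
  u K p l = ℕtoℚ ((p ℕ.+ l) choose p) * powℚ K (suc (p ℕ.+ l))

  Δ-u-0 : ∀ K n → Δ K (u K 0) n ≡ K * δ n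
  Δ-u-0 K zero    = ℚP.*-identityˡ (K * 1ℚ)
  Δ-u-0 K (suc n) = regroup K (powℚ K n)
    where
    regroup : ∀ k x → 1ℚ * (k * (k * x)) - k * (1ℚ * (k * x)) ≡ k * 0ℚ
    regroup = solve-∀ ℚ-ring

  Δ-u-suc : ∀ K p n → Δ K (u K (suc p)) n ≡ K * u K p n
  Δ-u-suc K p zero    = trans (cong (λ z → ℕtoℚ z * (K * powℚ K (suc (p ℕ.+ 0)))) (trans (top (suc p)) (sym (top p)))) (regroup (ℕtoℚ ((p ℕ.+ 0) choose p)) K (powℚ K (suc (p ℕ.+ 0))))
    where
    top : ∀ p → (p ℕ.+ 0) choose p ≡ 1
    top p = trans (cong (_choose p) (ℕP.+-identityʳ p)) (nCn≡1 p)
    regroup : ∀ c k x → c * (k * x) ≡ k * (c * x)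
    regroup = solve-∀ ℚ-ring
  Δ-u-suc K p (suc n) = begin
    ℕtoℚ ((suc p ℕ.+ suc n) choose suc p) * (K * x) - K * (ℕtoℚ ((suc p ℕ.+ n) choose suc p) * powℚ K (suc (suc p ℕ.+ n)))
      ≡⟨ cong₂ (λ y z → y * (K * x) - K * (ℕtoℚ (z choose suc p) * powℚ K (suc z))) pascal (sym (ℕP.+-suc p n)) ⟩
    (ℕtoℚ ((p ℕ.+ suc n) choose p) + ℕtoℚ ((p ℕ.+ suc n) choose suc p)) * (K * x) - K * (ℕtoℚ ((p ℕ.+ suc n) choose suc p) * x)
      ≡⟨ regroup (ℕtoℚ ((p ℕ.+ suc n) choose p)) (ℕtoℚ ((p ℕ.+ suc n) choose suc p)) K x ⟩
    K * (ℕtoℚ ((p ℕ.+ suc n) choose p) * x) ∎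
    where
    open ≡-Reasoning
    x = powℚ K (suc (p ℕ.+ suc n))
    pascal : ℕtoℚ ((suc p ℕ.+ suc n) choose suc p) ≡ ℕtoℚ ((p ℕ.+ suc n) choose p) + ℕtoℚ ((p ℕ.+ suc n) choose suc p)
    pascal = trans (cong ℕtoℚ (sym (nCk+nC[k+1]≡[n+1]C[k+1] (p ℕ.+ suc n) p))) (ℕtoℚ-+ ((p ℕ.+ suc n) choose p) ((p ℕ.+ suc n) choose suc p))
    regroup : ∀ a b k x → (a + b) * (k * x) - k * (b * x) ≡ k * (a * x)
    regroup = solve-∀ ℚ-ring

  Δ-injective : ∀ K {f g} → (∀ n → Δ K f n ≡ Δ K g n) → ∀ n → f n ≡ g n
  Δ-injective K         e zero    = e 0
  Δ-injective K {f} {g} e (suc n) = begin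
    f (suc n)                      ≡⟨ regroup (f (suc n)) (K * f n) ⟩
    f (suc n) - K * f n + K * f n  ≡⟨ cong₂ (λ y z → y + K * z) (e (suc n)) (Δ-injective K e n) ⟩
    g (suc n) - K * g n + K * g n  ≡⟨ regroup (g (suc n)) (K * g n) ⟨
    g (suc n)                      ∎
    where
    open ≡-Reasoning
    regroup : ∀ x y → x ≡ x - y + y
    regroup = solve-∀ ℚ-ring

  conv-u-0 : ∀ K X n → Δ K (conv (u K 0) X) n ≡ K * X n
  conv-u-0 K X n = trans (Δ-convˡ K n (u K 0) X) (trans (conv-cong n {g = X} (Δ-u-0 K) (λ _ → refl)) (trans (conv-*ˡ n K δ X) (cong (K *_) (conv-δ n X))))

  conv-u-suc : ∀ K p X n → Δ K (conv (u K (suc p)) X) n ≡ K * conv (u K p) X n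
  conv-u-suc K p X n = trans (Δ-convˡ K n (u K (suc p)) X) (trans (conv-cong n {g = X} (Δ-u-suc K p) (λ _ → refl)) (conv-*ˡ n K (u K p) X))

  conv-u-pw : ∀ K p n → conv (u K p) (pw K) n ≡ u K (suc p) n
  conv-u-pw K p = Δ-injective K λ n → trans (Δ-convʳ K n (u K p) (pw K))
    (trans (conv-cong n {f = u K p} (λ _ → refl) Δ-pw) (trans (conv-*ʳ n K (u K p) δ) (trans (cong (K *_) (trans (conv-comm n (u K p) δ) (conv-δ n (u K p)))) (sym (Δ-u-suc K p n)))))
    where
    Δ-pw : ∀ n → Δ K (pw K) n ≡ K * δ n
    Δ-pw zero    = refl
    Δ-pw (suc n) = trans (ℚP.+-inverseʳ (K * pw K n)) (sym (ℚP.*-zeroʳ K))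

  from-Δ : ∀ K f n {x} → Δ K f (suc n) ≡ x → f (suc n) ≡ K * f n + x
  from-Δ K f n {x} e = trans (regroup (f (suc n)) (K * f n)) (cong (K * f n +_) e)
    where
    regroup : ∀ x y → x ≡ y + (x - y)
    regroup = solve-∀ ℚ-ring

  -- With K = 1/k, x = 1/j and y = 1/(j+k) this is the partial fraction expansion of 1/(j^(q+1) (j+k)^(p+1)) in j.
  partial-fractions : ∀ {x y K} → x * y ≡ K * (x - y) → ∀ p q →
    pw x q * pw y p ≡ sgn (suc p) * conv (u (- K) p) (pw x) q + sgn (suc q) * conv (u K q) (pw y) p
  partial-fractions {x} {y} {K} xy = go
    where
    open ≡-Reasoning
    A B : ℕ → ℕ → ℚ
    A p q = conv (u (- K) p) (pw x) q
    B q p = conv (u K q) (pw y) p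
    go : ∀ p q → pw x q * pw y p ≡ sgn (suc p) * A p q + sgn (suc q) * B q p
    go zero zero = trans (regroup₁ x y) (trans xy (regroup₂ x y K))
      where
      regroup₁ : ∀ x y → x * 1ℚ * (y * 1ℚ) ≡ x * y
      regroup₁ = solve-∀ ℚ-ring
      regroup₂ : ∀ x y k → k * (x - y) ≡ (- 1ℚ) * (1ℚ * ((- k) * 1ℚ) * (x * 1ℚ)) + (- 1ℚ) * (1ℚ * (k * 1ℚ) * (y * 1ℚ))
      regroup₂ = solve-∀ ℚ-ring
    go (suc p) zero = begin
      x * 1ℚ * (y * pw y p)                                                       ≡⟨ regroup₁ x y (pw y p) ⟩
      x * y * pw y p                                                              ≡⟨ cong (_* pw y p) xy ⟩
      K * (x - y) * pw y p                                                        ≡⟨ regroup₂ K x y (pw y p) ⟩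
      K * (x * 1ℚ * pw y p) - K * (y * pw y p)                                    ≡⟨ cong (λ z → K * z - K * (y * pw y p)) (go p zero) ⟩
      K * (sgn (suc p) * A p 0 + (- 1ℚ) * B 0 p) - K * (y * pw y p)               ≡⟨ regroup₃ K (sgn (suc p)) (A p 0) (B 0 p) (y * pw y p) ⟩
      sgn (suc (suc p)) * ((- K) * A p 0) + (- 1ℚ) * (K * B 0 p + K * pw y (suc p)) ≡⟨ cong₂ (λ a b → sgn (suc (suc p)) * a + (- 1ℚ) * b) (sym (conv-u-suc (- K) p (pw x) 0)) (sym (from-Δ K (B 0) p (conv-u-0 K (pw y) (suc p)))) ⟩
      sgn (suc (suc p)) * A (suc p) 0 + (- 1ℚ) * B 0 (suc p)                      ∎
      where
      regroup₁ : ∀ x y z → x * 1ℚ * (y * z) ≡ x * y * z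
      regroup₁ = solve-∀ ℚ-ring
      regroup₂ : ∀ k x y z → k * (x - y) * z ≡ k * (x * 1ℚ * z) - k * (y * z)
      regroup₂ = solve-∀ ℚ-ring
      regroup₃ : ∀ k s a b z → k * (s * a + (- 1ℚ) * b) - k * z ≡ (- s) * ((- k) * a) + (- 1ℚ) * (k * b + k * z)
      regroup₃ = solve-∀ ℚ-ring
    go zero (suc q) = begin
      x * pw x q * (y * 1ℚ)                                                       ≡⟨ regroup₁ x y (pw x q) ⟩
      x * y * pw x q                                                              ≡⟨ cong (_* pw x q) xy ⟩
      K * (x - y) * pw x q                                                        ≡⟨ regroup₂ K x y (pw x q) ⟩
      K * (x * pw x q) - K * (pw x q * (y * 1ℚ))                                  ≡⟨ cong (λ z → K * (x * pw x q) - K * z) (go zero q) ⟩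
      K * (x * pw x q) - K * ((- 1ℚ) * A 0 q + sgn (suc q) * B q 0)               ≡⟨ regroup₃ K (sgn (suc q)) (A 0 q) (B q 0) (x * pw x q) ⟩
      (- 1ℚ) * ((- K) * A 0 q + (- K) * pw x (suc q)) + sgn (suc (suc q)) * (K * B q 0) ≡⟨ cong₂ (λ a b → (- 1ℚ) * a + sgn (suc (suc q)) * b) (sym (from-Δ (- K) (A 0) q (conv-u-0 (- K) (pw x) (suc q)))) (sym (conv-u-suc K q (pw y) 0)) ⟩
      (- 1ℚ) * A 0 (suc q) + sgn (suc (suc q)) * B (suc q) 0                      ∎
      where
      regroup₁ : ∀ x y z → x * z * (y * 1ℚ) ≡ x * y * z
      regroup₁ = solve-∀ ℚ-ring
      regroup₂ : ∀ k x y z → k * (x - y) * z ≡ k * (x * z) - k * (z * (y * 1ℚ))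
      regroup₂ = solve-∀ ℚ-ring
      regroup₃ : ∀ k s a b z → k * z - k * ((- 1ℚ) * a + s * b) ≡ (- 1ℚ) * ((- k) * a + (- k) * z) + (- s) * (k * b)
      regroup₃ = solve-∀ ℚ-ring
    go (suc p) (suc q) = begin
      x * pw x q * (y * pw y p)                                                   ≡⟨ regroup₁ x y (pw x q) (pw y p) ⟩
      x * y * (pw x q * pw y p)                                                   ≡⟨ cong (_* (pw x q * pw y p)) xy ⟩
      K * (x - y) * (pw x q * pw y p)                                             ≡⟨ regroup₂ K x y (pw x q) (pw y p) ⟩
      K * (x * pw x q * pw y p) - K * (pw x q * (y * pw y p))                     ≡⟨ cong₂ (λ a b → K * a - K * b) (go p (suc q)) (go (suc p) q) ⟩
      K * (sgn (suc p) * A p (suc q) + sgn (suc (suc q)) * B (suc q) p) - K * (sgn (suc (suc p)) * A (suc p) q + sgn (suc q) * B q (suc p))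
        ≡⟨ regroup₃ K (sgn (suc p)) (sgn (suc q)) (A p (suc q)) (B (suc q) p) (A (suc p) q) (B q (suc p)) ⟩
      sgn (suc (suc p)) * ((- K) * A (suc p) q + (- K) * A p (suc q)) + sgn (suc (suc q)) * (K * B (suc q) p + K * B q (suc p))
        ≡⟨ cong₂ (λ a b → sgn (suc (suc p)) * a + sgn (suc (suc q)) * b) (sym (from-Δ (- K) (A (suc p)) q (conv-u-suc (- K) p (pw x) (suc q)))) (sym (from-Δ K (B (suc q)) p (conv-u-suc K q (pw y) (suc p)))) ⟩
      sgn (suc (suc p)) * A (suc p) (suc q) + sgn (suc (suc q)) * B (suc q) (suc p) ∎
      where
      regroup₁ : ∀ x y z w → x * z * (y * w) ≡ x * y * (z * w)
      regroup₁ = solve-∀ ℚ-ring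
      regroup₂ : ∀ k x y z w → k * (x - y) * (z * w) ≡ k * (x * z * w) - k * (z * (y * w))
      regroup₂ = solve-∀ ℚ-ring
      regroup₃ : ∀ k s t a b c d → k * (s * a + (- t) * b) - k * ((- s) * c + t * d) ≡ (- s) * ((- k) * c + (- k) * a) + (- t) * (k * b + k * d)
      regroup₃ = solve-∀ ℚ-ring

  -- rd κ i = 1/(κ - i), with the value 0 on the diagonal
  rd : ℕ → ℕ → ℚ
  rd zero    zero    = 0ℚ
  rd zero    (suc i) = - inv i
  rd (suc κ) zero    = inv κ
  rd (suc κ) (suc i) = rd κ i

  rd-diag : ∀ κ → rd κ κ ≡ 0ℚ
  rd-diag zero    = refl
  rd-diag (suc κ) = rd-diag κ

  rd-anti : ∀ κ i → rd κ i ≡ - rd i κ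
  rd-anti zero    zero    = refl
  rd-anti zero    (suc i) = refl
  rd-anti (suc κ) zero    = double-neg (inv κ)
    where
    double-neg : ∀ x → x ≡ - - x
    double-neg = solve-∀ ℚ-ring
  rd-anti (suc κ) (suc i) = rd-anti κ i

  rd-below : ∀ {κ i} → i ℕ.< κ → rd κ i ≡ inv (κ ℕ.∸ suc i)
  rd-below {suc κ} {zero}  _         = refl
  rd-below {suc κ} {suc i} (s≤s i<κ) = rd-below i<κ

  rd-above : ∀ κ i → rd κ (suc κ ℕ.+ i) ≡ - inv i
  rd-above zero    i = refl
  rd-above (suc κ) i = rd-above κ i

  rd-cancel : ∀ κ i → κ ≢ i → rd κ i * (ℕtoℚ κ - ℕtoℚ i) ≡ 1ℚ
  rd-cancel zero    zero    ne = ⊥-elim (ne refl)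
  rd-cancel zero    (suc i) ne = trans (regroup (inv i) (ℕtoℚ (suc i))) (inv-cancel i)
    where
    regroup : ∀ x y → (- x) * (0ℚ - y) ≡ x * y
    regroup = solve-∀ ℚ-ring
  rd-cancel (suc κ) zero    ne = trans (regroup (inv κ) (ℕtoℚ (suc κ))) (inv-cancel κ)
    where
    regroup : ∀ x y → x * (y - 0ℚ) ≡ x * y
    regroup = solve-∀ ℚ-ring
  rd-cancel (suc κ) (suc i) ne = trans (cong (rd κ i *_) (trans (cong₂ _-_ (ℕtoℚ-suc κ) (ℕtoℚ-suc i)) (regroup (ℕtoℚ κ) (ℕtoℚ i)))) (rd-cancel κ i (ne ∘ cong suc))
    where
    regroup : ∀ x y → 1ℚ + x - (1ℚ + y) ≡ x - y
    regroup = solve-∀ ℚ-ring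

  xy-pos : ∀ κ i → inv i * inv (suc κ ℕ.+ i) ≡ inv κ * (inv i - inv (suc κ ℕ.+ i))
  xy-pos κ i = sym (trans (regroup₁ (inv κ) (inv i) (inv (suc κ ℕ.+ i))) (trans (cong (_- inv κ * inv (suc κ ℕ.+ i)) (*-inv κ i)) (regroup₂ (inv κ) (inv i) (inv (suc κ ℕ.+ i)))))
    where
    regroup₁ : ∀ k x y → k * (x - y) ≡ k * x - k * y
    regroup₁ = solve-∀ ℚ-ring
    regroup₂ : ∀ k x y → y * (k + x) - k * y ≡ x * y
    regroup₂ = solve-∀ ℚ-ring

  xy-neg : ∀ κ i → κ ≢ i → (- inv i) * rd κ i ≡ inv κ * (- inv i - rd κ i)
  xy-neg κ i ne = begin
    (- I) * y                                                        ≡⟨ trans (unit₁ I y) (cong (λ z → (- I) * (y * z)) (sym (inv-cancel κ))) ⟩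
    (- I) * (y * (K * ℕtoℚ (suc κ)))                                 ≡⟨ cong (λ z → (- I) * (y * (K * z))) (ℕtoℚ-suc κ) ⟩
    (- I) * (y * (K * (1ℚ + a)))                                     ≡⟨ regroup₁ I K y a b ⟩
    (- K) * (I * (y * (a - b)) + y * (I * (1ℚ + b)))                 ≡⟨ cong₂ (λ u v → (- K) * (I * u + y * v)) (rd-cancel κ i ne) (trans (cong (I *_) (sym (ℕtoℚ-suc i))) (inv-cancel i)) ⟩
    (- K) * (I * 1ℚ + y * 1ℚ)                                        ≡⟨ regroup₂ I K y ⟩
    K * (- I - y)                                                    ∎
    where
    open ≡-Reasoning
    I = inv i
    K = inv κ
    y = rd κ i
    a = ℕtoℚ κ
    b = ℕtoℚ i
    unit₁ : ∀ I y → (- I) * y ≡ (- I) * (y * 1ℚ)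
    unit₁ = solve-∀ ℚ-ring
    regroup₁ : ∀ I K y a b → (- I) * (y * (K * (1ℚ + a))) ≡ (- K) * (I * (y * (a - b)) + y * (I * (1ℚ + b)))
    regroup₁ = solve-∀ ℚ-ring
    regroup₂ : ∀ I K y → (- K) * (I * 1ℚ + y * 1ℚ) ≡ K * (- I - y)
    regroup₂ = solve-∀ ℚ-ring

module PowerSums where

  open Sums
  open Polylogarithms
  open DoubleSums
  open PartialFractions

  open Linear

  Et : ℕ → ℕ → ℚ
  Et p M = sum M (λ i → sgn i * powℚ (inv i) p)

  sum-conv : ∀ M n f (F : ℕ → ℕ → ℚ) → sum M (λ i → conv f (F i) n) ≡ conv f (λ s → sum M (λ i → F i s)) n
  sum-conv M n f F = L-conv (sum-linear M) n f F

  pw-neg : ∀ x s → pw (- x) s ≡ sgn (suc s) * pw x s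
  pw-neg x s = powℚ-neg x (suc s)

  pw-0 : ∀ s → pw 0ℚ s ≡ 0ℚ
  pw-0 s = ℚP.*-zeroˡ (powℚ 0ℚ s)

  ind : ℕ → ℕ → ℚ
  ind zero    zero    = 1ℚ
  ind zero    (suc i) = 0ℚ
  ind (suc κ) zero    = 0ℚ
  ind (suc κ) (suc i) = ind κ i

  ind-≢ : ∀ κ i → κ ≢ i → ind κ i ≡ 0ℚ
  ind-≢ zero    zero    ne = ⊥-elim (ne refl)
  ind-≢ zero    (suc i) ne = refl
  ind-≢ (suc κ) zero    ne = refl
  ind-≢ (suc κ) (suc i) ne = ind-≢ κ i (ne ∘ cong suc)

  ind-diag : ∀ κ → ind κ κ ≡ 1ℚ
  ind-diag zero    = refl
  ind-diag (suc κ) = ind-diag κ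

  sum-ind : ∀ {κ M} → κ ℕ.< M → (f : ℕ → ℚ) → sum M (λ i → f i * ind κ i) ≡ f κ
  sum-ind {zero} {suc M} _ f = trans (sum-shift M (λ i → f i * ind 0 i)) (trans (cong₂ _+_ (ℚP.*-identityʳ (f 0)) (trans (sum-cong M (λ i → ℚP.*-zeroʳ (f (suc i)))) (sum-0 M))) (ℚP.+-identityʳ (f 0)))
  sum-ind {suc κ} {suc M} (s≤s κ<M) f = trans (sum-shift M (λ i → f i * ind (suc κ) i)) (trans (cong (_+ sum M (λ i → f (suc i) * ind κ i)) (ℚP.*-zeroʳ (f 0))) (trans (ℚP.+-identityˡ _) (sum-ind κ<M (f ∘ suc))))

  -- Power sums over j = ±1, ..., ±M of 1/j and of 1/(j + k), with signs (-1)^(j-1); here k = κ + 1.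
  tX : ℕ → ℕ → ℚ
  tX M s = sum M (λ i → sgn i * (pw (inv i) s + pw (- inv i) s))

  tY : ℕ → ℕ → ℕ → ℚ
  tY M κ s = sum M (λ i → sgn i * (pw (inv (suc κ ℕ.+ i)) s + pw (rd κ i) s))

  U : ℕ → ℕ → ℕ → ℕ → ℚ
  U M κ p q = sum M (λ i → sgn i * (pw (inv i) q * pw (inv (suc κ ℕ.+ i)) p + pw (- inv i) q * pw (rd κ i) p))

  U-formula : ∀ {M κ} → κ ℕ.< M → ∀ p q → U M κ p q ≡
    sgn (suc p) * conv (u (- inv κ) p) (tX M) q + sgn (suc q) * conv (u (inv κ) q) (tY M κ) p - sgn κ * (sgn (suc p) * u (- inv κ) (suc p) q)
  U-formula {M} {κ} κ<M p q = begin
    U M κ p q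
      ≡⟨ sum-cong M term ⟩
    sum M (λ i → α * conv f (X̂ i) q + β * conv g (Ŷ i) p - sgn i * Q * ind κ i)
      ≡⟨ sum-- M (λ i → α * conv f (X̂ i) q + β * conv g (Ŷ i) p) (λ i → sgn i * Q * ind κ i) ⟩
    sum M (λ i → α * conv f (X̂ i) q + β * conv g (Ŷ i) p) - sum M (λ i → sgn i * Q * ind κ i)
      ≡⟨ cong₂ _-_ (trans (sum-+ M (λ i → α * conv f (X̂ i) q) (λ i → β * conv g (Ŷ i) p))
                     (cong₂ _+_ (trans (sum-*ˡ M α _) (cong (α *_) (sum-conv M q f X̂))) (trans (sum-*ˡ M β _) (cong (β *_) (sum-conv M p g Ŷ)))))
                   (sum-ind κ<M (λ i → sgn i * Q)) ⟩
    α * conv f (tX M) q + β * conv g (tY M κ) p - sgn κ * Q ∎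
    where
    open ≡-Reasoning
    K = inv κ
    α = sgn (suc p)
    β = sgn (suc q)
    f = u (- K) p
    g = u K q
    Q = α * u (- K) (suc p) q
    X̂ Ŷ : ℕ → ℕ → ℚ
    X̂ i s = sgn i * (pw (inv i) s + pw (- inv i) s)
    Ŷ i s = sgn i * (pw (inv (suc κ ℕ.+ i)) s + pw (rd κ i) s)
    rhs′ : ℚ → ℚ → ℚ
    rhs′ x y = α * conv f (pw x) q + β * conv g (pw y) p
    neg-term : ∀ i → Dec (κ ≡ i) → pw (- inv i) q * pw (rd κ i) p ≡ rhs′ (- inv i) (rd κ i) - Q * ind κ i
    neg-term i (no κ≢i) = trans (partial-fractions { - inv i} {rd κ i} {inv κ} (xy-neg κ i κ≢i) p q)
      (sym (trans (cong (λ z → rhs′ (- inv i) (rd κ i) - Q * z) (ind-≢ κ i κ≢i)) (minus-zero (rhs′ (- inv i) (rd κ i)) Q)))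
      where
      minus-zero : ∀ a q → a - q * 0ℚ ≡ a
      minus-zero = solve-∀ ℚ-ring
    neg-term i (yes refl) = trans (trans (cong (λ z → pw (- K) q * z) (trans (cong (λ z → pw z p) (rd-diag κ)) (pw-0 p))) (ℚP.*-zeroʳ (pw (- K) q)))
      (sym (trans (cong₂ (λ y z → α * conv f (pw (- K)) q + β * y - Q * z) vanish (ind-diag κ)) (trans (cong (λ z → α * z + β * 0ℚ - Q * 1ℚ) (conv-u-pw (- K) p q)) (cancel (α * u (- K) (suc p) q) β))))
      where
      cancel : ∀ a b → a + b * 0ℚ - a * 1ℚ ≡ 0ℚ
      cancel = solve-∀ ℚ-ring
      vanish : conv g (pw (rd κ κ)) p ≡ 0ℚ
      vanish = trans (conv-comm p g (pw (rd κ κ))) (trans (conv-cong p {g = g} (λ s → trans (cong (λ z → pw z s) (rd-diag κ)) (pw-0 s)) (λ _ → refl)) (conv-0ˡ p g))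
    term : ∀ i → sgn i * (pw (inv i) q * pw (inv (suc κ ℕ.+ i)) p + pw (- inv i) q * pw (rd κ i) p) ≡ α * conv f (X̂ i) q + β * conv g (Ŷ i) p - sgn i * Q * ind κ i
    term i = begin
      sgn i * (pw (inv i) q * pw (inv (suc κ ℕ.+ i)) p + pw (- inv i) q * pw (rd κ i) p)
        ≡⟨ cong₂ (λ a b → sgn i * (a + b)) (partial-fractions {inv i} {inv (suc κ ℕ.+ i)} {inv κ} (xy-pos κ i) p q) (neg-term i (κ ℕP.≟ i)) ⟩
      sgn i * (rhs′ (inv i) (inv (suc κ ℕ.+ i)) + (rhs′ (- inv i) (rd κ i) - Q * ind κ i))
        ≡⟨ regroup (sgn i) α (conv f (pw (inv i)) q) (conv f (pw (- inv i)) q) β (conv g (pw (inv (suc κ ℕ.+ i))) p) (conv g (pw (rd κ i)) p) Q (ind κ i) ⟩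
      α * (sgn i * (conv f (pw (inv i)) q + conv f (pw (- inv i)) q)) + β * (sgn i * (conv g (pw (inv (suc κ ℕ.+ i))) p + conv g (pw (rd κ i)) p)) - sgn i * Q * ind κ i
        ≡⟨ cong₂ (λ a b → α * a + β * b - sgn i * Q * ind κ i) (collect′ q f (pw (inv i)) (pw (- inv i))) (collect′ p g (pw (inv (suc κ ℕ.+ i))) (pw (rd κ i))) ⟩
      α * conv f (X̂ i) q + β * conv g (Ŷ i) p - sgn i * Q * ind κ i ∎
      where
      regroup : ∀ s a x x′ b y y′ q e → s * (a * x + b * y + (a * x′ + b * y′ - q * e)) ≡ a * (s * (x + x′)) + b * (s * (y + y′)) - s * q * e
      regroup = solve-∀ ℚ-ring
      collect′ : ∀ n f x y → sgn i * (conv f x n + conv f y n) ≡ conv f (λ s → sgn i * (x s + y s)) n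
      collect′ n f x y = sym (trans (conv-*ʳ n (sgn i) f (λ s → x s + y s)) (cong (sgn i *_) (conv-+ʳ n f x y)))

  tX-eval : ∀ M s → tX M s ≡ (1ℚ + sgn (suc s)) * Et (suc s) M
  tX-eval M s = trans (sum-cong M (λ i → trans (cong (λ z → sgn i * (pw (inv i) s + z)) (pw-neg (inv i) s)) (regroup (sgn i) (pw (inv i) s) (sgn (suc s))))) (sum-*ˡ M (1ℚ + sgn (suc s)) _)
    where
    regroup : ∀ s p t → s * (p + t * p) ≡ (1ℚ + t) * (s * p)
    regroup = solve-∀ ℚ-ring

  rd-sum : ∀ κ m (w : ℕ → ℚ) s → sum (suc κ ℕ.+ m) (λ i → w i * pw (rd κ i) s) ≡
    sum κ (λ t → w (κ ℕ.∸ suc t) * pw (inv t) s) + sum m (λ i → w (suc κ ℕ.+ i) * pw (- inv i) s)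
  rd-sum κ m w s = begin
    sum (suc κ ℕ.+ m) F                                    ≡⟨ sum-split (suc κ) m F ⟩
    sum κ F + F κ + sum m (λ i → F (suc κ ℕ.+ i))          ≡⟨ cong₂ _+_ (trans (cong₂ _+_ below diag) (ℚP.+-identityʳ (sum κ G))) (sum-cong m (λ i → cong (λ z → w (suc κ ℕ.+ i) * pw z s) (rd-above κ i))) ⟩
    sum κ G + sum m (λ i → w (suc κ ℕ.+ i) * pw (- inv i) s) ∎
    where
    open ≡-Reasoning
    F G : ℕ → ℚ
    F i = w i * pw (rd κ i) s
    G t = w (κ ℕ.∸ suc t) * pw (inv t) s
    diag : F κ ≡ 0ℚ
    diag = trans (cong (λ z → w κ * z) (trans (cong (λ z → pw z s) (rd-diag κ)) (pw-0 s))) (ℚP.*-zeroʳ (w κ))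
    flip-twice : ∀ {i} → i ℕ.< κ → κ ℕ.∸ suc (κ ℕ.∸ suc i) ≡ i
    flip-twice {i} i<κ = trans (cong (κ ℕ.∸_) (sym (ℕP.+-∸-assoc 1 i<κ))) (ℕP.m∸[m∸n]≡n (ℕP.<⇒≤ i<κ))
    below : sum κ F ≡ sum κ G
    below = trans (sum-cong< κ (λ i i<κ → cong₂ (λ a b → w a * pw b s) (sym (flip-twice i<κ)) (rd-below i<κ))) (sum-reverse κ G)

  sgn-flip : ∀ {i κ} → i ℕ.< κ → sgn (κ ℕ.∸ suc i) ≡ - sgn κ * sgn i
  sgn-flip {i} {κ} i<κ = begin
    sgn (κ ℕ.∸ suc i)                                        ≡⟨ unit (sgn (κ ℕ.∸ suc i)) ⟩
    sgn (κ ℕ.∸ suc i) * 1ℚ                                   ≡⟨ cong (sgn (κ ℕ.∸ suc i) *_) (sgn-square i) ⟨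
    sgn (κ ℕ.∸ suc i) * (sgn i * sgn i)                      ≡⟨ regroup (sgn (κ ℕ.∸ suc i)) (sgn i) ⟩
    - (sgn (suc i) * sgn (κ ℕ.∸ suc i)) * sgn i              ≡⟨ cong (λ z → - z * sgn i) (sgn-+ (suc i) (κ ℕ.∸ suc i)) ⟨
    - sgn (suc i ℕ.+ (κ ℕ.∸ suc i)) * sgn i                  ≡⟨ cong (λ z → - sgn z * sgn i) (ℕP.m+[n∸m]≡n i<κ) ⟩
    - sgn κ * sgn i                                          ∎
    where
    open ≡-Reasoning
    unit : ∀ x → x ≡ x * 1ℚ
    unit = solve-∀ ℚ-ring
    regroup : ∀ a s → a * (s * s) ≡ - ((- s) * a) * s
    regroup = solve-∀ ℚ-ring

  tY-eval : ∀ {M κ} → κ ℕ.< M → ∀ s → tY M κ s ≡ - sgn κ * (Et (suc s) (suc κ ℕ.+ M) + sgn (suc s) * Et (suc s) (M ℕ.∸ suc κ)) + pw (inv κ) s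
  tY-eval {M} {κ} κ<M s = begin
    tY M κ s
      ≡⟨ trans (sum-cong M (λ i → ℚP.*-distribˡ-+ (sgn i) (pw (inv (suc κ ℕ.+ i)) s) (pw (rd κ i) s))) (sum-+ M (λ i → sgn i * pw (inv (suc κ ℕ.+ i)) s) (λ i → sgn i * pw (rd κ i) s)) ⟩
    sum M (λ i → sgn i * pw (inv (suc κ ℕ.+ i)) s) + sum M (λ i → sgn i * pw (rd κ i) s)
      ≡⟨ cong₂ _+_ first (trans (cong (λ N → sum N (λ i → sgn i * pw (rd κ i) s)) (sym (ℕP.m+[n∸m]≡n κ<M))) (trans (rd-sum κ m′ sgn s) (cong₂ _+_ second third))) ⟩
    - sgn κ * (Et s′ (suc κ ℕ.+ M) - (Et s′ κ + sgn κ * pw (inv κ) s)) + (- sgn κ * Et s′ κ + - sgn κ * (sgn s′ * Et s′ m′))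
      ≡⟨ regroup (sgn κ) (Et s′ (suc κ ℕ.+ M)) (Et s′ κ) (pw (inv κ) s) (sgn s′ * Et s′ m′) ⟩
    - sgn κ * (Et s′ (suc κ ℕ.+ M) + sgn s′ * Et s′ m′) + sgn κ * sgn κ * pw (inv κ) s
      ≡⟨ cong (- sgn κ * (Et s′ (suc κ ℕ.+ M) + sgn s′ * Et s′ m′) +_) (trans (cong (_* pw (inv κ) s) (sgn-square κ)) (ℚP.*-identityˡ _)) ⟩
    - sgn κ * (Et s′ (suc κ ℕ.+ M) + sgn s′ * Et s′ m′) + pw (inv κ) s ∎
    where
    open ≡-Reasoning
    s′ = suc s
    m′ = M ℕ.∸ suc κ
    regroup : ∀ k x y p z → - k * (x - (y + k * p)) + (- k * y + - k * z) ≡ - k * (x + z) + k * k * p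
    regroup = solve-∀ ℚ-ring
    minus-sum : ∀ a b → b ≡ a + b - a
    minus-sum = solve-∀ ℚ-ring
    shift-sign : ∀ i → sgn i ≡ - sgn κ * sgn (suc κ ℕ.+ i)
    shift-sign i = sym (trans (cong (- sgn κ *_) (sgn-+ (suc κ) i)) (trans (regroup′ (sgn κ) (sgn i)) (trans (cong (_* sgn i) (sgn-square κ)) (ℚP.*-identityˡ (sgn i)))))
      where
      regroup′ : ∀ k s → - k * ((- k) * s) ≡ k * k * s
      regroup′ = solve-∀ ℚ-ring
    first : sum M (λ i → sgn i * pw (inv (suc κ ℕ.+ i)) s) ≡ - sgn κ * (Et s′ (suc κ ℕ.+ M) - Et s′ (suc κ))
    first = begin
      sum M (λ i → sgn i * pw (inv (suc κ ℕ.+ i)) s)                               ≡⟨ sum-cong M (λ i → trans (cong (_* pw (inv (suc κ ℕ.+ i)) s) (shift-sign i)) (ℚP.*-assoc (- sgn κ) (sgn (suc κ ℕ.+ i)) _)) ⟩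
      sum M (λ i → - sgn κ * (sgn (suc κ ℕ.+ i) * pw (inv (suc κ ℕ.+ i)) s))       ≡⟨ sum-*ˡ M (- sgn κ) _ ⟩
      - sgn κ * sum M (λ i → sgn (suc κ ℕ.+ i) * pw (inv (suc κ ℕ.+ i)) s)         ≡⟨ cong (- sgn κ *_) (trans (minus-sum (Et s′ (suc κ)) _) (cong (_- Et s′ (suc κ)) (sym (sum-split (suc κ) M (λ i → sgn i * powℚ (inv i) s′))))) ⟩
      - sgn κ * (Et s′ (suc κ ℕ.+ M) - Et s′ (suc κ))                              ∎
    second : sum κ (λ t → sgn (κ ℕ.∸ suc t) * pw (inv t) s) ≡ - sgn κ * Et s′ κ
    second = trans (sum-cong< κ (λ t t<κ → trans (cong (_* pw (inv t) s) (sgn-flip t<κ)) (ℚP.*-assoc (- sgn κ) (sgn t) _))) (sum-*ˡ κ (- sgn κ) _)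
    third : sum m′ (λ i → sgn (suc κ ℕ.+ i) * pw (- inv i) s) ≡ - sgn κ * (sgn s′ * Et s′ m′)
    third = trans (sum-cong m′ (λ i → trans (cong₂ _*_ (sgn-+ (suc κ) i) (pw-neg (inv i) s)) (regroup′ (sgn κ) (sgn i) (sgn s′) (pw (inv i) s)))) (trans (sum-*ˡ m′ (- sgn κ) _) (cong (- sgn κ *_) (sum-*ˡ m′ (sgn s′) _)))
      where
      regroup′ : ∀ k s t p → (- k) * s * (t * p) ≡ - k * (t * (s * p))
      regroup′ = solve-∀ ℚ-ring

  -- The effect on the power sums of truncating at M
  errY : ℕ → ℕ → ℕ → ℚ
  errY M κ s = - sgn κ * (Et (suc s) (suc κ ℕ.+ M) - Et (suc s) M + sgn (suc s) * (Et (suc s) (M ℕ.∸ suc κ) - Et (suc s) M))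

  tY-split : ∀ {M κ} → κ ℕ.< M → ∀ s → tY M κ s ≡ (- sgn κ) * tX M s + pw (inv κ) s + errY M κ s
  tY-split {M} {κ} κ<M s = trans (tY-eval κ<M s) (trans (regroup (sgn κ) (Et (suc s) (suc κ ℕ.+ M)) (Et (suc s) M) (sgn (suc s)) (Et (suc s) (M ℕ.∸ suc κ)) (pw (inv κ) s))
    (cong (λ z → (- sgn κ) * z + pw (inv κ) s + errY M κ s) (sym (tX-eval M s))))
    where
    regroup : ∀ k a b t c p → - k * (a + t * c) + p ≡ (- k) * ((1ℚ + t) * b) + p + - k * (a - b + t * (c - b))
    regroup = solve-∀ ℚ-ring

  -- The effect of exchanging the order of summation over a square
  errZ : ℕ → ℕ → ℕ → ℚ
  errZ M s i = Z (suc s) M - Z (suc s) (suc i ℕ.+ M) + (Z (suc s) M - Z (suc s) (M ℕ.∸ suc i))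

  sum-rd : ∀ {M i} → i ℕ.< M → ∀ s → sgn (suc s) ≡ - 1ℚ → sum M (λ κ → pw (rd κ i) s) ≡ Z (suc s) (M ℕ.∸ suc i) - Z (suc s) i
  sum-rd {M} {i} i<M s odd = begin
    sum M (λ κ → pw (rd κ i) s)                                          ≡⟨ sum-cong M (λ κ → trans (cong (λ z → pw z s) (rd-anti κ i)) (trans (pw-neg (rd i κ) s) (cong (_* pw (rd i κ) s) odd))) ⟩
    sum M (λ κ → (- 1ℚ) * pw (rd i κ) s)                                 ≡⟨ cong (λ N → sum N (λ κ → (- 1ℚ) * pw (rd i κ) s)) (sym (ℕP.m+[n∸m]≡n i<M)) ⟩
    sum (suc i ℕ.+ m′) (λ κ → (- 1ℚ) * pw (rd i κ) s)                    ≡⟨ rd-sum i m′ (λ _ → - 1ℚ) s ⟩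
    sum i (λ t → (- 1ℚ) * pw (inv t) s) + sum m′ (λ t → (- 1ℚ) * pw (- inv t) s)  ≡⟨ cong₂ _+_ (sum-*ˡ i (- 1ℚ) (λ t → pw (inv t) s)) (sum-cong m′ (λ t → trans (cong ((- 1ℚ) *_) (trans (pw-neg (inv t) s) (cong (_* pw (inv t) s) odd))) (double-neg (pw (inv t) s)))) ⟩
    (- 1ℚ) * Z (suc s) i + Z (suc s) m′                                  ≡⟨ regroup (Z (suc s) i) (Z (suc s) m′) ⟩
    Z (suc s) m′ - Z (suc s) i                                           ∎
    where
    open ≡-Reasoning
    m′ = M ℕ.∸ suc i
    double-neg : ∀ x → (- 1ℚ) * ((- 1ℚ) * x) ≡ x
    double-neg = solve-∀ ℚ-ring
    regroup : ∀ x y → (- 1ℚ) * x + y ≡ y - x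
    regroup = solve-∀ ℚ-ring

  Sd : ℕ → ℕ → ℕ → ℚ
  Sd M p q = sum M (λ i → sgn i * pw (inv i) q * Z½ (suc p) i)

  -- Σ_k Σ_j (-1)^(j-1) j^-(q+1) (k^-(p+1) - (k+j)^-(p+1)) over 1 ≤ k ≤ M and 0 < |j| ≤ M, summed over k first
  exchange : ∀ M p q → sgn (suc p) ≡ - 1ℚ → sgn (suc q) ≡ 1ℚ →
    sum M (λ κ → pw (inv κ) p * tX M q - U M κ p q) ≡ ℕtoℚ 2 * Sd M p q + sum M (λ i → sgn i * pw (inv i) q * errZ M p i)
  exchange M p q odd even = begin
    sum M (λ κ → pw (inv κ) p * tX M q - U M κ p q)
      ≡⟨ sum-cong M inner ⟩
    sum M (λ κ → sum M (λ i → G κ i))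
      ≡⟨ sum-swap M M G ⟩
    sum M (λ i → sum M (λ κ → G κ i))
      ≡⟨ sum-cong< M outer ⟩
    sum M (λ i → ℕtoℚ 2 * (w i * Z½ (suc p) i) + w i * errZ M p i)
      ≡⟨ trans (sum-+ M (λ i → ℕtoℚ 2 * (w i * Z½ (suc p) i)) (λ i → w i * errZ M p i)) (cong (_+ sum M (λ i → w i * errZ M p i)) (sum-*ˡ M (ℕtoℚ 2) _)) ⟩
    ℕtoℚ 2 * Sd M p q + sum M (λ i → w i * errZ M p i) ∎
    where
    open ≡-Reasoning
    w : ℕ → ℚ
    w i = sgn i * pw (inv i) q
    G : ℕ → ℕ → ℚ
    G κ i = w i * (ℕtoℚ 2 * pw (inv κ) p - pw (inv (suc i ℕ.+ κ)) p - pw (rd κ i) p)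
    neg-even : ∀ i → pw (- inv i) q ≡ pw (inv i) q
    neg-even i = trans (pw-neg (inv i) q) (trans (cong (_* pw (inv i) q) even) (ℚP.*-identityˡ _))
    inner : ∀ κ → pw (inv κ) p * tX M q - U M κ p q ≡ sum M (λ i → G κ i)
    inner κ = trans (cong (_- U M κ p q) (sym (sum-*ˡ M (pw (inv κ) p) (λ i → sgn i * (pw (inv i) q + pw (- inv i) q)))))
      (trans (sym (sum-- M (λ i → pw (inv κ) p * (sgn i * (pw (inv i) q + pw (- inv i) q))) (λ i → sgn i * (pw (inv i) q * pw (inv (suc κ ℕ.+ i)) p + pw (- inv i) q * pw (rd κ i) p))))
        (sum-cong M (λ i → trans (cong₂ (λ a b → pw (inv κ) p * (sgn i * (pw (inv i) q + a)) - sgn i * (pw (inv i) q * pw (inv (suc b)) p + a * pw (rd κ i) p)) (neg-even i) (ℕP.+-comm κ i))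
          (regroup (pw (inv κ) p) (sgn i) (pw (inv i) q) (pw (inv (suc i ℕ.+ κ)) p) (pw (rd κ i) p)))))
      where
      regroup : ∀ k s x y r → k * (s * (x + x)) - s * (x * y + x * r) ≡ s * x * (ℕtoℚ 2 * k - y - r)
      regroup = solve-∀ ℚ-ring
    outer : ∀ i → i ℕ.< M → sum M (λ κ → G κ i) ≡ ℕtoℚ 2 * (w i * Z½ (suc p) i) + w i * errZ M p i
    outer i i<M = begin
      sum M (λ κ → G κ i)
        ≡⟨ sum-*ˡ M (w i) _ ⟩
      w i * sum M (λ κ → ℕtoℚ 2 * pw (inv κ) p - pw (inv (suc i ℕ.+ κ)) p - pw (rd κ i) p)
        ≡⟨ cong (w i *_) (trans (sum-- M (λ κ → ℕtoℚ 2 * pw (inv κ) p - pw (inv (suc i ℕ.+ κ)) p) (λ κ → pw (rd κ i) p)) (cong₂ _-_ (trans (sum-- M (λ κ → ℕtoℚ 2 * pw (inv κ) p) (λ κ → pw (inv (suc i ℕ.+ κ)) p)) (cong₂ _-_ (sum-*ˡ M (ℕtoℚ 2) _) shifted)) (sum-rd i<M p odd))) ⟩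
      w i * (ℕtoℚ 2 * Z (suc p) M - (Z (suc p) (suc i ℕ.+ M) - (Z (suc p) i + pw (inv i) p)) - (Z (suc p) (M ℕ.∸ suc i) - Z (suc p) i))
        ≡⟨ regroup (w i) (Z (suc p) M) (Z (suc p) (suc i ℕ.+ M)) (Z (suc p) i) (pw (inv i) p) (Z (suc p) (M ℕ.∸ suc i)) ⟩
      ℕtoℚ 2 * (w i * Z½ (suc p) i) + w i * errZ M p i ∎
      where
      minus-sum : ∀ a b → b ≡ a + b - a
      minus-sum = solve-∀ ℚ-ring
      shifted : sum M (λ κ → pw (inv (suc i ℕ.+ κ)) p) ≡ Z (suc p) (suc i ℕ.+ M) - (Z (suc p) i + pw (inv i) p)
      shifted = trans (minus-sum (Z (suc p) (suc i)) _) (cong (_- Z (suc p) (suc i)) (sym (sum-split (suc i) M (λ i → powℚ (inv i) (suc p)))))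
      regroup : ∀ w a b c p d → w * (ℕtoℚ 2 * a - (b - (c + p)) - (d - c)) ≡ ℕtoℚ 2 * (w * (c + ½ * p)) + w * (a - b + (a - d))
      regroup = solve-∀ ℚ-ring

module Parity where

  open Sums
  open Growth
  open Polylogarithms
  open DoubleSums
  open PartialFractions
  open PowerSums

  conv-odd : ∀ f {g} → (∀ t → g (dbl t) ≡ 0ℚ) → ∀ b → conv f g (suc (dbl b)) ≡ conv (f ∘ dbl) (g ∘ suc ∘ dbl) b
  conv-odd f {g} z zero    = trans (cong (λ y → f 0 * g 1 + f 1 * y) (z 0)) (regroup (f 0 * g 1) (f 1))
    where
    regroup : ∀ x y → x + y * 0ℚ ≡ x
    regroup = solve-∀ ℚ-ring
  conv-odd f {g} z (suc b) = cong (f 0 * g (suc (dbl (suc b))) +_) (trans (cong₂ (λ y w → f 1 * y + w) (z (suc b)) (conv-odd (f ∘ suc ∘ suc) z b)) (regroup (conv (f ∘ suc ∘ suc ∘ dbl) (g ∘ suc ∘ dbl) b) (f 1)))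
    where
    regroup : ∀ x y → y * 0ℚ + x ≡ x
    regroup = solve-∀ ℚ-ring

  sum-convˡ : ∀ M n (F : ℕ → ℕ → ℚ) g → sum M (λ i → conv (F i) g n) ≡ conv (λ s → sum M (λ i → F i s)) g n
  sum-convˡ M n F g = trans (sum-cong M (λ i → conv-comm n (F i) g)) (trans (sum-conv M n g F) (conv-comm n g (λ s → sum M (λ i → F i s))))

  τ : ℕ → ℕ → ℚ
  τ M zero    = 1ℚ
  τ M (suc t) = tX M (suc (dbl t))

  A B : ℕ → ℕ → ℕ → ℚ
  A M a t = - (ℕtoℚ ((dbl a ℕ.+ dbl (suc t)) choose dbl a) * Z (suc (dbl a ℕ.+ dbl (suc t))) M)
  B M b l = ℕtoℚ ((suc (dbl b) ℕ.+ suc (dbl l)) choose suc (dbl b)) * Et (suc (suc (dbl b) ℕ.+ suc (dbl l))) M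

  tX-even : ∀ M t → tX M (dbl t) ≡ 0ℚ
  tX-even M t = trans (tX-eval M (dbl t)) (trans (cong (λ z → (1ℚ + - z) * Et (suc (dbl t)) M) (sgn-dbl t)) (ℚP.*-zeroˡ (Et (suc (dbl t)) M)))

  dbl-+ : ∀ m n → dbl m ℕ.+ dbl n ≡ dbl (m ℕ.+ n)
  dbl-+ zero    n = refl
  dbl-+ (suc m) n = cong (suc ∘ suc) (dbl-+ m n)

  sum-u : ∀ M q l → sum M (λ κ → u (inv κ) q l) ≡ ℕtoℚ ((q ℕ.+ l) choose q) * Z (suc (q ℕ.+ l)) M
  sum-u M q l = sum-*ˡ M (ℕtoℚ ((q ℕ.+ l) choose q)) (λ κ → powℚ (inv κ) (suc (q ℕ.+ l)))

  u-neg : ∀ K p l → u (- K) p l ≡ sgn (suc (p ℕ.+ l)) * u K p l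
  u-neg K p l = trans (cong (ℕtoℚ ((p ℕ.+ l) choose p) *_) (powℚ-neg K (suc (p ℕ.+ l)))) (regroup (ℕtoℚ ((p ℕ.+ l) choose p)) (sgn (suc (p ℕ.+ l))) (powℚ K (suc (p ℕ.+ l))))
    where
    regroup : ∀ a b c → a * (b * c) ≡ b * (a * c)
    regroup = solve-∀ ℚ-ring

  sum-sgn-u : ∀ M q l → sum M (λ κ → sgn κ * u (inv κ) q l) ≡ ℕtoℚ ((q ℕ.+ l) choose q) * Et (suc (q ℕ.+ l)) M
  sum-sgn-u M q l = trans (sum-cong M (λ κ → regroup (sgn κ) (ℕtoℚ ((q ℕ.+ l) choose q)) (powℚ (inv κ) (suc (q ℕ.+ l))))) (sum-*ˡ M (ℕtoℚ ((q ℕ.+ l) choose q)) _)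
    where
    regroup : ∀ a b c → a * (b * c) ≡ b * (a * c)
    regroup = solve-∀ ℚ-ring

  module _ (M a b : ℕ) where
    private
      p = dbl a
      q = suc (dbl b)
      g : ℕ → ℕ → ℚ
      g κ = u (inv κ) q
      f : ℕ → ℕ → ℚ
      f κ = u (- inv κ) p
      Σf Σg : ℕ → ℚ
      Σf l = sum M (λ κ → f κ l)
      Σg l = sum M (λ κ → sgn κ * g κ l)

    errU : ℚ
    errU = sum M (λ κ → conv (u (inv κ) (suc (dbl b))) (errY M κ) (dbl a))

    U-split : ∀ κ → κ ℕ.< M → pw (inv κ) p * tX M q - U M κ p q ≡
      pw (inv κ) p * tX M q + conv (f κ) (tX M) q + sgn κ * conv (g κ) (tX M) p - u (inv κ) (suc q) p - conv (g κ) (errY M κ) p - sgn κ * u (- inv κ) (suc p) q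
    U-split κ κ<M = begin
      pw (inv κ) p * tX M q - U M κ p q
        ≡⟨ cong (λ z → pw (inv κ) p * tX M q - z) (U-formula κ<M p q) ⟩
      pw (inv κ) p * tX M q - (- sgn (dbl a) * conv (f κ) (tX M) q + - - sgn (dbl b) * conv (g κ) (tY M κ) p - sgn κ * (- sgn (dbl a) * u (- inv κ) (suc p) q))
        ≡⟨ cong₂ (λ x y → pw (inv κ) p * tX M q - (- x * conv (f κ) (tX M) q + - - y * conv (g κ) (tY M κ) p - sgn κ * (- x * u (- inv κ) (suc p) q))) (sgn-dbl a) (sgn-dbl b) ⟩
      pw (inv κ) p * tX M q - (- 1ℚ * conv (f κ) (tX M) q + - - 1ℚ * conv (g κ) (tY M κ) p - sgn κ * (- 1ℚ * u (- inv κ) (suc p) q))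
        ≡⟨ cong (λ z → pw (inv κ) p * tX M q - (- 1ℚ * conv (f κ) (tX M) q + - - 1ℚ * z - sgn κ * (- 1ℚ * u (- inv κ) (suc p) q))) conv-tY ⟩
      pw (inv κ) p * tX M q - (- 1ℚ * conv (f κ) (tX M) q + - - 1ℚ * ((- sgn κ) * conv (g κ) (tX M) p + u (inv κ) (suc q) p + conv (g κ) (errY M κ) p) - sgn κ * (- 1ℚ * u (- inv κ) (suc p) q))
        ≡⟨ regroup (pw (inv κ) p * tX M q) (conv (f κ) (tX M) q) (sgn κ) (conv (g κ) (tX M) p) (u (inv κ) (suc q) p) (conv (g κ) (errY M κ) p) (u (- inv κ) (suc p) q) ⟩
      pw (inv κ) p * tX M q + conv (f κ) (tX M) q + sgn κ * conv (g κ) (tX M) p - u (inv κ) (suc q) p - conv (g κ) (errY M κ) p - sgn κ * u (- inv κ) (suc p) q ∎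
      where
      open ≡-Reasoning
      regroup : ∀ x y k z v e w → x - ((- 1ℚ) * y + (- - 1ℚ) * ((- k) * z + v + e) - k * ((- 1ℚ) * w)) ≡ x + y + k * z - v - e - k * w
      regroup = solve-∀ ℚ-ring
      conv-tY : conv (g κ) (tY M κ) p ≡ (- sgn κ) * conv (g κ) (tX M) p + u (inv κ) (suc q) p + conv (g κ) (errY M κ) p
      conv-tY = begin
        conv (g κ) (tY M κ) p
          ≡⟨ conv-cong p {f = g κ} (λ _ → refl) (tY-split κ<M) ⟩
        conv (g κ) (λ s → (- sgn κ) * tX M s + pw (inv κ) s + errY M κ s) p
          ≡⟨ conv-+ʳ p (g κ) (λ s → (- sgn κ) * tX M s + pw (inv κ) s) (errY M κ) ⟩
        conv (g κ) (λ s → (- sgn κ) * tX M s + pw (inv κ) s) p + conv (g κ) (errY M κ) p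
          ≡⟨ cong (_+ conv (g κ) (errY M κ) p) (trans (conv-+ʳ p (g κ) (λ s → (- sgn κ) * tX M s) (pw (inv κ))) (cong₂ _+_ (conv-*ʳ p (- sgn κ) (g κ) (tX M)) (conv-u-pw (inv κ) q p))) ⟩
        (- sgn κ) * conv (g κ) (tX M) p + u (inv κ) (suc q) p + conv (g κ) (errY M κ) p ∎

    A-part : Z (suc p) M * tX M q + conv Σf (tX M) q - sum M (λ κ → u (inv κ) (suc q) p) ≡ conv (A M a) (τ M) b
    A-part = trans (cong₂ (λ x y → Z (suc p) M * tX M q + x - y) (trans (conv-odd Σf (tX-even M) b) (conv-cong b {g = tX M ∘ suc ∘ dbl} coef (λ _ → refl))) last) (go b)
      where
      A′ : ℕ → ℚ
      A′ zero    = - Z (suc p) M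
      A′ (suc t) = A M a t
      coef : ∀ t → Σf (dbl t) ≡ A′ t
      coef t = trans (trans (sum-cong M (λ κ → u-neg (inv κ) p (dbl t))) (trans (sum-*ˡ M (sgn (suc (p ℕ.+ dbl t))) _) (cong₂ _*_ (cong -_ (trans (cong sgn (dbl-+ a t)) (sgn-dbl (a ℕ.+ t)))) (sum-u M p (dbl t))))) (by-cases t)
        where
        minus : ∀ x → (- 1ℚ) * x ≡ - x
        minus = solve-∀ ℚ-ring
        by-cases : ∀ t → - 1ℚ * (ℕtoℚ ((p ℕ.+ dbl t) choose p) * Z (suc (p ℕ.+ dbl t)) M) ≡ A′ t
        by-cases zero    = trans (cong (- 1ℚ *_) (trans (cong₂ (λ x y → ℕtoℚ (x choose p) * Z (suc y) M) (ℕP.+-identityʳ p) (ℕP.+-identityʳ p)) (trans (cong (λ z → ℕtoℚ z * Z (suc p) M) (nCn≡1 p)) (ℚP.*-identityˡ (Z (suc p) M))))) (minus (Z (suc p) M))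
        by-cases (suc t) = minus (ℕtoℚ ((p ℕ.+ dbl (suc t)) choose p) * Z (suc (p ℕ.+ dbl (suc t))) M)
      last : sum M (λ κ → u (inv κ) (suc q) p) ≡ - A M a b
      last = trans (sum-u M (suc q) p) (trans (cong₂ (λ x y → ℕtoℚ x * Z (suc y) M) (trans (C-sym (suc q) p) (cong (_choose p) (ℕP.+-comm (suc q) p))) (ℕP.+-comm (suc q) p)) (double-neg _))
        where
        double-neg : ∀ x → x ≡ - - x
        double-neg = solve-∀ ℚ-ring
      go : ∀ b → Z (suc p) M * tX M (suc (dbl b)) + conv A′ (tX M ∘ suc ∘ dbl) b - - A M a b ≡ conv (A M a) (τ M) b
      go zero    = regroup (Z (suc p) M) (tX M 1) (A M a 0)
        where
        regroup : ∀ z x y → z * x + (- z) * x - - y ≡ y * 1ℚ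
        regroup = solve-∀ ℚ-ring
      go (suc b) = trans (regroup (Z (suc p) M) (tX M (suc (dbl (suc b)))) (conv (A M a) (tX M ∘ suc ∘ dbl) b) (A M a (suc b))) (sym (conv-suc b (A M a) (τ M)))
        where
        regroup : ∀ z x c y → z * x + ((- z) * x + c) - - y ≡ c + y * 1ℚ
        regroup = solve-∀ ℚ-ring

    B-part : conv Σg (tX M) p - sum M (λ κ → sgn κ * u (- inv κ) (suc p) q) ≡ conv (B M b) (τ M) a
    B-part = trans (cong₂ (λ x y → x - y) (conv-cong p {g = tX M} coef (λ _ → refl)) last) (go a)
      where
      B′ : ℕ → ℚ
      B′ l = ℕtoℚ ((q ℕ.+ l) choose q) * Et (suc (q ℕ.+ l)) M
      coef : ∀ l → Σg l ≡ B′ l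
      coef l = sum-sgn-u M q l
      flip-sign : ∀ k s w → k * ((- - s) * w) ≡ s * (k * w)
      flip-sign = solve-∀ ℚ-ring
      parity : sgn (suc (suc p ℕ.+ q)) ≡ - 1ℚ
      parity = trans (cong sgn (cong (suc ∘ suc) (ℕP.+-suc p (dbl b)))) (trans (cong (λ z → sgn (suc (suc (suc z)))) (dbl-+ a b)) (trans (double-neg (sgn (dbl (a ℕ.+ b)))) (cong -_ (sgn-dbl (a ℕ.+ b)))))
        where
        double-neg : ∀ x → - - - x ≡ - x
        double-neg = solve-∀ ℚ-ring
      last : sum M (λ κ → sgn κ * u (- inv κ) (suc p) q) ≡ - B M b a
      last = begin
        sum M (λ κ → sgn κ * u (- inv κ) (suc p) q)                         ≡⟨ sum-cong M (λ κ → trans (cong (sgn κ *_) (trans (u-neg (inv κ) (suc p) q) (cong (_* u (inv κ) (suc p) q) parity))) (minus (sgn κ) (u (inv κ) (suc p) q))) ⟩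
        sum M (λ κ → - (sgn κ * u (inv κ) (suc p) q))                       ≡⟨ sum-neg M _ ⟩
        - sum M (λ κ → sgn κ * u (inv κ) (suc p) q)                         ≡⟨ cong -_ (sum-sgn-u M (suc p) q) ⟩
        - (ℕtoℚ ((suc p ℕ.+ q) choose suc p) * Et (suc (suc p ℕ.+ q)) M)         ≡⟨ cong -_ (cong₂ (λ x y → ℕtoℚ x * Et (suc y) M) (trans (C-sym (suc p) q) (cong (_choose q) (ℕP.+-comm (suc p) q))) (ℕP.+-comm (suc p) q)) ⟩
        - B M b a                                                           ∎
        where
        open ≡-Reasoning
        minus : ∀ k w → k * (- 1ℚ * w) ≡ - (k * w)
        minus = solve-∀ ℚ-ring
      go : ∀ a → conv B′ (tX M) (dbl a) - - B M b a ≡ conv (B M b) (τ M) a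
      go zero    = trans (cong (λ z → B′ 0 * z - - B M b 0) (tX-even M 0)) (regroup (B′ 0) (B M b 0))
        where
        regroup : ∀ x y → x * 0ℚ - - y ≡ y * 1ℚ
        regroup = solve-∀ ℚ-ring
      go (suc a) = trans (cong₂ (λ y z → B′ 0 * y + z - - B M b (suc a)) (tX-even M (suc a)) (conv-odd (B′ ∘ suc) (tX-even M) a))
        (trans (regroup (B′ 0) (conv (B M b) (tX M ∘ suc ∘ dbl) a) (B M b (suc a))) (sym (conv-suc a (B M b) (τ M))))
        where
        regroup : ∀ x c y → x * 0ℚ + c - - y ≡ c + y * 1ℚ
        regroup = solve-∀ ℚ-ring

    parity-sum : sum M (λ κ → pw (inv κ) p * tX M q - U M κ p q) ≡ conv (A M a) (τ M) b + conv (B M b) (τ M) a - errU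
    parity-sum = begin
      sum M (λ κ → pw (inv κ) p * tX M q - U M κ p q)
        ≡⟨ sum-cong< M U-split ⟩
      sum M (λ κ → x₁ κ + x₂ κ + x₃ κ - x₄ κ - x₅ κ - x₆ κ)
        ≡⟨ trans (sum-- M (λ κ → x₁ κ + x₂ κ + x₃ κ - x₄ κ - x₅ κ) x₆) (cong (_- sum M x₆)
             (trans (sum-- M (λ κ → x₁ κ + x₂ κ + x₃ κ - x₄ κ) x₅) (cong (_- sum M x₅)
               (trans (sum-- M (λ κ → x₁ κ + x₂ κ + x₃ κ) x₄) (cong (_- sum M x₄)
                 (trans (sum-+ M (λ κ → x₁ κ + x₂ κ) x₃) (cong (_+ sum M x₃) (sum-+ M x₁ x₂)))))))) ⟩
      sum M x₁ + sum M x₂ + sum M x₃ - sum M x₄ - sum M x₅ - sum M x₆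
        ≡⟨ cong₂ (λ y z → y + z - sum M x₄ - sum M x₅ - sum M x₆) (cong₂ _+_ (sum-*ʳ M (tX M q) (λ κ → pw (inv κ) p)) (sum-convˡ M q f (tX M)))
             (trans (sum-cong M (λ κ → sym (conv-*ˡ p (sgn κ) (g κ) (tX M)))) (sum-convˡ M p (λ κ l → sgn κ * g κ l) (tX M))) ⟩
      Z (suc p) M * tX M q + conv Σf (tX M) q + conv Σg (tX M) p - sum M x₄ - errU - sum M x₆
        ≡⟨ regroup (Z (suc p) M * tX M q) (conv Σf (tX M) q) (conv Σg (tX M) p) (sum M x₄) errU (sum M x₆) ⟩
      (Z (suc p) M * tX M q + conv Σf (tX M) q - sum M x₄) + (conv Σg (tX M) p - sum M x₆) - errU
        ≡⟨ cong₂ (λ y z → y + z - errU) A-part B-part ⟩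
      conv (A M a) (τ M) b + conv (B M b) (τ M) a - errU ∎
      where
      open ≡-Reasoning
      x₁ x₂ x₃ x₄ x₅ x₆ : ℕ → ℚ
      x₁ κ = pw (inv κ) p * tX M q
      x₂ κ = conv (f κ) (tX M) q
      x₃ κ = sgn κ * conv (g κ) (tX M) p
      x₄ κ = u (inv κ) (suc q) p
      x₅ κ = conv (g κ) (errY M κ) p
      x₆ κ = sgn κ * u (- inv κ) (suc p) q
      regroup : ∀ a b c d e f → a + b + c - d - e - f ≡ (a + b - d) + (c - f) - e
      regroup = solve-∀ ℚ-ring

    errS : ℚ
    errS = sum M (λ i → sgn i * pw (inv i) (suc (dbl b)) * errZ M (dbl a) i)

    double-sum : ℕtoℚ 2 * Sd M p q ≡ conv (A M a) (τ M) b + conv (B M b) (τ M) a - (errU + errS)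
    double-sum = begin
      ℕtoℚ 2 * Sd M p q                         ≡⟨ minus-sum (ℕtoℚ 2 * Sd M p q) errS ⟩
      ℕtoℚ 2 * Sd M p q + errS - errS           ≡⟨ cong (_- errS) (exchange M p q (cong -_ (sgn-dbl a)) (trans (double-neg (sgn (dbl b))) (sgn-dbl b))) ⟨
      sum M (λ κ → pw (inv κ) p * tX M q - U M κ p q) - errS ≡⟨ cong (_- errS) parity-sum ⟩
      conv (A M a) (τ M) b + conv (B M b) (τ M) a - errU - errS ≡⟨ regroup (conv (A M a) (τ M) b + conv (B M b) (τ M) a) errU errS ⟩
      conv (A M a) (τ M) b + conv (B M b) (τ M) a - (errU + errS) ∎
      where
      open ≡-Reasoning
      minus-sum : ∀ a b → a ≡ a + b - b
      minus-sum = solve-∀ ℚ-ring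
      double-neg : ∀ x → - - x ≡ x
      double-neg = solve-∀ ℚ-ring
      regroup : ∀ a b c → a - b - c ≡ a - (b + c)
      regroup = solve-∀ ℚ-ring

  pw≤inv : ∀ t s → pw (inv t) s ≤ inv t
  pw≤inv t s = ℚP.≤-trans (*-monoˡ (inv-nonneg t) (pow≤1 s)) (ℚP.≤-reflexive (ℚP.*-identityʳ (inv t)))
    where
    pow≤1 : ∀ s → powℚ (inv t) s ≤ 1ℚ
    pow≤1 zero    = ℚP.≤-refl
    pow≤1 (suc s) = *-mono {inv t} {1ℚ} {powℚ (inv t) s} {1ℚ} 0≤1 (powℚ-nonneg (inv-nonneg t) s) (inv≤1 t) (pow≤1 s)

  ∣pw∣ : ∀ t s → ∣ pw (inv t) s ∣ ≤ inv t
  ∣pw∣ t s = subst (_≤ inv t) (sym (ℚP.0≤p⇒∣p∣≡p (powℚ-nonneg (inv-nonneg t) (suc s)))) (pw≤inv t s)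

  ∣sgn*∣ : ∀ i {x y} → ∣ x ∣ ≤ y → ∣ sgn i * x ∣ ≤ y
  ∣sgn*∣ i {x} {y} le = subst (_≤ y) (sym (trans (ℚP.∣p*q∣≡∣p∣*∣q∣ (sgn i) x) (trans (cong (_* ∣ x ∣) (∣sgn∣ i)) (ℚP.*-identityˡ ∣ x ∣)))) le

  sum-increment : ∀ {F : ℕ → ℚ} → (∀ t → ∣ F t ∣ ≤ inv t) → ∀ x d → ∣ sum (x ℕ.+ d) F - sum x F ∣ ≤ ℕtoℚ d * inv x
  sum-increment {F} le x d = begin
    ∣ sum (x ℕ.+ d) F - sum x F ∣           ≡⟨ cong ∣_∣ (trans (cong (_- sum x F) (sum-split x d F)) (cancel (sum x F) _)) ⟩
    ∣ sum d (λ i → F (x ℕ.+ i)) ∣           ≤⟨ ∣sum∣≤ d (λ i _ → ℚP.≤-trans (le (x ℕ.+ i)) (inv-anti (ℕP.m≤m+n x i))) ⟩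
    sum d (λ _ → inv x)                     ≡⟨ const d ⟩
    ℕtoℚ d * inv x                          ∎
    where
    open ℚP.≤-Reasoning
    cancel : ∀ a b → a + b - a ≡ b
    cancel = solve-∀ ℚ-ring
    regroup : ∀ n y → n * y + y ≡ (1ℚ + n) * y
    regroup = solve-∀ ℚ-ring
    const : ∀ d → sum d (λ _ → inv x) ≡ ℕtoℚ d * inv x
    const zero    = sym (ℚP.*-zeroˡ (inv x))
    const (suc d) = trans (cong (_+ inv x) (const d)) (trans (regroup (ℕtoℚ d) (inv x)) (cong (_* inv x) (sym (ℕtoℚ-suc d))))

  module _ {F : ℕ → ℚ} (le : ∀ t → ∣ F t ∣ ≤ inv t) {m i : ℕ} (i≤m : i ℕ.≤ m) where
    private
      bound₀ = ℕtoℚ (suc i) * inv (m ℕ.∸ i)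

    above : ∣ sum (suc i ℕ.+ suc m) F - sum (suc m) F ∣ ≤ bound₀
    above = ℚP.≤-trans (subst (λ z → ∣ sum z F - sum (suc m) F ∣ ≤ ℕtoℚ (suc i) * inv (suc m)) (ℕP.+-comm (suc m) (suc i)) (sum-increment le (suc m) (suc i)))
      (*-monoˡ (ℕtoℚ-nonneg (suc i)) (inv-anti (ℕP.≤-trans (ℕP.m∸n≤m m i) (ℕP.n≤1+n m))))

    below : ∣ sum (suc m) F - sum (m ℕ.∸ i) F ∣ ≤ bound₀
    below = subst (λ z → ∣ sum z F - sum (m ℕ.∸ i) F ∣ ≤ bound₀) (trans (ℕP.+-suc (m ℕ.∸ i) i) (cong suc (ℕP.m∸n+n≡m i≤m))) (sum-increment le (m ℕ.∸ i) (suc i))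

  ∣-∣-comm : ∀ x y → ∣ x - y ∣ ≡ ∣ y - x ∣
  ∣-∣-comm x y = trans (cong ∣_∣ (flip-sign x y)) (ℚP.∣-p∣≡∣p∣ (y - x))
    where
    flip-sign : ∀ x y → x - y ≡ - (y - x)
    flip-sign = solve-∀ ℚ-ring

  errZ-bound : ∀ {m i} → i ℕ.≤ m → ∀ s → ∣ errZ (suc m) s i ∣ ≤ ℕtoℚ 2 * (ℕtoℚ (suc i) * inv (m ℕ.∸ i))
  errZ-bound {m} {i} i≤m s = ℚP.≤-trans (∣+∣≤ (subst (_≤ ℕtoℚ (suc i) * inv (m ℕ.∸ i)) (∣-∣-comm (Z (suc s) (suc i ℕ.+ suc m)) (Z (suc s) (suc m))) (above (λ t → ∣pw∣ t s) i≤m)) (below (λ t → ∣pw∣ t s) i≤m))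
    (ℚP.≤-reflexive (two (ℕtoℚ (suc i) * inv (m ℕ.∸ i))))
    where
    two : ∀ x → x + x ≡ ℕtoℚ 2 * x
    two = solve-∀ ℚ-ring

  errY-bound : ∀ {m κ} → κ ℕ.≤ m → ∀ s → ∣ errY (suc m) κ s ∣ ≤ ℕtoℚ 2 * (ℕtoℚ (suc κ) * inv (m ℕ.∸ κ))
  errY-bound {m} {κ} κ≤m s = subst (λ z → ∣ z ∣ ≤ ℕtoℚ 2 * Y) (regroup (sgn κ) (Et s′ (suc κ ℕ.+ suc m) - Et s′ (suc m) + sgn s′ * (Et s′ (m ℕ.∸ κ) - Et s′ (suc m))))
    (∣sgn*∣ (suc κ) (ℚP.≤-trans (∣+∣≤ (above le κ≤m) (∣sgn*∣ s′ (subst (_≤ Y) (∣-∣-comm (Et s′ (suc m)) (Et s′ (m ℕ.∸ κ))) (below le κ≤m)))) (ℚP.≤-reflexive (two Y))))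
    where
    s′ = suc s
    Y = ℕtoℚ (suc κ) * inv (m ℕ.∸ κ)
    le : ∀ t → ∣ sgn t * powℚ (inv t) s′ ∣ ≤ inv t
    le t = ∣sgn*∣ t (∣pw∣ t s)
    two : ∀ x → x + x ≡ ℕtoℚ 2 * x
    two = solve-∀ ℚ-ring
    regroup : ∀ k x → (- k) * x ≡ - k * x
    regroup = solve-∀ ℚ-ring

  -- Weights O(1/j²) make errors of size j/(M - j + 1) negligible.
  error-Sml : ∀ C → 0ℚ ≤ C → (w e : ℕ → ℕ → ℚ) → (∀ m i → ∣ w m i ∣ ≤ C * inv² i) →
    (∀ m i → i ℕ.≤ m → ∣ e m i ∣ ≤ ℕtoℚ 2 * (ℕtoℚ (suc i) * inv (m ℕ.∸ i))) → Sml (λ m → sum (suc m) (λ i → w m i * e m i))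
  error-Sml C 0≤C w e hw he = bnd (ℕtoℚ 4 * (C * ℕtoℚ 2)) 1 (*-nonneg (ℕtoℚ-nonneg 4) (*-nonneg 0≤C (ℕtoℚ-nonneg 2))) λ m →
    subst (λ z → ∣ z ∣ ≤ ℕtoℚ 4 * (C * ℕtoℚ 2) * powℚ (h m) 1 * inv m) (sum-cong (suc m) (λ i → rebalance (w m i) (e m i) i))
      (convolution-bound m (λ i → w m i * ℕtoℚ (suc i)) (λ i → e m i * inv i) 0≤C (ℕtoℚ-nonneg 2) (λ i _ → bound-w m i) (λ i i≤m → bound-e m i i≤m))
    where
    regroup₁ : ∀ w e i n → w * n * (e * i) ≡ w * e * (i * n)
    regroup₁ = solve-∀ ℚ-ring
    rebalance : ∀ w e i → w * ℕtoℚ (suc i) * (e * inv i) ≡ w * e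
    rebalance w e i = trans (regroup₁ w e (inv i) (ℕtoℚ (suc i))) (trans (cong (w * e *_) (inv-cancel i)) (ℚP.*-identityʳ (w * e)))
    regroup₂ : ∀ c i n → c * (i * i) * n ≡ c * i * (i * n)
    regroup₂ = solve-∀ ℚ-ring
    regroup₃ : ∀ t n y i → t * (n * y) * i ≡ t * y * (i * n)
    regroup₃ = solve-∀ ℚ-ring
    ∣suc∣ : ∀ i → ∣ ℕtoℚ (suc i) ∣ ≤ ℕtoℚ (suc i)
    ∣suc∣ i = ℚP.≤-reflexive (ℚP.0≤p⇒∣p∣≡p (ℕtoℚ-nonneg (suc i)))
    bound-w : ∀ m i → ∣ w m i * ℕtoℚ (suc i) ∣ ≤ C * inv i
    bound-w m i = ℚP.≤-trans (∣*∣≤ (hw m i) (∣suc∣ i)) (ℚP.≤-reflexive (trans (regroup₂ C (inv i) (ℕtoℚ (suc i))) (trans (cong (C * inv i *_) (inv-cancel i)) (ℚP.*-identityʳ (C * inv i)))))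
    bound-e : ∀ m i → i ℕ.≤ m → ∣ e m i * inv i ∣ ≤ ℕtoℚ 2 * inv (m ℕ.∸ i)
    bound-e m i i≤m = ℚP.≤-trans (∣*∣≤ (he m i i≤m) (ℚP.≤-reflexive (∣inv∣ i)))
      (ℚP.≤-reflexive (trans (regroup₃ (ℕtoℚ 2) (ℕtoℚ (suc i)) (inv (m ℕ.∸ i)) (inv i)) (trans (cong (ℕtoℚ 2 * inv (m ℕ.∸ i) *_) (inv-cancel i)) (ℚP.*-identityʳ (ℕtoℚ 2 * inv (m ℕ.∸ i))))))

  ∣pw∣² : ∀ i s → ∣ pw (inv i) (suc s) ∣ ≤ inv² i
  ∣pw∣² i s = subst (_≤ inv² i) (sym (ℚP.0≤p⇒∣p∣≡p (powℚ-nonneg (inv-nonneg i) (suc (suc s))))) (*-monoˡ (inv-nonneg i) (pw≤inv i s))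

  errS-Sml : ∀ a b → Sml (λ m → errS (suc m) a b)
  errS-Sml a b = error-Sml 1ℚ 0≤1 (λ m i → sgn i * pw (inv i) (suc (dbl b))) (λ m i → errZ (suc m) (dbl a) i)
    (λ m i → subst (∣ sgn i * pw (inv i) (suc (dbl b)) ∣ ≤_) (sym (ℚP.*-identityˡ (inv² i))) (∣sgn*∣ i (∣pw∣² i (dbl b)))) (λ m i i≤m → errZ-bound i≤m (dbl a))

  errU-Sml : ∀ a b → Sml (λ m → errU (suc m) a b)
  errU-Sml a b = bnd-cong (λ m → sym (expand m)) (bnd-sum inv-nonneg (suc p) (λ l _ → error-Sml (coef l) (ℕtoℚ-nonneg ((q ℕ.+ l) choose q)) (λ m κ → u (inv κ) q l) (λ m κ → errY (suc m) κ (p ℕ.∸ l)) (λ m κ → bound-u κ l) (λ m κ κ≤m → errY-bound κ≤m (p ℕ.∸ l))))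
    where
    p = dbl a
    q = suc (dbl b)
    coef : ℕ → ℚ
    coef l = ℕtoℚ ((q ℕ.+ l) choose q)
    bound-u : ∀ κ l → ∣ u (inv κ) q l ∣ ≤ coef l * inv² κ
    bound-u κ l = ∣*∣≤ (ℚP.≤-reflexive (ℚP.0≤p⇒∣p∣≡p (ℕtoℚ-nonneg ((q ℕ.+ l) choose q)))) (∣pw∣² κ (dbl b ℕ.+ l))
    expand : ∀ m → errU (suc m) a b ≡ sum (suc p) (λ l → sum (suc m) (λ κ → u (inv κ) q l * errY (suc m) κ (p ℕ.∸ l)))
    expand m = trans (sum-cong (suc m) (λ κ → conv-as-sum p (u (inv κ) q) (errY (suc m) κ))) (sum-swap (suc m) (suc p) (λ κ l → u (inv κ) q l * errY (suc m) κ (p ℕ.∸ l)))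

module Asymptotics where

  open Sums
  open Growth
  open Polylogarithms
  open Realisation
  open DoubleSums
  open PartialFractions
  open PowerSums
  open Parity

  open Linear

  μ-nonneg : ∀ M j → j ℕ.≤ M → 0ℚ ≤ μ M j
  μ-nonneg M zero    _   = 0≤1
  μ-nonneg M (suc j) j<M = *-nonneg (μ-nonneg M j (ℕP.<⇒≤ j<M)) (*-nonneg (difference-nonneg (ℕtoℚ-mono (ℕP.<⇒≤ j<M))) (inv-nonneg (M ℕ.+ j)))
    where
    difference-nonneg : ∀ {x y} → x ≤ y → 0ℚ ≤ y - x
    difference-nonneg {x} {y} le = subst (_≤ y - x) (ℚP.+-inverseʳ x) (ℚP.+-monoˡ-≤ (- x) le)

  μ-ratio : ∀ M j → 1ℚ - (ℕtoℚ M - ℕtoℚ j) * inv (M ℕ.+ j) ≡ (1ℚ + (ℕtoℚ j + ℕtoℚ j)) * inv (M ℕ.+ j)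
  μ-ratio M j = trans (cong (λ z → z - (ℕtoℚ M - ℕtoℚ j) * inv (M ℕ.+ j)) (sym (trans (cong (inv (M ℕ.+ j) *_) (sym (trans (ℕtoℚ-suc (M ℕ.+ j)) (cong (1ℚ +_) (ℕtoℚ-+ M j))))) (inv-cancel (M ℕ.+ j)))))
    (regroup (ℕtoℚ M) (ℕtoℚ j) (inv (M ℕ.+ j)))
    where
    regroup : ∀ x y i → i * (1ℚ + (x + y)) - (x - y) * i ≡ (1ℚ + (y + y)) * i
    regroup = solve-∀ ℚ-ring

  0≤1+2j : ∀ j → 0ℚ ≤ 1ℚ + (ℕtoℚ j + ℕtoℚ j)
  0≤1+2j j = +-nonneg 0≤1 (+-nonneg (ℕtoℚ-nonneg j) (ℕtoℚ-nonneg j))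

  μ≤1 : ∀ M j → j ℕ.≤ M → μ M j ≤ 1ℚ
  μ≤1 M zero    _   = ℚP.≤-refl
  μ≤1 M (suc j) j<M = ℚP.≤-trans (subst (_≤ μ M j) (sym (regroup (μ M j) r)) (minus-nonneg (*-nonneg (μ-nonneg M j (ℕP.<⇒≤ j<M)) (subst (0ℚ ≤_) (sym (μ-ratio M j)) (*-nonneg (0≤1+2j j) (inv-nonneg (M ℕ.+ j))))))) (μ≤1 M j (ℕP.<⇒≤ j<M))
    where
    r = (ℕtoℚ M - ℕtoℚ j) * inv (M ℕ.+ j)
    regroup : ∀ x r → x * r ≡ x - x * (1ℚ - r)
    regroup = solve-∀ ℚ-ring
    minus-nonneg : ∀ {x y} → 0ℚ ≤ y → x - y ≤ x
    minus-nonneg {x} {y} 0≤y = sub-nonneg (subst (0ℚ ≤_) (cancel x y) 0≤y)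
      where
      cancel : ∀ x y → y ≡ x - (x - y)
      cancel = solve-∀ ℚ-ring

  1-μ≤ : ∀ m j → j ℕ.≤ suc m → 1ℚ - μ (suc m) j ≤ ℕtoℚ j * ℕtoℚ j * inv m
  1-μ≤ m zero    _   = ℚP.≤-reflexive (regroup (inv m))
    where
    regroup : ∀ i → 1ℚ - 1ℚ ≡ 0ℚ * 0ℚ * i
    regroup = solve-∀ ℚ-ring
  1-μ≤ m (suc j) j<M = begin
    1ℚ - μ M j * r                                       ≡⟨ regroup₁ (μ M j) r ⟩
    1ℚ - μ M j + μ M j * (1ℚ - r)                        ≡⟨ cong (λ z → 1ℚ - μ M j + μ M j * z) (μ-ratio M j) ⟩
    1ℚ - μ M j + μ M j * ((1ℚ + (y + y)) * inv (M ℕ.+ j))  ≤⟨ ℚP.+-mono-≤ (1-μ≤ m j (ℕP.<⇒≤ j<M)) (*-mono 0≤1 (*-nonneg (0≤1+2j j) (inv-nonneg (M ℕ.+ j))) (μ≤1 M j (ℕP.<⇒≤ j<M)) (*-monoˡ (0≤1+2j j) (inv-anti (ℕP.≤-trans (ℕP.n≤1+n m) (ℕP.m≤m+n M j))))) ⟩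
    y * y * inv m + 1ℚ * ((1ℚ + (y + y)) * inv m)        ≡⟨ regroup₂ y (inv m) ⟩
    (1ℚ + y) * (1ℚ + y) * inv m                          ≡⟨ cong (λ z → z * z * inv m) (ℕtoℚ-suc j) ⟨
    ℕtoℚ (suc j) * ℕtoℚ (suc j) * inv m                  ∎
    where
    open ℚP.≤-Reasoning
    M = suc m
    y = ℕtoℚ j
    r = (ℕtoℚ M - y) * inv (M ℕ.+ j)
    regroup₁ : ∀ x r → 1ℚ - x * r ≡ 1ℚ - x + x * (1ℚ - r)
    regroup₁ = solve-∀ ℚ-ring
    regroup₂ : ∀ y i → y * y * i + 1ℚ * ((1ℚ + (y + y)) * i) ≡ (1ℚ + y) * (1ℚ + y) * i
    regroup₂ = solve-∀ ℚ-ring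

  -- The limit is taken along N L = 2 (L+1)²: even, and a multiple of a square, which turns the error Σ_j min(1, j²/N)/j² into O(1/L).
  k m N : ℕ → ℕ
  k L = L ℕ.+ L ℕ.* suc L
  m L = k L ℕ.+ suc (k L)
  N L = suc (m L)

  η : ℕ → ℚ
  η L = h (N L)

  open Classes η (λ L → 1≤h (N L)) using () renaming
    (bnd-+ to η-+; bnd-- to η--; bnd-*one to η-*; bnd-scale to η-scale; bnd-conv to η-conv; bnd-const to η-const; bnd-0 to η-0; bnd-sum to η-sum) public

  Null Lg : (ℕ → ℚ) → Set
  Null = Bnd η inv
  Lg   = Bnd η one

  sample : ∀ {s} → Sml s → (v : ℕ → ℕ) → (∀ L → v L ℕ.≤ N L) → (∀ L → L ℕ.≤ v L) → Null (s ∘ v)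
  sample {s} x@(bnd C e 0≤C b) v v≤N ≤v = bnd C e 0≤C λ L → ℚP.≤-trans (bound≤ inv-nonneg x (v≤N L)) (*-monoˡ (coef-nonneg x (N L)) (inv-anti (≤v L)))

  sample-Log : ∀ {s} → Log s → Lg (s ∘ N)
  sample-Log x = bnd-∘ N x

  L≤k : ∀ L → L ℕ.≤ k L
  L≤k L = ℕP.m≤m+n L (L ℕ.* suc L)

  L≤m : ∀ L → L ℕ.≤ m L
  L≤m L = ℕP.≤-trans (L≤k L) (ℕP.m≤m+n (k L) (suc (k L)))

  sample-m : ∀ {s} → Sml s → Null (s ∘ m)
  sample-m x = sample x m (λ L → ℕP.n≤1+n (m L)) L≤m

  sample-N : ∀ {s} → Sml s → Null (s ∘ N)
  sample-N x = sample x N (λ L → ℕP.≤-refl) (λ L → ℕP.≤-trans (L≤m L) (ℕP.n≤1+n (m L)))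

  suc*inv-k : ∀ L → ℕtoℚ (suc L) * inv (k L) ≤ inv L
  suc*inv-k L = begin
    ℕtoℚ (suc L) * inv (k L)          ≤⟨ *-monoˡ (ℕtoℚ-nonneg (suc L)) (inv-≤ (k L) {inv L * inv L} (ℚP.≤-reflexive square)) ⟩
    ℕtoℚ (suc L) * (inv L * inv L)    ≡⟨ trans (regroup (ℕtoℚ (suc L)) (inv L)) (trans (cong (_* inv L) (inv-cancel L)) (ℚP.*-identityˡ (inv L))) ⟩
    inv L                             ∎
    where
    open ℚP.≤-Reasoning
    regroup : ∀ n i → n * (i * i) ≡ i * n * i
    regroup = solve-∀ ℚ-ring
    regroup′ : ∀ n i → i * n * (i * n) ≡ n * n * (i * i)
    regroup′ = solve-∀ ℚ-ring
    square : 1ℚ ≡ ℕtoℚ (suc (k L)) * (inv L * inv L)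
    square = trans (sym (trans (sym (regroup′ (ℕtoℚ (suc L)) (inv L))) (trans (cong (λ z → z * z) (inv-cancel L)) (ℚP.*-identityʳ 1ℚ)))) (cong (_* (inv L * inv L)) (sym (ℕtoℚ-* (suc L) (suc L))))

  1-μ-nonneg : ∀ M j → j ℕ.≤ M → 0ℚ ≤ 1ℚ - μ M j
  1-μ-nonneg M j j≤M = subst (_≤ 1ℚ - μ M j) (ℚP.+-inverseʳ (μ M j)) (ℚP.+-monoˡ-≤ (- μ M j) (μ≤1 M j j≤M))

  1-μ≤1 : ∀ M j → j ℕ.≤ M → 1ℚ - μ M j ≤ 1ℚ
  1-μ≤1 M j j≤M = sub-nonneg (subst (0ℚ ≤_) (cancel (μ M j)) (μ-nonneg M j j≤M))
    where
    cancel : ∀ x → x ≡ 1ℚ - (1ℚ - x)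
    cancel = solve-∀ ℚ-ring

  sum-const : ∀ d x → sum d (λ _ → x) ≡ ℕtoℚ d * x
  sum-const zero    x = sym (ℚP.*-zeroˡ x)
  sum-const (suc d) x = trans (cong (_+ x) (sum-const d x)) (trans (regroup (ℕtoℚ d) x) (cong (_* x) (sym (ℕtoℚ-suc d))))
    where
    regroup : ∀ n y → n * y + y ≡ (1ℚ + n) * y
    regroup = solve-∀ ℚ-ring

  μ-defect : ∀ L → sum (N L) (λ i → inv² i * (1ℚ - μ (N L) (suc i))) ≤ ℕtoℚ 2 * inv L
  μ-defect L = begin
    sum (N L) F                                                             ≡⟨ cong (λ z → sum z F) split ⟨
    sum (suc L ℕ.+ d) F                                                     ≡⟨ sum-split (suc L) d F ⟩
    sum (suc L) F + sum d (λ i → F (suc L ℕ.+ i))                           ≤⟨ ℚP.+-mono-≤ (sum-mono< (suc L) near) (sum-mono< d far) ⟩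
    sum (suc L) (λ _ → inv (k L)) + sum d (λ i → inv² (suc L ℕ.+ i))        ≤⟨ ℚP.+-mono-≤ (ℚP.≤-trans (ℚP.≤-reflexive (sum-const (suc L) (inv (k L)))) (suc*inv-k L)) (ℚP.≤-trans (inv²-tail L d) (sub-nonneg (subst (0ℚ ≤_) (cancel (inv L) (inv (L ℕ.+ d))) (inv-nonneg (L ℕ.+ d))))) ⟩
    inv L + inv L                                                           ≡⟨ two (inv L) ⟩
    ℕtoℚ 2 * inv L                                                          ∎
    where
    open ℚP.≤-Reasoning
    F : ℕ → ℚ
    F i = inv² i * (1ℚ - μ (N L) (suc i))
    d = N L ℕ.∸ suc L
    sL≤N : suc L ℕ.≤ N L
    sL≤N = s≤s (L≤m L)
    split : suc L ℕ.+ d ≡ N L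
    split = ℕP.m+[n∸m]≡n sL≤N
    cancel : ∀ a b → b ≡ a - (a - b)
    cancel = solve-∀ ℚ-ring
    two : ∀ x → x + x ≡ ℕtoℚ 2 * x
    two = solve-∀ ℚ-ring
    regroup : ∀ i n j → i * i * (n * n * j) ≡ i * n * (i * n) * j
    regroup = solve-∀ ℚ-ring
    near : ∀ i → i ℕ.< suc L → F i ≤ inv (k L)
    near i i<sL = ℚP.≤-trans (*-monoˡ (inv²-nonneg i) (1-μ≤ (m L) (suc i) (ℕP.≤-trans i<sL sL≤N)))
      (ℚP.≤-trans (ℚP.≤-reflexive (trans (regroup (inv i) (ℕtoℚ (suc i)) (inv (m L))) (trans (cong (λ z → z * z * inv (m L)) (inv-cancel i)) (ℚP.*-identityˡ (inv (m L)))))) (inv-anti (ℕP.m≤m+n (k L) (suc (k L)))))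
    far : ∀ i → i ℕ.< d → F (suc L ℕ.+ i) ≤ inv² (suc L ℕ.+ i)
    far i i<d = ℚP.≤-trans (*-monoˡ (inv²-nonneg (suc L ℕ.+ i)) (1-μ≤1 (N L) (suc (suc L ℕ.+ i)) (subst₂ ℕ._≤_ (ℕP.+-suc (suc L) i) split (ℕP.+-monoʳ-≤ (suc L) i<d)))) (ℚP.≤-reflexive (ℚP.*-identityʳ _))

  μ-error : ∀ C e → 0ℚ ≤ C → (w : ℕ → ℕ → ℚ) → (∀ L i → i ℕ.< N L → ∣ w L i ∣ ≤ C * powℚ (η L) e * inv² i) →
    Null (λ L → sum (N L) (λ i → w L i * (1ℚ - μ (N L) (suc i))))
  μ-error C e 0≤C w hw = bnd (C * ℕtoℚ 2) e (*-nonneg 0≤C (ℕtoℚ-nonneg 2)) λ L → begin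
    ∣ sum (N L) (λ i → w L i * (1ℚ - μ (N L) (suc i))) ∣
      ≤⟨ ∣sum∣≤ (N L) (λ i i<N → ∣*∣≤ (hw L i i<N) (ℚP.≤-reflexive (ℚP.0≤p⇒∣p∣≡p (1-μ-nonneg (N L) (suc i) i<N)))) ⟩
    sum (N L) (λ i → C * powℚ (η L) e * inv² i * (1ℚ - μ (N L) (suc i)))
      ≡⟨ trans (sum-cong (N L) (λ i → ℚP.*-assoc (C * powℚ (η L) e) (inv² i) _)) (sum-*ˡ (N L) (C * powℚ (η L) e) _) ⟩
    C * powℚ (η L) e * sum (N L) (λ i → inv² i * (1ℚ - μ (N L) (suc i)))
      ≤⟨ *-monoˡ (*-nonneg 0≤C (powℚ-nonneg (0≤h (N L)) e)) (μ-defect L) ⟩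
    C * powℚ (η L) e * (ℕtoℚ 2 * inv L)
      ≡⟨ regroup C (powℚ (η L) e) (ℕtoℚ 2) (inv L) ⟩
    C * ℕtoℚ 2 * powℚ (η L) e * inv L ∎
    where
    open ℚP.≤-Reasoning
    regroup : ∀ a b c d → a * b * (c * d) ≡ a * c * b * d
    regroup = solve-∀ ℚ-ring

  Z½-bound : ∀ p i → ∣ Z½ (suc p) i ∣ ≤ h (suc i)
  Z½-bound p i = ℚP.≤-trans (∣+∣≤ {Z (suc p) i} {½ * pw (inv i) p} (∣sum∣≤ i (λ t _ → ∣pw∣ t p)) half) (q≤p+q 0≤1)
    where
    half : ∣ ½ * pw (inv i) p ∣ ≤ inv i
    half = ℚP.≤-trans (∣*∣≤ {½} {pw (inv i) p} {1ℚ} {inv i} ½≤1 (∣pw∣ i p)) (ℚP.≤-reflexive (ℚP.*-identityˡ (inv i)))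
      where
      ½≤1 : ∣ ½ ∣ ≤ 1ℚ
      ½≤1 = ℚP.≤ᵇ⇒≤ _

  Wt-Sd : ∀ a b → Null (λ L → Wt (N L) a b - ℕtoℚ 4 * Sd (N L) (dbl a) (suc (dbl b)))
  Wt-Sd a b = bnd-cong (λ L → sym (diff L)) (bnd-neg (μ-error (ℕtoℚ 4) 1 (ℕtoℚ-nonneg 4) w bound-w))
    where
    w : ℕ → ℕ → ℚ
    w L i = ℕtoℚ 4 * (sgn i * Z½ (suc (dbl a)) i) * powℚ (inv i) (dbl (suc b))
    bound-w : ∀ L i → i ℕ.< N L → ∣ w L i ∣ ≤ ℕtoℚ 4 * powℚ (η L) 1 * inv² i
    bound-w L i i<N = ∣*∣≤ {ℕtoℚ 4 * (sgn i * Z½ (suc (dbl a)) i)} (∣*∣≤ {ℕtoℚ 4} {sgn i * Z½ (suc (dbl a)) i} {ℕtoℚ 4} ℚP.≤-refl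
      (∣sgn*∣ i (ℚP.≤-trans (Z½-bound (dbl a) i) (ℚP.≤-trans (h-mono i<N) (ℚP.≤-reflexive (sym (ℚP.*-identityʳ (η L)))))))) (∣pw∣² i (dbl b))
    term : ∀ f s z u p → f * (s * z) * (u * p) - f * (s * p * z) ≡ - (f * (s * z) * p * (1ℚ - u))
    term = solve-∀ ℚ-ring
    diff : ∀ L → Wt (N L) a b - ℕtoℚ 4 * Sd (N L) (dbl a) (suc (dbl b)) ≡ - sum (N L) (λ i → w L i * (1ℚ - μ (N L) (suc i)))
    diff L = trans (cong (λ z → Wt (N L) a b - z) (sym (sum-*ˡ (N L) (ℕtoℚ 4) (λ i → sgn i * pw (inv i) (suc (dbl b)) * Z½ (suc (dbl a)) i))))
      (trans (sym (sum-- (N L) (λ i → ℕtoℚ 4 * (sgn i * Z½ (suc (dbl a)) i) * (μ (N L) (suc i) * powℚ (inv i) (dbl (suc b)))) (λ i → ℕtoℚ 4 * (sgn i * pw (inv i) (suc (dbl b)) * Z½ (suc (dbl a)) i))))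
        (trans (sum-cong (N L) (λ i → term (ℕtoℚ 4) (sgn i) (Z½ (suc (dbl a)) i) (μ (N L) (suc i)) (powℚ (inv i) (dbl (suc b))))) (sum-neg (N L) _)))

  τ-hc : ∀ t → Null (λ L → τ (N L) t - hc (N L) t)
  τ-hc zero    = bnd-cong (λ L → sym (ℚP.+-inverseʳ 1ℚ)) (η-0 inv-nonneg)
  τ-hc (suc t) = bnd-cong (λ L → sym (diff L)) (μ-error (ℕtoℚ 2) 0 (ℕtoℚ-nonneg 2) w bound-w)
    where
    w : ℕ → ℕ → ℚ
    w L i = ℕtoℚ 2 * (sgn i * powℚ (inv i) (dbl (suc t)))
    bound-w : ∀ L i → i ℕ.< N L → ∣ w L i ∣ ≤ ℕtoℚ 2 * 1ℚ * inv² i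
    bound-w L i _ = ∣*∣≤ {ℕtoℚ 2} {sgn i * powℚ (inv i) (dbl (suc t))} {ℕtoℚ 2 * 1ℚ} ℚP.≤-refl (∣sgn*∣ i (∣pw∣² i (dbl t)))
    term : ∀ f s u p → f * (s * p) - f * (s * u * p) ≡ f * (s * p) * (1ℚ - u)
    term = solve-∀ ℚ-ring
    τ-Et : ∀ L → τ (N L) (suc t) ≡ ℕtoℚ 2 * Et (dbl (suc t)) (N L)
    τ-Et L = trans (tX-eval (N L) (suc (dbl t))) (cong (λ z → (1ℚ + z) * Et (dbl (suc t)) (N L)) (sgn-dbl (suc t)))
    diff : ∀ L → τ (N L) (suc t) - hc (N L) (suc t) ≡ sum (N L) (λ i → w L i * (1ℚ - μ (N L) (suc i)))
    diff L = trans (cong (_- hc (N L) (suc t)) (trans (τ-Et L) (sym (sum-*ˡ (N L) (ℕtoℚ 2) (λ i → sgn i * powℚ (inv i) (dbl (suc t)))))))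
      (trans (sym (sum-- (N L) (λ i → ℕtoℚ 2 * (sgn i * powℚ (inv i) (dbl (suc t)))) (λ i → ℕtoℚ 2 * (sgn i * μ (N L) (suc i) * powℚ (inv i) (dbl (suc t))))))
        (sum-cong (N L) (λ i → term (ℕtoℚ 2) (sgn i) (μ (N L) (suc i)) (powℚ (inv i) (dbl (suc t))))))

  power-sum-Log : ∀ {F : ℕ → ℚ} → (∀ t → ∣ F t ∣ ≤ inv t) → Lg (λ L → sum (N L) F)
  power-sum-Log {F} le = bnd 1ℚ 1 0≤1 λ L → ℚP.≤-trans (∣sum∣≤ (N L) (λ t _ → le t)) (ℚP.≤-trans (q≤p+q 0≤1) (ℚP.≤-reflexive (unit (η L))))
    where
    unit : ∀ x → x ≡ 1ℚ * (x * 1ℚ) * 1ℚ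
    unit = solve-∀ ℚ-ring

  Z-Lg : ∀ s → Lg (λ L → Z (suc s) (N L))
  Z-Lg s = power-sum-Log (λ t → ∣pw∣ t s)

  Et-Lg : ∀ s → Lg (λ L → Et (suc s) (N L))
  Et-Lg s = power-sum-Log (λ t → ∣sgn*∣ t (∣pw∣ t s))

  A-Lg : ∀ a t → Lg (λ L → A (N L) a t)
  A-Lg a t = bnd-neg (η-scale (λ _ → 0≤1) (ℕtoℚ ((dbl a ℕ.+ dbl (suc t)) choose dbl a)) (Z-Lg (dbl a ℕ.+ dbl (suc t))))

  B-Lg : ∀ b l → Lg (λ L → B (N L) b l)
  B-Lg b l = η-scale (λ _ → 0≤1) (ℕtoℚ ((suc (dbl b) ℕ.+ suc (dbl l)) choose suc (dbl b))) (Et-Lg (suc (dbl b) ℕ.+ suc (dbl l)))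

  Tc-Lg : ∀ t → Lg (λ L → Tc (N L) t)
  Tc-Lg t = η-scale (λ _ → 0≤1) (sgn t) (sample-Log (zs-Log (replicate t 2)))

  infix 4 _~_
  record _~_ (s t : ℕ → ℚ) : Set where
    constructor null
    field
      difference : Null (λ L → s L - t L)
  open _~_

  ~-trans : ∀ {s t r} → s ~ t → t ~ r → s ~ r
  ~-trans {s} {t} {r} (null x) (null y) = null (bnd-cong (λ L → regroup (s L) (t L) (r L)) (η-+ inv-nonneg x y))
    where
    regroup : ∀ a b c → a - b + (b - c) ≡ a - c
    regroup = solve-∀ ℚ-ring

  ~-reflexive : ∀ {s t} → (∀ L → s L ≡ t L) → s ~ t
  ~-reflexive {s} {t} e = null (bnd-cong (λ L → sym (trans (cong (_- t L) (e L)) (ℚP.+-inverseʳ (t L)))) (η-0 inv-nonneg))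

  ~-+ : ∀ {s t s′ t′} → s ~ t → s′ ~ t′ → (λ L → s L + s′ L) ~ (λ L → t L + t′ L)
  ~-+ {s} {t} {s′} {t′} (null x) (null y) = null (bnd-cong (λ L → regroup (s L) (t L) (s′ L) (t′ L)) (η-+ inv-nonneg x y))
    where
    regroup : ∀ a b c d → a - b + (c - d) ≡ a + c - (b + d)
    regroup = solve-∀ ℚ-ring

  ~-* : ∀ {r s t} → Lg r → s ~ t → (λ L → r L * s L) ~ (λ L → r L * t L)
  ~-* {r} {s} {t} l (null x) = null (bnd-cong (λ L → regroup (r L) (s L) (t L)) (η-* inv-nonneg l x))
    where
    regroup : ∀ a b c → a * (b - c) ≡ a * b - a * c
    regroup = solve-∀ ℚ-ring

  ~-conv : ∀ n {f s t : ℕ → ℕ → ℚ} → (∀ i → Lg (λ L → f L i)) → (∀ i → (λ L → s L i) ~ (λ L → t L i)) →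
    (λ L → conv (f L) (s L) n) ~ (λ L → conv (f L) (t L) n)
  ~-conv n {f} {s} {t} l x = null (bnd-cong diff (η-conv inv-nonneg n (λ i _ → l i) (λ i _ → difference (x i))))
    where
    minus : ∀ a b → a - b ≡ a + (- 1ℚ) * b
    minus = solve-∀ ℚ-ring
    diff : ∀ L → conv (f L) (λ i → s L i - t L i) n ≡ conv (f L) (s L) n - conv (f L) (t L) n
    diff L = trans (conv-cong n {f = f L} (λ _ → refl) (λ i → minus (s L i) (t L i))) (trans (conv-+ʳ n (f L) (s L) (λ i → (- 1ℚ) * t L i))
      (trans (cong (conv (f L) (s L) n +_) (conv-*ʳ n (- 1ℚ) (f L) (t L))) (sym (minus (conv (f L) (s L) n) (conv (f L) (t L) n)))))

  Wt~ : ∀ a b → (λ L → Wt (N L) a b) ~ (λ L → ℕtoℚ 2 * (conv (A (N L) a) (hc (N L)) b + conv (B (N L) b) (hc (N L)) a))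
  Wt~ a b = ~-trans {t = λ L → ℕtoℚ 4 * Sd (N L) (dbl a) (suc (dbl b))} (null (Wt-Sd a b)) (~-trans {t = λ L → ℕtoℚ 2 * (conv (A (N L) a) (τ (N L)) b + conv (B (N L) b) (τ (N L)) a)} parity
      (~-* {r = λ _ → ℕtoℚ 2} (η-const (ℕtoℚ 2)) (~-+ {s = λ L → conv (A (N L) a) (τ (N L)) b} {t = λ L → conv (A (N L) a) (hc (N L)) b}
        (~-conv b {f = λ L → A (N L) a} {s = λ L → τ (N L)} {t = λ L → hc (N L)} (A-Lg a) (λ i → null (τ-hc i))) (~-conv a {f = λ L → B (N L) b} {s = λ L → τ (N L)} {t = λ L → hc (N L)} (B-Lg b) (λ i → null (τ-hc i))))))
    where
    AB : ℕ → ℚ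
    AB L = conv (A (N L) a) (τ (N L)) b + conv (B (N L) b) (τ (N L)) a
    regroup : ∀ x e → - (ℕtoℚ 2 * e) ≡ ℕtoℚ 2 * (x - e) - ℕtoℚ 2 * x
    regroup = solve-∀ ℚ-ring
    four : ∀ s → ℕtoℚ 4 * s ≡ ℕtoℚ 2 * (ℕtoℚ 2 * s)
    four = solve-∀ ℚ-ring
    parity : (λ L → ℕtoℚ 4 * Sd (N L) (dbl a) (suc (dbl b))) ~ (λ L → ℕtoℚ 2 * AB L)
    parity = null (bnd-cong (λ L → sym (trans (cong (_- ℕtoℚ 2 * AB L) (trans (four (Sd (N L) (dbl a) (suc (dbl b)))) (cong (ℕtoℚ 2 *_) (double-sum (N L) a b)))) (sym (regroup (AB L) (errU (N L) a b + errS (N L) a b)))))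
      (bnd-neg (η-scale inv-nonneg (ℕtoℚ 2) (η-+ inv-nonneg (sample-m (errU-Sml a b)) (sample-m (errS-Sml a b))))))

  Hc~ : ∀ a b → (λ L → Hc (N L) a b) ~ (λ L → ℕtoℚ 2 * (conv (Tc (N L)) (λ i → A (N L) i b) a + conv (Tc (N L)) (λ j → B (N L) j a) b))
  Hc~ a b = ~-trans {t = λ L → conv² (Tc (N L)) (Wt (N L)) a b} (~-reflexive (λ L → Hc≡ (N L) a b))
    (~-trans {t = λ L → conv² (Tc (N L)) (G L) a b}
      (~-conv a {f = λ L → Tc (N L)} {s = λ L i → conv (Tc (N L)) (Wt (N L) i) b} {t = λ L i → conv (Tc (N L)) (G L i) b} Tc-Lg
        (λ i → ~-conv b {f = λ L → Tc (N L)} {s = λ L → Wt (N L) i} {t = λ L → G L i} Tc-Lg (λ j → Wt~ i j)))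
      (~-reflexive (λ L → simplify (N L))))
    where
    g : ℕ → ℕ → ℕ → ℚ
    g M i j = ℕtoℚ 2 * (conv (A M i) (hc M) j + conv (B M j) (hc M) i)
    G : ℕ → ℕ → ℕ → ℚ
    G L = g (N L)
    module _ (M : ℕ) where
      open ≡-Reasoning
      T = Tc M
      cancel : ∀ f n → conv T (conv f (hc M)) n ≡ f n
      cancel f n = begin
        conv T (conv f (hc M)) n       ≡⟨ conv-cong n {f = T} (λ _ → refl) (λ i → conv-comm i f (hc M)) ⟩
        conv T (conv (hc M) f) n       ≡⟨ conv-assoc n T (hc M) f ⟨
        conv (conv T (hc M)) f n       ≡⟨ conv-cong n {g = f} (Tc-hc M) (λ _ → refl) ⟩
        conv δ f n                     ≡⟨ conv-δ n f ⟩
        f n                            ∎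
      T-linear : ∀ n → Linear (λ φ → conv T φ n)
      T-linear n = record { L-cong = λ e → conv-cong n {f = T} (λ _ → refl) e ; L-+ = conv-+ʳ n T ; L-* = λ q → conv-*ʳ n q T }
      inner : ∀ i → conv T (g M i) b ≡ ℕtoℚ 2 * (A M i b + conv (λ l → conv T (λ j → B M j l) b) (hc M) i)
      inner i = begin
        conv T (g M i) b
          ≡⟨ conv-*ʳ b (ℕtoℚ 2) T (λ j → conv (A M i) (hc M) j + conv (B M j) (hc M) i) ⟩
        ℕtoℚ 2 * conv T (λ j → conv (A M i) (hc M) j + conv (B M j) (hc M) i) b
          ≡⟨ cong (ℕtoℚ 2 *_) (conv-+ʳ b T (conv (A M i) (hc M)) (λ j → conv (B M j) (hc M) i)) ⟩
        ℕtoℚ 2 * (conv T (conv (A M i) (hc M)) b + conv T (λ j → conv (B M j) (hc M) i) b)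
          ≡⟨ cong₂ (λ x y → ℕtoℚ 2 * (x + y)) (cancel (A M i) b) exchange-conv ⟩
        ℕtoℚ 2 * (A M i b + conv (λ l → conv T (λ j → B M j l) b) (hc M) i) ∎
        where
        exchange-conv : conv T (λ j → conv (B M j) (hc M) i) b ≡ conv (λ l → conv T (λ j → B M j l) b) (hc M) i
        exchange-conv = trans (conv-cong b {f = T} (λ _ → refl) (λ j → conv-comm i (B M j) (hc M)))
          (trans (L-conv (T-linear b) i (hc M) (B M)) (conv-comm i (hc M) (λ l → conv T (λ j → B M j l) b)))
      simplify : conv² T (g M) a b ≡ ℕtoℚ 2 * (conv T (λ i → A M i b) a + conv T (λ j → B M j a) b)
      simplify = begin
        conv T (λ i → conv T (g M i) b) a
          ≡⟨ conv-cong a {f = T} (λ _ → refl) inner ⟩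
        conv T (λ i → ℕtoℚ 2 * (A M i b + conv Y (hc M) i)) a
          ≡⟨ conv-*ʳ a (ℕtoℚ 2) T (λ i → A M i b + conv Y (hc M) i) ⟩
        ℕtoℚ 2 * conv T (λ i → A M i b + conv Y (hc M) i) a
          ≡⟨ cong (ℕtoℚ 2 *_) (trans (conv-+ʳ a T (λ i → A M i b) (conv Y (hc M))) (cong (conv T (λ i → A M i b) a +_) (cancel Y a))) ⟩
        ℕtoℚ 2 * (conv T (λ i → A M i b) a + conv T (λ j → B M j a) b) ∎
        where
        Y : ℕ → ℚ
        Y l = conv T (λ j → B M j l) b

module Zagier where

  open Sums
  open Growth
  open Polylogarithms
  open DoubleSums
  open PartialFractions
  open PowerSums
  open Parity
  open Asymptotics

  dbl≡2* : ∀ n → 2 ℕ.* n ≡ dbl n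
  dbl≡2* zero    = refl
  dbl≡2* (suc n) = cong suc (trans (ℕP.+-suc n (n ℕ.+ 0)) (cong suc (dbl≡2* n)))

  sum-pairs : ∀ n F → sum (n ℕ.+ n) F ≡ sum n (λ i → F (i ℕ.+ i) + F (suc (i ℕ.+ i)))
  sum-pairs zero    F = refl
  sum-pairs (suc n) F = trans (cong (λ z → sum z F) (cong suc (ℕP.+-suc n n))) (trans (cong (λ z → z + F (n ℕ.+ n) + F (suc (n ℕ.+ n))) (sum-pairs n F))
    (ℚP.+-assoc (sum n (λ i → F (i ℕ.+ i) + F (suc (i ℕ.+ i)))) (F (n ℕ.+ n)) (F (suc (n ℕ.+ n)))))

  inv-odd : ∀ i → inv (suc (i ℕ.+ i)) ≡ ½ * inv i
  inv-odd i = begin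
    x                                         ≡⟨ ℚP.*-identityʳ x ⟨
    x * 1ℚ                                    ≡⟨ cong (x *_) (inv-cancel i) ⟨
    x * (inv i * ℕtoℚ (suc i))                ≡⟨ regroup x (inv i) (ℕtoℚ (suc i)) ⟩
    ½ * inv i * (x * (ℕtoℚ (suc i) + ℕtoℚ (suc i)))  ≡⟨ cong (λ z → ½ * inv i * (x * z)) (trans (cong ℕtoℚ (cong suc (sym (ℕP.+-suc i i)))) (ℕtoℚ-+ (suc i) (suc i))) ⟨
    ½ * inv i * (x * ℕtoℚ (suc (suc (i ℕ.+ i))))     ≡⟨ cong (½ * inv i *_) (inv-cancel (suc (i ℕ.+ i))) ⟩
    ½ * inv i * 1ℚ                            ≡⟨ ℚP.*-identityʳ (½ * inv i) ⟩
    ½ * inv i                                 ∎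
    where
    open ≡-Reasoning
    x = inv (suc (i ℕ.+ i))
    regroup : ∀ x y n → x * (y * n) ≡ ½ * y * (x * (n + n))
    regroup = solve-∀ ℚ-ring

  Et-pairs : ∀ e K → Et (suc e) (K ℕ.+ K) ≡ Z (suc e) (K ℕ.+ K) - powℚ ½ e * Z (suc e) K
  Et-pairs e K = begin
    Et (suc e) (K ℕ.+ K)
      ≡⟨ trans (sum-pairs K (λ i → sgn i * pw (inv i) e)) (sum-cong K pair) ⟩
    sum K (λ i → pw (inv (i ℕ.+ i)) e + pw (inv (suc (i ℕ.+ i))) e - powℚ ½ e * pw (inv i) e)
      ≡⟨ sum-- K (λ i → pw (inv (i ℕ.+ i)) e + pw (inv (suc (i ℕ.+ i))) e) (λ i → powℚ ½ e * pw (inv i) e) ⟩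
    sum K (λ i → pw (inv (i ℕ.+ i)) e + pw (inv (suc (i ℕ.+ i))) e) - sum K (λ i → powℚ ½ e * pw (inv i) e)
      ≡⟨ cong₂ _-_ (sym (sum-pairs K (λ i → pw (inv i) e))) (sum-*ˡ K (powℚ ½ e) (λ i → pw (inv i) e)) ⟩
    Z (suc e) (K ℕ.+ K) - powℚ ½ e * Z (suc e) K ∎
    where
    open ≡-Reasoning
    regroup : ∀ x b z → 1ℚ * x + (- 1ℚ) * (½ * b * z) ≡ x + ½ * b * z - b * z
    regroup = solve-∀ ℚ-ring
    pair : ∀ i → sgn (i ℕ.+ i) * pw (inv (i ℕ.+ i)) e + sgn (suc (i ℕ.+ i)) * pw (inv (suc (i ℕ.+ i))) e ≡ pw (inv (i ℕ.+ i)) e + pw (inv (suc (i ℕ.+ i))) e - powℚ ½ e * pw (inv i) e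
    pair i = trans (cong₂ (λ s y → s * pw (inv (i ℕ.+ i)) e + - s * y) (trans (sgn-+ i i) (sgn-square i)) odd)
      (trans (regroup (pw (inv (i ℕ.+ i)) e) (powℚ ½ e) (pw (inv i) e)) (cong (λ y → pw (inv (i ℕ.+ i)) e + y - powℚ ½ e * pw (inv i) e) (sym odd)))
      where
      odd : pw (inv (suc (i ℕ.+ i))) e ≡ ½ * powℚ ½ e * pw (inv i) e
      odd = trans (cong (λ z → pw z e) (inv-odd i)) (powℚ-* ½ (inv i) (suc e))

  Z-tail : ∀ e L → ∣ Z (suc (suc e)) (suc (k L) ℕ.+ suc (k L)) - Z (suc (suc e)) (suc (k L)) ∣ ≤ inv L
  Z-tail e L = begin
    ∣ sum (K ℕ.+ K) F - sum K F ∣              ≡⟨ cong ∣_∣ (trans (cong (_- sum K F) (sum-split K K F)) (cancel (sum K F) _)) ⟩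
    ∣ sum K (λ i → F (K ℕ.+ i)) ∣              ≤⟨ ∣sum∣≤ K (λ i _ → ∣pw∣² (K ℕ.+ i) e) ⟩
    sum K (λ i → inv² (K ℕ.+ i))               ≤⟨ inv²-tail (k L) K ⟩
    inv (k L) - inv (k L ℕ.+ K)                ≤⟨ sub-nonneg (subst (0ℚ ≤_) (flip-sign (inv (k L)) (inv (k L ℕ.+ K))) (inv-nonneg (k L ℕ.+ K))) ⟩
    inv (k L)                                  ≤⟨ inv-anti (L≤k L) ⟩
    inv L                                      ∎
    where
    open ℚP.≤-Reasoning
    K = suc (k L)
    F : ℕ → ℚ
    F i = powℚ (inv i) (suc (suc e))
    cancel : ∀ a b → a + b - a ≡ b
    cancel = solve-∀ ℚ-ring
    flip-sign : ∀ a b → b ≡ a - (a - b)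
    flip-sign = solve-∀ ℚ-ring

  Et~Z : ∀ e → (λ L → Et (suc (suc e)) (N L)) ~ (λ L → (1ℚ - powℚ ½ (suc e)) * Z (suc (suc e)) (N L))
  Et~Z e = null (bnd-cong (λ L → sym (trans (cong (_- (1ℚ - powℚ ½ (suc e)) * Z (suc (suc e)) (N L)) (Et-pairs (suc e) (suc (k L)))) (regroup (powℚ ½ (suc e)) (Z (suc (suc e)) (N L)) (Z (suc (suc e)) (suc (k L))))))
    (η-scale inv-nonneg (powℚ ½ (suc e)) (bnd 1ℚ 0 0≤1 (λ L → ℚP.≤-trans (Z-tail e L) (ℚP.≤-reflexive (unit (inv L)))))))
    where
    regroup : ∀ p x y → x - p * y - (1ℚ - p) * x ≡ p * (x - y)
    regroup = solve-∀ ℚ-ring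
    unit : ∀ x → x ≡ 1ℚ * 1ℚ * x
    unit = solve-∀ ℚ-ring

  B̃ : ℕ → ℕ → ℕ → ℚ
  B̃ M b l = ℕtoℚ ((suc (dbl b) ℕ.+ suc (dbl l)) choose suc (dbl b)) * ((1ℚ - powℚ ½ (suc (dbl b) ℕ.+ suc (dbl l))) * Z (suc (suc (dbl b) ℕ.+ suc (dbl l))) M)

  B~ : ∀ b l → (λ L → B (N L) b l) ~ (λ L → B̃ (N L) b l)
  B~ b l = ~-* {r = λ _ → ℕtoℚ ((suc (dbl b) ℕ.+ suc (dbl l)) choose suc (dbl b))} (η-const _) (Et~Z (dbl b ℕ.+ suc (dbl l)))

  zs-single : ∀ k M → zs (suc k ∷ []) M ≡ Z (suc k) M
  zs-single k zero    = refl
  zs-single k (suc M) = cong₂ _+_ (zs-single k M) (ℚP.*-identityʳ (powℚ (inv M) (suc k)))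

  powℚ-[-1] : ∀ r → powℚ (- 1ℚ) r ≡ sgn r
  powℚ-[-1] r = trans (powℚ-neg 1ℚ r) (trans (cong (sgn r *_) (powℚ-1 r)) (ℚP.*-identityʳ (sgn r)))

  coefficient-dbl : ∀ a b r → coefficient a b r ≡ ℕtoℚ 2 * sgn r * (ℕtoℚ (dbl r choose dbl (suc b)) - (1ℚ - powℚ ½ (dbl r)) * ℕtoℚ (dbl r choose suc (dbl a)))
  coefficient-dbl a b r = cong₂ (λ x y → ℕtoℚ 2 * x * y) (powℚ-[-1] r)
    (cong₂ (λ x y → ℕtoℚ x - y) (cong₂ _choose_ (dbl≡2* r) (trans (ℕP.+-comm (2 ℕ.* b) 2) (cong (suc ∘ suc) (dbl≡2* b))))
      (cong₂ (λ x y → (1ℚ - powℚ ½ x) * ℕtoℚ y) (dbl≡2* r) (cong₂ _choose_ (dbl≡2* r) (trans (ℕP.+-comm (2 ℕ.* a) 1) (cong suc (dbl≡2* a))))))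

  dbl-mono : ∀ {m n} → m ℕ.≤ n → dbl m ℕ.≤ dbl n
  dbl-mono z≤n       = z≤n
  dbl-mono (s≤s m≤n) = s≤s (s≤s (dbl-mono m≤n))

  rhs-sum : ℕ → ℕ → ℕ → ℚ
  rhs-sum M a b = sum (a ℕ.+ b ℕ.+ 1) (λ s → coefficient a b (suc s) * (zs ((2 ℕ.* suc s ℕ.+ 1) ∷ []) M * zs (replicate (a ℕ.+ b ℕ.+ 1 ℕ.∸ suc s) 2) M))

  module _ (M a b : ℕ) where
    private
      T : ℕ → ℚ
      T t = zs (replicate t 2) M
      Zo : ℕ → ℚ
      Zo s = Z (suc (dbl (suc s))) M
      n = a ℕ.+ b ℕ.+ 1
      P₁ P₂ : ℕ → ℕ → ℚ
      P₁ s t = ℕtoℚ 2 * sgn (suc s) * ℕtoℚ (dbl (suc s) choose dbl (suc b)) * (Zo s * T t)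
      P₂ s t = ℕtoℚ 2 * sgn (suc s) * ((1ℚ - powℚ ½ (dbl (suc s))) * ℕtoℚ (dbl (suc s) choose suc (dbl a))) * (Zo s * T t)
      n≡₁ : n ≡ b ℕ.+ suc a
      n≡₁ = trans (ℕP.+-comm (a ℕ.+ b) 1) (trans (cong suc (ℕP.+-comm a b)) (sym (ℕP.+-suc b a)))
      n≡₂ : n ≡ a ℕ.+ suc b
      n≡₂ = trans (ℕP.+-comm (a ℕ.+ b) 1) (sym (ℕP.+-suc a b))

      sgn-cancel : ∀ x y t → t ℕ.≤ x → sgn (x ℕ.+ y) * sgn (x ℕ.∸ t) ≡ sgn (y ℕ.+ t)
      sgn-cancel x y t t≤x = begin
        sgn (x ℕ.+ y) * s                       ≡⟨ cong (λ z → sgn (z ℕ.+ y) * s) (sym (ℕP.m+[n∸m]≡n t≤x)) ⟩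
        sgn (t ℕ.+ (x ℕ.∸ t) ℕ.+ y) * s         ≡⟨ cong (_* s) (trans (sgn-+ (t ℕ.+ (x ℕ.∸ t)) y) (cong (_* sgn y) (sgn-+ t (x ℕ.∸ t)))) ⟩
        sgn t * s * sgn y * s                   ≡⟨ regroup (sgn t) s (sgn y) ⟩
        sgn y * sgn t * (s * s)                 ≡⟨ trans (cong (sgn y * sgn t *_) (sgn-square (x ℕ.∸ t))) (ℚP.*-identityʳ (sgn y * sgn t)) ⟩
        sgn y * sgn t                           ≡⟨ sgn-+ y t ⟨
        sgn (y ℕ.+ t)                           ∎
        where
        open ≡-Reasoning
        s = sgn (x ℕ.∸ t)
        regroup : ∀ t s y → t * s * y * s ≡ y * t * (s * s)
        regroup = solve-∀ ℚ-ring

    -- The terms with s < y vanish because of their binomial coefficients.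
    reindex : ∀ x y (P : ℕ → ℕ → ℚ) → n ≡ y ℕ.+ suc x → (∀ s t → s ℕ.< y → P s t ≡ 0ℚ) → sum n (λ s → P s (n ℕ.∸ suc s)) ≡ sum (suc x) (λ t → P (y ℕ.+ t) (x ℕ.∸ t))
    reindex x y P e z = begin
      sum n (λ s → P s (n ℕ.∸ suc s))                       ≡⟨ cong (λ n → sum n (λ s → P s (n ℕ.∸ suc s))) e ⟩
      sum (y ℕ.+ suc x) (λ s → P s (y ℕ.+ suc x ℕ.∸ suc s)) ≡⟨ sum-split y (suc x) (λ s → P s (y ℕ.+ suc x ℕ.∸ suc s)) ⟩
      sum y (λ s → P s (y ℕ.+ suc x ℕ.∸ suc s)) + sum (suc x) (λ t → P (y ℕ.+ t) (y ℕ.+ suc x ℕ.∸ suc (y ℕ.+ t)))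
        ≡⟨ cong₂ _+_ (trans (sum-cong< y (λ s s<y → z s _ s<y)) (sum-0 y)) (sum-cong (suc x) (λ t → cong (P (y ℕ.+ t)) (trans (cong (y ℕ.+ suc x ℕ.∸_) (sym (ℕP.+-suc y t))) (ℕP.[m+n]∸[m+o]≡n∸o y (suc x) (suc t))))) ⟩
      0ℚ + sum (suc x) (λ t → P (y ℕ.+ t) (x ℕ.∸ t))        ≡⟨ ℚP.+-identityˡ _ ⟩
      sum (suc x) (λ t → P (y ℕ.+ t) (x ℕ.∸ t))             ∎
      where open ≡-Reasoning

    private
      zero-term : ∀ {x y z w} → y ≡ 0 → x * ℕtoℚ y * z ≡ w → 0ℚ ≡ w
      zero-term {x} {z = z} refl e = trans (sym (trans (cong (_* z) (ℚP.*-zeroʳ x)) (ℚP.*-zeroˡ z))) e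

      vanish₁ : ∀ s t → s ℕ.< b → P₁ s t ≡ 0ℚ
      vanish₁ s t s<b = sym (zero-term {ℕtoℚ 2 * sgn (suc s)} {dbl (suc s) choose dbl (suc b)} {Zo s * T t} (k>n⇒nCk≡0 (ℕP.≤-trans (ℕP.n≤1+n _) (dbl-mono (s≤s s<b)))) refl)

      vanish₂ : ∀ s t → s ℕ.< a → P₂ s t ≡ 0ℚ
      vanish₂ s t s<a = sym (zero-term {ℕtoℚ 2 * sgn (suc s) * (1ℚ - powℚ ½ (dbl (suc s)))} {dbl (suc s) choose suc (dbl a)} {Zo s * T t} (k>n⇒nCk≡0 (s≤s (dbl-mono s<a))) (cong (_* (Zo s * T t)) (ℚP.*-assoc (ℕtoℚ 2 * sgn (suc s)) (1ℚ - powℚ ½ (dbl (suc s))) _)))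

    part-A : sgn (a ℕ.+ b) * (ℕtoℚ 2 * conv (Tc M) (λ i → A M i b) a) ≡ sum n (λ s → P₁ s (n ℕ.∸ suc s))
    part-A = sym (trans (reindex a b P₁ n≡₁ vanish₁) (sym (trans (cong (λ z → sgn (a ℕ.+ b) * (ℕtoℚ 2 * z)) (trans (conv-comm a (Tc M) (λ i → A M i b)) (conv-as-sum a (λ i → A M i b) (Tc M))))
      (trans (cong (sgn (a ℕ.+ b) *_) (sym (sum-*ˡ (suc a) (ℕtoℚ 2) _))) (trans (sym (sum-*ˡ (suc a) (sgn (a ℕ.+ b)) _)) (sum-cong< (suc a) (λ { t (s≤s t≤a) → term t t≤a })))))))
      where
      regroup : ∀ σ τ f c z x → σ * (f * (- (c * z) * (τ * x))) ≡ f * (- (σ * τ)) * c * (z * x)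
      regroup = solve-∀ ℚ-ring
      index : ∀ t → dbl t ℕ.+ dbl (suc b) ≡ dbl (suc (b ℕ.+ t))
      index t = trans (dbl-+ t (suc b)) (cong dbl (ℕP.+-comm t (suc b)))
      term : ∀ t → t ℕ.≤ a → sgn (a ℕ.+ b) * (ℕtoℚ 2 * (A M t b * Tc M (a ℕ.∸ t))) ≡ P₁ (b ℕ.+ t) (a ℕ.∸ t)
      term t t≤a = trans (cong₂ (λ x y → sgn (a ℕ.+ b) * (ℕtoℚ 2 * (- (ℕtoℚ x * Z (suc y) M) * Tc M (a ℕ.∸ t)))) (trans (C-sym (dbl t) (dbl (suc b))) (cong (_choose dbl (suc b)) (index t))) (index t))
        (trans (regroup (sgn (a ℕ.+ b)) (sgn (a ℕ.∸ t)) (ℕtoℚ 2) (ℕtoℚ (dbl (suc (b ℕ.+ t)) choose dbl (suc b))) (Zo (b ℕ.+ t)) (T (a ℕ.∸ t)))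
          (cong (λ z → ℕtoℚ 2 * (- z) * ℕtoℚ (dbl (suc (b ℕ.+ t)) choose dbl (suc b)) * (Zo (b ℕ.+ t) * T (a ℕ.∸ t))) (sgn-cancel a b t t≤a)))

    part-B : sgn (a ℕ.+ b) * (ℕtoℚ 2 * conv (Tc M) (λ j → B̃ M j a) b) ≡ - sum n (λ s → P₂ s (n ℕ.∸ suc s))
    part-B = sym (trans (cong -_ (reindex b a P₂ n≡₂ vanish₂)) (sym (trans (cong (λ z → sgn (a ℕ.+ b) * (ℕtoℚ 2 * z)) (trans (conv-comm b (Tc M) (λ i → B̃ M i a)) (conv-as-sum b (λ i → B̃ M i a) (Tc M))))
      (trans (cong (sgn (a ℕ.+ b) *_) (sym (sum-*ˡ (suc b) (ℕtoℚ 2) _))) (trans (sym (sum-*ˡ (suc b) (sgn (a ℕ.+ b)) _)) (trans (sum-cong< (suc b) (λ { t (s≤s t≤b) → term t t≤b })) (sum-neg (suc b) (λ t → P₂ (a ℕ.+ t) (b ℕ.∸ t)))))))))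
      where
      regroup : ∀ σ τ f c ν z x → σ * (f * (c * (ν * z) * (τ * x))) ≡ - (f * (- (σ * τ)) * (ν * c) * (z * x))
      regroup = solve-∀ ℚ-ring
      index : ∀ t → suc (dbl t) ℕ.+ suc (dbl a) ≡ dbl (suc (a ℕ.+ t))
      index t = trans (cong suc (ℕP.+-suc (dbl t) (dbl a))) (cong (suc ∘ suc) (trans (dbl-+ t a) (cong dbl (ℕP.+-comm t a))))
      term : ∀ t → t ℕ.≤ b → sgn (a ℕ.+ b) * (ℕtoℚ 2 * (B̃ M t a * Tc M (b ℕ.∸ t))) ≡ - P₂ (a ℕ.+ t) (b ℕ.∸ t)
      term t t≤b = trans (cong₂ (λ x y → sgn (a ℕ.+ b) * (ℕtoℚ 2 * (ℕtoℚ x * ((1ℚ - powℚ ½ y) * Z (suc y) M) * Tc M (b ℕ.∸ t)))) (trans (C-sym (suc (dbl t)) (suc (dbl a))) (cong (_choose suc (dbl a)) (index t))) (index t))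
        (trans (regroup (sgn (a ℕ.+ b)) (sgn (b ℕ.∸ t)) (ℕtoℚ 2) (ℕtoℚ (dbl (suc (a ℕ.+ t)) choose suc (dbl a))) (1ℚ - powℚ ½ (dbl (suc (a ℕ.+ t)))) (Zo (a ℕ.+ t)) (T (b ℕ.∸ t)))
          (cong (λ z → - (ℕtoℚ 2 * (- z) * ((1ℚ - powℚ ½ (dbl (suc (a ℕ.+ t)))) * ℕtoℚ (dbl (suc (a ℕ.+ t)) choose suc (dbl a))) * (Zo (a ℕ.+ t) * T (b ℕ.∸ t))))
            (trans (cong (λ z → sgn z * sgn (b ℕ.∸ t)) (ℕP.+-comm a b)) (sgn-cancel b a t t≤b))))

    rhs-sum≡ : sgn (a ℕ.+ b) * (ℕtoℚ 2 * (conv (Tc M) (λ i → A M i b) a + conv (Tc M) (λ j → B̃ M j a) b)) ≡ rhs-sum M a b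
    rhs-sum≡ = begin
      sgn (a ℕ.+ b) * (ℕtoℚ 2 * (x + y))                                  ≡⟨ regroup (sgn (a ℕ.+ b)) (ℕtoℚ 2) x y ⟩
      sgn (a ℕ.+ b) * (ℕtoℚ 2 * x) + sgn (a ℕ.+ b) * (ℕtoℚ 2 * y)         ≡⟨ cong₂ _+_ part-A part-B ⟩
      sum n (λ s → P₁ s (n ℕ.∸ suc s)) - sum n (λ s → P₂ s (n ℕ.∸ suc s)) ≡⟨ sum-- n (λ s → P₁ s (n ℕ.∸ suc s)) (λ s → P₂ s (n ℕ.∸ suc s)) ⟨
      sum n (λ s → P₁ s (n ℕ.∸ suc s) - P₂ s (n ℕ.∸ suc s))               ≡⟨ sum-cong n term ⟩
      rhs-sum M a b                                                       ∎
      where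
      open ≡-Reasoning
      x = conv (Tc M) (λ i → A M i b) a
      y = conv (Tc M) (λ j → B̃ M j a) b
      regroup : ∀ s f x y → s * (f * (x + y)) ≡ s * (f * x) + s * (f * y)
      regroup = solve-∀ ℚ-ring
      factor : ∀ w p q z → w * p * z - w * q * z ≡ w * (p - q) * z
      factor = solve-∀ ℚ-ring
      odd-index : ∀ s → suc (dbl (suc s)) ≡ 2 ℕ.* suc s ℕ.+ 1
      odd-index s = sym (trans (ℕP.+-comm (2 ℕ.* suc s) 1) (cong suc (dbl≡2* (suc s))))
      term : ∀ s → P₁ s (n ℕ.∸ suc s) - P₂ s (n ℕ.∸ suc s) ≡ coefficient a b (suc s) * (zs ((2 ℕ.* suc s ℕ.+ 1) ∷ []) M * T (n ℕ.∸ suc s))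
      term s = trans (factor (ℕtoℚ 2 * sgn (suc s)) (ℕtoℚ (dbl (suc s) choose dbl (suc b))) ((1ℚ - powℚ ½ (dbl (suc s))) * ℕtoℚ (dbl (suc s) choose suc (dbl a))) (Zo s * T (n ℕ.∸ suc s)))
        (cong₂ (λ u v → u * (v * T (n ℕ.∸ suc s))) (sym (coefficient-dbl a b (suc s))) (trans (sym (zs-single (dbl (suc s)) M)) (cong (λ z → zs (z ∷ []) M) (odd-index s))))

  zagier : ∀ a b → (λ L → zs (H a b) (N L)) ~ (λ L → rhs-sum (N L) a b)
  zagier a b = ~-trans {t = λ L → sgn (a ℕ.+ b) * Hc (N L) a b} (~-reflexive (λ L → unsign (zs (H a b) (N L))))
    (~-trans {t = λ L → sgn (a ℕ.+ b) * (ℕtoℚ 2 * (conv (Tc (N L)) (λ i → A (N L) i b) a + conv (Tc (N L)) (λ j → B̃ (N L) j a) b))}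
      (~-* {r = λ _ → sgn (a ℕ.+ b)} (η-const (sgn (a ℕ.+ b))) (~-trans (Hc~ a b)
        (~-* {r = λ _ → ℕtoℚ 2} (η-const (ℕtoℚ 2)) (~-+ {s = λ L → conv (Tc (N L)) (λ i → A (N L) i b) a} {t = λ L → conv (Tc (N L)) (λ i → A (N L) i b) a} (~-reflexive (λ _ → refl))
          (~-conv b {f = λ L → Tc (N L)} {s = λ L j → B (N L) j a} {t = λ L j → B̃ (N L) j a} Tc-Lg (λ j → B~ j a))))))
      (~-reflexive (λ L → rhs-sum≡ (N L) a b)))
    where
    unsign : ∀ x → x ≡ sgn (a ℕ.+ b) * (sgn (a ℕ.+ b) * x)
    unsign x = sym (trans (sym (ℚP.*-assoc (sgn (a ℕ.+ b)) (sgn (a ℕ.+ b)) x)) (trans (cong (_* x) (sgn-square (a ℕ.+ b))) (ℚP.*-identityˡ x)))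

module Segments where

  open Sums
  open Shuffles
  open Polylogarithms using (is-x0)

  module Coproduct (V : ℚ-module) where
    open Pairing V public

    Kernel : Set
    Kernel = Word → Word → Carrierᴹ

    -- The letter after a segment, the word being followed by ε_{n+1} = x0.
    hd : Word → X
    hd []      = x0
    hd (b ∷ w) = b

    ω : X → X → ℚ
    ω a b = is-x0 b - is-x0 a

    ω-trans : ∀ a b c → ω a b + ω b c ≡ ω a c
    ω-trans a b c = regroup (is-x0 a) (is-x0 b) (is-x0 c)
      where
      regroup : ∀ x y z → y - x + (z - y) ≡ z - x
      regroup = solve-∀ ℚ-ring

    zero-sum : ∀ {x y} → x ≈ᴹ 0ᴹ → y ≈ᴹ 0ᴹ → x +ᴹ y ≈ᴹ 0ᴹ
    zero-sum e e′ = ≈ᴹ-trans (+ᴹ-cong e e′) (+ᴹ-identityˡ 0ᴹ)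

    zero-scale : ∀ q {x} → x ≈ᴹ 0ᴹ → q *ₗ x ≈ᴹ 0ᴹ
    zero-scale q e = ≈ᴹ-trans (*ₗ-congˡ e) (*ₗ-zeroʳ q)

    Sh-zero : ∀ u v {φ} → (∀ w → φ w ≈ᴹ 0ᴹ) → Sh u v φ ≈ᴹ 0ᴹ
    Sh-zero u v z = ≈ᴹ-trans (Sh-cong u v z) (Sh-0 u v)

    pair-zero′ : ∀ {A : Set} (f : FC A) {φ} → (∀ a → φ a ≈ᴹ 0ᴹ) → ⟪ f , φ ⟫ ≈ᴹ 0ᴹ
    pair-zero′ []            z = ≈ᴹ-refl
    pair-zero′ ((q , a) ∷ f) z = zero-sum (zero-scale q (z a)) (pair-zero′ f z)

    Sh-cong-length : ∀ u v {φ ψ} → (∀ w → length w ≡ length u ℕ.+ length v → φ w ≈ᴹ ψ w) → Sh u v φ ≈ᴹ Sh u v ψ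
    Sh-cong-length []      v       e = e v refl
    Sh-cong-length (a ∷ u) []      e = e (a ∷ u) (sym (ℕP.+-identityʳ _))
    Sh-cong-length (a ∷ u) (b ∷ v) e = +ᴹ-cong (Sh-cong-length u (b ∷ v) (λ w l → e (a ∷ w) (cong suc l)))
      (Sh-cong-length (a ∷ u) v (λ w l → e (b ∷ w) (trans (cong suc l) (sym (ℕP.+-suc (suc (length u)) (length v))))))

    pair-Iseg-cong : ∀ a w b {φ ψ} → (∀ u → length u ≡ length w → φ u ≈ᴹ ψ u) → ⟪ Iseg a w b , φ ⟫ ≈ᴹ ⟪ Iseg a w b , ψ ⟫
    pair-Iseg-cong x1 w       x0 e = +ᴹ-congʳ (*ₗ-congˡ (e w refl))
    pair-Iseg-cong x0 w       x1 e = +ᴹ-congʳ (*ₗ-congˡ (e (reverse w) (LP.length-reverse w)))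
    pair-Iseg-cong x0 []      x0 e = +ᴹ-congʳ (*ₗ-congˡ (e [] refl))
    pair-Iseg-cong x0 (_ ∷ _) x0 e = ≈ᴹ-refl
    pair-Iseg-cong x1 []      x1 e = +ᴹ-congʳ (*ₗ-congˡ (e [] refl))
    pair-Iseg-cong x1 (_ ∷ _) x1 e = ≈ᴹ-refl

    pair-Iseg-zero : ∀ a w b {φ} → (∀ u → length u ≡ length w → φ u ≈ᴹ 0ᴹ) → ⟪ Iseg a w b , φ ⟫ ≈ᴹ 0ᴹ
    pair-Iseg-zero a w b z = ≈ᴹ-trans (pair-Iseg-cong a w b z) (pair-zero′ (Iseg a w b) (λ _ → ≈ᴹ-refl))

    pair-Iseg-[] : ∀ a b φ → ⟪ Iseg a [] b , φ ⟫ ≈ᴹ φ []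
    pair-Iseg-[] x1 x0 φ = pair-wd [] φ
    pair-Iseg-[] x0 x1 φ = pair-wd [] φ
    pair-Iseg-[] x0 x0 φ = pair-wd [] φ
    pair-Iseg-[] x1 x1 φ = pair-wd [] φ

    pair-Iseg : ∀ a c w b {ψ} → KillsProducts ψ → ⟪ Iseg a (c ∷ w) b , ψ ⟫ ≈ᴹ ω a b *ₗ ψ (c ∷ w)
    pair-Iseg x1 c w x0 {ψ} kill = +ᴹ-identityʳ _
    pair-Iseg x0 c w x0 {ψ} kill = ≈ᴹ-sym (*ₗ-zeroˡ (ψ (c ∷ w)))
    pair-Iseg x1 c w x1 {ψ} kill = ≈ᴹ-sym (*ₗ-zeroˡ (ψ (c ∷ w)))
    pair-Iseg x0 c w x1 {ψ} kill = begin
      (- sgn (length w)) *ₗ ψ (reverse (c ∷ w)) +ᴹ 0ᴹ             ≈⟨ +ᴹ-identityʳ _ ⟩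
      (- sgn (length w)) *ₗ ψ (reverse (c ∷ w))                   ≈⟨ *ₗ-congʳ (minus (sgn (length w))) ⟩
      ((- 1ℚ) * sgn (length w)) *ₗ ψ (reverse (c ∷ w))            ≈⟨ *ₗ-assoc (- 1ℚ) (sgn (length w)) _ ⟩
      (- 1ℚ) *ₗ (sgn (length w) *ₗ ψ (reverse (c ∷ w)))           ≈⟨ *ₗ-congˡ (antipode {ψ} kill c w) ⟨
      (- 1ℚ) *ₗ ψ (c ∷ w)                                         ∎
      where
      minus : ∀ x → - x ≡ (- 1ℚ) * x
      minus = solve-∀ ℚ-ring

    Full : List (Poly × Word) → Kernel → Carrierᴹ
    Full []            φ = 0ᴹ
    Full ((L , R) ∷ G) φ = ⟪ L , (λ p → φ p R) ⟫ +ᴹ Full G φ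

    Full-zero : ∀ G {φ} → (∀ p s → φ p s ≈ᴹ 0ᴹ) → Full G φ ≈ᴹ 0ᴹ
    Full-zero []            z = ≈ᴹ-refl
    Full-zero ((L , R) ∷ G) z = zero-sum (pair-zero′ L (λ p → z p R)) (Full-zero G z)

    Full-map : ∀ {k} (f : Poly) e G G′ φ → (∀ L R → k (L , R) ≡ (sh f L , e ∷ R)) →
      Full (map k G ++ G′) φ ≈ᴹ Full G (λ p s → ⟪ f , (λ u → Sh u p (λ q → φ q (e ∷ s))) ⟫) +ᴹ Full G′ φ
    Full-map f e []            G′ φ k≡ = ≈ᴹ-sym (+ᴹ-identityˡ _)
    Full-map {k} f e ((L , R) ∷ G) G′ φ k≡ = ≈ᴹ-trans (+ᴹ-cong head (Full-map f e G G′ φ k≡)) (≈ᴹ-sym (+ᴹ-assoc _ _ _))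
      where
      pull : ∀ q (L : Poly) (φ : Word → Carrierᴹ) → q *ₗ ⟪ L , φ ⟫ ≈ᴹ ⟪ L , (λ p → q *ₗ φ p) ⟫
      pull q []            φ = *ₗ-zeroʳ q
      pull q ((r , p) ∷ L) φ = ≈ᴹ-trans (*ₗ-distribˡ q _ _) (+ᴹ-cong (≈ᴹ-trans (≈ᴹ-sym (*ₗ-assoc q r (φ p))) (≈ᴹ-trans (*ₗ-congʳ (ℚP.*-comm q r)) (*ₗ-assoc r q (φ p)))) (pull q L φ))
      add : ∀ (L : Poly) (φ ψ : Word → Carrierᴹ) → ⟪ L , φ ⟫ +ᴹ ⟪ L , ψ ⟫ ≈ᴹ ⟪ L , (λ p → φ p +ᴹ ψ p) ⟫
      add []            φ ψ = +ᴹ-identityˡ 0ᴹ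
      add ((r , p) ∷ L) φ ψ = ≈ᴹ-trans (interchange _ _ _ _) (+ᴹ-cong (≈ᴹ-sym (*ₗ-distribˡ r _ _)) (add L φ ψ))
      exchange : ∀ f L → ⟪ f , (λ u → ⟪ L , (λ p → Sh u p (λ q → φ q (e ∷ R))) ⟫) ⟫ ≈ᴹ ⟪ L , (λ p → ⟪ f , (λ u → Sh u p (λ q → φ q (e ∷ R))) ⟫) ⟫
      exchange []            L = ≈ᴹ-sym (pair-zero′ L (λ _ → ≈ᴹ-refl))
      exchange ((q , u) ∷ f) L = ≈ᴹ-trans (+ᴹ-cong (pull q L _) (exchange f L)) (add L _ _)
      head : ⟪ proj₁ (k (L , R)) , (λ p → φ p (proj₂ (k (L , R)))) ⟫ ≈ᴹ ⟪ L , (λ p → ⟪ f , (λ u → Sh u p (λ q → φ q (e ∷ R))) ⟫) ⟫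
      head = ≈ᴹ-trans (≈ᴹ-reflexive (cong (λ z → ⟪ proj₁ z , (λ p → φ p (proj₂ z)) ⟫) (k≡ L R))) (≈ᴹ-trans (pair-sh f L (λ p → φ p (e ∷ R))) (exchange f L))

    gon-suc : ∀ a buf e rest φ → Full (gonAux a buf (e ∷ rest)) φ ≈ᴹ
      Full (gonAux e [] rest) (λ p s → ⟪ Iseg a buf e , (λ u → Sh u p (λ q → φ q (e ∷ s))) ⟫) +ᴹ Full (gonAux a (buf ++ [ e ]) rest) φ
    gon-suc a buf e rest φ = Full-map (Iseg a buf e) e (gonAux e [] rest) (gonAux a (buf ++ [ e ]) rest) φ (λ L R → refl)

    private
      full-end : ∀ a buf φ → Full (gonAux a buf []) φ ≈ᴹ ⟪ Iseg a buf x0 , (λ p → φ p []) ⟫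
      full-end a buf φ = +ᴹ-identityʳ _

      length-∷ʳ : ∀ (buf : Word) e rest → length (buf ++ [ e ]) ℕ.+ length rest ≡ length buf ℕ.+ length (e ∷ rest)
      length-∷ʳ buf e rest = trans (cong (ℕ._+ length rest) (LP.length-++ buf)) (ℕP.+-assoc (length buf) 1 (length rest))

    gon-cong-length : ∀ a buf rest {φ ψ} → (∀ p s → length p ℕ.+ length s ≡ length buf ℕ.+ length rest → φ p s ≈ᴹ ψ p s) →
      Full (gonAux a buf rest) φ ≈ᴹ Full (gonAux a buf rest) ψ
    gon-cong-length a buf []         {φ} {ψ} e = ≈ᴹ-trans (full-end a buf φ) (≈ᴹ-trans (pair-Iseg-cong a buf x0 (λ u l → e u [] (cong (ℕ._+ 0) l))) (≈ᴹ-sym (full-end a buf ψ)))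
    gon-cong-length a buf (c ∷ rest) {φ} {ψ} e = ≈ᴹ-trans (gon-suc a buf c rest φ) (≈ᴹ-trans (+ᴹ-cong
        (gon-cong-length c [] rest (λ p s l → pair-Iseg-cong a buf c (λ u lu → Sh-cong-length u p (λ w lw → e w (c ∷ s) (lengths p s u w l lu lw)))))
        (gon-cong-length a (buf ++ [ c ]) rest (λ p s l → e p s (trans l (length-∷ʳ buf c rest)))))
      (≈ᴹ-sym (gon-suc a buf c rest ψ)))
      where
      lengths : ∀ (p s u w : Word) → length p ℕ.+ length s ≡ length rest → length u ≡ length buf → length w ≡ length u ℕ.+ length p → length w ℕ.+ suc (length s) ≡ length buf ℕ.+ suc (length rest)
      lengths p s u w l lu lw = trans (cong (ℕ._+ suc (length s)) (trans lw (cong (ℕ._+ length p) lu))) (trans (ℕP.+-assoc (length buf) (length p) (suc (length s)))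
        (cong (length buf ℕ.+_) (trans (ℕP.+-suc (length p) (length s)) (cong suc l))))

    gon-nonempty : ∀ a c buf rest {χ : Kernel} → (∀ d p s → χ (d ∷ p) s ≈ᴹ 0ᴹ) → Full (gonAux a (c ∷ buf) rest) χ ≈ᴹ 0ᴹ
    gon-nonempty a c buf [] {χ} z = ≈ᴹ-trans (full-end a (c ∷ buf) χ) (pair-Iseg-zero a (c ∷ buf) x0 (λ { (d ∷ u) _ → z d u [] }))
    gon-nonempty a c buf (e ∷ rest) {χ} z = ≈ᴹ-trans (gon-suc a (c ∷ buf) e rest χ) (zero-sum
      (Full-zero (gonAux e [] rest) (λ p s → pair-Iseg-zero a (c ∷ buf) e (λ { (d ∷ u) _ → ≈ᴹ-trans (Sh-cong-length (d ∷ u) p {ψ = λ _ → 0ᴹ} (λ { (f ∷ w) _ → z f w (e ∷ s) })) (Sh-0 (d ∷ u) p) })))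
      (gon-nonempty a c (buf ++ [ e ]) rest z))

    gon-empty : ∀ a rest {χ : Kernel} → (∀ d p s → χ (d ∷ p) s ≈ᴹ 0ᴹ) → Full (gonAux a [] rest) χ ≈ᴹ χ [] rest
    gon-empty a []         {χ} z = ≈ᴹ-trans (full-end a [] χ) (pair-Iseg-[] a x0 (λ p → χ p []))
    gon-empty a (e ∷ rest) {χ} z = begin
      Full (gonAux a [] (e ∷ rest)) χ
        ≈⟨ gon-suc a [] e rest χ ⟩
      Full (gonAux e [] rest) (λ p s → ⟪ Iseg a [] e , (λ u → Sh u p (λ q → χ q (e ∷ s))) ⟫) +ᴹ Full (gonAux a [ e ] rest) χ
        ≈⟨ +ᴹ-cong (gon-empty e rest (λ d p s → ≈ᴹ-trans (pair-Iseg-[] a e _) (z d p (e ∷ s)))) (gon-nonempty a e [] rest z) ⟩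
      ⟪ Iseg a [] e , (λ u → Sh u [] (λ q → χ q (e ∷ rest))) ⟫ +ᴹ 0ᴹ
        ≈⟨ +ᴹ-identityʳ _ ⟩
      ⟪ Iseg a [] e , (λ u → Sh u [] (λ q → χ q (e ∷ rest))) ⟫
        ≈⟨ pair-Iseg-[] a e _ ⟩
      χ [] (e ∷ rest) ∎

    Cut : Word → Kernel → Carrierᴹ
    Cut []      k = k [] []
    Cut (e ∷ w) k = k [] (e ∷ w) +ᴹ Cut w (λ p s → k (e ∷ p) s)

    Cut⁺ : Word → Kernel → Carrierᴹ
    Cut⁺ []      k = 0ᴹ
    Cut⁺ (e ∷ w) k = Cut w (λ p s → k (e ∷ p) s)

    Cut-split : ∀ w k → Cut w k ≈ᴹ k [] w +ᴹ Cut⁺ w k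
    Cut-split []      k = ≈ᴹ-sym (+ᴹ-identityʳ _)
    Cut-split (e ∷ w) k = ≈ᴹ-refl

    Cut-cong : ∀ w {k l} → (∀ p s → k p s ≈ᴹ l p s) → Cut w k ≈ᴹ Cut w l
    Cut-cong []      e = e [] []
    Cut-cong (c ∷ w) e = +ᴹ-cong (e [] (c ∷ w)) (Cut-cong w (λ p s → e (c ∷ p) s))

    Cut-+ : ∀ w k l → Cut w (λ p s → k p s +ᴹ l p s) ≈ᴹ Cut w k +ᴹ Cut w l
    Cut-+ []      k l = ≈ᴹ-refl
    Cut-+ (c ∷ w) k l = ≈ᴹ-trans (+ᴹ-congˡ (Cut-+ w _ _)) (interchange _ _ _ _)

    Cut-0 : ∀ w → Cut w (λ _ _ → 0ᴹ) ≈ᴹ 0ᴹ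
    Cut-0 []      = ≈ᴹ-refl
    Cut-0 (c ∷ w) = zero-sum ≈ᴹ-refl (Cut-0 w)

    Cut-zero : ∀ w {k} → (∀ p s → k p s ≈ᴹ 0ᴹ) → Cut w k ≈ᴹ 0ᴹ
    Cut-zero w z = ≈ᴹ-trans (Cut-cong w z) (Cut-0 w)

    Cut⁺-zero : ∀ w {k} → (∀ c p s → k (c ∷ p) s ≈ᴹ 0ᴹ) → Cut⁺ w k ≈ᴹ 0ᴹ
    Cut⁺-zero []      z = ≈ᴹ-refl
    Cut⁺-zero (e ∷ w) z = Cut-zero w (z e)

    -- Deconcatenation is a morphism for the shuffle product.
    Sh-Cut : ∀ u v k → Sh u v (λ w → Cut w k) ≈ᴹ Cut u (λ p s → Cut v (λ p′ s′ → Sh p p′ (λ q → Sh s s′ (k q))))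
    Sh-Cut []      v       k = ≈ᴹ-refl
    Sh-Cut (c ∷ u) []      k = Cut-cong (c ∷ u) {k} {λ p s → Sh p [] (λ q → Sh s [] (k q))} (λ p s → ≈ᴹ-sym (≈ᴹ-trans (Sh-[] p (λ q → Sh s [] (k q))) (Sh-[] s (k p))))
    Sh-Cut (c ∷ u) (d ∷ v) k = begin
      Sh u (d ∷ v) (λ w → k [] (c ∷ w) +ᴹ Cut w (kᶜ c)) +ᴹ Sh (c ∷ u) v (λ w → k [] (d ∷ w) +ᴹ Cut w (kᶜ d))
        ≈⟨ ≈ᴹ-trans (+ᴹ-cong (Sh-+ u (d ∷ v) _ _) (Sh-+ (c ∷ u) v _ _)) (interchange _ _ _ _) ⟩
      Sh (c ∷ u) (d ∷ v) (k []) +ᴹ (Sh u (d ∷ v) (λ w → Cut w (kᶜ c)) +ᴹ Sh (c ∷ u) v (λ w → Cut w (kᶜ d)))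
        ≈⟨ +ᴹ-congˡ (+ᴹ-cong (Sh-Cut u (d ∷ v) (kᶜ c)) (Sh-Cut (c ∷ u) v (kᶜ d))) ⟩
      Sh (c ∷ u) (d ∷ v) (k []) +ᴹ (Cut u (λ p s → A p s +ᴹ Cut v (B p s)) +ᴹ (C′ +ᴹ Cut u (λ p s → Cut v (D p s))))
        ≈⟨ +ᴹ-congˡ (x∙yz≈y∙xz _ _ _) ⟩
      Sh (c ∷ u) (d ∷ v) (k []) +ᴹ (C′ +ᴹ (Cut u (λ p s → A p s +ᴹ Cut v (B p s)) +ᴹ Cut u (λ p s → Cut v (D p s))))
        ≈⟨ ≈ᴹ-trans (≈ᴹ-sym (+ᴹ-assoc _ _ _)) (+ᴹ-congˡ (≈ᴹ-sym (Cut-+ u _ _))) ⟩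
      Sh (c ∷ u) (d ∷ v) (k []) +ᴹ C′ +ᴹ Cut u (λ p s → A p s +ᴹ Cut v (B p s) +ᴹ Cut v (D p s))
        ≈⟨ +ᴹ-congˡ (Cut-cong u (λ p s → ≈ᴹ-trans (+ᴹ-assoc _ _ _) (+ᴹ-cong (Sh-[] p _) (≈ᴹ-sym (Cut-+ v _ _))))) ⟩
      Sh (c ∷ u) (d ∷ v) (k []) +ᴹ C′ +ᴹ Cut u (λ p s → Sh s (d ∷ v) (k (c ∷ p)) +ᴹ Cut v (λ p′ s′ → B p s p′ s′ +ᴹ D p s p′ s′)) ∎
      where
      kᶜ : X → Kernel
      kᶜ c p s = k (c ∷ p) s
      A : Kernel
      A p s = Sh p [] (λ q → Sh s (d ∷ v) (k (c ∷ q)))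
      B D : Word → Word → Kernel
      B p s p′ s′ = Sh p (d ∷ p′) (λ q → Sh s s′ (k (c ∷ q)))
      D p s p′ s′ = Sh (c ∷ p) p′ (λ q → Sh s s′ (k (d ∷ q)))
      C′ : Carrierᴹ
      C′ = Cut v (λ p′ s′ → Sh [] p′ (λ q → Sh (c ∷ u) s′ (k (d ∷ q))))

    Cut-axes : ∀ u v (K : Word → Word → Kernel) → (∀ c p d p′ s s′ → K (c ∷ p) (d ∷ p′) s s′ ≈ᴹ 0ᴹ) → (∀ s s′ → K [] [] s s′ ≈ᴹ 0ᴹ) →
      Cut u (λ p s → Cut v (λ p′ s′ → K p p′ s s′)) ≈ᴹ Cut u (λ p s → K p [] s v) +ᴹ Cut v (λ p′ s′ → K [] p′ u s′)
    Cut-axes u v K z z₀ = begin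
      Cut u (λ p s → Cut v (λ p′ s′ → K p p′ s s′))
        ≈⟨ Cut-cong u (λ p s → Cut-split v (λ p′ s′ → K p p′ s s′)) ⟩
      Cut u (λ p s → K p [] s v +ᴹ Cut⁺ v (λ p′ s′ → K p p′ s s′))
        ≈⟨ Cut-+ u _ _ ⟩
      Cut u (λ p s → K p [] s v) +ᴹ Cut u (λ p s → Cut⁺ v (λ p′ s′ → K p p′ s s′))
        ≈⟨ +ᴹ-congˡ (≈ᴹ-trans (Cut-split u _) (+ᴹ-congˡ (Cut⁺-zero u (λ c p s → Cut⁺-zero v (λ d p′ s′ → z c p d p′ s s′))))) ⟩
      Cut u (λ p s → K p [] s v) +ᴹ (Cut⁺ v (λ p′ s′ → K [] p′ u s′) +ᴹ 0ᴹ)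
        ≈⟨ +ᴹ-congˡ (≈ᴹ-trans (+ᴹ-comm _ 0ᴹ) (≈ᴹ-trans (+ᴹ-congʳ (≈ᴹ-sym (z₀ u v))) (≈ᴹ-sym (Cut-split v (λ p′ s′ → K [] p′ u s′))))) ⟩
      Cut u (λ p s → K p [] s v) +ᴹ Cut v (λ p′ s′ → K [] p′ u s′) ∎

    -- The infinitesimal coaction: sums over the segments of a word, extended by a letter on the left and by x0 on the right

    Head : X → Word → Kernel → Carrierᴹ
    Head a w φ = Cut w (λ p s → ω a (hd s) *ₗ φ p s)

    D : X → Word → Kernel → Carrierᴹ
    D a []      φ = 0ᴹ
    D a (e ∷ w) φ = Head a (e ∷ w) φ +ᴹ D e w (λ p s → φ p (e ∷ s))

    Head-cong : ∀ a w {φ ψ} → (∀ p s → φ p s ≈ᴹ ψ p s) → Head a w φ ≈ᴹ Head a w ψ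
    Head-cong a w e = Cut-cong w (λ p s → *ₗ-congˡ (e p s))

    D-cong : ∀ a w {φ ψ} → (∀ p s → φ p s ≈ᴹ ψ p s) → D a w φ ≈ᴹ D a w ψ
    D-cong a []      e = ≈ᴹ-refl
    D-cong a (c ∷ w) {φ} {ψ} e = +ᴹ-cong (Head-cong a (c ∷ w) {φ} {ψ} e) (D-cong c w (λ p s → e p (c ∷ s)))

    Head-+ : ∀ a w φ ψ → Head a w (λ p s → φ p s +ᴹ ψ p s) ≈ᴹ Head a w φ +ᴹ Head a w ψ
    Head-+ a w φ ψ = ≈ᴹ-trans (Cut-cong w (λ p s → *ₗ-distribˡ (ω a (hd s)) (φ p s) (ψ p s))) (Cut-+ w _ _)

    D-+ : ∀ a w φ ψ → D a w (λ p s → φ p s +ᴹ ψ p s) ≈ᴹ D a w φ +ᴹ D a w ψ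
    D-+ a []      φ ψ = ≈ᴹ-sym (+ᴹ-identityˡ 0ᴹ)
    D-+ a (c ∷ w) φ ψ = ≈ᴹ-trans (+ᴹ-cong (Head-+ a (c ∷ w) φ ψ) (D-+ c w _ _)) (interchange _ _ _ _)

    record Good (φ : Kernel) : Set where
      field
        kills : ∀ s → KillsProducts (λ p → φ p s)
        unit  : ∀ s → φ [] s ≈ᴹ 0ᴹ

    Good-∷ : ∀ {φ} e → Good φ → Good (λ p s → φ p (e ∷ s))
    Good-∷ e g = record { kills = λ s → Good.kills g (e ∷ s) ; unit = λ s → Good.unit g (e ∷ s) }

    gon-window : ∀ a c buf rest {φ} → Good φ → Full (gonAux a (c ∷ buf) rest) φ ≈ᴹ Cut rest (λ p s → ω a (hd s) *ₗ φ (c ∷ buf ++ p) s)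
    gon-window a c buf [] {φ} g = ≈ᴹ-trans (full-end a (c ∷ buf) φ) (≈ᴹ-trans (pair-Iseg a c buf x0 (Good.kills g []))
      (*ₗ-congˡ (≈ᴹ-reflexive (cong (λ z → φ (c ∷ z) []) (sym (LP.++-identityʳ buf))))))
    gon-window a c buf (e ∷ rest) {φ} g = ≈ᴹ-trans (gon-suc a (c ∷ buf) e rest φ) (+ᴹ-cong first second)
      where
      χ : Kernel
      χ p s = ⟪ Iseg a (c ∷ buf) e , (λ u → Sh u p (λ q → φ q (e ∷ s))) ⟫
      first : Full (gonAux e [] rest) χ ≈ᴹ ω a e *ₗ φ (c ∷ buf ++ []) (e ∷ rest)
      first = ≈ᴹ-trans (gon-empty e rest (λ d p s → pair-Iseg-zero a (c ∷ buf) e (λ { (f ∷ u) _ → Good.kills g (e ∷ s) f u d p })))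
        (≈ᴹ-trans (pair-cong (Iseg a (c ∷ buf) e) (λ u → Sh-[] u _)) (≈ᴹ-trans (pair-Iseg a c buf e (Good.kills g (e ∷ rest)))
          (*ₗ-congˡ (≈ᴹ-reflexive (cong (λ z → φ (c ∷ z) (e ∷ rest)) (sym (LP.++-identityʳ buf)))))))
      second : Full (gonAux a (c ∷ buf ++ [ e ]) rest) φ ≈ᴹ Cut rest (λ p s → ω a (hd s) *ₗ φ (c ∷ buf ++ e ∷ p) s)
      second = ≈ᴹ-trans (gon-window a c (buf ++ [ e ]) rest g) (Cut-cong rest (λ p s → *ₗ-congˡ (≈ᴹ-reflexive (cong (λ z → φ (c ∷ z) s) (LP.++-assoc buf [ e ] p)))))

    -- Modulo products in the left factor only the terms of the Goncharov coproduct with a single non-trivial segment survive.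
    gon-D : ∀ a w {φ} → Good φ → Full (gonAux a [] w) φ ≈ᴹ D a w φ
    gon-D a []      {φ} g = ≈ᴹ-trans (full-end a [] φ) (≈ᴹ-trans (pair-Iseg-[] a x0 (λ p → φ p [])) (Good.unit g []))
    gon-D a (e ∷ w) {φ} g = ≈ᴹ-trans (gon-suc a [] e w φ) (≈ᴹ-trans (+ᴹ-comm _ _) (+ᴹ-cong window rest))
      where
      window : Full (gonAux a [ e ] w) φ ≈ᴹ Head a (e ∷ w) φ
      window = ≈ᴹ-trans (gon-window a e [] w g) (≈ᴹ-sym (≈ᴹ-trans (+ᴹ-congʳ (zero-scale (ω a e) (Good.unit g (e ∷ w)))) (+ᴹ-identityˡ _)))
      rest : Full (gonAux e [] w) (λ p s → ⟪ Iseg a [] e , (λ u → Sh u p (λ q → φ q (e ∷ s))) ⟫) ≈ᴹ D e w (λ p s → φ p (e ∷ s))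
      rest = ≈ᴹ-trans (gon-cong-length e [] w (λ p s _ → pair-Iseg-[] a e _)) (gon-D e w (Good-∷ e g))

    Sh-swap : ∀ p p′ s s′ (k : Kernel) → Sh p p′ (λ q → Sh s s′ (k q)) ≈ᴹ Sh s s′ (λ r → Sh p p′ (λ q → k q r))
    Sh-swap []      p′       s s′ k = ≈ᴹ-refl
    Sh-swap (c ∷ p) []       s s′ k = ≈ᴹ-refl
    Sh-swap (c ∷ p) (d ∷ p′) s s′ k = ≈ᴹ-trans (+ᴹ-cong (Sh-swap p (d ∷ p′) s s′ _) (Sh-swap (c ∷ p) p′ s s′ _)) (≈ᴹ-sym (Sh-+ s s′ _ _))

    private
      -- Inserting a segment into the gaps between the letters of v that precede the first letter of s telescopes.
      telescope : ∀ a d s v ψ → Sh s (d ∷ v) (λ r → ω a (hd r) *ₗ ψ r) +ᴹ ω d (hd s) *ₗ Sh s v (ψ ∘ (d ∷_)) ≈ᴹ ω a (hd s) *ₗ Sh s (d ∷ v) ψ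
      telescope a d []      v ψ = ≈ᴹ-trans (≈ᴹ-sym (*ₗ-distribʳ _ _ _)) (*ₗ-congʳ (ω-trans a d x0))
      telescope a d (c ∷ s) v ψ = begin
        Sh s (d ∷ v) (λ r → ω a c *ₗ ψ (c ∷ r)) +ᴹ Sh (c ∷ s) v (λ r → ω a d *ₗ ψ (d ∷ r)) +ᴹ ω d c *ₗ Y
          ≈⟨ +ᴹ-congʳ (+ᴹ-cong (Sh-*ₗ (ω a c) s (d ∷ v) _) (Sh-*ₗ (ω a d) (c ∷ s) v _)) ⟩
        ω a c *ₗ Sh s (d ∷ v) (ψ ∘ (c ∷_)) +ᴹ ω a d *ₗ Y +ᴹ ω d c *ₗ Y
          ≈⟨ +ᴹ-assoc _ _ _ ⟩
        ω a c *ₗ Sh s (d ∷ v) (ψ ∘ (c ∷_)) +ᴹ (ω a d *ₗ Y +ᴹ ω d c *ₗ Y)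
          ≈⟨ +ᴹ-congˡ (≈ᴹ-trans (≈ᴹ-sym (*ₗ-distribʳ _ _ _)) (*ₗ-congʳ (ω-trans a d c))) ⟩
        ω a c *ₗ Sh s (d ∷ v) (ψ ∘ (c ∷_)) +ᴹ ω a c *ₗ Y
          ≈⟨ *ₗ-distribˡ _ _ _ ⟨
        ω a c *ₗ Sh (c ∷ s) (d ∷ v) ψ ∎
        where
        Y = Sh (c ∷ s) v (ψ ∘ (d ∷_))

      head-shuffle : ∀ a c u d v {φ} → Good φ → let cu = c ∷ u ; dv = d ∷ v in
        Sh cu dv (λ w → Head a w φ) +ᴹ (Head d cu (λ p s → Sh s v (λ r → φ p (d ∷ r))) +ᴹ Head c dv (λ p s → Sh u s (λ r → φ p (c ∷ r)))) ≈ᴹ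
        Head a cu (λ p s → Sh s dv (φ p)) +ᴹ Head a dv (λ p s → Sh cu s (φ p))
      head-shuffle a c u d v {φ} g = begin
        Sh cu dv (λ w → Head a w φ) +ᴹ (Head d cu (λ p s → Sh s v (λ r → φ p (d ∷ r))) +ᴹ Head c dv (λ p s → Sh u s (λ r → φ p (c ∷ r))))
          ≈⟨ +ᴹ-congʳ (≈ᴹ-trans (Sh-Cut cu dv k) (Cut-axes cu dv (λ p p′ s s′ → Sh p p′ (λ q → Sh s s′ (k q))) both neither)) ⟩
        Cut cu (λ p s → Sh p [] (λ q → Sh s dv (k q))) +ᴹ Cut dv (λ p s → Sh cu s (k p)) +ᴹ (Head d cu (λ p s → Sh s v (λ r → φ p (d ∷ r))) +ᴹ Head c dv (λ p s → Sh u s (λ r → φ p (c ∷ r))))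
          ≈⟨ interchange _ _ _ _ ⟩
        Cut cu (λ p s → Sh p [] (λ q → Sh s dv (k q))) +ᴹ Head d cu (λ p s → Sh s v (λ r → φ p (d ∷ r))) +ᴹ (Cut dv (λ p s → Sh cu s (k p)) +ᴹ Head c dv (λ p s → Sh u s (λ r → φ p (c ∷ r))))
          ≈⟨ +ᴹ-cong (≈ᴹ-trans (≈ᴹ-sym (Cut-+ cu k₁ l₁)) (Cut-cong cu {λ p s → k₁ p s +ᴹ l₁ p s} {λ p s → ω a (hd s) *ₗ Sh s dv (φ p)} (λ p s → ≈ᴹ-trans (+ᴹ-congʳ (Sh-[] p _)) (telescope a d s v (φ p)))))
                     (≈ᴹ-trans (≈ᴹ-sym (Cut-+ dv k₂ l₂)) (Cut-cong dv {λ p s → k₂ p s +ᴹ l₂ p s} {λ p s → ω a (hd s) *ₗ Sh cu s (φ p)}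
                       (λ p s → ≈ᴹ-trans (+ᴹ-cong (Sh-comm cu s (k p)) (*ₗ-congˡ (Sh-comm u s (λ r → φ p (c ∷ r))))) (≈ᴹ-trans (telescope a c s u (φ p)) (*ₗ-congˡ (Sh-comm s cu (φ p))))))) ⟩
        Head a cu (λ p s → Sh s dv (φ p)) +ᴹ Head a dv (λ p s → Sh cu s (φ p)) ∎
        where
        cu = c ∷ u
        dv = d ∷ v
        k : Kernel
        k p s = ω a (hd s) *ₗ φ p s
        k₁ l₁ k₂ l₂ : Kernel
        k₁ p s = Sh p [] (λ q → Sh s dv (k q))
        l₁ p s = ω d (hd s) *ₗ Sh s v (λ r → φ p (d ∷ r))
        k₂ p s = Sh cu s (k p)
        l₂ p s = ω c (hd s) *ₗ Sh u s (λ r → φ p (c ∷ r))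
        both : ∀ c p d p′ s s′ → Sh (c ∷ p) (d ∷ p′) (λ q → Sh s s′ (k q)) ≈ᴹ 0ᴹ
        both c p d p′ s s′ = ≈ᴹ-trans (Sh-swap (c ∷ p) (d ∷ p′) s s′ k) (Sh-zero s s′ (λ r → ≈ᴹ-trans (Sh-*ₗ (ω a (hd r)) (c ∷ p) (d ∷ p′) (λ q → φ q r)) (zero-scale (ω a (hd r)) (Good.kills g r c p d p′))))
        neither : ∀ s s′ → Sh s s′ (k []) ≈ᴹ 0ᴹ
        neither s s′ = Sh-zero s s′ (λ r → zero-scale (ω a (hd r)) (Good.unit g r))

    D-shuffle : ∀ a u v {φ} → Good φ → Sh u v (λ w → D a w φ) ≈ᴹ D a u (λ p s → Sh s v (φ p)) +ᴹ D a v (λ p s → Sh u s (φ p))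
    D-shuffle a []      v       g = ≈ᴹ-sym (+ᴹ-identityˡ _)
    D-shuffle a (c ∷ u) []      {φ} g = ≈ᴹ-trans (D-cong a (c ∷ u) {φ} {λ p s → Sh s [] (φ p)} (λ p s → ≈ᴹ-sym (Sh-[] s (φ p)))) (≈ᴹ-sym (+ᴹ-identityʳ _))
    D-shuffle a (c ∷ u) (d ∷ v) {φ} g = begin
      Sh u dv (λ w → Head a (c ∷ w) φ +ᴹ D c w φᶜ) +ᴹ Sh cu v (λ w → Head a (d ∷ w) φ +ᴹ D d w φᵈ)
        ≈⟨ ≈ᴹ-trans (+ᴹ-cong (Sh-+ u dv _ _) (Sh-+ cu v _ _)) (interchange _ _ _ _) ⟩
      Sh cu dv (λ w → Head a w φ) +ᴹ (Sh u dv (λ w → D c w φᶜ) +ᴹ Sh cu v (λ w → D d w φᵈ))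
        ≈⟨ +ᴹ-congˡ (+ᴹ-cong (D-shuffle c u (d ∷ v) (Good-∷ c g)) (D-shuffle d (c ∷ u) v (Good-∷ d g))) ⟩
      Sh cu dv (λ w → Head a w φ) +ᴹ (x₁ +ᴹ (h₁ +ᴹ y₂) +ᴹ (h₂ +ᴹ x₂ +ᴹ y₁))
        ≈⟨ +ᴹ-congˡ (sort x₁ h₁ y₂ h₂ x₂ y₁) ⟩
      Sh cu dv (λ w → Head a w φ) +ᴹ (h₂ +ᴹ h₁ +ᴹ (x₁ +ᴹ x₂ +ᴹ (y₂ +ᴹ y₁)))
        ≈⟨ +ᴹ-assoc _ _ _ ⟨
      Sh cu dv (λ w → Head a w φ) +ᴹ (h₂ +ᴹ h₁) +ᴹ (x₁ +ᴹ x₂ +ᴹ (y₂ +ᴹ y₁))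
        ≈⟨ +ᴹ-cong (head-shuffle a c u d v g) (+ᴹ-cong (≈ᴹ-sym (D-+ c u _ _)) (≈ᴹ-sym (D-+ d v _ _))) ⟩
      Head a cu (λ p s → Sh s dv (φ p)) +ᴹ Head a dv (λ p s → Sh cu s (φ p)) +ᴹ
        (D c u (λ p s → Sh (c ∷ s) dv (φ p)) +ᴹ D d v (λ p s → Sh cu (d ∷ s) (φ p)))
        ≈⟨ interchange _ _ _ _ ⟩
      D a cu (λ p s → Sh s dv (φ p)) +ᴹ D a dv (λ p s → Sh cu s (φ p)) ∎
      where
      cu = c ∷ u
      dv = d ∷ v
      φᶜ φᵈ : Kernel
      φᶜ p s = φ p (c ∷ s)
      φᵈ p s = φ p (d ∷ s)
      x₁ = D c u (λ p s → Sh s dv (φᶜ p))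
      h₁ = Head c dv (λ p s → Sh u s (φᶜ p))
      y₂ = D d v (λ p s → Sh u (d ∷ s) (φᶜ p))
      h₂ = Head d cu (λ p s → Sh s v (φᵈ p))
      x₂ = D c u (λ p s → Sh (c ∷ s) v (φᵈ p))
      y₁ = D d v (λ p s → Sh cu s (φᵈ p))
      sort : ∀ x₁ h₁ y₂ h₂ x₂ y₁ → x₁ +ᴹ (h₁ +ᴹ y₂) +ᴹ (h₂ +ᴹ x₂ +ᴹ y₁) ≈ᴹ h₂ +ᴹ h₁ +ᴹ (x₁ +ᴹ x₂ +ᴹ (y₂ +ᴹ y₁))
      sort x₁ h₁ y₂ h₂ x₂ y₁ = begin
        x₁ +ᴹ (h₁ +ᴹ y₂) +ᴹ (h₂ +ᴹ x₂ +ᴹ y₁)        ≈⟨ +ᴹ-cong (≈ᴹ-trans (≈ᴹ-sym (+ᴹ-assoc _ _ _)) (+ᴹ-congʳ (+ᴹ-comm x₁ h₁))) ≈ᴹ-refl ⟩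
        h₁ +ᴹ x₁ +ᴹ y₂ +ᴹ (h₂ +ᴹ x₂ +ᴹ y₁)          ≈⟨ interchange _ _ _ _ ⟩
        h₁ +ᴹ x₁ +ᴹ (h₂ +ᴹ x₂) +ᴹ (y₂ +ᴹ y₁)        ≈⟨ +ᴹ-congʳ (interchange _ _ _ _) ⟩
        h₁ +ᴹ h₂ +ᴹ (x₁ +ᴹ x₂) +ᴹ (y₂ +ᴹ y₁)        ≈⟨ +ᴹ-assoc _ _ _ ⟩
        h₁ +ᴹ h₂ +ᴹ (x₁ +ᴹ x₂ +ᴹ (y₂ +ᴹ y₁))        ≈⟨ +ᴹ-congʳ (+ᴹ-comm h₁ h₂) ⟩
        h₂ +ᴹ h₁ +ᴹ (x₁ +ᴹ x₂ +ᴹ (y₂ +ᴹ y₁))        ∎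

module WeightParts where

  open Shuffles
  open Segments

  module Weight (V : ℚ-module) where
    open Coproduct V public

    select : {P : Set} → Dec P → Carrierᴹ → Carrierᴹ
    select (yes _) x = x
    select (no _)  x = 0ᴹ

    select-yes : {P : Set} (d : Dec P) → P → ∀ x → select d x ≈ᴹ x
    select-yes (yes _) _ x = ≈ᴹ-refl
    select-yes (no ¬p) p x = ⊥-elim (¬p p)

    select-no : {P : Set} (d : Dec P) → ¬ P → ∀ x → select d x ≈ᴹ 0ᴹ
    select-no (yes p) ¬p x = ⊥-elim (¬p p)
    select-no (no _)  _  x = ≈ᴹ-refl

    part : ℕ → Kernel → Kernel
    part t φ p s = select (length p ℕ.≟ t) (φ p s)

    record Graded (t : ℕ) (φ : Kernel) : Set where
      field
        kills   : ∀ s → KillsProducts (λ p → φ p s)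
        support : ∀ p s → length p ≢ t → φ p s ≈ᴹ 0ᴹ

    Graded-∷ : ∀ {t φ} e → Graded t φ → Graded t (λ p s → φ p (e ∷ s))
    Graded-∷ e g = record { kills = λ s → Graded.kills g (e ∷ s) ; support = λ p s → Graded.support g p (e ∷ s) }

    Graded-Sh : ∀ {t φ} v → Graded t φ → Graded t (λ p s → Sh s v (φ p))
    Graded-Sh {φ = φ} v g = record
      { kills   = λ s a u b w → ≈ᴹ-trans (Sh-swap (a ∷ u) (b ∷ w) s v φ) (Sh-zero s v (λ r → Graded.kills g r a u b w))
      ; support = λ p s ne → Sh-zero s v (λ r → Graded.support g p r ne)
      }

    Graded⇒Good : ∀ {t φ} → Graded (suc t) φ → Good φ
    Graded⇒Good g = record { kills = Graded.kills g ; unit = λ s → Graded.support g [] s (λ ()) }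

    part-Graded : ∀ t {φ} → (∀ s → KillsProducts (λ p → φ p s)) → Graded t (part t φ)
    part-Graded t {φ} kill = record { kills = kills ; support = λ p s ne → select-no (length p ℕ.≟ t) ne (φ p s) }
      where
      kills : ∀ s → KillsProducts (λ p → part t φ p s)
      kills s a u b v = go (length (a ∷ u) ℕ.+ length (b ∷ v) ℕ.≟ t)
        where
        go : Dec (length (a ∷ u) ℕ.+ length (b ∷ v) ≡ t) → Sh (a ∷ u) (b ∷ v) (λ p → part t φ p s) ≈ᴹ 0ᴹ
        go (yes e) = ≈ᴹ-trans (Sh-cong-length (a ∷ u) (b ∷ v) {λ p → part t φ p s} {λ p → φ p s} (λ w l → select-yes (length w ℕ.≟ t) (trans l e) (φ w s))) (kill s a u b v)
        go (no ne) = ≈ᴹ-trans (Sh-cong-length (a ∷ u) (b ∷ v) {λ p → part t φ p s} {λ _ → 0ᴹ} (λ w l → select-no (length w ℕ.≟ t) (λ e → ne (trans (sym l) e)) (φ w s))) (Sh-0 (a ∷ u) (b ∷ v))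

    pair-⊗w : ∀ L R (ψ : Word × Word → Carrierᴹ) → ⟪ L ⊗w R , ψ ⟫ ≈ᴹ ⟪ L , (λ p → ψ (p , R)) ⟫
    pair-⊗w L R ψ = pair-map _ ψ (λ p → ψ (p , R)) (λ q u → +ᴹ-identityʳ _) L

    Full-concatMap : ∀ {k : Poly × Word → Tensor} {ψ : Word × Word → Carrierᴹ} (φ : Kernel) → (∀ L R → ⟪ k (L , R) , ψ ⟫ ≈ᴹ ⟪ L , (λ p → φ p R) ⟫) →
      ∀ G → ⟪ concatMap k G , ψ ⟫ ≈ᴹ Full G φ
    Full-concatMap         φ e []            = ≈ᴹ-refl
    Full-concatMap {k} {ψ} φ e ((L , R) ∷ G) = ≈ᴹ-trans (pair-++ (k (L , R)) (concatMap k G) ψ) (+ᴹ-cong (e L R) (Full-concatMap φ e G))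

    weight-part : ℕ → Word → (Word × Word → Carrierᴹ) → Kernel
    weight-part r w ψ p s = select (length s ℕ.+ (2 ℕ.* r ℕ.+ 1) ℕ.≟ length w) (ψ (p , s))

    -- The type of Dword-summand is left to unification, since it mentions a function local to Dword.
    mutual
      Dword-Full : ∀ r w (ψ : Word × Word → Carrierᴹ) → ⟪ Dword r w , ψ ⟫ ≈ᴹ Full (gon w) (weight-part r w ψ)
      Dword-Full r w ψ = Full-concatMap (weight-part r w ψ) (Dword-summand r w ψ) (gon w)

      Dword-summand : ∀ r w (ψ : Word × Word → Carrierᴹ) L R → _
      Dword-summand r w ψ L R with length R ℕ.+ (2 ℕ.* r ℕ.+ 1) ℕ.≟ length w
      ... | yes _ = pair-⊗w L R ψ
      ... | no  _ = ≈ᴹ-sym (pair-zero′ L (λ _ → ≈ᴹ-refl))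

    Dword-D : ∀ r w (ψ : Word × Word → Carrierᴹ) → (∀ s → KillsProducts (λ p → ψ (p , s))) →
      ⟪ Dword r w , ψ ⟫ ≈ᴹ D x1 w (part (2 ℕ.* r ℕ.+ 1) (λ p s → ψ (p , s)))
    Dword-D r w ψ kill = ≈ᴹ-trans (Dword-Full r w ψ) (≈ᴹ-trans (gon-cong-length x1 [] w same) (gon-D x1 w good))
      where
      t = 2 ℕ.* r ℕ.+ 1
      same : ∀ p s → length p ℕ.+ length s ≡ length w → weight-part r w ψ p s ≈ᴹ part t (λ p s → ψ (p , s)) p s
      same p s l = go (length p ℕ.≟ t)
        where
        go : Dec (length p ≡ t) → weight-part r w ψ p s ≈ᴹ part t (λ p s → ψ (p , s)) p s
        go (yes e) = ≈ᴹ-trans (select-yes (length s ℕ.+ t ℕ.≟ length w) (trans (ℕP.+-comm (length s) t) (trans (cong (ℕ._+ length s) (sym e)) l)) (ψ (p , s))) (≈ᴹ-sym (select-yes (length p ℕ.≟ t) e (ψ (p , s))))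
        go (no ne) = ≈ᴹ-trans (select-no (length s ℕ.+ t ℕ.≟ length w) (λ e → ne (ℕP.+-cancelʳ-≡ (length s) (length p) t (trans l (trans (sym e) (ℕP.+-comm (length s) t))))) (ψ (p , s))) (≈ᴹ-sym (select-no (length p ℕ.≟ t) ne (ψ (p , s))))
      good : Good (part t (λ p s → ψ (p , s)))
      good = record { kills = Graded.kills (part-Graded t {λ p s → ψ (p , s)} kill) ; unit = λ s → select-no (0 ℕ.≟ t) (λ e → nonzero (2 ℕ.* r) e) (ψ ([] , s)) }
        where
        nonzero : ∀ n → ¬ (0 ≡ n ℕ.+ 1)
        nonzero zero    ()
        nonzero (suc n) ()

    Cut-pick : ∀ {t} p s {k : Kernel} → length p ≡ t → (∀ p s → length p ≢ t → k p s ≈ᴹ 0ᴹ) → Cut (p ++ s) k ≈ᴹ k p s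
    Cut-pick []      s refl z = ≈ᴹ-trans (Cut-split s _) (≈ᴹ-trans (+ᴹ-congˡ (Cut⁺-zero s (λ c p s → z (c ∷ p) s (λ ())))) (+ᴹ-identityʳ _))
    Cut-pick (e ∷ p) s refl z = ≈ᴹ-trans (+ᴹ-cong (z [] (e ∷ p ++ s) (λ ())) (Cut-pick p s refl (λ p s ne → z (e ∷ p) s (ne ∘ ℕP.suc-injective)))) (+ᴹ-identityˡ _)

    Cut-short : ∀ {t} w {k : Kernel} → length w ℕ.< t → (∀ p s → length p ≢ t → k p s ≈ᴹ 0ᴹ) → Cut w k ≈ᴹ 0ᴹ
    Cut-short {suc t} []      _        z = z [] [] (λ ())
    Cut-short {suc t} (e ∷ w) (s≤s lt) z = zero-sum (z [] (e ∷ w) (λ ())) (Cut-short w lt (λ p s ne → z (e ∷ p) s (ne ∘ ℕP.suc-injective)))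

    Head-pick : ∀ {t φ} a p s → Graded t φ → length p ≡ t → Head a (p ++ s) φ ≈ᴹ ω a (hd s) *ₗ φ p s
    Head-pick a p s g l = Cut-pick p s l (λ p s ne → zero-scale (ω a (hd s)) (Graded.support g p s ne))

    Head-short : ∀ {t φ} a w → Graded t φ → length w ℕ.< t → Head a w φ ≈ᴹ 0ᴹ
    Head-short a w g lt = Cut-short w lt (λ p s ne → zero-scale (ω a (hd s)) (Graded.support g p s ne))

    D-short : ∀ {t φ} a w → Graded t φ → length w ℕ.< t → D a w φ ≈ᴹ 0ᴹ
    D-short a []      g lt = ≈ᴹ-refl
    D-short a (e ∷ w) g lt = zero-sum (Head-short a (e ∷ w) g lt) (D-short e w (Graded-∷ e g) (ℕP.<-trans (ℕP.n<1+n (length w)) lt))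

module Coefficients where

  open Sums
  open DoubleSums
  open PartialFractions
  open Parity
  open Zagier

  row : ℕ → ℕ → ℚ
  row n i = ℕtoℚ (n choose i)

  row-suc : ∀ n i → row (suc n) (suc i) ≡ row n i + row n (suc i)
  row-suc n i = trans (cong ℕtoℚ (sym (nCk+nC[k+1]≡[n+1]C[k+1] n i))) (ℕtoℚ-+ (n choose i) (n choose suc i))

  row-sum : ∀ n → sum (suc n) (row n) ≡ powℚ (ℕtoℚ 2) n
  row-sum zero    = refl
  row-sum (suc n) = begin
    sum (suc (suc n)) (row (suc n))                                ≡⟨ sum-shift (suc n) (row (suc n)) ⟩
    1ℚ + sum (suc n) (row (suc n) ∘ suc)                           ≡⟨ cong (1ℚ +_) (trans (sum-cong (suc n) (row-suc n)) (sum-+ (suc n) (row n) (row n ∘ suc))) ⟩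
    1ℚ + (sum (suc n) (row n) + sum (suc n) (row n ∘ suc))         ≡⟨ regroup 1ℚ (sum (suc n) (row n)) _ ⟩
    sum (suc n) (row n) + (1ℚ + sum (suc n) (row n ∘ suc))         ≡⟨ cong (sum (suc n) (row n) +_) (sum-shift (suc n) (row n)) ⟨
    sum (suc n) (row n) + (sum (suc n) (row n) + row n (suc n))    ≡⟨ cong₂ (λ x y → x + (x + y)) (row-sum n) (cong ℕtoℚ (k>n⇒nCk≡0 (ℕP.n<1+n n))) ⟩
    powℚ (ℕtoℚ 2) n + (powℚ (ℕtoℚ 2) n + 0ℚ)                       ≡⟨ double (powℚ (ℕtoℚ 2) n) ⟩
    powℚ (ℕtoℚ 2) (suc n)                                          ∎
    where
    open ≡-Reasoning
    regroup : ∀ a b c → a + (b + c) ≡ b + (a + c)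
    regroup = solve-∀ ℚ-ring
    double : ∀ x → x + (x + 0ℚ) ≡ (1ℚ + 1ℚ) * x
    double = solve-∀ ℚ-ring

  sum-dbl : ∀ n f → sum (dbl n) f ≡ sum n (λ i → f (dbl i) + f (suc (dbl i)))
  sum-dbl zero    f = refl
  sum-dbl (suc n) f = trans (ℚP.+-assoc (sum (dbl n) f) _ _) (cong (_+ (f (dbl n) + f (suc (dbl n)))) (sum-dbl n f))

  ν : ℕ → ℚ
  ν r = 1ℚ - powℚ ½ (dbl r)

  even odd : ℕ → ℕ → ℚ
  even r b = row (dbl r) (dbl (suc b))
  odd  r a = row (dbl r) (suc (dbl a))

  coefficient-row : ∀ a b r → coefficient a b r ≡ ℕtoℚ 2 * sgn r * (even r b - ν r * odd r a)
  coefficient-row = coefficient-dbl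

  odd-sum : ∀ r → sum (suc r) (odd (suc r)) ≡ powℚ (ℕtoℚ 2) (suc (dbl r))
  odd-sum r = trans (sum-cong (suc r) (λ i → row-suc (suc (dbl r)) (dbl i))) (trans (sym (sum-dbl (suc r) (row (suc (dbl r))))) (row-sum (suc (dbl r))))

  even-sum : ∀ r → sum (suc r) (even (suc r)) ≡ powℚ (ℕtoℚ 2) (suc (dbl r)) - 1ℚ
  even-sum r = begin
    sum (suc r) (even (suc r))                              ≡⟨ trans (sum-cong (suc r) (λ i → row-suc (suc (dbl r)) (suc (dbl i)))) (sym (sum-dbl (suc r) (R ∘ suc))) ⟩
    sum (dbl (suc r)) (R ∘ suc)                             ≡⟨ regroup 1ℚ (sum (dbl (suc r)) (R ∘ suc)) ⟩
    1ℚ + sum (dbl (suc r)) (R ∘ suc) - 1ℚ                   ≡⟨ cong (_- 1ℚ) (sum-shift (dbl (suc r)) R) ⟨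
    sum (dbl (suc r)) R + R (dbl (suc r)) - 1ℚ              ≡⟨ cong₂ (λ x y → x + y - 1ℚ) (row-sum (suc (dbl r))) (cong ℕtoℚ (k>n⇒nCk≡0 (ℕP.n<1+n (suc (dbl r))))) ⟩
    powℚ (ℕtoℚ 2) (suc (dbl r)) + 0ℚ - 1ℚ                   ≡⟨ cong (_- 1ℚ) (ℚP.+-identityʳ (powℚ (ℕtoℚ 2) (suc (dbl r)))) ⟩
    powℚ (ℕtoℚ 2) (suc (dbl r)) - 1ℚ                        ∎
    where
    open ≡-Reasoning
    R = row (suc (dbl r))
    regroup : ∀ a b → b ≡ a + b - a
    regroup = solve-∀ ℚ-ring

  coefficient-sum : ∀ r → sum (suc r) (λ a → coefficient a (r ℕ.∸ a) (suc r)) ≡ - sgn (suc r)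
  coefficient-sum r = begin
    sum (suc r) (λ a → coefficient a (r ℕ.∸ a) (suc r))
      ≡⟨ sum-cong (suc r) (λ a → coefficient-row a (r ℕ.∸ a) (suc r)) ⟩
    sum (suc r) (λ a → σ * (even (suc r) (r ℕ.∸ a) - ν (suc r) * odd (suc r) a))
      ≡⟨ trans (sum-*ˡ (suc r) σ _) (cong (σ *_) (trans (sum-- (suc r) _ _) (cong₂ _-_ (sum-reverse (suc r) (even (suc r))) (sum-*ˡ (suc r) (ν (suc r)) (odd (suc r)))))) ⟩
    σ * (sum (suc r) (even (suc r)) - ν (suc r) * sum (suc r) (odd (suc r)))
      ≡⟨ cong₂ (λ x y → σ * (x - ν (suc r) * y)) (even-sum r) (odd-sum r) ⟩
    σ * (P - 1ℚ - ν (suc r) * P)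
      ≡⟨ regroup (ℕtoℚ 2) (sgn (suc r)) ½ (powℚ ½ (suc (dbl r))) P ⟩
    ℕtoℚ 2 * sgn (suc r) * (½ * (powℚ ½ (suc (dbl r)) * P) - 1ℚ)
      ≡⟨ cong (λ z → ℕtoℚ 2 * sgn (suc r) * (½ * z - 1ℚ)) (trans (sym (powℚ-* ½ (ℕtoℚ 2) (suc (dbl r)))) (powℚ-1 (suc (dbl r)))) ⟩
    ℕtoℚ 2 * sgn (suc r) * (½ * 1ℚ - 1ℚ)
      ≡⟨ regroup′ (ℕtoℚ 2) (sgn (suc r)) (½ * 1ℚ - 1ℚ) ⟩
    ℕtoℚ 2 * (½ * 1ℚ - 1ℚ) * sgn (suc r)
      ≡⟨ ℚP.neg-distribˡ-* 1ℚ (sgn (suc r)) ⟨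
    - (1ℚ * sgn (suc r))
      ≡⟨ cong -_ (ℚP.*-identityˡ (sgn (suc r))) ⟩
    - sgn (suc r) ∎
    where
    open ≡-Reasoning
    σ = ℕtoℚ 2 * sgn (suc r)
    P = powℚ (ℕtoℚ 2) (suc (dbl r))
    regroup : ∀ t s f x P → t * s * (P - 1ℚ - (1ℚ - f * x) * P) ≡ t * s * (f * (x * P) - 1ℚ)
    regroup = solve-∀ ℚ-ring
    regroup′ : ∀ t s x → t * s * x ≡ t * x * s
    regroup′ = solve-∀ ℚ-ring

  row-0 : ∀ {n k} → n ℕ.< k → row n k ≡ 0ℚ
  row-0 lt = cong ℕtoℚ (k>n⇒nCk≡0 lt)

  row-sym : ∀ {n} k l → k ℕ.+ l ≡ n → row n k ≡ row n l
  row-sym k l refl = cong ℕtoℚ (C-sym k l)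

  odd-0 : ∀ {r a} → r ℕ.≤ a → odd r a ≡ 0ℚ
  odd-0 le = row-0 (s≤s (dbl-mono le))

  even-0 : ∀ {r b} → r ℕ.≤ b → even r b ≡ 0ℚ
  even-0 le = row-0 (ℕP.≤-trans (s≤s (dbl-mono le)) (ℕP.n≤1+n _))

  even-1 : ∀ r → even (suc r) r ≡ 1ℚ
  even-1 r = cong ℕtoℚ (nCn≡1 (dbl (suc r)))

  even-sym : ∀ a b → even (suc (suc (a ℕ.+ b))) a ≡ even (suc (suc (a ℕ.+ b))) b
  even-sym a b = row-sym (dbl (suc a)) (dbl (suc b)) (trans (dbl-+ (suc a) (suc b)) (cong (dbl ∘ suc) (ℕP.+-suc a b)))

  odd-sym : ∀ a b → odd (suc (a ℕ.+ b)) a ≡ odd (suc (a ℕ.+ b)) b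
  odd-sym a b = row-sym (suc (dbl a)) (suc (dbl b)) (cong suc (trans (ℕP.+-suc (dbl a) (dbl b)) (cong suc (dbl-+ a b))))

  private
    base-identity : ∀ σ n o → σ * (0ℚ - n * o) ≡ σ * (1ℚ - n * o) - σ
    base-identity = solve-∀ ℚ-ring
    middle-identity : ∀ σ n g o → σ * (g - n * 0ℚ) ≡ σ * (g - n * o) + (σ - σ * (1ℚ - n * o))
    middle-identity = solve-∀ ℚ-ring
    late-identity : ∀ σ n g o e o′ → σ * (g - n * o′) ≡ σ * (g - n * o) + (σ * (e - n * o′) - σ * (e - n * o))
    late-identity = solve-∀ ℚ-ring

  coefficient-base : ∀ r j → coefficient 0 (r ℕ.+ suc j) (suc r) ≡ coefficient 0 r (suc r) - ℕtoℚ 2 * sgn (suc r)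
  coefficient-base r j = begin
    coefficient 0 (r ℕ.+ suc j) (suc r)                              ≡⟨ coefficient-row 0 (r ℕ.+ suc j) (suc r) ⟩
    σ * (even (suc r) (r ℕ.+ suc j) - ν (suc r) * odd (suc r) 0)     ≡⟨ cong (λ z → σ * (z - ν (suc r) * odd (suc r) 0)) (even-0 {suc r} {r ℕ.+ suc j} (ℕP.≤-trans (s≤s (ℕP.m≤m+n r j)) (ℕP.≤-reflexive (sym (ℕP.+-suc r j))))) ⟩
    σ * (0ℚ - ν (suc r) * odd (suc r) 0)                             ≡⟨ base-identity σ (ν (suc r)) (odd (suc r) 0) ⟩
    σ * (1ℚ - ν (suc r) * odd (suc r) 0) - σ                         ≡⟨ cong (λ z → σ * (z - ν (suc r) * odd (suc r) 0) - σ) (even-1 r) ⟨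
    σ * (even (suc r) r - ν (suc r) * odd (suc r) 0) - σ             ≡⟨ cong (_- σ) (coefficient-row 0 r (suc r)) ⟨
    coefficient 0 r (suc r) - σ                                      ∎
    where
    open ≡-Reasoning
    σ = ℕtoℚ 2 * sgn (suc r)

  coefficient-early : ∀ a b {r} → r ℕ.≤ a → coefficient (suc a) b r ≡ coefficient a b r
  coefficient-early a b {r} le = trans (coefficient-row (suc a) b r)
    (trans (cong (λ z → ℕtoℚ 2 * sgn r * (even r b - ν r * z)) (trans (odd-0 {r} {suc a} (ℕP.m≤n⇒m≤1+n le)) (sym (odd-0 {r} {a} le)))) (sym (coefficient-row a b r)))

  coefficient-middle : ∀ a b → coefficient (suc a) b (suc a) ≡ coefficient a b (suc a) + (ℕtoℚ 2 * sgn (suc a) - coefficient 0 a (suc a))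
  coefficient-middle a b = begin
    coefficient (suc a) b r                                  ≡⟨ coefficient-row (suc a) b r ⟩
    σ * (even r b - ν r * odd r (suc a))                     ≡⟨ cong (λ z → σ * (even r b - ν r * z)) (odd-0 {r} {r} ℕP.≤-refl) ⟩
    σ * (even r b - ν r * 0ℚ)                                ≡⟨ middle-identity σ (ν r) (even r b) (odd r a) ⟩
    σ * (even r b - ν r * odd r a) + (σ - σ * (1ℚ - ν r * odd r a))
      ≡⟨ cong₂ (λ x y → σ * (even r b - ν r * odd r a) + (σ - σ * (x - ν r * y))) (sym (even-1 a)) (sym (odd-sym 0 a)) ⟩
    σ * (even r b - ν r * odd r a) + (σ - σ * (even r a - ν r * odd r 0))
      ≡⟨ cong₂ (λ x y → x + (σ - y)) (coefficient-row a b r) (coefficient-row 0 a r) ⟨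
    coefficient a b r + (σ - coefficient 0 a r)              ∎
    where
    open ≡-Reasoning
    r = suc a
    σ = ℕtoℚ 2 * sgn r

  coefficient-late : ∀ a b d → let r = suc (suc (a ℕ.+ d)) in
    coefficient (suc a) b r ≡ coefficient a b r + (coefficient (suc a) d r - coefficient (suc d) a r)
  coefficient-late a b d = begin
    coefficient (suc a) b r                                  ≡⟨ coefficient-row (suc a) b r ⟩
    σ * (even r b - ν r * odd r (suc a))                     ≡⟨ late-identity σ (ν r) (even r b) (odd r a) (even r d) (odd r (suc a)) ⟩
    σ * (even r b - ν r * odd r a) + (σ * (even r d - ν r * odd r (suc a)) - σ * (even r d - ν r * odd r a))
      ≡⟨ cong₂ (λ x y → σ * (even r b - ν r * odd r a) + (σ * (even r d - ν r * odd r (suc a)) - σ * (x - ν r * y))) (sym (even-sym a d)) odd-a ⟩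
    σ * (even r b - ν r * odd r a) + (σ * (even r d - ν r * odd r (suc a)) - σ * (even r a - ν r * odd r (suc d)))
      ≡⟨ cong₂ _+_ (sym (coefficient-row a b r)) (cong₂ _-_ (sym (coefficient-row (suc a) d r)) (sym (coefficient-row (suc d) a r))) ⟩
    coefficient a b r + (coefficient (suc a) d r - coefficient (suc d) a r) ∎
    where
    open ≡-Reasoning
    r = suc (suc (a ℕ.+ d))
    σ = ℕtoℚ 2 * sgn r
    odd-a : odd r a ≡ odd r (suc d)
    odd-a = subst (λ z → odd (suc z) a ≡ odd (suc z) (suc d)) (ℕP.+-suc a d) (odd-sym a (suc d))

module Coaction where

  open Sums
  open Shuffles
  open WeightParts
  open DoubleSums
  open Coefficients

  -- The words of ζ({2}^k), ζ({2}^a,3,{2}^b) and ζ(2r+1)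
  Tw : ℕ → Word
  Tw k = ι (replicate k 2)

  Hw : ℕ → ℕ → Word
  Hw a b = ι (H a b)

  Zw : ℕ → Word
  Zw r = ι [ suc (dbl r) ]

  Tw-+ : ∀ i j → Tw (i ℕ.+ j) ≡ Tw i ++ Tw j
  Tw-+ zero    j = refl
  Tw-+ (suc i) j = cong (λ w → x0 ∷ x1 ∷ w) (Tw-+ i j)

  Tw-∷ʳ : ∀ i w → Tw i ++ x0 ∷ w ≡ (Tw i ∷ʳ x0) ++ w
  Tw-∷ʳ i w = sym (LP.++-assoc (Tw i) [ x0 ] w)

  Hw-Tw : ∀ a b → Hw a b ≡ Tw a ++ x0 ∷ x0 ∷ x1 ∷ Tw b
  Hw-Tw zero    b = refl
  Hw-Tw (suc a) b = cong (λ w → x0 ∷ x1 ∷ w) (Hw-Tw a b)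

  Hw-+ : ∀ a b j → Hw a (b ℕ.+ j) ≡ Hw a b ++ Tw j
  Hw-+ zero    b j = cong (λ w → x0 ∷ x0 ∷ x1 ∷ w) (Tw-+ b j)
  Hw-+ (suc a) b j = cong (λ w → x0 ∷ x1 ∷ w) (Hw-+ a b j)

  Hw-shift : ∀ i a b → Hw (i ℕ.+ a) b ≡ Tw i ++ Hw a b
  Hw-shift zero    a b = refl
  Hw-shift (suc i) a b = cong (λ w → x0 ∷ x1 ∷ w) (Hw-shift i a b)

  length-Tw : ∀ k → length (Tw k) ≡ dbl k
  length-Tw zero    = refl
  length-Tw (suc k) = cong (suc ∘ suc) (length-Tw k)

  length-Hw : ∀ a b → length (Hw a b) ≡ suc (dbl (suc (a ℕ.+ b)))
  length-Hw zero    b = cong (suc ∘ suc ∘ suc) (length-Tw b)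
  length-Hw (suc a) b = cong (suc ∘ suc) (length-Hw a b)

  length-x0s : ∀ n w → length (replicate n x0 ++ w) ≡ n ℕ.+ length w
  length-x0s zero    w = refl
  length-x0s (suc n) w = cong suc (length-x0s n w)

  length-Zw : ∀ r → length (Zw r) ≡ suc (dbl r)
  length-Zw r = trans (length-x0s (dbl r) [ x1 ]) (ℕP.+-comm (dbl r) 1)

  Rw : ℕ → Word
  Rw zero    = []
  Rw (suc n) = x1 ∷ x0 ∷ Rw n

  Gw : ℕ → ℕ → Word
  Gw a b = Tw a ++ x0 ∷ x0 ∷ Rw b

  Rw-∷ʳ : ∀ n → Rw n ∷ʳ x1 ≡ x1 ∷ Tw n
  Rw-∷ʳ zero    = refl
  Rw-∷ʳ (suc n) = cong (λ w → x1 ∷ x0 ∷ w) (Rw-∷ʳ n)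

  reverse-Rw : ∀ n → reverse (Rw n) ≡ Tw n
  reverse-Rw zero    = refl
  reverse-Rw (suc n) = begin
    reverse ((x1 ∷ x0 ∷ []) ++ Rw n)     ≡⟨ LP.reverse-++ (x1 ∷ x0 ∷ []) (Rw n) ⟩
    reverse (Rw n) ++ Tw 1               ≡⟨ cong (_++ Tw 1) (reverse-Rw n) ⟩
    Tw n ++ Tw 1                         ≡⟨ Tw-+ n 1 ⟨
    Tw (n ℕ.+ 1)                         ≡⟨ cong Tw (ℕP.+-comm n 1) ⟩
    Tw (suc n)                           ∎
    where open ≡-Reasoning

  Gw-∷ʳ : ∀ a b → Hw a b ≡ Gw a b ∷ʳ x1
  Gw-∷ʳ a b = trans (Hw-Tw a b) (trans (cong (λ w → Tw a ++ x0 ∷ x0 ∷ w) (sym (Rw-∷ʳ b))) (sym (LP.++-assoc (Tw a) (x0 ∷ x0 ∷ Rw b) [ x1 ])))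

  length-Gw : ∀ a b → length (Gw a b) ≡ dbl (suc (a ℕ.+ b))
  length-Gw a b = ℕP.suc-injective (trans (sym (trans (LP.length-++ (Gw a b)) (ℕP.+-comm (length (Gw a b)) 1))) (trans (cong length (sym (Gw-∷ʳ a b))) (length-Hw a b)))

  reverse-Gw : ∀ a b → reverse (x1 ∷ Gw a b) ≡ Hw b a
  reverse-Gw a b = begin
    reverse ((x1 ∷ Tw a) ++ (x0 ∷ x0 ∷ Rw b))                        ≡⟨ LP.reverse-++ (x1 ∷ Tw a) (x0 ∷ x0 ∷ Rw b) ⟩
    reverse ((x0 ∷ x0 ∷ []) ++ Rw b) ++ reverse (x1 ∷ Tw a)          ≡⟨ cong₂ _++_ (LP.reverse-++ (x0 ∷ x0 ∷ []) (Rw b)) (cong reverse (sym (Rw-∷ʳ a))) ⟩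
    (reverse (Rw b) ++ x0 ∷ x0 ∷ []) ++ reverse (Rw a ∷ʳ x1)         ≡⟨ cong₂ (λ u v → (u ++ x0 ∷ x0 ∷ []) ++ v) (reverse-Rw b) (trans (LP.reverse-++ (Rw a) [ x1 ]) (cong (x1 ∷_) (reverse-Rw a))) ⟩
    (Tw b ++ x0 ∷ x0 ∷ []) ++ x1 ∷ Tw a                              ≡⟨ LP.++-assoc (Tw b) (x0 ∷ x0 ∷ []) (x1 ∷ Tw a) ⟩
    Tw b ++ x0 ∷ x0 ∷ x1 ∷ Tw a                                      ≡⟨ Hw-Tw b a ⟨
    Hw b a                                                           ∎
    where open ≡-Reasoning

  data Alternating : X → Word → Set where
    end  : Alternating x1 []
    alt0 : ∀ {w} → Alternating x0 w → Alternating x1 (x0 ∷ w)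
    alt1 : ∀ {w} → Alternating x1 w → Alternating x0 (x1 ∷ w)

  Tw-alternating : ∀ k → Alternating x1 (Tw k)
  Tw-alternating zero    = end
  Tw-alternating (suc k) = alt0 (alt1 (Tw-alternating k))

  module Windows (V : ℚ-module) where
    open Weight V public

    alternating-hd : ∀ r {a} p s → Alternating a (p ++ s) → length p ≡ suc (dbl r) → hd s ≡ a
    alternating-hd zero    (_ ∷ []) _ (alt0 (alt1 _)) _ = refl
    alternating-hd zero    (_ ∷ []) _ (alt1 end)      _ = refl
    alternating-hd zero    (_ ∷ []) _ (alt1 (alt0 _)) _ = refl
    alternating-hd (suc r) (_ ∷ _ ∷ p) s (alt0 (alt1 w)) l = alternating-hd r p s w (ℕP.suc-injective (ℕP.suc-injective l))
    alternating-hd (suc r) (_ ∷ _ ∷ p) s (alt1 (alt0 w)) l = alternating-hd r p s w (ℕP.suc-injective (ℕP.suc-injective l))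

    ω-same : ∀ {a b} → b ≡ a → ω a b ≡ 0ℚ
    ω-same {x0} refl = refl
    ω-same {x1} refl = refl

    Cut-zero-split : ∀ w {k} → (∀ p s → p ++ s ≡ w → k p s ≈ᴹ 0ᴹ) → Cut w k ≈ᴹ 0ᴹ
    Cut-zero-split []      z = z [] [] refl
    Cut-zero-split (e ∷ w) z = zero-sum (z [] (e ∷ w) refl) (Cut-zero-split w (λ p s eq → z (e ∷ p) s (cong (e ∷_) eq)))

    D-alternating : ∀ {r φ} a w → Alternating a w → Graded (suc (dbl r)) φ → D a w φ ≈ᴹ 0ᴹ
    D-alternating         a []      _  g = ≈ᴹ-refl
    D-alternating {r} {φ} a (e ∷ w) al g = zero-sum (Cut-zero-split (e ∷ w) vanish) (D-alternating {r} e w (rest al) (Graded-∷ e g))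
      where
      rest : ∀ {a e w} → Alternating a (e ∷ w) → Alternating e w
      rest (alt0 w) = w
      rest (alt1 w) = w
      vanish : ∀ p s → p ++ s ≡ e ∷ w → ω a (hd s) *ₗ φ p s ≈ᴹ 0ᴹ
      vanish p s eq = go (length p ℕ.≟ suc (dbl r))
        where
        go : Dec (length p ≡ suc (dbl r)) → ω a (hd s) *ₗ φ p s ≈ᴹ 0ᴹ
        go (yes l) = *ₗ-zeroˡ′ (ω-same {a} (alternating-hd r p s (subst (Alternating a) (sym eq) al) l)) (φ p s)
        go (no ne) = zero-scale (ω a (hd s)) (Graded.support g p s ne)

    insert-x0 : ∀ k (χ : Word → Carrierᴹ) (f : ℕ → ℚ) z → (∀ α → α ℕ.< k → χ (Hw α (k ℕ.∸ suc α)) ≈ᴹ f α *ₗ z) →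
      Sh [ x0 ] (Tw k) χ ≈ᴹ χ (Tw k ∷ʳ x0) +ᴹ (sum k f + sum k f) *ₗ z
    insert-x0 zero    χ f z e = ≈ᴹ-sym (≈ᴹ-trans (+ᴹ-congˡ (*ₗ-zeroˡ z)) (+ᴹ-identityʳ _))
    insert-x0 (suc k) χ f z e = begin
      χ (Hw 0 k) +ᴹ (χ (Hw 0 k) +ᴹ Sh [ x0 ] (Tw k) χ′)
        ≈⟨ +ᴹ-cong (e 0 (s≤s z≤n)) (+ᴹ-cong (e 0 (s≤s z≤n)) (insert-x0 k χ′ (f ∘ suc) z (λ α lt → e (suc α) (s≤s lt)))) ⟩
      f 0 *ₗ z +ᴹ (f 0 *ₗ z +ᴹ (χ (Tw (suc k) ∷ʳ x0) +ᴹ (Σf + Σf) *ₗ z))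
        ≈⟨ +ᴹ-assoc _ _ _ ⟨
      f 0 *ₗ z +ᴹ f 0 *ₗ z +ᴹ (χ (Tw (suc k) ∷ʳ x0) +ᴹ (Σf + Σf) *ₗ z)
        ≈⟨ ≈ᴹ-trans (≈ᴹ-sym (+ᴹ-assoc _ _ _)) (≈ᴹ-trans (+ᴹ-congʳ (+ᴹ-comm _ _)) (+ᴹ-assoc _ _ _)) ⟩
      χ (Tw (suc k) ∷ʳ x0) +ᴹ (f 0 *ₗ z +ᴹ f 0 *ₗ z +ᴹ (Σf + Σf) *ₗ z)
        ≈⟨ +ᴹ-congˡ (≈ᴹ-trans (+ᴹ-congʳ (≈ᴹ-sym (*ₗ-distribʳ z _ _))) (≈ᴹ-sym (*ₗ-distribʳ z _ _))) ⟩
      χ (Tw (suc k) ∷ʳ x0) +ᴹ (f 0 + f 0 + (Σf + Σf)) *ₗ z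
        ≈⟨ +ᴹ-congˡ (*ₗ-congʳ (trans (regroup (f 0) Σf) (cong₂ _+_ (sym (sum-shift k f)) (sym (sum-shift k f))))) ⟩
      χ (Tw (suc k) ∷ʳ x0) +ᴹ (sum (suc k) f + sum (suc k) f) *ₗ z ∎
      where
      χ′ = λ w → χ (x0 ∷ x1 ∷ w)
      Σf = sum k (f ∘ suc)
      regroup : ∀ a b → a + a + (b + b) ≡ (a + b) + (a + b)
      regroup = solve-∀ ℚ-ring

    -- The field known is the theorem in weight 2r+1 modulo products.
    record Reducible (r : ℕ) (φ : Kernel) : Set where
      field
        graded : Graded (suc (dbl r)) φ
        known  : ∀ a b s → suc (a ℕ.+ b) ≡ r → φ (Hw a b) s ≈ᴹ coefficient a b r *ₗ φ (Zw r) s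

    open Reducible

    Reducible-∷ : ∀ {r φ} e → Reducible r φ → Reducible r (λ p s → φ p (e ∷ s))
    Reducible-∷ e l = record { graded = Graded-∷ e (graded l) ; known = λ a b s → known l a b (e ∷ s) }

    cancel : ∀ {x y q p} → x +ᴹ q *ₗ y ≈ᴹ 0ᴹ → p ≡ - q → x ≈ᴹ p *ₗ y
    cancel {x} {y} {q} {p} e refl = difference-zero (≈ᴹ-trans (+ᴹ-congˡ (≈ᴹ-trans (≈ᴹ-sym (*ₗ-assoc (- 1ℚ) (- q) y)) (*ₗ-congʳ (double-neg q)))) e)
      where
      double-neg : ∀ q → - 1ℚ * - q ≡ q
      double-neg = solve-∀ ℚ-ring

    Reducible-insert : ∀ {r φ} s → Reducible (suc r) φ → φ (Tw (suc r) ∷ʳ x0) s ≈ᴹ (ℕtoℚ 2 * sgn (suc r)) *ₗ φ (Zw (suc r)) s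
    Reducible-insert {r} {φ} s l = cancel
      (≈ᴹ-trans (≈ᴹ-sym (insert-x0 (suc r) (λ p → φ p s) (λ a → coefficient a (r ℕ.∸ a) (suc r)) (φ (Zw (suc r)) s) value)) (Graded.kills (graded l) s x0 [] x0 (x1 ∷ Tw r)))
      (trans (regroup (sgn (suc r))) (cong (λ z → - (z + z)) (sym (coefficient-sum r))))
      where
      value : ∀ α → α ℕ.< suc r → φ (Hw α (r ℕ.∸ α)) s ≈ᴹ coefficient α (r ℕ.∸ α) (suc r) *ₗ φ (Zw (suc r)) s
      value α (s≤s α≤r) = known l α (r ℕ.∸ α) s (cong suc (ℕP.m+[n∸m]≡n α≤r))
      regroup : ∀ s → (1ℚ + 1ℚ) * s ≡ - (- s + - s)
      regroup = solve-∀ ℚ-ring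

    Reducible-antipode : ∀ {r φ} a b s → Reducible r φ → suc (b ℕ.+ a) ≡ r → φ (x1 ∷ Gw a b) s ≈ᴹ coefficient b a r *ₗ φ (Zw r) s
    Reducible-antipode {r} {φ} a b s l e = begin
      φ (x1 ∷ Gw a b) s                                             ≈⟨ antipode {λ p → φ p s} (Graded.kills (graded l) s) x1 (Gw a b) ⟩
      sgn (length (Gw a b)) *ₗ φ (reverse (x1 ∷ Gw a b)) s          ≈⟨ *ₗ-cong (trans (cong sgn (length-Gw a b)) (sgn-dbl (suc (a ℕ.+ b)))) (≈ᴹ-reflexive (cong (λ w → φ w s) (reverse-Gw a b))) ⟩
      1ℚ *ₗ φ (Hw b a) s                                            ≈⟨ *ₗ-identityˡ _ ⟩
      φ (Hw b a) s                                                  ≈⟨ known l b a s e ⟩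
      coefficient b a r *ₗ φ (Zw r) s                               ∎

    Head-at : ∀ {t φ} a w p s → w ≡ p ++ s → Graded t φ → length p ≡ t → Head a w φ ≈ᴹ ω a (hd s) *ₗ φ p s
    Head-at {φ = φ} a w p s refl g l = Head-pick {φ = φ} a p s g l

    hd-Tw : ∀ k → hd (Tw k) ≡ x0
    hd-Tw zero    = refl
    hd-Tw (suc k) = refl

    hd-Hw : ∀ a b → hd (Hw a b) ≡ x0
    hd-Hw zero    b = refl
    hd-Hw (suc a) b = refl

    Head-first : ∀ {r φ} a b j → Reducible r φ → suc (a ℕ.+ b) ≡ r → Head x1 (Hw a (b ℕ.+ j)) φ ≈ᴹ coefficient a b r *ₗ φ (Zw r) (Tw j)
    Head-first {r} {φ} a b j l e = begin
      Head x1 (Hw a (b ℕ.+ j)) φ               ≈⟨ Head-at {φ = φ} x1 (Hw a (b ℕ.+ j)) (Hw a b) (Tw j) (Hw-+ a b j) (graded l) (trans (length-Hw a b) (cong (suc ∘ dbl) e)) ⟩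
      ω x1 (hd (Tw j)) *ₗ φ (Hw a b) (Tw j)    ≈⟨ ≈ᴹ-trans (*ₗ-congʳ (cong (ω x1) (hd-Tw j))) (*ₗ-identityˡ _) ⟩
      φ (Hw a b) (Tw j)                        ≈⟨ known l a b (Tw j) e ⟩
      coefficient a b r *ₗ φ (Zw r) (Tw j)     ∎

    length-Tw-∷ʳ : ∀ r → length (Tw r ∷ʳ x0) ≡ suc (dbl r)
    length-Tw-∷ʳ r = trans (LP.length-++ (Tw r)) (trans (ℕP.+-comm (length (Tw r)) 1) (cong suc (length-Tw r)))

    -- The contributing segment is x1 ∷ Gw a b, whose reversal is Hw b a.
    Head-second : ∀ {r φ} a b j → Reducible r φ → suc (a ℕ.+ b) ≡ r →
      Head x0 (x1 ∷ Hw a (b ℕ.+ j)) (λ p s → φ p (x0 ∷ s)) ≈ᴹ (- coefficient b a r) *ₗ φ (Zw r) (Tw (suc j))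
    Head-second {r} {φ} a b j l e = begin
      Head x0 (x1 ∷ Hw a (b ℕ.+ j)) (λ p s → φ p (x0 ∷ s))
        ≈⟨ Head-at {φ = λ p s → φ p (x0 ∷ s)} x0 (x1 ∷ Hw a (b ℕ.+ j)) (x1 ∷ Gw a b) (x1 ∷ Tw j) split (Graded-∷ x0 (graded l)) (cong suc (trans (length-Gw a b) (cong dbl e))) ⟩
      (0ℚ - 1ℚ) *ₗ φ (x1 ∷ Gw a b) (Tw (suc j))
        ≈⟨ *ₗ-congˡ (Reducible-antipode a b (Tw (suc j)) l (trans (cong suc (ℕP.+-comm b a)) e)) ⟩
      (0ℚ - 1ℚ) *ₗ (coefficient b a r *ₗ φ (Zw r) (Tw (suc j)))
        ≈⟨ *ₗ-assoc _ _ _ ⟨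
      ((0ℚ - 1ℚ) * coefficient b a r) *ₗ φ (Zw r) (Tw (suc j))
        ≈⟨ *ₗ-congʳ (negate (coefficient b a r)) ⟩
      (- coefficient b a r) *ₗ φ (Zw r) (Tw (suc j)) ∎
      where
      split : x1 ∷ Hw a (b ℕ.+ j) ≡ (x1 ∷ Gw a b) ++ x1 ∷ Tw j
      split = cong (x1 ∷_) (trans (Hw-+ a b j) (trans (cong (_++ Tw j) (Gw-∷ʳ a b)) (LP.++-assoc (Gw a b) [ x1 ] (Tw j))))
      negate : ∀ x → (0ℚ - 1ℚ) * x ≡ - x
      negate = solve-∀ ℚ-ring

    D-Hw : ∀ r a b j {φ} → Reducible (suc r) φ → a ℕ.+ b ≡ r ℕ.+ j →
      D x1 (Hw a b) φ ≈ᴹ coefficient a b (suc r) *ₗ φ (Zw (suc r)) (Tw j)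
    D-Hw r zero .(r ℕ.+ j) j {φ} l refl = begin
      Head x1 (Hw 0 (r ℕ.+ j)) φ +ᴹ (Head x0 (Tw (suc r ℕ.+ j)) φ₁ +ᴹ D x0 (x1 ∷ Tw (r ℕ.+ j)) φ₂)
        ≈⟨ +ᴹ-cong (Head-first 0 r j l refl) (≈ᴹ-trans (+ᴹ-congˡ (D-alternating {suc r} x0 (x1 ∷ Tw (r ℕ.+ j)) (alt1 (Tw-alternating (r ℕ.+ j))) (Graded-∷ x0 (Graded-∷ x0 (graded l))))) (+ᴹ-identityʳ _)) ⟩
      coefficient 0 r (suc r) *ₗ φ (Zw (suc r)) (Tw j) +ᴹ Head x0 (Tw (suc r ℕ.+ j)) φ₁
        ≈⟨ second j ⟩
      coefficient 0 (r ℕ.+ j) (suc r) *ₗ φ (Zw (suc r)) (Tw j) ∎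
      where
      φ₁ φ₂ : Kernel
      φ₁ p s = φ p (x0 ∷ s)
      φ₂ p s = φ p (x0 ∷ x0 ∷ s)
      second : ∀ j → coefficient 0 r (suc r) *ₗ φ (Zw (suc r)) (Tw j) +ᴹ Head x0 (Tw (suc r ℕ.+ j)) φ₁ ≈ᴹ coefficient 0 (r ℕ.+ j) (suc r) *ₗ φ (Zw (suc r)) (Tw j)
      second zero    = ≈ᴹ-trans (+ᴹ-congˡ (Head-short {φ = φ₁} x0 (Tw (suc r ℕ.+ 0)) (Graded-∷ x0 (graded l)) (s≤s (ℕP.≤-reflexive (trans (length-Tw (suc r ℕ.+ 0)) (cong dbl (ℕP.+-identityʳ (suc r))))))))
        (≈ᴹ-trans (+ᴹ-identityʳ _) (*ₗ-congʳ (cong (λ b → coefficient 0 b (suc r)) (sym (ℕP.+-identityʳ r)))))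
      second (suc j) = begin
        coefficient 0 r (suc r) *ₗ z +ᴹ Head x0 (Tw (suc r ℕ.+ suc j)) φ₁
          ≈⟨ +ᴹ-congˡ (Head-at {φ = φ₁} x0 (Tw (suc r ℕ.+ suc j)) (Tw (suc r) ∷ʳ x0) (x1 ∷ Tw j) (trans (Tw-+ (suc r) (suc j)) (Tw-∷ʳ (suc r) (x1 ∷ Tw j))) (Graded-∷ x0 (graded l)) (length-Tw-∷ʳ (suc r))) ⟩
        coefficient 0 r (suc r) *ₗ z +ᴹ (0ℚ - 1ℚ) *ₗ φ (Tw (suc r) ∷ʳ x0) (Tw (suc j))
          ≈⟨ +ᴹ-congˡ (≈ᴹ-trans (*ₗ-congˡ (Reducible-insert (Tw (suc j)) l)) (≈ᴹ-sym (*ₗ-assoc _ _ z))) ⟩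
        coefficient 0 r (suc r) *ₗ z +ᴹ ((0ℚ - 1ℚ) * (ℕtoℚ 2 * sgn (suc r))) *ₗ z
          ≈⟨ *ₗ-distribʳ z _ _ ⟨
        (coefficient 0 r (suc r) + (0ℚ - 1ℚ) * (ℕtoℚ 2 * sgn (suc r))) *ₗ z
          ≈⟨ *ₗ-congʳ (trans (regroup (coefficient 0 r (suc r)) (ℕtoℚ 2 * sgn (suc r))) (sym (coefficient-base r j))) ⟩
        coefficient 0 (r ℕ.+ suc j) (suc r) *ₗ z ∎
        where
        z = φ (Zw (suc r)) (Tw (suc j))
        regroup : ∀ x y → x + (0ℚ - 1ℚ) * y ≡ x - y
        regroup = solve-∀ ℚ-ring
    D-Hw r (suc a) b zero {φ} l e = begin
      Head x1 (Hw (suc a) b) φ +ᴹ (Head x0 (x1 ∷ Hw a b) φ₁ +ᴹ D x1 (Hw a b) φ₂)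
        ≈⟨ +ᴹ-cong whole (zero-sum (Head-short {φ = φ₁} x0 (x1 ∷ Hw a b) (Graded-∷ x0 (graded l)) short) (D-short {φ = φ₂} x1 (Hw a b) (Graded-∷ x1 (Graded-∷ x0 (graded l))) (ℕP.<-trans (ℕP.n<1+n _) short))) ⟩
      coefficient (suc a) b (suc r) *ₗ φ (Zw (suc r)) [] +ᴹ 0ᴹ
        ≈⟨ +ᴹ-identityʳ _ ⟩
      coefficient (suc a) b (suc r) *ₗ φ (Zw (suc r)) [] ∎
      where
      φ₁ φ₂ : Kernel
      φ₁ p s = φ p (x0 ∷ s)
      φ₂ p s = φ p (x0 ∷ x1 ∷ s)
      index : suc (a ℕ.+ b) ≡ r
      index = trans e (ℕP.+-identityʳ r)
      whole : Head x1 (Hw (suc a) b) φ ≈ᴹ coefficient (suc a) b (suc r) *ₗ φ (Zw (suc r)) []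
      whole = ≈ᴹ-trans (≈ᴹ-reflexive (cong (λ b → Head x1 (Hw (suc a) b) φ) (sym (ℕP.+-identityʳ b)))) (Head-first (suc a) b 0 l (cong suc index))
      short : length (x1 ∷ Hw a b) ℕ.< suc (dbl (suc r))
      short = s≤s (ℕP.≤-reflexive (trans (cong suc (length-Hw a b)) (cong (suc ∘ suc ∘ dbl) index)))
    D-Hw r (suc a) b (suc j) {φ} l e = begin
      Head x1 (Hw (suc a) b) φ +ᴹ (Head x0 (x1 ∷ Hw a b) φ₁ +ᴹ D x1 (Hw a b) φ₂)
        ≈⟨ +ᴹ-congˡ (+ᴹ-congˡ (D-Hw r a b j (Reducible-∷ x1 (Reducible-∷ x0 l)) index)) ⟩
      Head x1 (Hw (suc a) b) φ +ᴹ (Head x0 (x1 ∷ Hw a b) φ₁ +ᴹ coefficient a b (suc r) *ₗ z)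
        ≈⟨ heads (ℕP.<-cmp r a) ⟩
      coefficient (suc a) b (suc r) *ₗ z ∎
      where
      φ₁ φ₂ : Kernel
      φ₁ p s = φ p (x0 ∷ s)
      φ₂ p s = φ p (x0 ∷ x1 ∷ s)
      z = φ (Zw (suc r)) (Tw (suc j))
      index : a ℕ.+ b ≡ r ℕ.+ j
      index = ℕP.suc-injective (trans e (ℕP.+-suc r j))
      combine : ∀ {h₁ h₂ x y w v} → h₁ ≈ᴹ x *ₗ z → h₂ ≈ᴹ y *ₗ z → v ≡ w + (x + y) → h₁ +ᴹ (h₂ +ᴹ w *ₗ z) ≈ᴹ v *ₗ z
      combine {x = x} {y} {w} e₁ e₂ refl = ≈ᴹ-trans (+ᴹ-cong e₁ (≈ᴹ-trans (+ᴹ-congʳ e₂) (≈ᴹ-sym (*ₗ-distribʳ z y w)))) (≈ᴹ-trans (≈ᴹ-sym (*ₗ-distribʳ z x (y + w))) (*ₗ-congʳ (regroup x y w)))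
        where
        regroup : ∀ x y w → x + (y + w) ≡ w + (x + y)
        regroup = solve-∀ ℚ-ring
      Goal : Set
      Goal = Head x1 (Hw (suc a) b) φ +ᴹ (Head x0 (x1 ∷ Hw a b) φ₁ +ᴹ coefficient a b (suc r) *ₗ z) ≈ᴹ coefficient (suc a) b (suc r) *ₗ z
      -- Both segments of weight 2r+1 end inside the initial Tw a and lie between equal letters.
      early : ∀ i → a ≡ suc r ℕ.+ i → Goal
      early i eq = combine {x = 0ℚ} {0ℚ} (≈ᴹ-trans first (≈ᴹ-sym (*ₗ-zeroˡ z))) (≈ᴹ-trans second (≈ᴹ-sym (*ₗ-zeroˡ z)))
        (trans (coefficient-early a b {suc r} (ℕP.≤-trans (ℕP.m≤m+n (suc r) i) (ℕP.≤-reflexive (sym eq)))) (sym (ℚP.+-identityʳ _)))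
        where
        word : Hw a b ≡ Tw (suc r) ++ Hw i b
        word = trans (cong (λ a → Hw a b) eq) (Hw-shift (suc r) i b)
        first : Head x1 (Hw (suc a) b) φ ≈ᴹ 0ᴹ
        first = ≈ᴹ-trans (Head-at {φ = φ} x1 (Hw (suc a) b) (Tw (suc r) ∷ʳ x0) (x1 ∷ Hw i b)
            (trans (cong (λ w → x0 ∷ x1 ∷ w) word) (trans (cong (_++ Hw i b) (trans (cong Tw (ℕP.+-comm 1 (suc r))) (Tw-+ (suc r) 1))) (trans (LP.++-assoc (Tw (suc r)) (Tw 1) (Hw i b)) (Tw-∷ʳ (suc r) (x1 ∷ Hw i b)))))
            (graded l) (length-Tw-∷ʳ (suc r)))
          (*ₗ-zeroˡ _)
        second : Head x0 (x1 ∷ Hw a b) φ₁ ≈ᴹ 0ᴹ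
        second = ≈ᴹ-trans (Head-at {φ = φ₁} x0 (x1 ∷ Hw a b) (x1 ∷ Tw (suc r)) (Hw i b) (cong (x1 ∷_) word) (Graded-∷ x0 (graded l)) (cong suc (length-Tw (suc r))))
          (*ₗ-zeroˡ′ (ω-same {x0} (hd-Hw i b)) _)
      middle : r ≡ a → Goal
      middle refl = combine (≈ᴹ-trans (Head-at {φ = φ} x1 (Hw (suc a) b) (Tw (suc a) ∷ʳ x0) (Tw (suc b))
            (trans (trans (cong (λ w → x0 ∷ x1 ∷ w) (Hw-Tw a b)) refl) (Tw-∷ʳ (suc a) (Tw (suc b)))) (graded l) (length-Tw-∷ʳ (suc a)))
          (≈ᴹ-trans (*ₗ-identityˡ _) (≈ᴹ-trans (≈ᴹ-reflexive (cong (λ j → φ (Tw (suc a) ∷ʳ x0) (Tw (suc j))) (ℕP.+-cancelˡ-≡ a b j index))) (Reducible-insert (Tw (suc j)) l))))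
        (≈ᴹ-trans (≈ᴹ-reflexive (cong (λ b → Head x0 (x1 ∷ Hw a b) φ₁) (ℕP.+-cancelˡ-≡ a b j index))) (Head-second a 0 j l (cong suc (ℕP.+-identityʳ a))))
        (coefficient-middle a b)
      late : ∀ d → r ≡ suc (a ℕ.+ d) → Goal
      late d refl = combine (≈ᴹ-trans (≈ᴹ-reflexive (cong (λ b → Head x1 (Hw (suc a) b) φ) (trans b≡ (sym (ℕP.+-suc d j))))) (Head-first (suc a) d (suc j) l refl))
        (≈ᴹ-trans (≈ᴹ-reflexive (cong (λ b → Head x0 (x1 ∷ Hw a b) φ₁) b≡)) (Head-second a (suc d) j l (cong suc (ℕP.+-suc a d))))
        (coefficient-late a b d)
        where
        b≡ : b ≡ suc d ℕ.+ j
        b≡ = ℕP.+-cancelˡ-≡ a b (suc d ℕ.+ j) (trans index (trans (cong suc (ℕP.+-assoc a d j)) (sym (ℕP.+-suc a (d ℕ.+ j)))))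
      heads : _ → Goal
      heads (tri< lt _ _) = early (a ℕ.∸ suc r) (sym (ℕP.m+[n∸m]≡n lt))
      heads (tri≈ _ eq _) = middle eq
      heads (tri> _ _ gt) = late (r ℕ.∸ suc a) (sym (ℕP.m+[n∸m]≡n gt))

    Sh-x0-power : ∀ k (ψ : Word → Carrierᴹ) → Sh [ x0 ] (replicate k x0) ψ ≈ᴹ ℕtoℚ (suc k) *ₗ ψ (replicate (suc k) x0)
    Sh-x0-power zero    ψ = ≈ᴹ-sym (*ₗ-identityˡ _)
    Sh-x0-power (suc k) ψ = begin
      y +ᴹ Sh [ x0 ] (replicate k x0) (ψ ∘ (x0 ∷_))   ≈⟨ +ᴹ-cong (≈ᴹ-sym (*ₗ-identityˡ y)) (Sh-x0-power k (ψ ∘ (x0 ∷_))) ⟩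
      1ℚ *ₗ y +ᴹ ℕtoℚ (suc k) *ₗ y                    ≈⟨ *ₗ-distribʳ y 1ℚ (ℕtoℚ (suc k)) ⟨
      (1ℚ + ℕtoℚ (suc k)) *ₗ y                        ≈⟨ *ₗ-congʳ (ℕtoℚ-suc (suc k)) ⟨
      ℕtoℚ (suc (suc k)) *ₗ y                         ∎
      where
      y = ψ (x0 ∷ x0 ∷ replicate k x0)

    kills-x0-power : ∀ {ψ} → KillsProducts ψ → ∀ k → ψ (replicate (suc (suc k)) x0) ≈ᴹ 0ᴹ
    kills-x0-power {ψ} kill k = begin
      y                                         ≈⟨ *ₗ-identityˡ y ⟨
      1ℚ *ₗ y                                   ≈⟨ *ₗ-congʳ (inv-cancel (suc k)) ⟨
      (inv (suc k) * ℕtoℚ (suc (suc k))) *ₗ y   ≈⟨ *ₗ-assoc _ _ y ⟩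
      inv (suc k) *ₗ (ℕtoℚ (suc (suc k)) *ₗ y)  ≈⟨ *ₗ-congˡ (≈ᴹ-trans (≈ᴹ-sym (Sh-x0-power (suc k) ψ)) (kill x0 [] x0 (replicate k x0))) ⟩
      inv (suc k) *ₗ 0ᴹ                         ≈⟨ *ₗ-zeroʳ _ ⟩
      0ᴹ                                        ∎
      where
      y = ψ (replicate (suc (suc k)) x0)

    private
      single : ℕ → Word
      single n = replicate n x0 ++ [ x1 ]

      x0-split : ∀ m n → single (m ℕ.+ n) ≡ replicate m x0 ++ single n
      x0-split zero    n = refl
      x0-split (suc m) n = cong (x0 ∷_) (x0-split m n)

      length-single : ∀ n → length (single n) ≡ suc n
      length-single n = trans (length-x0s n [ x1 ]) (ℕP.+-comm n 1)

      length-power : ∀ n → length (replicate n x0) ≡ n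
      length-power n = LP.length-replicate n

    Head-single-long : ∀ {r φ} a n → Graded (suc (dbl (suc r))) φ → suc (dbl (suc r)) ℕ.≤ n → Head a (single n) φ ≈ᴹ 0ᴹ
    Head-single-long {r} {φ} a n g le = begin
      Head a (single n) φ                                        ≈⟨ Head-at {φ = φ} a (single n) (replicate t x0) (single (n ℕ.∸ t)) (trans (cong single (sym (ℕP.m+[n∸m]≡n le))) (x0-split t (n ℕ.∸ t))) g (length-power t) ⟩
      ω a (hd (single (n ℕ.∸ t))) *ₗ φ (replicate t x0) (single (n ℕ.∸ t))    ≈⟨ zero-scale _ (kills-x0-power {λ p → φ p (single (n ℕ.∸ t))} (Graded.kills g (single (n ℕ.∸ t))) (suc (dbl r))) ⟩
      0ᴹ ∎
      where
      t = suc (dbl (suc r))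

    Head-single-short : ∀ {r φ} a n → Graded (suc (dbl (suc r))) φ → n ℕ.< dbl (suc r) → Head a (single n) φ ≈ᴹ 0ᴹ
    Head-single-short {φ = φ} a n g lt = Head-short {φ = φ} a (single n) g (ℕP.≤-trans (ℕP.≤-reflexive (cong suc (length-single n))) (s≤s lt))

    Head-single-whole : ∀ {r φ} a → Graded (suc (dbl (suc r))) φ → Head a (single (dbl (suc r))) φ ≈ᴹ ω a x0 *ₗ φ (Zw (suc r)) []
    Head-single-whole {r} {φ} a g = Head-at {φ = φ} a (Zw (suc r)) (Zw (suc r)) [] (sym (LP.++-identityʳ (Zw (suc r)))) g (length-Zw (suc r))

    D-single-x0 : ∀ {r φ} n → Graded (suc (dbl (suc r))) φ → D x0 (single n) φ ≈ᴹ 0ᴹ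
    D-single-x0 {r} {φ} zero    g = zero-sum (Head-single-short {r} {φ} x0 0 g (s≤s z≤n)) ≈ᴹ-refl
    D-single-x0 {r} {φ} (suc n) g = zero-sum (go (ℕP.<-cmp (suc n) (dbl (suc r)))) (D-single-x0 {r} n (Graded-∷ x0 g))
      where
      go : _ → Head x0 (single (suc n)) φ ≈ᴹ 0ᴹ
      go (tri< lt _ _) = Head-single-short {r} {φ} x0 (suc n) g lt
      go (tri≈ _ eq _) = ≈ᴹ-trans (≈ᴹ-reflexive (cong (λ n → Head x0 (single n) φ) eq)) (≈ᴹ-trans (Head-single-whole {r} {φ} x0 g) (*ₗ-zeroˡ _))
      go (tri> _ _ gt) = Head-single-long {r} {φ} x0 (suc n) g gt

    D-Zw-same : ∀ {r φ} → Graded (suc (dbl (suc r))) φ → D x1 (Zw (suc r)) φ ≈ᴹ φ (Zw (suc r)) []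
    D-Zw-same {r} {φ} g = ≈ᴹ-trans (+ᴹ-cong (≈ᴹ-trans (Head-single-whole {r} {φ} x1 g) (*ₗ-identityˡ _)) (D-single-x0 {r} (suc (dbl r)) (Graded-∷ x0 g))) (+ᴹ-identityʳ _)

    D-Zw-other : ∀ {r φ} s → r ≢ s → Graded (suc (dbl (suc r))) φ → D x1 (Zw (suc s)) φ ≈ᴹ 0ᴹ
    D-Zw-other {r} {φ} s ne g = zero-sum (go (ℕP.<-cmp (dbl (suc s)) (dbl (suc r)))) (D-single-x0 {r} (suc (dbl s)) (Graded-∷ x0 g))
      where
      dbl-injective : ∀ m n → dbl m ≡ dbl n → m ≡ n
      dbl-injective zero    zero    _ = refl
      dbl-injective (suc m) (suc n) e = cong suc (dbl-injective m n (ℕP.suc-injective (ℕP.suc-injective e)))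
      go : _ → Head x1 (single (dbl (suc s))) φ ≈ᴹ 0ᴹ
      go (tri< lt _ _) = Head-single-short {r} {φ} x1 (dbl (suc s)) g lt
      go (tri≈ _ eq _) = ⊥-elim (ne (sym (ℕP.suc-injective (dbl-injective (suc s) (suc r) eq))))
      go (tri> _ _ gt) = Head-single-long {r} {φ} x1 (dbl (suc s)) g gt

    D-product : ∀ {r φ} s k → Graded (suc (dbl (suc r))) φ → Sh (Zw (suc s)) (Tw k) (λ w → D x1 w φ) ≈ᴹ D x1 (Zw (suc s)) (λ p q → Sh q (Tw k) (φ p))
    D-product {r} {φ} s k g = ≈ᴹ-trans (D-shuffle x1 (Zw (suc s)) (Tw k) (Graded⇒Good g))
      (≈ᴹ-trans (+ᴹ-congˡ (D-alternating {suc r} x1 (Tw k) (Tw-alternating k) graded′)) (+ᴹ-identityʳ _))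
      where
      graded′ : Graded (suc (dbl (suc r))) (λ p q → Sh (Zw (suc s)) q (φ p))
      graded′ = record { kills = λ q → λ a u b v → ≈ᴹ-trans (Sh-swap (a ∷ u) (b ∷ v) (Zw (suc s)) q φ) (Sh-zero (Zw (suc s)) q (λ w → Graded.kills g w a u b v))
                       ; support = λ p q ne → Sh-zero (Zw (suc s)) q (λ w → Graded.support g p w ne) }

module Quotients where

  open Sums
  open Shuffles

  module Quotient {A : Set} (_≟A_ : DecidableEquality A) (S : FC A → Set) where

    private
      co : FC A → A → ℚ
      co = coeff _≟A_

      Z0 : FC A → Set
      Z0 = Span _≟A_ S

      co-⊖ : ∀ f g a → co (f ⊖ g) a ≡ co f a + - 1ℚ * co g a
      co-⊖ f g a = trans (coeff-++ _≟A_ f (neg g) a) (cong (co f a +_) (coeff-scale _≟A_ (- 1ℚ) g a))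

    Span-Same : ∀ {f g} → Same _≟A_ f g → Span _≟A_ S g → Span _≟A_ S f
    Span-Same e (L , s) = L , λ a → trans (e a) (s a)

    Span-[] : Span _≟A_ S []
    Span-[] = [] , λ a → refl

    Span-++ : ∀ f g → Span _≟A_ S f → Span _≟A_ S g → Span _≟A_ S (f ++ g)
    Span-++ f g (L , s) (K , t) = L ++ K , λ a → trans (coeff-++ _≟A_ f g a) (trans (cong₂ _+_ (s a) (t a))
      (trans (sym (coeff-++ _≟A_ (lincomb L) (lincomb K) a)) (cong (λ f → co f a) (sym (LP.concatMap-++ _ L K)))))

    Span-scale : ∀ q f → Span _≟A_ S f → Span _≟A_ S (scale q f)
    Span-scale q f (L , s) = map (λ { (p , g) → (q * p , g) }) L , λ a → trans (coeff-scale _≟A_ q f a) (trans (cong (q *_) (s a)) (go L a))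
      where
      go : ∀ (L : List (ℚ × Σ (FC A) S)) a → q * co (lincomb L) a ≡ co (lincomb (map (λ { (p , g) → (q * p , g) }) L)) a
      go []                a = ℚP.*-zeroʳ q
      go ((p , g , z) ∷ L) a = begin
        q * co (scale p g ++ lincomb L) a                        ≡⟨ cong (q *_) (trans (coeff-++ _≟A_ (scale p g) (lincomb L) a) (cong (_+ co (lincomb L) a) (coeff-scale _≟A_ p g a))) ⟩
        q * (p * co g a + co (lincomb L) a)                      ≡⟨ regroup q p (co g a) (co (lincomb L) a) ⟩
        q * p * co g a + q * co (lincomb L) a                    ≡⟨ cong₂ _+_ (sym (coeff-scale _≟A_ (q * p) g a)) (go L a) ⟩
        co (scale (q * p) g) a + co (lincomb (map (λ { (p , g) → (q * p , g) }) L)) a   ≡⟨ coeff-++ _≟A_ (scale (q * p) g) _ a ⟨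
        co (scale (q * p) g ++ lincomb (map (λ { (p , g) → (q * p , g) }) L)) a         ∎
        where
        open ≡-Reasoning
        regroup : ∀ q p x y → q * (p * x + y) ≡ q * p * x + q * y
        regroup = solve-∀ ℚ-ring

    Span-generator : ∀ {g} → S g → Span _≟A_ S g
    Span-generator {g} s = [ (1ℚ , g , s) ] , λ a → sym (trans (cong (λ f → co f a) (LP.++-identityʳ (scale 1ℚ g))) (trans (coeff-scale _≟A_ 1ℚ g a) (ℚP.*-identityˡ (co g a))))

    record _≋_ (f g : FC A) : Set where
      constructor modulo
      field
        difference : Span _≟A_ S (f ⊖ g)

    private
      build : ∀ k {f g} → Z0 k → (∀ a → co f a + - 1ℚ * co g a ≡ co k a) → f ≋ g
      build k {f} {g} z e = modulo (Span-Same {f ⊖ g} {k} (λ a → trans (co-⊖ f g a) (e a)) z)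

      same : ∀ {f g} → (∀ a → co f a ≡ co g a) → f ≋ g
      same {f} {g} e = build [] Span-[] (λ a → trans (cong (λ x → x + - 1ℚ * co g a) (e a)) (cancel (co g a)))
        where
        cancel : ∀ x → x + - 1ℚ * x ≡ 0ℚ
        cancel = solve-∀ ℚ-ring

      ≋-sym : ∀ {f g} → f ≋ g → g ≋ f
      ≋-sym {f} {g} (modulo z) = build (scale (- 1ℚ) (f ⊖ g)) (Span-scale (- 1ℚ) (f ⊖ g) z)
        (λ a → sym (trans (coeff-scale _≟A_ (- 1ℚ) (f ⊖ g) a) (trans (cong (- 1ℚ *_) (co-⊖ f g a)) (regroup (co f a) (co g a)))))
        where
        regroup : ∀ x y → - 1ℚ * (x + - 1ℚ * y) ≡ y + - 1ℚ * x
        regroup = solve-∀ ℚ-ring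

      ≋-trans : ∀ {f g k} → f ≋ g → g ≋ k → f ≋ k
      ≋-trans {f} {g} {k} (modulo z) (modulo w) = build ((f ⊖ g) ++ (g ⊖ k)) (Span-++ (f ⊖ g) (g ⊖ k) z w)
        (λ a → sym (trans (coeff-++ _≟A_ (f ⊖ g) (g ⊖ k) a) (trans (cong₂ _+_ (co-⊖ f g a) (co-⊖ g k a)) (regroup (co f a) (co g a) (co k a)))))
        where
        regroup : ∀ x y z → x + - 1ℚ * y + (y + - 1ℚ * z) ≡ x + - 1ℚ * z
        regroup = solve-∀ ℚ-ring

      ++-cong : ∀ {f f′ g g′} → f ≋ f′ → g ≋ g′ → (f ++ g) ≋ (f′ ++ g′)
      ++-cong {f} {f′} {g} {g′} (modulo z) (modulo w) = build ((f ⊖ f′) ++ (g ⊖ g′)) (Span-++ (f ⊖ f′) (g ⊖ g′) z w)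
        (λ a → trans (cong₂ (λ x y → x + - 1ℚ * y) (coeff-++ _≟A_ f g a) (coeff-++ _≟A_ f′ g′ a))
          (sym (trans (coeff-++ _≟A_ (f ⊖ f′) (g ⊖ g′) a) (trans (cong₂ _+_ (co-⊖ f f′ a) (co-⊖ g g′ a)) (regroup (co f a) (co f′ a) (co g a) (co g′ a))))))
        where
        regroup : ∀ x y z w → x + - 1ℚ * y + (z + - 1ℚ * w) ≡ x + z + - 1ℚ * (y + w)
        regroup = solve-∀ ℚ-ring

      scale-cong : ∀ {p q f g} → p ≡ q → f ≋ g → scale p f ≋ scale q g
      scale-cong {p} {.p} {f} {g} refl (modulo z) = build (scale p (f ⊖ g)) (Span-scale p (f ⊖ g) z)
        (λ a → trans (cong₂ (λ x y → x + - 1ℚ * y) (coeff-scale _≟A_ p f a) (coeff-scale _≟A_ p g a))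
          (sym (trans (coeff-scale _≟A_ p (f ⊖ g) a) (trans (cong (p *_) (co-⊖ f g a)) (regroup p (co f a) (co g a))))))
        where
        regroup : ∀ p x y → p * (x + - 1ℚ * y) ≡ p * x + - 1ℚ * (p * y)
        regroup = solve-∀ ℚ-ring

      scale-+ : ∀ f p q → scale (p + q) f ≋ (scale p f ++ scale q f)
      scale-+ f p q = same (λ a → trans (coeff-scale _≟A_ (p + q) f a) (trans (ℚP.*-distribʳ-+ (co f a) p q)
        (sym (trans (coeff-++ _≟A_ (scale p f) (scale q f) a) (cong₂ _+_ (coeff-scale _≟A_ p f a) (coeff-scale _≟A_ q f a))))))

      scale-++ : ∀ p f g → scale p (f ++ g) ≋ (scale p f ++ scale p g)
      scale-++ p f g = same (λ a → cong (λ k → co k a) (LP.map-++ _ f g))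

      neg-inverse : ∀ f → (neg f ++ f) ≋ []
      neg-inverse f = same (λ a → trans (coeff-++ _≟A_ (neg f) f a) (trans (cong (_+ co f a) (coeff-scale _≟A_ (- 1ℚ) f a)) (cancel (co f a))))
        where
        cancel : ∀ x → - 1ℚ * x + x ≡ 0ℚ
        cancel = solve-∀ ℚ-ring

      ++-comm : ∀ f g → (f ++ g) ≋ (g ++ f)
      ++-comm f g = same (λ a → trans (coeff-++ _≟A_ f g a) (trans (ℚP.+-comm (co f a) (co g a)) (sym (coeff-++ _≟A_ g f a))))

    quotient : ℚ-module
    quotient = record
      { Carrierᴹ = FC A ; _≈ᴹ_ = _≋_ ; _+ᴹ_ = _++_ ; _*ₗ_ = scale ; 0ᴹ = [] ; -ᴹ_ = neg
      ; isLeftModule = record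
        { isLeftSemimodule = record
          { +ᴹ-isCommutativeMonoid = record
            { isMonoid = record
              { isSemigroup = record
                { isMagma = record
                  { isEquivalence = record { refl = same (λ _ → refl) ; sym = ≋-sym ; trans = ≋-trans }
                  ; ∙-cong = ++-cong }
                ; assoc = λ f g k → same (λ a → cong (λ k → co k a) (LP.++-assoc f g k)) }
              ; identity = (λ f → same (λ _ → refl)) , (λ f → same (λ a → cong (λ k → co k a) (LP.++-identityʳ f))) }
            ; comm = ++-comm }
          ; isPreleftSemimodule = record
            { *ₗ-cong = scale-cong
            ; *ₗ-zeroˡ = λ f → same (λ a → trans (coeff-scale _≟A_ 0ℚ f a) (ℚP.*-zeroˡ (co f a)))
            ; *ₗ-distribʳ = scale-+
            ; *ₗ-identityˡ = λ f → same (λ a → trans (coeff-scale _≟A_ 1ℚ f a) (ℚP.*-identityˡ (co f a)))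
            ; *ₗ-assoc = λ p q f → same (λ a → trans (coeff-scale _≟A_ (p * q) f a) (trans (ℚP.*-assoc p q (co f a)) (sym (trans (coeff-scale _≟A_ p (scale q f) a) (cong (p *_) (coeff-scale _≟A_ q f a))))))
            ; *ₗ-zeroʳ = λ p → same (λ _ → refl)
            ; *ₗ-distribˡ = scale-++ } }
        ; -ᴹ‿cong = scale-cong { - 1ℚ} refl
        ; -ᴹ‿inverse = neg-inverse , λ f → ≋-trans (++-comm f (neg f)) (neg-inverse f) } }

    module _ where
      open Pairing quotient using (⟪_,_⟫; _≈ᴹ_; 0ᴹ)

      basis : A → FC A
      basis a = [ (1ℚ , a) ]

      pair-basis : ∀ f → ⟪ f , basis ⟫ ≡ f
      pair-basis []            = refl
      pair-basis ((q , a) ∷ f) = cong₂ (λ p g → (p , a) ∷ g) (ℚP.*-identityʳ q) (pair-basis f)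

      Span⇒≈0 : ∀ {f} → Span _≟A_ S f → ⟪ f , basis ⟫ ≈ᴹ 0ᴹ
      Span⇒≈0 {f} z = subst (_≋ []) (sym (pair-basis f)) (modulo (subst (Span _≟A_ S) (sym (LP.++-identityʳ f)) z))

      ≈0⇒Span : ∀ {f} → ⟪ f , basis ⟫ ≈ᴹ 0ᴹ → Span _≟A_ S f
      ≈0⇒Span {f} e = subst (Span _≟A_ S) (LP.++-identityʳ f) (_≋_.difference (subst (_≋ []) (pair-basis f) e))

module Comparison where

  open Shuffles
  open Coaction
  open DoubleSums
  open Zagier using (dbl≡2*)

  odd-index : ∀ r → 2 ℕ.* r ℕ.+ 1 ≡ suc (dbl r)
  odd-index r = trans (ℕP.+-comm (2 ℕ.* r) 1) (cong suc (dbl≡2* r))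

  module Evaluation (V : ℚ-module) where
    open Windows V public

    sumᴹ : ℕ → (ℕ → Carrierᴹ) → Carrierᴹ
    sumᴹ zero    f = 0ᴹ
    sumᴹ (suc n) f = f 0 +ᴹ sumᴹ n (f ∘ suc)

    sumᴹ-zero : ∀ n {f} → (∀ i → i ℕ.< n → f i ≈ᴹ 0ᴹ) → sumᴹ n f ≈ᴹ 0ᴹ
    sumᴹ-zero zero    z = ≈ᴹ-refl
    sumᴹ-zero (suc n) z = zero-sum (z 0 (s≤s z≤n)) (sumᴹ-zero n (λ i lt → z (suc i) (s≤s lt)))

    sumᴹ-pick : ∀ {n f} i → i ℕ.< n → (∀ j → j ℕ.< n → j ≢ i → f j ≈ᴹ 0ᴹ) → sumᴹ n f ≈ᴹ f i
    sumᴹ-pick {suc n} zero    _        z = ≈ᴹ-trans (+ᴹ-congˡ (sumᴹ-zero n (λ j lt → z (suc j) (s≤s lt) (λ ())))) (+ᴹ-identityʳ _)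
    sumᴹ-pick {suc n} (suc i) (s≤s lt) z = ≈ᴹ-trans (+ᴹ-congʳ (z 0 (s≤s z≤n) (λ ()))) (≈ᴹ-trans (+ᴹ-identityˡ _) (sumᴹ-pick i lt (λ j lt′ ne → z (suc j) (s≤s lt′) (ne ∘ ℕP.suc-injective))))

    pair-applyUpTo : ∀ {A : Set} n (g : ℕ → ℕ) (f : ℕ → FC A) φ χ → (∀ i → ⟪ f (g i) , φ ⟫ ≈ᴹ χ i) → ⟪ concatMap f (applyUpTo g n) , φ ⟫ ≈ᴹ sumᴹ n χ
    pair-applyUpTo zero    g f φ χ e = ≈ᴹ-refl
    pair-applyUpTo (suc n) g f φ χ e = ≈ᴹ-trans (pair-++ (f (g 0)) (concatMap f (applyUpTo (g ∘ suc) n)) φ) (+ᴹ-cong (e 0) (pair-applyUpTo n (g ∘ suc) f φ (χ ∘ suc) (e ∘ suc)))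

    pair-range : ∀ {A : Set} n {f : ℕ → FC A} φ χ → (∀ i → ⟪ f (suc i) , φ ⟫ ≈ᴹ χ i) → ⟪ concatMap f (map suc (upTo n)) , φ ⟫ ≈ᴹ sumᴹ n χ
    pair-range n {f} φ χ e = ≈ᴹ-trans (≈ᴹ-reflexive (cong (λ l → ⟪ concatMap f l , φ ⟫) (LP.map-upTo suc n))) (pair-applyUpTo n suc f φ χ e)

    rhs-term : ℕ → ℕ → (Word → Carrierᴹ) → ℕ → Carrierᴹ
    rhs-term a b φ i = coefficient a b (suc i) *ₗ Sh (Zw (suc i)) (Tw (a ℕ.+ b ℕ.∸ i)) φ

    pair-rhs : ∀ a b φ → ⟪ rhs a b , φ ⟫ ≈ᴹ sumᴹ (suc (a ℕ.+ b)) (rhs-term a b φ)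
    pair-rhs a b φ = ≈ᴹ-trans (pair-range (a ℕ.+ b ℕ.+ 1) φ (λ i → coefficient a b (suc i) *ₗ Sh (Zw (suc i)) (Tw (a ℕ.+ b ℕ.+ 1 ℕ.∸ suc i)) φ)
        (λ i → ≈ᴹ-trans (pair-scale (coefficient a b (suc i)) (sh (wd (ι [ 2 ℕ.* suc i ℕ.+ 1 ])) (wd (Tw (a ℕ.+ b ℕ.+ 1 ℕ.∸ suc i)))) φ)
          (*ₗ-congˡ (≈ᴹ-trans (pair-sh (wd (ι [ 2 ℕ.* suc i ℕ.+ 1 ])) (wd (Tw (a ℕ.+ b ℕ.+ 1 ℕ.∸ suc i))) φ)
            (≈ᴹ-trans (pair-wd (ι [ 2 ℕ.* suc i ℕ.+ 1 ]) (λ u → ⟪ wd (Tw (a ℕ.+ b ℕ.+ 1 ℕ.∸ suc i)) , (λ v → Sh u v φ) ⟫)) (≈ᴹ-trans (pair-wd (Tw (a ℕ.+ b ℕ.+ 1 ℕ.∸ suc i)) (λ v → Sh (ι [ 2 ℕ.* suc i ℕ.+ 1 ]) v φ))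
              (≈ᴹ-reflexive (cong (λ t → Sh (ι [ t ]) (Tw (a ℕ.+ b ℕ.+ 1 ℕ.∸ suc i)) φ) (odd-index (suc i))))))))))
      (≈ᴹ-reflexive (cong (λ n → sumᴹ n (λ i → coefficient a b (suc i) *ₗ Sh (Zw (suc i)) (Tw (n ℕ.∸ suc i)) φ)) (ℕP.+-comm (a ℕ.+ b) 1)))

    ZEq⇒known : ∀ {ψ} → KillsProducts ψ → (∀ f → InR f → ⟪ f , ψ ⟫ ≈ᴹ 0ᴹ) → ∀ a b → ZEq (lhs a b) (rhs a b) →
      ψ (Hw a b) ≈ᴹ coefficient a b (suc (a ℕ.+ b)) *ₗ ψ (Zw (suc (a ℕ.+ b)))
    ZEq⇒known {ψ} kill killR a b eq = begin
      ψ (Hw a b)                                                    ≈⟨ pair-wd (Hw a b) ψ ⟨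
      ⟪ lhs a b , ψ ⟫                                               ≈⟨ difference-zero (≈ᴹ-trans (≈ᴹ-sym (pair-⊖ (lhs a b) (rhs a b) ψ)) (killR (lhs a b ⊖ rhs a b) eq)) ⟩
      ⟪ rhs a b , ψ ⟫                                               ≈⟨ pair-rhs a b ψ ⟩
      sumᴹ (suc (a ℕ.+ b)) (rhs-term a b ψ)                         ≈⟨ sumᴹ-pick (a ℕ.+ b) (ℕP.n<1+n (a ℕ.+ b)) products ⟩
      rhs-term a b ψ (a ℕ.+ b)                                      ≈⟨ *ₗ-congˡ (≈ᴹ-trans (≈ᴹ-reflexive (cong (λ k → Sh (Zw (suc (a ℕ.+ b))) (Tw k) ψ) (ℕP.n∸n≡0 (a ℕ.+ b)))) (Sh-[] (Zw (suc (a ℕ.+ b))) ψ)) ⟩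
      coefficient a b (suc (a ℕ.+ b)) *ₗ ψ (Zw (suc (a ℕ.+ b)))     ∎
      where
      products : ∀ i → i ℕ.< suc (a ℕ.+ b) → i ≢ a ℕ.+ b → rhs-term a b ψ i ≈ᴹ 0ᴹ
      products i (s≤s le) ne = zero-scale (coefficient a b (suc i)) (positive (a ℕ.+ b ℕ.∸ i) (ℕP.m>n⇒m∸n≢0 (ℕP.≤∧≢⇒< le ne)))
        where
        positive : ∀ k → k ≢ 0 → Sh (Zw (suc i)) (Tw k) ψ ≈ᴹ 0ᴹ
        positive zero    ne = ⊥-elim (ne refl)
        positive (suc k) _  = kill x0 (replicate (suc (dbl i)) x0 ++ [ x1 ]) x0 (x1 ∷ Tw k)

    Sh-vanish : ∀ u v (φ : Word → Carrierᴹ) → (∀ w → length w ≡ length u ℕ.+ length v → φ w ≈ᴹ 0ᴹ) → Sh u v φ ≈ᴹ 0ᴹ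
    Sh-vanish u v φ z = ≈ᴹ-trans (Sh-cong-length u v {φ} {λ _ → 0ᴹ} z) (Sh-0 u v)

    module _ (ψ : Word × Word → Carrierᴹ) (killK : ∀ f s → InK f → ⟪ f , (λ p → ψ (p , s)) ⟫ ≈ᴹ 0ᴹ) (generator : ∀ {f} → GenK f → InK f) where

      private
        kill : ∀ s → KillsProducts (λ p → ψ (p , s))
        kill s a u b v = ≈ᴹ-trans (≈ᴹ-sym (pair-shw (a ∷ u) (b ∷ v) (λ p → ψ (p , s)))) (killK (shw (a ∷ u) (b ∷ v)) s (generator (k-prod a u b v)))

        killR : ∀ s f → InR f → ⟪ f , (λ p → ψ (p , s)) ⟫ ≈ᴹ 0ᴹ
        killR s f z = killK f s (generator (k-R f z))

      Dpoly-D : ∀ r f → ⟪ Dpoly r f , ψ ⟫ ≈ᴹ ⟪ f , (λ w → D x1 w (part (suc (dbl r)) (λ p s → ψ (p , s)))) ⟫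
      Dpoly-D r f = ≈ᴹ-trans (pair-concatMap _ ψ (λ w → ⟪ Dword r w , ψ ⟫) (λ q w → pair-scale q (Dword r w) ψ) f)
        (pair-cong f (λ w → ≈ᴹ-trans (Dword-D r w ψ kill) (≈ᴹ-reflexive (cong (λ t → D x1 w (part t (λ p s → ψ (p , s)))) (odd-index r)))))

      D-vanishes : ∀ r a b → suc r ℕ.≤ a ℕ.+ b → (∀ α β → α ℕ.+ β ≡ r → ZEq (lhs α β) (rhs α β)) → ⟪ Dpoly (suc r) (lhs a b ⊖ rhs a b) , ψ ⟫ ≈ᴹ 0ᴹ
      D-vanishes r a b le ih = begin
        ⟪ Dpoly (suc r) (lhs a b ⊖ rhs a b) , ψ ⟫       ≈⟨ Dpoly-D (suc r) (lhs a b ⊖ rhs a b) ⟩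
        ⟪ lhs a b ⊖ rhs a b , χ ⟫                       ≈⟨ pair-⊖ (lhs a b) (rhs a b) χ ⟩
        ⟪ lhs a b , χ ⟫ +ᴹ (- 1ℚ) *ₗ ⟪ rhs a b , χ ⟫    ≈⟨ +ᴹ-cong (≈ᴹ-trans (pair-wd (Hw a b) χ) (D-Hw r a b j level index)) (*ₗ-congˡ right) ⟩
        y +ᴹ (- 1ℚ) *ₗ y                                ≈⟨ ≈ᴹ-trans (+ᴹ-comm _ _) (neg-one y) ⟩
        0ᴹ ∎
        where
        φ : Kernel
        φ = part (suc (dbl (suc r))) (λ p s → ψ (p , s))
        χ : Word → Carrierᴹ
        χ w = D x1 w φ
        j = a ℕ.+ b ℕ.∸ r
        index : a ℕ.+ b ≡ r ℕ.+ j
        index = sym (ℕP.m+[n∸m]≡n (ℕP.≤-trans (ℕP.n≤1+n r) le))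
        y = coefficient a b (suc r) *ₗ φ (Zw (suc r)) (Tw j)
        visible : ∀ w s → length w ≡ suc (dbl (suc r)) → φ w s ≈ᴹ ψ (w , s)
        visible w s l = select-yes (length w ℕ.≟ suc (dbl (suc r))) l (ψ (w , s))
        level : Reducible (suc r) φ
        level = record
          { graded = part-Graded (suc (dbl (suc r))) {λ p s → ψ (p , s)} kill
          ; known  = λ α β s e → ≈ᴹ-trans (visible (Hw α β) s (trans (length-Hw α β) (cong (suc ∘ dbl) e)))
              (≈ᴹ-trans (ZEq⇒known {λ p → ψ (p , s)} (kill s) (killR s) α β (ih α β (ℕP.suc-injective e)))
                (≈ᴹ-trans (≈ᴹ-reflexive (cong (λ r → coefficient α β r *ₗ ψ (Zw r , s)) e)) (*ₗ-congˡ (≈ᴹ-sym (visible (Zw (suc r)) s (length-Zw (suc r))))))) }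
        graded = Reducible.graded level
        product : ∀ i → rhs-term a b χ i ≈ᴹ coefficient a b (suc i) *ₗ D x1 (Zw (suc i)) (λ p q → Sh q (Tw (a ℕ.+ b ℕ.∸ i)) (φ p))
        product i = *ₗ-congˡ (D-product {r} {φ} i (a ℕ.+ b ℕ.∸ i) graded)
        right : ⟪ rhs a b , χ ⟫ ≈ᴹ y
        right = ≈ᴹ-trans (pair-rhs a b χ) (≈ᴹ-trans (sumᴹ-pick r (s≤s (ℕP.≤-trans (ℕP.n≤1+n r) le))
            (λ i _ ne → ≈ᴹ-trans (product i) (zero-scale (coefficient a b (suc i)) (D-Zw-other {r} i (ne ∘ sym) (Graded-Sh {φ = φ} (Tw (a ℕ.+ b ℕ.∸ i)) graded)))))
          (≈ᴹ-trans (product r) (*ₗ-congˡ (D-Zw-same {r} (Graded-Sh {φ = φ} (Tw j) graded)))))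

open Sums
open Growth
open Shuffles
open Polylogarithms
open Realisation
open Coaction
open DoubleSums
open Parity using (dbl-+)
open Asymptotics
open Zagier
open Quotients
open Comparison

module ℚ-Evaluation = Evaluation ℚV
open ℚ-Evaluation using (⟪_,_⟫; pair-⊖; pair-wd; pair-scale; Sh; Sh-vanish; sumᴹ; sumᴹ-zero; pair-rhs; rhs-term)

indicator : Word → Word → ℚ
indicator w v with w ≟W v
... | yes _ = 1ℚ
... | no  _ = 0ℚ

indicator-0 : ∀ {w v} → w ≢ v → indicator w v ≡ 0ℚ
indicator-0 {w} {v} ne with w ≟W v
... | yes e = ⊥-elim (ne e)
... | no  _ = refl

pair-indicator : ∀ f w → coeffP f w ≡ ⟪ f , indicator w ⟫
pair-indicator []            w = refl
pair-indicator ((q , v) ∷ f) w with w ≟W v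
... | yes _ = cong₂ _+_ (sym (ℚP.*-identityʳ q)) (pair-indicator f w)
... | no  _ = trans (pair-indicator f w) (sym (trans (cong (_+ ⟪ f , indicator w ⟫) (ℚP.*-zeroʳ q)) (ℚP.+-identityˡ _)))

difference-Hom : ∀ a b → Hom (suc (dbl (suc (a ℕ.+ b)))) (lhs a b ⊖ rhs a b)
difference-Hom a b w ne = go (length w ℕ.≟ n)
  where
  n = suc (dbl (suc (a ℕ.+ b)))
  go : Dec (length w ≡ n) → length w ≡ n
  go (yes e) = e
  go (no w≢) = ⊥-elim (ne (begin
    coeffP (lhs a b ⊖ rhs a b) w                                       ≡⟨ pair-indicator (lhs a b ⊖ rhs a b) w ⟩
    ⟪ lhs a b ⊖ rhs a b , indicator w ⟫                                ≡⟨ pair-⊖ (lhs a b) (rhs a b) (indicator w) ⟩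
    ⟪ lhs a b , indicator w ⟫ + - 1ℚ * ⟪ rhs a b , indicator w ⟫       ≡⟨ cong₂ (λ x y → x + - 1ℚ * y) (trans (pair-wd (Hw a b) (indicator w)) (other (Hw a b) (length-Hw a b))) (trans (pair-rhs a b (indicator w)) (sumᴹ-zero (suc (a ℕ.+ b)) term)) ⟩
    0ℚ + - 1ℚ * 0ℚ                                                     ≡⟨⟩
    0ℚ                                                                 ∎))
    where
    open ≡-Reasoning
    other : ∀ v → length v ≡ n → indicator w v ≡ 0ℚ
    other v l = indicator-0 {w} {v} (λ e → w≢ (trans (cong length e) l))
    term : ∀ i → i ℕ.< suc (a ℕ.+ b) → rhs-term a b (indicator w) i ≡ 0ℚ
    term i (s≤s i≤) = trans (cong (coefficient a b (suc i) *_) (Sh-vanish (Zw (suc i)) (Tw (a ℕ.+ b ℕ.∸ i)) (indicator w) (λ v l → other v (trans l index)))) (ℚP.*-zeroʳ (coefficient a b (suc i)))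
      where
      index : length (Zw (suc i)) ℕ.+ length (Tw (a ℕ.+ b ℕ.∸ i)) ≡ n
      index = trans (cong₂ ℕ._+_ (length-Zw (suc i)) (length-Tw (a ℕ.+ b ℕ.∸ i))) (cong suc (trans (dbl-+ (suc i) (a ℕ.+ b ℕ.∸ i)) (cong (dbl ∘ suc) (ℕP.m+[n∸m]≡n i≤))))

open Quotient _≟WW_ GenT using () renaming (quotient to Q; basis to tensor; Span⇒≈0 to TensorZero⇒≈0; ≈0⇒Span to ≈0⇒TensorZero; Span-generator to TensorZero-generator)

module Tensors = Evaluation Q

InK-generator : ∀ {f} → GenK f → InK f
InK-generator = Quotient.Span-generator _≟W_ GenK

tensor-InK : ∀ f s → InK f → Tensors._≈ᴹ_ (Tensors.⟪_,_⟫ f (λ p → tensor (p , s))) Tensors.0ᴹ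
tensor-InK f s z = Tensors.≈ᴹ-trans (Tensors.≈ᴹ-sym (Tensors.pair-⊗w f s tensor)) (TensorZero⇒≈0 {f ⊗w s} (TensorZero-generator (t-left f z s)))

dbl-cancel : ∀ m n → dbl m ℕ.< dbl n → m ℕ.< n
dbl-cancel m n lt = ℕP.≰⇒> (λ n≤m → ℕP.<⇒≱ lt (dbl-mono n≤m))

in-kernel : ∀ a b → (∀ α β → α ℕ.+ β ℕ.< a ℕ.+ b → ZEq (lhs α β) (rhs α β)) → InKerD< (suc (dbl (suc (a ℕ.+ b)))) (lhs a b ⊖ rhs a b)
in-kernel a b ih zero    (s≤s ()) _
in-kernel a b ih (suc r) _ lt = ≈0⇒TensorZero {Dpoly (suc r) (lhs a b ⊖ rhs a b)} (Tensors.D-vanishes tensor tensor-InK InK-generator r a b r< (λ α β e → ih α β (subst (ℕ._< a ℕ.+ b) (sym e) r<)))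
  where
  r< : r ℕ.< a ℕ.+ b
  r< = ℕP.≤-pred (dbl-cancel (suc r) (suc (a ℕ.+ b)) (ℕP.≤-pred (subst (ℕ._< suc (dbl (suc (a ℕ.+ b)))) (odd-index (suc r)) lt)))

square-zero : ∀ p → p * p ≡ 0ℚ → p ≡ 0ℚ
square-zero p e = go (p ℚP.≟ 0ℚ)
  where
  go : Dec (p ≡ 0ℚ) → p ≡ 0ℚ
  go (yes z) = z
  go (no ne) = begin
    p                   ≡⟨ ℚP.*-identityˡ p ⟨
    1ℚ * p              ≡⟨ cong (_* p) (ℚP.*-inverseˡ p {{≢-nonZero ne}}) ⟨
    1/p * p * p         ≡⟨ ℚP.*-assoc 1/p p p ⟩
    1/p * (p * p)       ≡⟨ cong (1/p *_) e ⟩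
    1/p * 0ℚ            ≡⟨ ℚP.*-zeroʳ 1/p ⟩
    0ℚ                  ∎
    where
    open ≡-Reasoning
    1/p = 1/_ p {{≢-nonZero ne}}

suc-N : ∀ L → ℕtoℚ (suc (N L)) * (inv L * inv L) ≤ 1ℚ + 1ℚ + 1ℚ
suc-N L = begin
  ℕtoℚ (suc (N L)) * (i * i)                ≡⟨ cong (_* (i * i)) (trans (ℕtoℚ-suc (N L)) (cong (1ℚ +_) (trans (cong ℕtoℚ (cong suc (ℕP.+-suc (k L) (k L)))) (trans (cong (λ z → ℕtoℚ (suc z)) (sym (ℕP.+-suc (k L) (k L)))) (ℕtoℚ-+ (suc (k L)) (suc (k L))))))) ⟩
  (1ℚ + (ℕtoℚ (suc (k L)) + ℕtoℚ (suc (k L)))) * (i * i)   ≡⟨ cong (λ z → (1ℚ + (z + z)) * (i * i)) (ℕtoℚ-* (suc L) (suc L)) ⟩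
  (1ℚ + (y * y + y * y)) * (i * i)          ≡⟨ regroup i y ⟩
  i * i + (i * y * (i * y) + i * y * (i * y))   ≡⟨ cong (λ z → i * i + (z * z + z * z)) (inv-cancel L) ⟩
  i * i + (1ℚ * 1ℚ + 1ℚ * 1ℚ)               ≤⟨ ℚP.+-monoˡ-≤ (1ℚ * 1ℚ + 1ℚ * 1ℚ) (*-mono 0≤1 (inv-nonneg L) (inv≤1 L) (inv≤1 L)) ⟩
  1ℚ * 1ℚ + (1ℚ * 1ℚ + 1ℚ * 1ℚ)             ≡⟨⟩
  1ℚ + 1ℚ + 1ℚ                              ∎
  where
  open ℚP.≤-Reasoning
  i = inv L
  y = ℕtoℚ (suc L)
  regroup : ∀ i y → (1ℚ + (y * y + y * y)) * (i * i) ≡ i * i + (i * y * (i * y) + i * y * (i * y))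
  regroup = solve-∀ ℚ-ring

Null-const : ∀ q → Null (λ _ → q) → q ≡ 0ℚ
Null-const q (bnd C e 0≤C bound) with powh≤ (e ℕ.+ (e ℕ.+ (e ℕ.+ e)))
... | d , 0≤d , hd≤ = ℚP.∣p∣≡0⇒p≡0 q (square-zero p (square-zero (p * p) (archimedean (*-nonneg 0≤p² 0≤p²) (*-nonneg (*-nonneg 0≤C⁴ 0≤d) (+-nonneg (+-nonneg 0≤1 0≤1) 0≤1)) estimate)))
  where
  p = ∣ q ∣
  0≤p = ℚP.0≤∣p∣ q
  0≤p² = *-nonneg 0≤p 0≤p
  C⁴ = C * C * (C * C)
  0≤C⁴ = *-nonneg (*-nonneg 0≤C 0≤C) (*-nonneg 0≤C 0≤C)
  estimate : ∀ L → p * p * (p * p) ≤ C⁴ * d * (1ℚ + 1ℚ + 1ℚ) * inv L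
  estimate L = begin
    p * p * (p * p)                                        ≤⟨ *-mono (*-nonneg 0≤x 0≤x) 0≤p² p²≤ p²≤ ⟩
    x * x * (x * x)                                        ≡⟨ regroup₁ C y i ⟩
    C⁴ * (y * (y * (y * y))) * (i * i * (i * i))           ≡⟨ cong (λ z → C⁴ * z * (i * i * (i * i))) pow ⟩
    C⁴ * powℚ (η L) (e ℕ.+ (e ℕ.+ (e ℕ.+ e))) * (i * i * (i * i))   ≤⟨ *-monoʳ (*-nonneg 0≤i² 0≤i²) (*-monoˡ 0≤C⁴ (hd≤ (N L))) ⟩
    C⁴ * (d * ℕtoℚ (suc (N L))) * (i * i * (i * i))        ≡⟨ regroup₂ C⁴ d (ℕtoℚ (suc (N L))) i ⟩
    C⁴ * d * (ℕtoℚ (suc (N L)) * (i * i)) * (i * i)        ≤⟨ *-mono (*-nonneg (*-nonneg 0≤C⁴ 0≤d) (+-nonneg (+-nonneg 0≤1 0≤1) 0≤1)) 0≤i² (*-monoˡ (*-nonneg 0≤C⁴ 0≤d) (suc-N L)) (ℚP.≤-trans (*-monoˡ (inv-nonneg L) (inv≤1 L)) (ℚP.≤-reflexive (ℚP.*-identityʳ i))) ⟩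
    C⁴ * d * (1ℚ + 1ℚ + 1ℚ) * i                            ∎
    where
    open ℚP.≤-Reasoning
    y = powℚ (η L) e
    i = inv L
    x = C * y * i
    0≤i² = *-nonneg (inv-nonneg L) (inv-nonneg L)
    0≤x : 0ℚ ≤ x
    0≤x = ℚP.≤-trans 0≤p (bound L)
    p²≤ : p * p ≤ x * x
    p²≤ = *-mono 0≤x 0≤p (bound L) (bound L)
    pow : y * (y * (y * y)) ≡ powℚ (η L) (e ℕ.+ (e ℕ.+ (e ℕ.+ e)))
    pow = sym (trans (powℚ-+ (η L) e (e ℕ.+ (e ℕ.+ e))) (cong (y *_) (trans (powℚ-+ (η L) e (e ℕ.+ e)) (cong (y *_) (powℚ-+ (η L) e e)))))
    regroup₁ : ∀ C y i → C * y * i * (C * y * i) * (C * y * i * (C * y * i)) ≡ C * C * (C * C) * (y * (y * (y * y))) * (i * i * (i * i))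
    regroup₁ = solve-∀ ℚ-ring
    regroup₂ : ∀ C d n i → C * (d * n) * (i * i * (i * i)) ≡ C * d * (n * (i * i)) * (i * i)
    regroup₂ = solve-∀ ℚ-ring

1≤Z : ∀ p L → 1ℚ ≤ Z p (N L)
1≤Z p L = begin
  1ℚ                                                      ≡⟨ trans (cong (λ z → powℚ z p) inv-0) (powℚ-1 p) ⟨
  powℚ (inv 0) p                                          ≤⟨ p≤p+q (sum-nonneg (m L) (λ i → powℚ-nonneg (inv-nonneg (suc i)) p)) ⟩
  powℚ (inv 0) p + sum (m L) (λ i → powℚ (inv (suc i)) p) ≡⟨ sum-shift (m L) (λ i → powℚ (inv i) p) ⟨
  Z p (N L)                                               ∎
  where
  open ℚP.≤-Reasoning

Null-divide : ∀ {q} {z : ℕ → ℚ} → (∀ L → 1ℚ ≤ z L) → Null (λ L → q * z L) → Null (λ _ → q)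
Null-divide {q} {z} 1≤z (bnd C e 0≤C bound) = bnd C e 0≤C (λ L → ℚP.≤-trans (begin
  ∣ q ∣            ≡⟨ ℚP.*-identityʳ ∣ q ∣ ⟨
  ∣ q ∣ * 1ℚ       ≤⟨ *-monoˡ (ℚP.0≤∣p∣ q) (ℚP.≤-trans (1≤z L) (ℚP.≤-reflexive (sym (ℚP.0≤p⇒∣p∣≡p (ℚP.≤-trans 0≤1 (1≤z L)))))) ⟩
  ∣ q ∣ * ∣ z L ∣  ≡⟨ ℚP.∣p*q∣≡∣p∣*∣q∣ q (z L) ⟨
  ∣ q * z L ∣      ∎) (bound L))
  where open ℚP.≤-Reasoning

sumᴹ≡sum : ∀ n f → sumᴹ n f ≡ sum n f
sumᴹ≡sum zero    f = refl
sumᴹ≡sum (suc n) f = trans (cong (f 0 +_) (sumᴹ≡sum n (f ∘ suc))) (sym (sum-shift n f))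

replicate-admissible : ∀ n → Admissible (replicate n 2)
replicate-admissible zero    = inj₁ refl
replicate-admissible (suc n) = inj₂ (0 , replicate n 2 , refl)

H-admissible : ∀ a b → Admissible (H a b)
H-admissible zero    b = inj₂ (1 , replicate b 2 , refl)
H-admissible (suc a) b = inj₂ (0 , H a b , refl)

rhs-real : ∀ a b → (λ L → rhs-sum (N L) a b) ~ (λ L → ⟪ rhs a b , real (N L) ⟫)
rhs-real a b = null (bnd-cong (λ L → sym (value L)) (η-sum inv-nonneg (suc (a ℕ.+ b)) (λ s _ → η-scale inv-nonneg (coefficient a b (suc s))
    (sample-N (real-product (suc (dbl s)) [] {replicate (a ℕ.+ b ℕ.∸ s) 2} (replicate-admissible (a ℕ.+ b ℕ.∸ s)))))))
  where
  n = suc (a ℕ.+ b)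
  distribute : ∀ x y z → x * y - x * z ≡ x * (y - z)
  distribute = solve-∀ ℚ-ring
  value : ∀ L → rhs-sum (N L) a b - ⟪ rhs a b , real (N L) ⟫ ≡
    sum n (λ s → coefficient a b (suc s) * (zs (suc (suc (suc (dbl s))) ∷ []) (N L) * zs (replicate (a ℕ.+ b ℕ.∸ s) 2) (N L) - Sh (Zw (suc s)) (Tw (a ℕ.+ b ℕ.∸ s)) (real (N L))))
  value L = begin
    rhs-sum (N L) a b - ⟪ rhs a b , real (N L) ⟫
      ≡⟨ cong₂ _-_ (cong (λ n → sum n (λ s → coefficient a b (suc s) * (zs ((2 ℕ.* suc s ℕ.+ 1) ∷ []) (N L) * zs (replicate (n ℕ.∸ suc s) 2) (N L)))) (ℕP.+-comm (a ℕ.+ b) 1))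
           (trans (pair-rhs a b (real (N L))) (sumᴹ≡sum n (rhs-term a b (real (N L))))) ⟩
    sum n (λ s → coefficient a b (suc s) * (zs ((2 ℕ.* suc s ℕ.+ 1) ∷ []) (N L) * zs (replicate (a ℕ.+ b ℕ.∸ s) 2) (N L))) - sum n (rhs-term a b (real (N L)))
      ≡⟨ sum-- n _ (rhs-term a b (real (N L))) ⟨
    sum n (λ s → coefficient a b (suc s) * (zs ((2 ℕ.* suc s ℕ.+ 1) ∷ []) (N L) * zs (replicate (a ℕ.+ b ℕ.∸ s) 2) (N L)) - rhs-term a b (real (N L)) s)
      ≡⟨ sum-cong n (λ s → trans (distribute (coefficient a b (suc s)) (zs ((2 ℕ.* suc s ℕ.+ 1) ∷ []) (N L) * zs (replicate (a ℕ.+ b ℕ.∸ s) 2) (N L)) (Sh (Zw (suc s)) (Tw (a ℕ.+ b ℕ.∸ s)) (real (N L))))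
           (cong (λ t → coefficient a b (suc s) * (zs (t ∷ []) (N L) * zs (replicate (a ℕ.+ b ℕ.∸ s) 2) (N L) - Sh (Zw (suc s)) (Tw (a ℕ.+ b ℕ.∸ s)) (real (N L)))) (odd-index (suc s)))) ⟩
    sum n (λ s → coefficient a b (suc s) * (zs (suc (suc (suc (dbl s))) ∷ []) (N L) * zs (replicate (a ℕ.+ b ℕ.∸ s) 2) (N L) - Sh (Zw (suc s)) (Tw (a ℕ.+ b ℕ.∸ s)) (real (N L)))) ∎
    where open ≡-Reasoning

multiple-zero : ∀ a b q → let n = suc (a ℕ.+ b) in ZEq (lhs a b ⊖ rhs a b) (scale q (wd (Zw n))) → q ≡ 0ℚ
multiple-zero a b q eq = Null-const q (Null-divide {q} {λ L → Z p (N L)} (1≤Z p) (bnd-cong value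
    (η-- inv-nonneg (_~_.difference lhs~rhs) (sample-N (InR-Sml (f ⊖ scale q (wd (Zw n))) eq)))))
  where
  n = suc (a ℕ.+ b)
  p = suc (dbl n)
  f = lhs a b ⊖ rhs a b
  lhs~rhs : (λ L → zs (H a b) (N L)) ~ (λ L → ⟪ rhs a b , real (N L) ⟫)
  lhs~rhs = ~-trans (zagier a b) (rhs-real a b)
  regroup : ∀ x y q z → x - y - (x + - 1ℚ * y + - 1ℚ * (q * z)) ≡ q * z
  regroup = solve-∀ ℚ-ring
  value : ∀ L → zs (H a b) (N L) - ⟪ rhs a b , real (N L) ⟫ - ⟪ f ⊖ scale q (wd (Zw n)) , real (N L) ⟫ ≡ q * Z p (N L)
  value L = trans (cong (λ z → zs (H a b) (N L) - ⟪ rhs a b , real (N L) ⟫ - z) (begin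
      ⟪ f ⊖ scale q (wd (Zw n)) , real (N L) ⟫
        ≡⟨ pair-⊖ f (scale q (wd (Zw n))) (real (N L)) ⟩
      ⟪ f , real (N L) ⟫ + - 1ℚ * ⟪ scale q (wd (Zw n)) , real (N L) ⟫
        ≡⟨ cong₂ (λ x y → x + - 1ℚ * y)
             (trans (pair-⊖ (lhs a b) (rhs a b) (real (N L))) (cong (λ x → x + - 1ℚ * ⟪ rhs a b , real (N L) ⟫) (trans (pair-wd (Hw a b) (real (N L))) (real-ι (H-admissible a b) (N L)))))
             (trans (pair-scale q (wd (Zw n)) (real (N L))) (cong (q *_) (trans (pair-wd (Zw n) (real (N L))) (trans (real-ι (inj₂ (suc (dbl (a ℕ.+ b)) , [] , refl)) (N L)) (zs-single (dbl n) (N L)))))) ⟩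
      zs (H a b) (N L) + - 1ℚ * ⟪ rhs a b , real (N L) ⟫ + - 1ℚ * (q * Z p (N L)) ∎))
    (regroup (zs (H a b) (N L)) ⟪ rhs a b , real (N L) ⟫ q (Z p (N L)))
    where open ≡-Reasoning

theorem-step : KernelConjecture → ∀ a b → (∀ α β → α ℕ.+ β ℕ.< a ℕ.+ b → ZEq (lhs α β) (rhs α β)) → ZEq (lhs a b) (rhs a b)
theorem-step kc a b ih with Equivalence.to (kc (suc (dbl (suc (a ℕ.+ b)))) (s≤s (s≤s z≤n)) (lhs a b ⊖ rhs a b) (difference-Hom a b)) (in-kernel a b ih)
... | q , eq = Quotient.Span-Same _≟W_ IdealGen {f} {f ⊖ scale q (wd (Zw (suc (a ℕ.+ b))))} same eq
  where
  f = lhs a b ⊖ rhs a b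
  regroup : ∀ x y → x ≡ x + - 1ℚ * (0ℚ * y)
  regroup = solve-∀ ℚ-ring
  same : Same _≟W_ f (f ⊖ scale q (wd (Zw (suc (a ℕ.+ b)))))
  same w = trans (regroup (coeffP f w) (coeffP (wd (Zw (suc (a ℕ.+ b)))) w)) (trans (cong (λ z → coeffP f w + - 1ℚ * (z * coeffP (wd (Zw (suc (a ℕ.+ b)))) w)) (sym (multiple-zero a b q eq)))
    (sym (trans (coeff-++ _≟W_ f (neg (scale q (wd (Zw (suc (a ℕ.+ b)))))) w) (cong (coeffP f w +_) (trans (coeff-scale _≟W_ (- 1ℚ) (scale q (wd (Zw (suc (a ℕ.+ b))))) w) (cong (- 1ℚ *_) (coeff-scale _≟W_ q (wd (Zw (suc (a ℕ.+ b)))) w)))))))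

theorem6p10 : KernelConjecture → (a b : ℕ) → ZEq (lhs a b) (rhs a b)
theorem6p10 kc a b = below (suc (a ℕ.+ b)) a b ℕP.≤-refl
  where
  below : ∀ n a b → a ℕ.+ b ℕ.< n → ZEq (lhs a b) (rhs a b)
  below (suc n) a b (s≤s le) = theorem-step kc a b (λ α β lt → below n α β (ℕP.<-≤-trans lt le))
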